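{- Let $k$ be a positive integer and let $I \subseteq \{1,\dots,k\}$. Let $G$ be a $(26k + 24|I|)$-connected graph and let $S = \{\{s_1,t_1\},\dots,\{s_k,t_k\}\}$ be a set of $k$ pairs of vertices of $G$, where all $2k$ vertices $s_1,\dots,s_k,t_1,\dots,t_k$ are distinct. If there is a nice partition $(A,B)$ of $G$ that has a parity breaking matching for $(S,I)$, then for every choice of parities $(p_i)_{i \in I}$ (each $p_i \in \{\text{odd},\text{even}\}$), $G$ contains pairwise vertex-disjoint paths $P_1,\dots,P_k$ such that $P_i$ connects $s_i$ and $t_i$ for every $i \in \{1,\dots,k\}$, and the length of $P_i$ has parity $p_i$ for every $i \in I$.
   Context: All graphs are finite and simple. An odd cycle cover of $G$ is a set $X \subseteq V(G)$ such that $G - X$ is bipartite; it is minimum if it has minimum cardinality. A partition $(A,B)$ of $G$ is a partition of $V(G)$ into two sets $A, B$; $G_{A,B}$ denotes the graph $G[A] \cup G[B]$ (the edges of $G$ with both ends in $A$ or both ends in $B$). A partition $(A,B)$ is nice if there is a minimum odd cycle cover $X$ of $G$ such that $(A \setminus X, B \setminus X)$ is a bipartition of $G - X$ (i.e. $G-X$ has no edge with both ends in $A\setminus X$ or both in $B\setminus X$), and every vertex of $X$ with more neighbors in $B \setminus X$ than in $A \setminus X$ lies in $A$, and every vertex of $X$ with more neighbors in $A \setminus X$ than in $B\setminus X$ lies in $B$. Given such a nice partition $(A,B)$, $S=\{\{s_1,t_1\},\dots,\{s_k,t_k\}\}$ and $I \subseteq \{1,\dots,k\}$, a parity breaking matching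 for $(S,I)$ is a matching $M = \{m_i\}_{i \in I}$ (one edge $m_i$ for each $i\in I$) with $M \subseteq E(G_{A,B})$ such that $m_i \cap \{s_j,t_j\} = \emptyset$ for all $i \in I$ and all $j \in \{1,\dots,k\}$ with $j \ne i$. -}

module Defs where

open import Data.Nat using (ℕ; zero; suc; _+_; _*_; _<_; _≤_; _%_)
open import Data.Fin using (Fin; zero; suc; fromℕ; inject₁)
open import Data.Fin.Subset using (Subset; _∈_; _∉_; ∣_∣; _∩_; ∁)
open import Data.Vec using (lookup; tabulate)
open import Data.Bool using (Bool; true; false)
open import Data.Product using (_×_; Σ; ∃; _,_; proj₁; proj₂)
open import Relation.Binary.PropositionalEquality using (_≡_; _≢_)
open import Function.Definitions using (Injective)

record Graph (n : ℕ) : Set where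
  field
    adj    : Fin n → Fin n → Bool
    sym    : ∀ u v → adj u v ≡ adj v u
    irrefl : ∀ v → adj v v ≡ false
open Graph public

module _ {n : ℕ} (G : Graph n) where

  Edge : Fin n → Fin n → Set
  Edge u v = adj G u v ≡ true

  record Path (s t : Fin n) : Set where
    field
      len   : ℕ
      vert  : Fin (suc len) → Fin n
      inj   : Injective _≡_ _≡_ vert
      start : vert zero ≡ s
      end   : vert (fromℕ len) ≡ t
      step  : ∀ (i : Fin len) → Edge (vert (inject₁ i)) (vert (suc i))
  open Path public

  ConnectedMinus : Subset n → Set
  ConnectedMinus X = ∀ u v → u ∉ X → v ∉ X →
    Σ (Path u v) λ P → ∀ i → vert P i ∉ X

  KConnected : ℕ → Set
  KConnected κ = κ < n × (∀ (X : Subset n) → ∣ X ∣ < κ → ConnectedMinus X)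

  -- (A ∖ X, B ∖ X) is a bipartition of G - X, where B is the complement
  -- of A (a partition of V(G) is encoded by the subset A).
  BipartitionMinus : Subset n → Subset n → Set
  BipartitionMinus X A = ∀ u v → u ∉ X → v ∉ X → Edge u v →
    lookup A u ≢ lookup A v

  OddCycleCover : Subset n → Set
  OddCycleCover X = ∃ λ (A : Subset n) → BipartitionMinus X A

  MinOddCycleCover : Subset n → Set
  MinOddCycleCover X =
    OddCycleCover X × (∀ Y → OddCycleCover Y → ∣ X ∣ ≤ ∣ Y ∣)

  N : Fin n → Subset n
  N x = tabulate (adj G x)

  Nice : Subset n → Set
  Nice A = ∃ λ X → MinOddCycleCover X × BipartitionMinus X A ×
    (∀ x → x ∈ X →
      ∣ N x ∩ ∁ X ∩ A ∣ < ∣ N x ∩ ∁ X ∩ ∁ A ∣ → x ∈ A) ×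
    (∀ x → x ∈ X →
      ∣ N x ∩ ∁ X ∩ ∁ A ∣ < ∣ N x ∩ ∁ X ∩ A ∣ → x ∉ A)

  -- parity breaking matching for (S , I) w.r.t. the partition (A , ∁ A);
  -- S is given by s t : Fin k → Fin n, edge m_i has ends proj₁ (m i),
  -- proj₂ (m i) (only relevant for i ∈ I).
  ParityBreakingMatching : (k : ℕ) → (s t : Fin k → Fin n) → Subset k →
    Subset n → (Fin k → Fin n × Fin n) → Set
  ParityBreakingMatching k s t I A m =
    (∀ i → i ∈ I → Edge (proj₁ (m i)) (proj₂ (m i))
                 × lookup A (proj₁ (m i)) ≡ lookup A (proj₂ (m i))) ×
    (∀ i j → i ∈ I → j ∈ I → i ≢ j →
       proj₁ (m i) ≢ proj₁ (m j) × proj₁ (m i) ≢ proj₂ (m j) ×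
       proj₂ (m i) ≢ proj₁ (m j) × proj₂ (m i) ≢ proj₂ (m j)) ×
    (∀ i j → i ∈ I → i ≢ j →
       proj₁ (m i) ≢ s j × proj₁ (m i) ≢ t j ×
       proj₂ (m i) ≢ s j × proj₂ (m i) ≢ t j)

  HasParityBreakingMatching : (k : ℕ) → (s t : Fin k → Fin n) →
    Subset k → Subset n → Set
  HasParityBreakingMatching k s t I A =
    ∃ λ m → ParityBreakingMatching k s t I A m

data Parity : Set where
  odd even : Parity

HasParity : ℕ → Parity → Set
HasParity ℓ odd  = ℓ % 2 ≡ 1
HasParity ℓ even = ℓ % 2 ≡ 0

{-# OPTIONS --safe #-}
module Submission where

open import Data.Nat hiding (_!)
open import Data.Nat.Properties renaming (≤-reflexive to ≤-eq)
open import Data.Nat.DivMod using ([m+n]%n≡m%n)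
open import Data.Nat.Solver using (module +-*-Solver)
open import Data.Fin using (Fin; zero; suc; toℕ; fromℕ; inject₁; _↑ˡ_; _↑ʳ_; splitAt)
open import Data.Fin.Properties using (toℕ-injective; splitAt-↑ˡ; splitAt-↑ʳ; join-splitAt) renaming (_≟_ to _≟F_; any? to anyF?; all? to allF?)
open import Data.Fin.Subset using (Subset; ∣_∣; _∩_; ∁) renaming (_∈_ to _∈ˢ_; _∉_ to _∉ˢ_)
open import Data.Bool using (Bool; true; false; if_then_else_; _∧_; _∨_; not; _xor_) renaming (_≟_ to _≟B_; T to IsTrue)
open import Data.Bool.Solver using (module xor-∧-Solver)
open import Data.List using (List; []; _∷_; _++_; length; reverse; foldl)
open import Data.List.Properties using (length-++; length-reverse; reverse-++; ++-assoc)
open import Data.List.Membership.Propositional using (_∈_; _∉_)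
open import Data.List.Membership.Propositional.Properties renaming (∈-++⁺ˡ to ∈ˡ; ∈-++⁺ʳ to ∈ʳ; ∈-++⁻ to ∈⁻)
open import Data.List.Relation.Unary.Any using (here; there)
open import Data.Vec using (Vec; []; _∷_; lookup; tabulate)
open import Data.Vec.Properties using (lookup∘tabulate; lookup-zipWith; lookup-map; lookup⇒[]=; []=⇒lookup)
open import Data.Product using (Σ; Σ-syntax; _×_; _,_) renaming (proj₁ to fst; proj₂ to snd)
open import Data.Sum using (_⊎_) renaming (inj₁ to inl; inj₂ to inr; [_,_]′ to [_,_])
open import Data.Empty using (⊥) renaming (⊥-elim to void)
open import Data.Unit using (⊤; tt)
open import Function.Definitions using (Injective)
open import Relation.Nullary using (¬_; Dec; yes; no; does)
open import Relation.Binary.PropositionalEquality using (_≡_; _≢_; refl; sym; trans; cong; cong₂; subst; subst₂)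

-- Let r = k + |I|. The engine is a linkage theorem in the spirit of Thomas and Wollan: if the edges meeting W ∖ X have density more than
-- D ≥ 6r and no small separation cuts off a dense part, then any pairing of a set X of at most 2r roots can be linked. A minimal
-- counterexample has no contractible edge, so a vertex of low degree together with its neighbours is so dense that it contains a set
-- in which any r pairs can be linked; Menger's theorem joins the roots to that set, or yields a smaller separation.
-- If some odd cycle cover has fewer than 4k + 2|I| vertices, then the cross edges of the nice partition form such a graph, and the edges
-- of the matching are inserted into the links to correct parities. Otherwise a maximum cut contains a set W linked by cross edges,
-- and (by a Gallai–Edmonds argument in a double cover) there are 2k + |I| disjoint paths with ends in W that break the parity of the cut.
-- Paths from the terminals to W with as few edges as possible outside those meet at most 2k of them, which leaves |I| to correct parities.
-- All existence statements are proved under double negation; the conclusion is decidable.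

-- Linear arithmetic over ℕ

-- Links run in a bipartite subgraph, so their ends force their parity; a wrong parity is repaired
-- by a detour through one path or edge that disagrees with the bipartition. Each of the `k` paths
-- needs one link and each index of `I` possibly a second one behind its detour: `r` links, `2 * r`
-- roots. The connectivity is `24 * r + 2 * k`. A maximum cut keeps half of every degree,
-- `12 * r + k`; this gives the density `6 * r` that the linkage theorem demands, and the surplus
-- from `k` pays for the edges among the roots, which do not count there but number at most `r * r`
-- by bipartiteness. The threshold `4 * k + 2 * |I|` is the number of ends of `2 * k + |I|` paths.
-- Menger's theorem and the packing of parity-breaking paths both reduce to maximum matchings in a
-- double cover, where a path enters a vertex at one copy and leaves it at the other. For the
-- packing, the side on which a path arrives therefore records its parity. The barrier of a maximum
-- matching yields the small separator or the small odd cycle cover.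

module Linear where

 infixl 6 _:+_
 infixl 7 _:*_
 infix 4 _:≤_ _:<_
 infixr 3 _⇒_

 data Expr (n : ℕ) : Set where
  var  : Fin n → Expr n
  #_   : ℕ → Expr n
  _:+_ : Expr n → Expr n → Expr n
  _:*_ : ℕ → Expr n → Expr n

 data Rel (n : ℕ) : Set where
  _:≤_ _:<_ : Expr n → Expr n → Rel n

 data Prob (n : ℕ) : Set where
  qed  : Rel n → Prob n
  absurd : Prob n
  _⇒_  : Rel n → Prob n → Prob n

 Env : ℕ → Set
 Env n = Vec ℕ n

 evalV : ∀ {n} → Env n → Fin n → ℕ
 evalV (x ∷ ρ) zero    = x
 evalV (x ∷ ρ) (suc i) = evalV ρ i

 eval : ∀ {n} → Env n → Expr n → ℕ
 eval ρ (var i)  = evalV ρ i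
 eval ρ (# k)    = k
 eval ρ (a :+ b) = eval ρ a + eval ρ b
 eval ρ (k :* a) = k * eval ρ a

 evalR : ∀ {n} → Env n → Rel n → Set
 evalR ρ (a :≤ b) = eval ρ a ≤ eval ρ b
 evalR ρ (a :< b) = eval ρ a < eval ρ b

 evalP : ∀ {n} → Env n → Prob n → Set
 evalP ρ (qed r) = evalR ρ r
 evalP ρ absurd  = ⊥
 evalP ρ (r ⇒ p) = evalR ρ r → evalP ρ p

 LF : ℕ → Set
 LF n = ℕ × Vec ℕ n

 vzero : ∀ n → Vec ℕ n
 vzero zero    = []
 vzero (suc n) = 0 ∷ vzero n

 vunit : ∀ {n} → Fin n → Vec ℕ n
 vunit zero    = 1 ∷ vzero _
 vunit (suc i) = 0 ∷ vunit i

 vadd : ∀ {n} → Vec ℕ n → Vec ℕ n → Vec ℕ n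
 vadd []       []       = []
 vadd (x ∷ xs) (y ∷ ys) = (x + y) ∷ vadd xs ys

 vmul : ∀ {n} → ℕ → Vec ℕ n → Vec ℕ n
 vmul k []       = []
 vmul k (x ∷ xs) = (k * x) ∷ vmul k xs

 norm : ∀ {n} → Expr n → LF n
 norm (var i)  = 0 , vunit i
 norm (# k)    = k , vzero _
 norm (a :+ b) = fst (norm a) + fst (norm b) , vadd (snd (norm a)) (snd (norm b))
 norm (k :* a) = k * fst (norm a) , vmul k (snd (norm a))

 dot : ∀ {n} → Env n → Vec ℕ n → ℕ
 dot []      []       = 0
 dot (x ∷ ρ) (c ∷ cs) = c * x + dot ρ cs

 evalL : ∀ {n} → Env n → LF n → ℕ
 evalL ρ (k , cs) = k + dot ρ cs

 dot-zero : ∀ {n} (ρ : Env n) → dot ρ (vzero n) ≡ 0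
 dot-zero []      = refl
 dot-zero (x ∷ ρ) = dot-zero ρ

 dot-unit : ∀ {n} (ρ : Env n) i → dot ρ (vunit i) ≡ evalV ρ i
 dot-unit (x ∷ ρ) zero    = trans (cong (x + 0 +_) (dot-zero ρ)) (trans (+-identityʳ _) (+-identityʳ _))
 dot-unit (x ∷ ρ) (suc i) = dot-unit ρ i

 +-exchange : ∀ a b c d → (a + b) + (c + d) ≡ (a + c) + (b + d)
 +-exchange a b c d = trans (+-assoc a b (c + d)) (trans (cong (a +_)
  (trans (sym (+-assoc b c d)) (trans (cong (_+ d) (+-comm b c)) (+-assoc c b d)))) (sym (+-assoc a c (b + d))))

 dot-add : ∀ {n} (ρ : Env n) xs ys → dot ρ (vadd xs ys) ≡ dot ρ xs + dot ρ ys
 dot-add []      []       []       = refl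
 dot-add (e ∷ ρ) (x ∷ xs) (y ∷ ys) = trans (cong₂ _+_ (*-distribʳ-+ e x y) (dot-add ρ xs ys))
  (+-exchange (x * e) (y * e) (dot ρ xs) (dot ρ ys))

 dot-mul : ∀ {n} (ρ : Env n) k xs → dot ρ (vmul k xs) ≡ k * dot ρ xs
 dot-mul []      k []       = sym (*-zeroʳ k)
 dot-mul (e ∷ ρ) k (x ∷ xs) = trans (cong₂ _+_ (*-assoc k x e) (dot-mul ρ k xs))
  (sym (*-distribˡ-+ k (x * e) (dot ρ xs)))

 norm-sound : ∀ {n} (ρ : Env n) e → evalL ρ (norm e) ≡ eval ρ e
 norm-sound ρ (var i)  = dot-unit ρ i
 norm-sound ρ (# k)    = trans (cong (k +_) (dot-zero ρ)) (+-identityʳ k)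
 norm-sound ρ (a :+ b) = trans (cong (fst (norm a) + fst (norm b) +_) (dot-add ρ (snd (norm a)) (snd (norm b))))
  (trans (+-exchange (fst (norm a)) (fst (norm b)) _ _) (cong₂ _+_ (norm-sound ρ a) (norm-sound ρ b)))
 norm-sound ρ (k :* a) = trans (cong (k * fst (norm a) +_) (dot-mul ρ k (snd (norm a))))
  (trans (sym (*-distribˡ-+ k (fst (norm a)) _)) (cong (k *_) (norm-sound ρ a)))

 vleq : ∀ {n} → Vec ℕ n → Vec ℕ n → Bool
 vleq []       []       = true
 vleq (x ∷ xs) (y ∷ ys) = (x ≤ᵇ y) ∧ vleq xs ys

 T-∧ : ∀ {a b} → IsTrue (a ∧ b) → IsTrue a × IsTrue b
 T-∧ {true} {true} _ = tt , tt

 dot-mono : ∀ {n} (ρ : Env n) xs ys → IsTrue (vleq xs ys) → dot ρ xs ≤ dot ρ ys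
 dot-mono []      []       []       _ = z≤n
 dot-mono (e ∷ ρ) (x ∷ xs) (y ∷ ys) t =
  +-mono-≤ (*-monoˡ-≤ e (≤ᵇ⇒≤ x y (fst (T-∧ t)))) (dot-mono ρ xs ys (snd (T-∧ {x ≤ᵇ y} t)))

 Ineqs : ℕ → Set
 Ineqs n = List (Expr n × Expr n)

 Holds : ∀ {n} → Env n → Ineqs n → Set
 Holds ρ []             = ⊤
 Holds ρ ((l , r) ∷ hs) = (eval ρ l ≤ eval ρ r) × Holds ρ hs

 combine : ∀ {n} → Ineqs n → List ℕ → Expr n × Expr n
 combine []             ms       = # 0 , # 0
 combine (h ∷ hs)       []       = # 0 , # 0
 combine ((l , r) ∷ hs) (m ∷ ms) = m :* l :+ fst (combine hs ms) , m :* r :+ snd (combine hs ms)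

 combine-sound : ∀ {n} (ρ : Env n) hs ms → Holds ρ hs →
  eval ρ (fst (combine hs ms)) ≤ eval ρ (snd (combine hs ms))
 combine-sound ρ []       ms       _        = z≤n
 combine-sound ρ (h ∷ hs) []       _        = z≤n
 combine-sound ρ (h ∷ hs) (m ∷ ms) (p , ps) = +-mono-≤ (*-monoʳ-≤ m p) (combine-sound ρ hs ms ps)

 -- Comparing coefficients is enough because the variables range over ℕ: a left side that is larger
 -- in the constant and nowhere smaller in a coefficient exceeds the right side at every point.
 refutes : ∀ {n} → Expr n × Expr n → Bool
 refutes (l , r) = (fst (norm r) <ᵇ fst (norm l)) ∧ vleq (snd (norm r)) (snd (norm l))

 refute : ∀ {n} (ρ : Env n) hs ms → IsTrue (refutes (combine hs ms)) → Holds ρ hs → ⊥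
 refute ρ hs ms t h with combine hs ms | combine-sound ρ hs ms h
 ... | l , r | l≤r = <-irrefl refl (<-≤-trans
  (subst₂ _<_ (norm-sound ρ r) (norm-sound ρ l)
   (+-mono-<-≤ (<ᵇ⇒< _ _ (fst (T-∧ {fst (norm r) <ᵇ fst (norm l)} t)))
         (dot-mono ρ _ _ (snd (T-∧ {fst (norm r) <ᵇ fst (norm l)} t))))) l≤r)

 hyp : ∀ {n} → Rel n → Expr n × Expr n
 hyp (a :≤ b) = a , b
 hyp (a :< b) = (# 1 :+ a) , b

 neg : ∀ {n} → Rel n → Expr n × Expr n
 neg (a :≤ b) = (# 1 :+ b) , a
 neg (a :< b) = b , a

 hyps : ∀ {n} → Prob n → Ineqs n
 hyps (qed r) = neg r ∷ []
 hyps absurd  = []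
 hyps (r ⇒ p) = hyp r ∷ hyps p

 hyp-sound : ∀ {n} (ρ : Env n) r → evalR ρ r → eval ρ (fst (hyp r)) ≤ eval ρ (snd (hyp r))
 hyp-sound ρ (a :≤ b) h = h
 hyp-sound ρ (a :< b) h = h

 prob : ∀ {n} (ρ : Env n) (p : Prob n) → (Holds ρ (hyps p) → ⊥) → evalP ρ p
 prob ρ (qed (a :≤ b)) k = ≮⇒≥ (λ b<a → k (b<a , tt))
 prob ρ (qed (a :< b)) k = ≰⇒> (λ b≤a → k (b≤a , tt))
 prob ρ absurd         k = k tt
 prob ρ (r ⇒ p)        k = λ h → prob ρ p (λ hs → k (hyp-sound ρ r h , hs))

 -- A higher-order front end: a problem is written as a function of its variables, and `apply`
 -- supplies the indices.
 Curried : ℕ → ℕ → Set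
 Curried n zero    = Prob n
 Curried n (suc m) = Expr n → Curried n m

 apply : ∀ {n} m → (Fin m → Fin n) → Curried n m → Prob n
 apply zero    g f = f
 apply (suc m) g f = apply m (λ i → g (suc i)) (f (var (g zero)))

 problem : ∀ {n} → Curried n n → Prob n
 problem {n} = apply n (λ i → i)

 -- ms are the multipliers of the hypotheses and of the negated goal in a combination that is contradictory.
 lin : ∀ {n} (ms : List ℕ) (ρ : Env n) (f : Curried n n) →
  {_ : IsTrue (refutes (combine (hyps (problem f)) ms))} → evalP ρ (problem f)
 lin ms ρ f {t} = prob ρ (problem f) (refute ρ (hyps (problem f)) ms t)

open Linear using (lin; _:+_; _:*_; _:≤_; _:<_; #_; _⇒_; qed; absurd; +-exchange)

-- Classical reasoning inside double negation

NN : ∀ {a} → Set a → Set a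
NN A = ¬ ¬ A

infixl 1 _>>=_
_>>=_ : ∀ {a b} {A : Set a} {B : Set b} → NN A → (A → NN B) → NN B
m >>= f = λ k → m (λ a → f a k)

ret : ∀ {a} {A : Set a} → A → NN A
ret a k = k a

run : NN ⊥ → ⊥
run m = m (λ x → x)

em : ∀ {a} (P : Set a) → NN (Dec P)
em P k = k (no (λ p → k (yes p)))

stable : ∀ {a} {A : Set a} → Dec A → NN A → A
stable (yes a) _ = a
stable (no ¬a) m = void (m ¬a)

argmin : ∀ {a} {A : Set a} (μ : A → ℕ) → A → NN (Σ[ a ∈ A ] (∀ b → μ a ≤ μ b))
argmin {A = A} μ a0 = go (μ a0) a0 ≤-refl
 where
 go : ∀ m a → μ a ≤ m → NN (Σ[ a ∈ A ] (∀ b → μ a ≤ μ b))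
 step : ∀ m b → μ b < m → NN (Σ[ a ∈ A ] (∀ b → μ a ≤ μ b))
 go m a le = em (Σ[ b ∈ A ] μ b < μ a) >>= λ where
  (no none)      → ret (a , λ b → ≮⇒≥ (λ lt → none (b , lt)))
  (yes (b , lt)) → step m b (<-≤-trans lt le)
 step (suc m) b (s≤s lt) = go m b lt

argmax : ∀ {a} {A : Set a} (μ : A → ℕ) (B : ℕ) → (∀ a → μ a ≤ B) → A → NN (Σ[ a ∈ A ] (∀ b → μ b ≤ μ a))
argmax μ B bd a0 = argmin (λ a → B ∸ μ a) a0 >>= λ where
 (a , min) → ret (a , λ b → ∸-cancelʳ-≤ (bd b) (min b))

-- Induction on the size of the index set; finiteness is what lets the double negation move past the
-- quantifier.
choose : ∀ {a n} {P : Fin n → Set a} → (∀ x → NN (P x)) → NN (∀ x → P x)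
choose {n = zero}  f = ret (λ ())
choose {n = suc n} f = f zero >>= λ p → choose (λ x → f (suc x)) >>= λ ps →
 ret (λ { zero → p ; (suc x) → ps x })

Sub : ℕ → Set
Sub n = Fin n → Bool

-- Makes an arbitrary predicate, such as reachability, into a Boolean subset whose elements can be
-- counted.
compr : ∀ {a n} (P : Fin n → Set a) → NN (Σ[ S ∈ Sub n ] (∀ x → (S x ≡ true → P x) × (P x → S x ≡ true)))
compr P = choose (λ x → em (P x)) >>= λ d → ret ((λ x → does (d x)) , λ x → lem (d x))
 where
 lem : ∀ {a} {A : Set a} (d : Dec A) → (does d ≡ true → A) × (A → does d ≡ true)
 lem (yes a) = (λ _ → a) , (λ _ → refl)
 lem (no ¬a) = (λ ()) , (λ a → void (¬a a))

-- Boolean reflection and decidable subsets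

infix 4 _!
_! : Bool → Set
b ! = b ≡ true

t≢f : true ≢ false
t≢f ()

∧-i : ∀ {a b} → a ! → b ! → a ∧ b !
∧-i refl refl = refl

∧-l : ∀ {a b} → a ∧ b ! → a !
∧-l {true} _ = refl

∧-r : ∀ {a b} → a ∧ b ! → b !
∧-r {true} p = p

∨-l : ∀ {a b} → a ! → a ∨ b !
∨-l refl = refl

∨-r : ∀ {a b} → b ! → a ∨ b !
∨-r {true} refl = refl
∨-r {false} refl = refl

∨-e : ∀ {a b} → a ∨ b ! → a ! ⊎ b !
∨-e {true}  _ = inl refl
∨-e {false} p = inr p

not-i : ∀ {a} → ¬ (a !) → not a !
not-i {true}  f = void (f refl)
not-i {false} _ = refl

not-e : ∀ {a} → not a ! → ¬ (a !)
not-e {true} () _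
not-e {false} _ ()

bool : ∀ b → b ! ⊎ ¬ (b !)
bool true  = inl refl
bool false = inr λ ()

T? : ∀ b → Dec (b !)
T? true  = yes refl
T? false = no λ ()

infix 5 _==_
abstract
 -- Kept opaque, so that a case split on `x == y` abstracts a single neutral Boolean; the facts of
 -- this block are the only access.
 _==_ : ∀ {n} → Fin n → Fin n → Bool
 x == y = does (x ≟F y)

 ==-e : ∀ {n} {x y : Fin n} → (x == y) ! → x ≡ y
 ==-e {x = x} {y} p with x ≟F y
 ... | yes q = q
 ... | no _ = void (t≢f (sym p))

 ==-refl : ∀ {n} (x : Fin n) → (x == x) !
 ==-refl x with x ≟F x
 ... | yes _ = refl
 ... | no ¬p = void (¬p refl)

 s==s : ∀ {n} (x y : Fin n) → (suc x == suc y) ≡ (x == y)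
 s==s x y = refl

 z==s : ∀ {n} (x : Fin n) → (zero == suc x) ≡ false
 z==s x = refl

 s==z : ∀ {n} (x : Fin n) → (suc x == zero) ≡ false
 s==z x = refl

==-i : ∀ {n} {x y : Fin n} → x ≡ y → (x == y) !
==-i refl = ==-refl _

anyb : ∀ {n} → Sub n → Bool
anyb {zero}  S = false
anyb {suc n} S = S zero ∨ anyb (λ x → S (suc x))

anyb-i : ∀ {n} (S : Sub n) x → S x ! → anyb S !
anyb-i S zero    p = ∨-l p
anyb-i S (suc x) p = ∨-r {S zero} (anyb-i (λ x → S (suc x)) x p)

anyb-e : ∀ {n} (S : Sub n) → anyb S ! → Σ[ x ∈ Fin n ] S x !
anyb-e {suc n} S p with S zero in eq
... | true  = zero , eq
... | false = let (x , q) = anyb-e (λ x → S (suc x)) p in suc x , q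

-- Finite sums and cardinalities

b2n : Bool → ℕ
b2n true  = 1
b2n false = 0

sum : ∀ {n} → (Fin n → ℕ) → ℕ
sum {zero}  f = 0
sum {suc n} f = f zero + sum (λ x → f (suc x))

sum-mono : ∀ {n} {f g : Fin n → ℕ} → (∀ x → f x ≤ g x) → sum f ≤ sum g
sum-mono {zero}  h = z≤n
sum-mono {suc n} h = +-mono-≤ (h zero) (sum-mono (λ x → h (suc x)))

sum-cong : ∀ {n} {f g : Fin n → ℕ} → (∀ x → f x ≡ g x) → sum f ≡ sum g
sum-cong {zero}  h = refl
sum-cong {suc n} h = cong₂ _+_ (h zero) (sum-cong (λ x → h (suc x)))

sum-+ : ∀ {n} (f g : Fin n → ℕ) → sum (λ x → f x + g x) ≡ sum f + sum g
sum-+ {zero}  f g = refl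
sum-+ {suc n} f g = trans (cong (f zero + g zero +_) (sum-+ (λ x → f (suc x)) (λ x → g (suc x))))
 (+-exchange (f zero) (g zero) _ _)

sum-*ˡ : ∀ {n} k (f : Fin n → ℕ) → sum (λ x → k * f x) ≡ k * sum f
sum-*ˡ {zero}  k f = sym (*-zeroʳ k)
sum-*ˡ {suc n} k f = trans (cong (k * f zero +_) (sum-*ˡ k (λ x → f (suc x)))) (sym (*-distribˡ-+ k (f zero) _))

sum-0 : ∀ n → sum {n} (λ _ → 0) ≡ 0
sum-0 zero    = refl
sum-0 (suc n) = sum-0 n

sum-swap : ∀ {n m} (f : Fin n → Fin m → ℕ) → sum (λ x → sum (f x)) ≡ sum (λ y → sum (λ x → f x y))
sum-swap {zero}  {m} f = sym (sum-0 m)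
sum-swap {suc n} f = trans (cong (sum (f zero) +_) (sum-swap (λ x → f (suc x))))
 (sym (sum-+ (f zero) (λ y → sum (λ x → f (suc x) y))))

sum-≥ : ∀ {n} (f : Fin n → ℕ) x → f x ≤ sum f
sum-≥ f zero    = m≤m+n _ _
sum-≥ f (suc x) = ≤-trans (sum-≥ (λ x → f (suc x)) x) (m≤n+m _ _)

sum-δ : ∀ {n} (f : Fin n → ℕ) z → sum (λ y → b2n (y == z) * f y) ≡ f z
sum-δ {suc n} f zero rewrite ==-refl {suc n} zero =
 trans (cong (f zero + 0 +_) (trans (sum-cong (λ y → cong (λ b → b2n b * f (suc y)) (s==z y))) (sum-0 n)))
 (trans (+-identityʳ _) (+-identityʳ _))
sum-δ {suc n} f (suc z) = cong₂ _+_ (cong (λ b → b2n b * f zero) (z==s z))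
 (trans (sum-cong (λ y → cong (λ b → b2n b * f (suc y)) (s==s y z))) (sum-δ (λ y → f (suc y)) z))

sum-ex : ∀ {n} (f : Fin n → ℕ) → 1 ≤ sum f → Σ[ x ∈ Fin n ] 1 ≤ f x
sum-ex {suc n} f h with f zero in eq
... | suc k = zero , subst (1 ≤_) (sym eq) (s≤s z≤n)
... | zero  = let (x , p) = sum-ex (λ x → f (suc x)) h in suc x , p

abstract
 card : ∀ {n} → Sub n → ℕ
 card S = sum (λ x → b2n (S x))

 card-def : ∀ {n} (S : Sub n) → card S ≡ sum (λ x → b2n (S x))
 card-def S = refl

b2n-t : ∀ {b} → b ! → b2n b ≡ 1
b2n-t refl = refl

b2n≤1 : ∀ b → b2n b ≤ 1
b2n≤1 true  = s≤s z≤n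
b2n≤1 false = z≤n

b2n-imp : ∀ {a k} → (a ! → 1 ≤ k) → b2n a ≤ k
b2n-imp {true}  f = f refl
b2n-imp {false} f = z≤n

b2n-le : ∀ {a b} → (a ! → b !) → b2n a ≤ b2n b
b2n-le f = b2n-imp (λ p → ≤-eq (sym (b2n-t (f p))))

b2n-pos : ∀ {b} → 1 ≤ b2n b → b !
b2n-pos {true} _ = refl

abstract
 card-mono : ∀ {n} {S U : Sub n} → (∀ x → S x ! → U x !) → card S ≤ card U
 card-mono h = sum-mono (λ x → b2n-le (h x))

abstract
 card-cong : ∀ {n} {S U : Sub n} → (∀ x → S x ≡ U x) → card S ≡ card U
 card-cong h = sum-cong (λ x → cong b2n (h x))

abstract
 card-∪ : ∀ {n} {S U V : Sub n} → (∀ x → S x ! → U x ! ⊎ V x !) → card S ≤ card U + card V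
 card-∪ {S = S} {U} {V} h = subst (card S ≤_) (sum-+ (λ x → b2n (U x)) (λ x → b2n (V x)))
  (sum-mono (λ x → b2n-imp (λ p → pt x (h x p))))
  where
  pt : ∀ x → U x ! ⊎ V x ! → 1 ≤ b2n (U x) + b2n (V x)
  pt x (inl u) rewrite u = s≤s z≤n
  pt x (inr v) rewrite v = m≤n+m 1 _

abstract
 card-⊎ : ∀ {n} {S U V : Sub n} → (∀ x → U x ! → S x !) → (∀ x → V x ! → S x !) →
  (∀ x → U x ! → V x ! → ⊥) → card U + card V ≤ card S
 card-⊎ {S = S} {U} {V} hu hv d = subst (_≤ card S) (sum-+ (λ x → b2n (U x)) (λ x → b2n (V x))) (sum-mono pt)
  where
  pt : ∀ x → b2n (U x) + b2n (V x) ≤ b2n (S x)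
  pt x with U x in eu | V x in ev
  ... | true  | true  = void (d x eu ev)
  ... | true  | false = ≤-eq (sym (b2n-t (hu x eu)))
  ... | false | true  = ≤-eq (sym (b2n-t (hv x ev)))
  ... | false | false = z≤n

abstract
 card-ex : ∀ {n} (S : Sub n) → 1 ≤ card S → Σ[ x ∈ Fin n ] S x !
 card-ex S h = let (x , p) = sum-ex _ h in x , b2n-pos p

abstract
 card-pos : ∀ {n} (S : Sub n) {x} → S x ! → 1 ≤ card S
 card-pos S {x} p = ≤-trans (≤-eq (sym (b2n-t p))) (sum-≥ (λ x → b2n (S x)) x)

abstract
 card-sing : ∀ {n} (z : Fin n) → card (λ y → y == z) ≡ 1
 card-sing z = trans (sum-cong {g = λ y → b2n (y == z) * 1} (λ y → sym (*-identityʳ (b2n (y == z))))) (sum-δ (λ _ → 1) z)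

card-≤1 : ∀ {n} (S : Sub n) → (∀ x y → S x ! → S y ! → x ≡ y) → card S ≤ 1
card-≤1 S h with card S in eq
... | zero  = z≤n
... | suc k = let (x , p) = card-ex S (subst (1 ≤_) (sym eq) (s≤s z≤n)) in
 subst (_≤ 1) eq (subst (card S ≤_) (card-sing x) (card-mono (λ y q → ==-i (h y x q p))))

card-strict : ∀ {n} {S U : Sub n} → (∀ x → S x ! → U x !) → ∀ x → U x ! → ¬ (S x !) → card S < card U
card-strict {S = S} {U} h x ux sx = subst (_≤ card U) (cong (_+ card S) (card-sing x))
 (card-⊎ (λ y p → subst (λ z → U z !) (sym (==-e p)) ux) h (λ y p q → sx (subst (λ z → S z !) (==-e p) q)))

abstract
 -- Double counting of the pairs `(x , f x)`: every row of `S` holds one of them, every column at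
 -- most one.
 card-inj : ∀ {n m} {S : Sub n} {U : Sub m} (f : Fin n → Fin m) → (∀ x → S x ! → U (f x) !) →
  (∀ x y → S x ! → S y ! → f x ≡ f y → x ≡ y) → card S ≤ card U
 card-inj {S = S} {U} f into inj = ≤-trans (≤-eq (trans (sum-cong (λ x → sym (trans (sum-cong (λ y → *-comm (b2n (y == f x)) (b2n (S x))))
   (trans (sum-*ˡ (b2n (S x)) (λ y → b2n (y == f x))) (trans (cong (b2n (S x) *_) (card-sing (f x))) (*-identityʳ _))))))
   (sum-swap (λ x y → b2n (y == f x) * b2n (S x)))))
  (sum-mono (λ y → ≤-trans (≤-eq (sum-cong (λ x → mul∧ (y == f x) (S x)))) (col y)))
  where
  mul∧ : ∀ a b → b2n a * b2n b ≡ b2n (a ∧ b)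
  mul∧ true b = +-identityʳ _
  mul∧ false b = refl
  col : ∀ y → card (λ x → (y == f x) ∧ S x) ≤ b2n (U y)
  col y with U y in eq
  ... | true  = card-≤1 _ (λ a b p q → inj a b (∧-r {y == f a} p) (∧-r {y == f b} q) (trans (sym (==-e {x = y} {f a} (∧-l p))) (==-e {x = y} {f b} (∧-l q))))
  ... | false with card (λ x → (y == f x) ∧ S x) in eq2
  ...   | zero = z≤n
  ...   | suc k = let (x , p) = card-ex (λ x → (y == f x) ∧ S x) (subst (1 ≤_) (sym eq2) (s≤s z≤n)) in
      void (t≢f (trans (sym (into x (∧-r {y == f x} p))) (trans (cong U (sym (==-e {x = y} {f x} (∧-l p)))) eq)))

abstract
 card-≤n : ∀ {n} (S : Sub n) → card S ≤ n
 card-≤n {zero}  S = z≤n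
 card-≤n {suc n} S = +-mono-≤ (b2n≤1 (S zero)) (card-≤n (λ x → S (suc x)))

abstract
 card-full : ∀ n → card {n} (λ _ → true) ≡ n
 card-full zero    = refl
 card-full (suc n) = cong suc (card-full n)

card-∅ : ∀ {n} (S : Sub n) → (∀ x → ¬ (S x !)) → card S ≡ 0
card-∅ S h with card S in eq
... | zero = refl
... | suc k = let (x , p) = card-ex S (subst (1 ≤_) (sym eq) (s≤s z≤n)) in void (h x p)

-- Serves to enlarge a set of roots to exactly `2 * r` vertices, the size for which the edge count
-- of `Min.massed` is made.
pad : ∀ {n} (S U : Sub n) m → (∀ x → S x ! → U x !) → card S ≤ m → m ≤ card U →
 Σ[ V ∈ Sub n ] (∀ x → S x ! → V x !) × (∀ x → V x ! → U x !) × card V ≡ m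
pad {n} S U m su sm mu = go (m ∸ card S) S su refl sm
 where
 go : ∀ d S → (∀ x → S x ! → U x !) → m ∸ card S ≡ d → card S ≤ m →
  Σ[ V ∈ Sub n ] (∀ x → S x ! → V x !) × (∀ x → V x ! → U x !) × card V ≡ m
 go zero    S su e sm = S , (λ _ p → p) , su , ≤-antisym sm (m∸n≡0⇒m≤n e)
 go (suc d) S su e sm =
  let lt : card S < m
      lt = ≰⇒> (λ ms → 0≢1+n (trans (sym (m≤n⇒m∸n≡0 ms)) e))
      (x , p) = card-ex (λ x → U x ∧ not (S x)) (+-cancelˡ-≤ (card S) 1 _ (≤-trans (subst (_≤ m) (+-comm 1 _) lt)
        (≤-trans mu (card-∪ (λ x ux → [ inl , (λ ns → inr (∧-i ux (not-i ns))) ] (bool (S x)))))))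
      S' = λ y → S y ∨ (y == x)
      c : card S' ≡ suc (card S)
      c = ≤-antisym (subst (card S' ≤_) (trans (cong (card S +_) (card-sing x)) (+-comm _ 1)) (card-∪ (λ y q → ∨-e {S y} q)))
           (card-strict (λ y q → ∨-l q) x (∨-r {S x} (==-refl x)) (not-e (∧-r {U x} p)))
      (V , a , b , e') = go d S' (λ y q → [ su y , (λ r → subst (λ z → U z !) (sym (==-e r)) (∧-l p)) ] (∨-e {S y} q))
        (trans (cong (m ∸_) c) (trans (sym (pred[m∸n]≡m∸[1+n] m (card S))) (cong pred e))) (subst (_≤ m) (sym c) lt)
  in V , (λ y q → a y (∨-l q)) , b , e'

-- Maximum matchings and the Gallai–Edmonds barrier

module Matching {N : ℕ} (Adj : Fin N → Fin N → Set) (adj-sym : ∀ {x y} → Adj x y → Adj y x) where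

 -- A matching is an involution whose fixed points are the unmatched vertices. Agreement of two
 -- matchings at a vertex is then a plain equation.
 record Mat (W : Sub N) : Set where
  field
   μ   : Fin N → Fin N
   inv : ∀ x → μ (μ x) ≡ x
   ok  : ∀ x → μ x ≢ x → W x ! × Adj x (μ x)
 open Mat public

 missed : ∀ {W} → Mat W → Sub N
 missed {W} M x = W x ∧ (μ M x == x)

 miss : ∀ {W} → Mat W → ℕ
 miss M = card (missed M)

 missed-i : ∀ {W} (M : Mat W) {x} → W x ! → μ M x ≡ x → missed M x !
 missed-i M w e = ∧-i w (==-i e)

 missed-e : ∀ {W} (M : Mat W) {x} → missed M x ! → W x ! × μ M x ≡ x
 missed-e {W} M {x} p = ∧-l p , ==-e (∧-r {W x} p)

 lt : Fin N → Fin N → Bool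
 lt x y = toℕ x <ᵇ toℕ y

 lt-asym : ∀ {x y} → lt x y ! → lt y x ! → ⊥
 lt-asym {x} {y} p q = <-asym (<ᵇ⇒< _ _ (subst IsTrue (sym p) tt)) (<ᵇ⇒< (toℕ y) (toℕ x) (subst IsTrue (sym q) tt))

 lt-irr : ∀ {x} → lt x x ! → ⊥
 lt-irr {x} p = lt-asym {x} {x} p p

 lt-tri : ∀ {x y} → x ≢ y → lt x y ! ⊎ lt y x !
 lt-tri {x} {y} ne with toℕ x <? toℕ y
 ... | yes p = inl (T→≡ (<⇒<ᵇ p))
  where T→≡ : ∀ {b} → IsTrue b → b !
        T→≡ {true} _ = refl
 ... | no ¬p = inr (T→≡ (<⇒<ᵇ (≤∧≢⇒< (≮⇒≥ ¬p) (λ e → ne (toℕ-inj (sym e))))))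
  where T→≡ : ∀ {b} → IsTrue b → b !
        T→≡ {true} _ = refl
        open import Data.Fin.Properties using () renaming (toℕ-injective to toℕ-inj)

 up down : ∀ {W} → Mat W → Sub N
 up M x = lt x (μ M x)
 down M x = lt (μ M x) x

 size : ∀ {W} → Mat W → ℕ
 size M = card (up M)

 up≡down : ∀ {W} (M : Mat W) → card (up M) ≡ card (down M)
 up≡down M = ≤-antisym
  (card-inj (μ M) (λ x p → trans (cong (λ z → lt z (μ M x)) (inv M x)) p) (λ x y _ _ e → injμ x y e))
  (card-inj (μ M) (λ x p → trans (cong (lt (μ M x)) (inv M x)) p) (λ x y _ _ e → injμ x y e))
  where
  injμ : ∀ x y → μ M x ≡ μ M y → x ≡ y
  injμ x y e = trans (sym (inv M x)) (trans (cong (μ M) e) (inv M y))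

 card-W : ∀ {W} (M : Mat W) → card W ≡ miss M + (size M + size M)
 card-W {W} M = trans (card-def W) (trans (sum-cong pt) (trans (sum-+ (λ x → b2n (missed M x)) (λ x → b2n (up M x) + b2n (down M x)))
  (cong₂ _+_ (sym (card-def (missed M))) (trans (sum-+ (λ x → b2n (up M x)) (λ x → b2n (down M x)))
   (cong₂ _+_ (sym (card-def (up M))) (trans (sym (card-def (down M))) (sym (up≡down M))))))))
  where
  pt : ∀ x → b2n (W x) ≡ b2n (missed M x) + (b2n (up M x) + b2n (down M x))
  pt x with μ M x ≟F x
  ... | yes e rewrite e with lt x x in q
  ...   | true = void (lt-irr {x} q)
  ...   | false rewrite ==-refl x with W x
  ...     | true = refl
  ...     | false = refl
  pt x | no ne with ok M x ne | lt-tri ne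
  ... | w , _ | inl p rewrite w | p with lt x (μ M x) in q | μ M x == x in e
  ...   | true  | _ = void (lt-asym {x} {μ M x} q p)
  ...   | false | true = void (ne (==-e e))
  ...   | false | false = refl
  pt x | no ne | w , _ | inr p rewrite w | p with lt (μ M x) x in q | μ M x == x in e
  ...   | true  | _ = void (lt-asym {x} {μ M x} p q)
  ...   | false | true = void (ne (==-e e))
  ...   | false | false = refl

 IsMax : ∀ {W} → Mat W → Set
 IsMax {W} M = ∀ (M' : Mat W) → miss M ≤ miss M'

 emptyMat : ∀ W → Mat W
 emptyMat W = record { μ = λ x → x ; inv = λ _ → refl ; ok = λ x ne → void (ne refl) }

 maxMat : ∀ W → NN (Σ[ M ∈ Mat W ] IsMax M)
 maxMat W = argmin miss (emptyMat W)

 -- One alternating step: the missed vertex `x` takes `y` away from its partner, which becomes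
 -- missed in place of `x`. If `y` had no partner, the matching grows.
 module Rematch {W : Sub N} (M : Mat W) (x y : Fin N) (x≢y : x ≢ y) (wx : W x !) (wy : W y !)
         (a : Adj x y) (mx : μ M x ≡ x) where

  re : Fin N → Fin N
  re t with t ≟F x | t ≟F y | t ≟F μ M y
  ... | yes _ | _     | _     = y
  ... | no _  | yes _ | _     = x
  ... | no _  | no _  | yes _ = t
  ... | no _  | no _  | no _  = μ M t

  re-x : re x ≡ y
  re-x with x ≟F x | x ≟F y | x ≟F μ M y
  ... | yes _ | _ | _ = refl
  ... | no n  | _ | _ = void (n refl)

  re-y : re y ≡ x
  re-y with y ≟F x | y ≟F y | y ≟F μ M y
  ... | yes e | _ | _ = void (x≢y (sym e))
  ... | no _ | yes _ | _ = refl
  ... | no _ | no n  | _ = void (n refl)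

  re-o : ∀ {t} → t ≢ x → t ≢ y → t ≡ μ M y → re t ≡ t
  re-o {t} a b c with t ≟F x | t ≟F y | t ≟F μ M y
  ... | yes e | _ | _ = void (a e)
  ... | no _ | yes e | _ = void (b e)
  ... | no _ | no _ | yes _ = refl
  ... | no _ | no _ | no n = void (n c)

  re-n : ∀ {t} → t ≢ x → t ≢ y → t ≢ μ M y → re t ≡ μ M t
  re-n {t} a b c with t ≟F x | t ≟F y | t ≟F μ M y
  ... | yes e | _ | _ = void (a e)
  ... | no _ | yes e | _ = void (b e)
  ... | no _ | no _ | yes e = void (c e)
  ... | no _ | no _ | no _ = refl

  swap : ∀ {s t} → μ M s ≡ t → s ≡ μ M t
  swap {s} e = trans (sym (inv M s)) (cong (μ M) e)

  data Case (t : Fin N) : Set where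
   is-x : t ≡ x → Case t
   is-y : t ≡ y → Case t
   is-o : t ≢ x → t ≢ y → t ≡ μ M y → Case t
   is-n : t ≢ x → t ≢ y → t ≢ μ M y → Case t

  case : ∀ t → Case t
  case t with t ≟F x | t ≟F y | t ≟F μ M y
  ... | yes e | _ | _ = is-x e
  ... | no _ | yes e | _ = is-y e
  ... | no p | no q | yes e = is-o p q e
  ... | no p | no q | no r = is-n p q r

  reInv : ∀ t → re (re t) ≡ t
  reInv t with case t
  ... | is-x refl = trans (cong re re-x) re-y
  ... | is-y refl = trans (cong re re-y) re-x
  ... | is-o p q e = trans (cong re (re-o p q e)) (re-o p q e)
  ... | is-n p q r = trans (cong re (re-n p q r)) (trans (re-n (λ e → p (trans (swap e) mx)) (λ e → r (swap e))
      (λ e → q (trans (swap e) (inv M y)))) (inv M t))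

  reMat : Mat W
  reMat = record { μ = re ; inv = reInv ; ok = ok' }
   where
   ok' : ∀ t → re t ≢ t → W t ! × Adj t (re t)
   ok' t ne with case t
   ... | is-x refl = wx , subst (Adj t) (sym re-x) a
   ... | is-y refl = wy , subst (Adj t) (sym re-y) (adj-sym a)
   ... | is-o p q e = void (ne (re-o p q e))
   ... | is-n p q r = let e = re-n p q r ; (w , d) = ok M t (λ f → ne (trans e f)) in w , subst (Adj t) (sym e) d

  re-missed : ∀ t → missed reMat t ! → t ≢ x × t ≢ y × (t ≡ μ M y ⊎ missed M t !)
  re-missed t h with missed-e reMat h | case t
  ... | w , e | is-x refl = void (x≢y (trans (sym e) re-x))
  ... | w , e | is-y refl = void (x≢y (trans (sym re-y) e))
  ... | w , e | is-o p q f = p , q , inl f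
  ... | w , e | is-n p q r = p , q , inr (missed-i M w (trans (sym (re-n p q r)) e))

  x-missed : missed M x !
  x-missed = missed-i M wx mx

  rest : card (λ t → missed M t ∧ not (t == x)) < miss M
  rest = card-strict (λ t p → ∧-l p) x x-missed (λ p → not-e (∧-r {missed M x} p) (==-refl x))

  re-≤ : miss reMat ≤ miss M
  re-≤ = ≤-trans (≤-trans (card-∪ {U = λ t → missed M t ∧ not (t == x)} {V = λ t → t == μ M y}
   (λ t h → let (p , q , c) = re-missed t h in
     [ (λ e → inr (==-i e)) , (λ m → inl (∧-i m (not-i (λ e → p (==-e e))))) ] c))
   (≤-eq (trans (cong (card (λ t → missed M t ∧ not (t == x)) +_) (card-sing (μ M y))) (+-comm _ 1)))) rest

  re-< : μ M y ≡ y → miss reMat < miss M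
  re-< e = ≤-<-trans (card-mono (λ t h → let (p , q , c) = re-missed t h in
   [ (λ f → void (q (trans f e))) , (λ m → ∧-i m (not-i (λ e → p (==-e e)))) ] c)) rest

 -- Gallai's relation. It holds along edges, and once every vertex is missable it spreads to all
 -- pairs of distinct vertices of a component.
 Sim : Sub N → Fin N → Fin N → Set
 Sim W u v = (M : Mat W) → IsMax M → μ M u ≡ u → μ M v ≡ v → ⊥

 AllMissable : Sub N → Set
 AllMissable W = ∀ v → W v ! → NN (Σ[ M ∈ Mat W ] IsMax M × μ M v ≡ v)

 edge-sim : ∀ {W x y} → W x ! → W y ! → x ≢ y → Adj x y → Sim W x y
 edge-sim wx wy ne a M mx ex ey = <⇒≱ (Rematch.re-< M _ _ ne wx wy a ex ey) (mx (Rematch.reMat M _ _ ne wx wy a ex))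

 -- Among the maximum matchings missing v take one that agrees with M as often as possible;
 -- rematching a vertex it misses along M increases the agreement.
 sim-trans : ∀ {W} → AllMissable W → ∀ {u v w} → W u ! → W v ! → W w ! → u ≢ w →
  Sim W u v → Sim W v w → Sim W u w
 sim-trans {W} am {u} {v} {w} wu wv ww u≢w suv svw M mxM eu ew = run (am v wv >>= λ { (ν0 , mx0 , e0) →
  argmax {A = Σ[ ν ∈ Mat W ] IsMax ν × μ ν v ≡ v} agr N (λ a → card-≤n _) (ν0 , mx0 , e0) >>= λ { ((ν , mxν , ev) , best) →
  ret (go ν mxν ev best) }})
  where
  agr : Σ[ ν ∈ Mat W ] IsMax ν × μ ν v ≡ v → ℕ
  agr (ν , _) = card (λ t → μ ν t == μ M t)
  go : (ν : Mat W) (mxν : IsMax ν) (ev : μ ν v ≡ v) → (∀ b → agr b ≤ agr (ν , mxν , ev)) → ⊥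
  go ν mxν ev best = <⇒≱ more (best (R.reMat , (λ M' → ≤-trans R.re-≤ (mxν M')) , rv))
   where
   split : ∀ t → missed ν t ! → missed M t ! ⊎ ¬ (missed M t !) → Dec (t ≡ v) →
    missed ν t ∧ not (missed M t) ∧ not (t == v) ! ⊎ ((t == v) ∨ (missed M t ∧ not (t == u) ∧ not (t == w))) !
   split t h d (yes e) = inr (∨-l (==-i e))
   split t h (inr nm) (no ne) = inl (∧-i h (∧-i (not-i nm) (not-i (λ e → ne (==-e e)))))
   split t h (inl m) (no ne) = inr (∨-r {t == v} (∧-i m (∧-i
    (not-i (λ e → suv ν mxν (subst (λ z → μ ν z ≡ z) (==-e e) (snd (missed-e ν h))) ev))
    (not-i (λ e → svw ν mxν ev (subst (λ z → μ ν z ≡ z) (==-e e) (snd (missed-e ν h))))))))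
   odd : Sub N
   odd t = missed ν t ∧ not (missed M t) ∧ not (t == v)
   M' : Sub N
   M' t = missed M t ∧ not (t == u) ∧ not (t == w)
   -- `M` misses `u` and `w`, while `ν`, which misses `v`, covers both. As `M` misses no more
   -- vertices than `ν` does, `ν` misses a vertex besides `v` that `M` covers; this is the `x`
   -- below.
   c1 : miss ν ≤ card odd + (1 + card M')
   c1 = ≤-trans (card-∪ {U = odd} {V = λ t → (t == v) ∨ M' t} (λ t h → split t h (bool (missed M t)) (t ≟F v)))
       (+-monoʳ-≤ (card odd) (≤-trans (card-∪ {U = _== v} {V = M'} (λ t h → ∨-e h)) (≤-eq (cong (_+ card M') (card-sing v)))))
   c2' : 2 ≤ card (λ t → (t == u) ∨ (t == w))
   c2' = ≤-trans (≤-eq (sym (cong₂ _+_ (card-sing u) (card-sing w)))) (card-⊎ {U = _== u} {V = _== w} (λ t → ∨-l) (λ t → ∨-r {t == u})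
       (λ t p q → u≢w (trans (sym (==-e p)) (==-e q))))
   c3 : card (λ t → (t == u) ∨ (t == w)) + card M' ≤ miss M
   c3 = card-⊎ (λ t h → [ (λ e → subst (λ z → missed M z !) (sym (==-e e)) (missed-i M wu eu)) ,
               (λ e → subst (λ z → missed M z !) (sym (==-e e)) (missed-i M ww ew)) ] (∨-e h))
       (λ t → ∧-l) (λ t p q → [ not-e (∧-l (∧-r {missed M t} q)) , not-e (∧-r {not (t == u)} (∧-r {missed M t} q)) ] (∨-e p))
   c : 1 ≤ card odd
   c = lin (1 ∷ 1 ∷ 1 ∷ 1 ∷ 1 ∷ []) (miss ν ∷ card odd ∷ card M' ∷ miss M ∷ card (λ t → (t == u) ∨ (t == w)) ∷ [])
      (λ n o m k d → n :≤ o :+ (# 1 :+ m) ⇒ # 2 :≤ d ⇒ d :+ m :≤ k ⇒ k :≤ n ⇒ qed (# 1 :≤ o))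
      c1 c2' c3 (mxM ν)
   x = fst (card-ex odd c)
   ox : odd x !
   ox = snd (card-ex odd c)
   wx = fst (missed-e ν (∧-l ox))
   ex = snd (missed-e ν (∧-l ox))
   x≢v : x ≢ v
   x≢v e = not-e (∧-r {not (missed M x)} (∧-r {missed ν x} ox)) (==-i e)
   y = μ M x
   y≢x : y ≢ x
   y≢x e = not-e (∧-l (∧-r {missed ν x} ox)) (missed-i M wx e)
   axy = snd (ok M x y≢x)
   wy = fst (ok M y (λ e → y≢x (sym (trans (sym (inv M x)) e))))
   module R = Rematch ν x y (λ e → y≢x (sym e)) wx wy axy ex
   νy : μ ν y ≢ y
   νy e = <⇒≱ (R.re-< e) (mxν R.reMat)
   v≢y : v ≢ y
   v≢y e = νy (subst (λ z → μ ν z ≡ z) e ev)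
   rv : R.re v ≡ v
   rv = trans (R.re-n (λ e → x≢v (sym e)) v≢y (λ e → v≢y (trans (sym ev) (trans (cong (μ ν) e) (inv ν y))))) ev
   -- The rematching alters `ν` only at `x`, at `y` and at the old partner of `y`, and at none of
   -- these did `ν` agree with `M`. So all agreements survive, and one at `x` is gained.
   keep1 : ∀ t → μ ν t ≡ μ M t → t ≢ x
   keep1 t e f = y≢x (sym (trans (sym ex) (subst (λ z → μ ν z ≡ μ M z) f e)))
   keep2 : ∀ t → μ ν t ≡ μ M t → t ≢ y
   keep2 t e f = y≢x (sym (trans (sym ex) (trans (cong (μ ν) (sym (trans (subst (λ z → μ ν z ≡ μ M z) f e) (inv M x)))) (inv ν y))))
   keep3 : ∀ t → μ ν t ≡ μ M t → t ≢ μ ν y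
   keep3 t e f = keep1 t e (trans (sym (inv M t)) (trans (cong (μ M) (trans (sym e) (trans (cong (μ ν) f) (inv ν y)))) (inv M x)))
   keep : ∀ t → μ ν t ≡ μ M t → R.re t ≡ μ M t
   keep t e = trans (R.re-n (keep1 t e) (keep2 t e) (keep3 t e)) e
   more : card (λ t → μ ν t == μ M t) < card (λ t → R.re t == μ M t)
   more = card-strict (λ t p → ==-i (keep t (==-e p))) x (==-i R.re-x) (λ p → y≢x (sym (trans (sym ex) (==-e p))))

 data Conn (W : Sub N) : Fin N → Fin N → Set where
  nil  : ∀ {x} → W x ! → Conn W x x
  cons : ∀ {x y z} → W x ! → Adj x y → Conn W y z → Conn W x z

 conn-l : ∀ {W x y} → Conn W x y → W x !
 conn-l (nil w) = w
 conn-l (cons w _ _) = w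

 conn-r : ∀ {W x y} → Conn W x y → W y !
 conn-r (nil w) = w
 conn-r (cons _ _ c) = conn-r c

 conn-trans : ∀ {W x y z} → Conn W x y → Conn W y z → Conn W x z
 conn-trans (nil _) d = d
 conn-trans (cons w a c) d = cons w a (conn-trans c d)

 conn-sym : ∀ {W x y} → Conn W x y → Conn W y x
 conn-sym (nil w) = nil w
 conn-sym (cons w a c) = conn-trans (conn-sym c) (cons (conn-l c) (adj-sym a) (nil w))

 -- Transitivity along the connecting walk. The form in which this is used: a maximum matching
 -- misses at most one vertex of each component.
 conn-sim : ∀ {W} → AllMissable W → ∀ {x y} → Conn W x y → x ≢ y → Sim W x y
 conn-sim am (nil _) ne = void (ne refl)
 conn-sim am {x} {y} (cons {y = z} w a c) ne with x ≟F z | z ≟F y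
 ... | yes refl | _        = conn-sim am c ne
 ... | no x≢z   | yes refl = edge-sim w (conn-l c) x≢z a
 ... | no x≢z   | no z≢y   = sim-trans am w (conn-l c) (conn-r c) ne (edge-sim w (conn-l c) x≢z a) (conn-sim am c z≢y)

 -- A certificate of Tutte-Berge type: every vertex of `W` outside `W'` raises the number of missed
 -- vertices by at least one on average. `count` states this without subtraction.
 record Barrier (W : Sub N) (m : ℕ) : Set where
  field
   W'       : Sub N
   W'⊆W     : ∀ x → W' x ! → W x !
   M'       : Mat W'
   max      : IsMax M'
   missable : AllMissable W'
   count    : m + card W ≤ miss M' + card W'

 -- As long as some vertex is covered by all maximum matchings it is deleted, and each deletion
 -- increases the number of missed vertices.
 barrier : ∀ {W} (M : Mat W) → IsMax M → NN (Barrier W (miss M))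
 barrier {W} M mx = go (card W) W ≤-refl M mx
  where
  go : ∀ c W → card W ≤ c → (M : Mat W) → IsMax M → NN (Barrier W (miss M))
  lower : ∀ c W → card W ≤ c → (M : Mat W) → IsMax M → ∀ v → W v ! → ¬ NN (Σ[ M ∈ Mat W ] IsMax M × μ M v ≡ v) → NN (Barrier W (miss M))
  go c W le M mx = em (Σ[ v ∈ Fin N ] W v ! × ¬ NN (Σ[ M ∈ Mat W ] IsMax M × μ M v ≡ v)) >>= λ where
   (no h) → ret (record { W' = W ; W'⊆W = λ _ p → p ; M' = M ; max = mx
              ; missable = λ v w k → h (v , w , λ nn → nn k) ; count = ≤-refl })
   (yes (v , w , nm)) → lower c W le M mx v w nm
  lower zero W le M mx v w nm = void (<⇒≱ (card-pos W w) le)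
  lower (suc c) W le M mx v w nm = maxMat W1 >>= λ { (M1 , mx1) →
   go c W1 (≤-pred (<-≤-trans W1<W le)) M1 mx1 >>= λ B → ret (record
    { W' = Barrier.W' B ; W'⊆W = λ x p → ∧-l (Barrier.W'⊆W B x p) ; M' = Barrier.M' B ; max = Barrier.max B
    ; missable = Barrier.missable B
    ; count = cnt M1 (miss (Barrier.M' B)) (card (Barrier.W' B)) (Barrier.count B) }) }
   where
   W1 : Sub N
   W1 x = W x ∧ not (x == v)
   W1<W : card W1 < card W
   W1<W = card-strict (λ x → ∧-l) v w (λ p → not-e (∧-r {W v} p) (==-refl v))
   W≤ : card W ≤ suc (card W1)
   W≤ = ≤-trans (card-∪ {U = _== v} {V = W1} (λ x p → [ inl , (λ ne → inr (∧-i p (not-i ne))) ] (bool (x == v))))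
       (≤-eq (cong (_+ card W1) (card-sing v)))
   lift : Mat W1 → Mat W
   lift M1 = record { μ = μ M1 ; inv = inv M1 ; ok = λ x ne → ∧-l (fst (ok M1 x ne)) , snd (ok M1 x ne) }
   cnt : ∀ (M1 : Mat W1) a b → miss M1 + card W1 ≤ a + b → miss M + card W ≤ a + b
   cnt M1 a b h = lin (2 ∷ 0 ∷ 1 ∷ 2 ∷ 1 ∷ 1 ∷ 1 ∷ []) (miss M ∷ size M ∷ miss M1 ∷ size M1 ∷ card W ∷ card W1 ∷ a ∷ b ∷ [])
    (λ m s m₁ s1 w w1 a b → s1 :< s ⇒ w :≤ m :+ (s :+ s) ⇒ m :+ (s :+ s) :≤ w ⇒ w :≤ # 1 :+ w1 ⇒
      w1 :≤ m₁ :+ (s1 :+ s1) ⇒ m₁ :+ w1 :≤ a :+ b ⇒ qed (m :+ w :≤ a :+ b))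
    sz (≤-eq (card-W M)) (≤-eq (sym (card-W M))) W≤ (≤-eq (card-W M1)) h
    where
    μv : μ M1 v ≡ v
    μv with μ M1 v ≟F v
    ... | yes e = e
    ... | no ne = void (not-e (∧-r {W v} (fst (ok M1 v ne))) (==-refl v))
    -- Otherwise `M1`, read as a matching of `W`, would be maximum and miss `v`.
    sz : size M1 < size M
    sz = ≰⇒> λ s≤ → nm λ k → k (lift M1 , (λ M″ → ≤-trans (+-cancelʳ-≤ (size M + size M) _ _ (begin
       miss (lift M1) + (size M + size M) ≤⟨ +-monoʳ-≤ (miss (lift M1)) (+-mono-≤ s≤ s≤) ⟩
       miss (lift M1) + (size M1 + size M1) ≡⟨ sym (card-W (lift M1)) ⟩
       card W ≡⟨ card-W M ⟩
       miss M + (size M + size M) ∎)) (mx M″)) , μv)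
     where open ≤-Reasoning

-- Lists without repetition, parity of lengths

Uniq : ∀ {A : Set} → List A → Set
Uniq []      = ⊤
Uniq (x ∷ L) = x ∉ L × Uniq L

uniq-++ : ∀ {A : Set} (L M : List A) → Uniq L → Uniq M → (∀ {x} → x ∈ L → x ∈ M → ⊥) → Uniq (L ++ M)
uniq-++ []      M u w d = w
uniq-++ (x ∷ L) M (x∉ , u) w d = (λ m → [ x∉ , d (here refl) ] (∈⁻ L m)) , uniq-++ L M u w (λ a b → d (there a) b)

isOdd : ℕ → Bool
isOdd zero    = false
isOdd (suc n) = not (isOdd n)

isOdd-+ : ∀ m n → isOdd (m + n) ≡ isOdd m xor isOdd n
isOdd-+ zero    n = refl
isOdd-+ (suc m) n rewrite isOdd-+ m n with isOdd m | isOdd n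
... | true  | true  = refl
... | true  | false = refl
... | false | true  = refl
... | false | false = refl

xor-self : ∀ a → a xor a ≡ false
xor-self true  = refl
xor-self false = refl

-- The double cover: every vertex v has the two copies mk v false and mk v true.

module DC (n : ℕ) where
 abstract
  mk : Fin n → Bool → Fin (n + n)
  mk v false = v ↑ˡ n
  mk v true  = n ↑ʳ v

  base : Fin (n + n) → Fin n
  base x = [ (λ v → v) , (λ v → v) ] (splitAt n x)

  side : Fin (n + n) → Bool
  side x = [ (λ _ → false) , (λ _ → true) ] (splitAt n x)

  base-mk : ∀ v b → base (mk v b) ≡ v
  base-mk v false rewrite splitAt-↑ˡ n v n = refl
  base-mk v true  rewrite splitAt-↑ʳ n n v = refl

  side-mk : ∀ v b → side (mk v b) ≡ b
  side-mk v false rewrite splitAt-↑ˡ n v n = refl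
  side-mk v true  rewrite splitAt-↑ʳ n n v = refl

  mk-η : ∀ x → mk (base x) (side x) ≡ x
  mk-η x with splitAt n x in e
  ... | inl v = trans (cong (λ s → [ _↑ˡ n , n ↑ʳ_ ] s) (sym e)) (join-splitAt n n x)
  ... | inr v = trans (cong (λ s → [ _↑ˡ n , n ↑ʳ_ ] s) (sym e)) (join-splitAt n n x)

  card-cover : ∀ S → card S ≡ card (λ v → S (mk v false)) + card (λ v → S (mk v true))
  card-cover S = trans (card-def S) (trans (split n (λ x → b2n (S x)))
    (cong₂ _+_ (sym (card-def (λ v → S (mk v false)))) (sym (card-def (λ v → S (mk v true))))))
   where
   split : ∀ m {k} (f : Fin (m + k) → ℕ) → sum f ≡ sum (λ i → f (i ↑ˡ k)) + sum (λ i → f (m ↑ʳ i))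
   split zero    f = refl
   split (suc m) f = trans (cong (f zero +_) (split m (λ i → f (suc i)))) (sym (+-assoc (f zero) _ _))

 mir : Fin (n + n) → Fin (n + n)
 mir x = mk (base x) (not (side x))

 base-mir : ∀ x → base (mir x) ≡ base x
 base-mir x = base-mk _ _

 side-mir : ∀ x → side (mir x) ≡ not (side x)
 side-mir x = side-mk _ _

 cover-≡ : ∀ {x y} → base x ≡ base y → side x ≡ side y → x ≡ y
 cover-≡ {x} {y} p q = trans (sym (mk-η x)) (trans (cong₂ mk p q) (mk-η y))

 mir-mir : ∀ x → mir (mir x) ≡ x
 mir-mir x = cover-≡ (trans (base-mir _) (base-mir x)) (trans (side-mir _) (trans (cong not (side-mir x)) (nn (side x))))
  where nn : ∀ b → not (not b) ≡ b
        nn true = refl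
        nn false = refl

 mir-≢ : ∀ x → mir x ≢ x
 mir-≢ x e with side x | trans (sym (side-mir x)) (cong side e)
 ... | true  | ()
 ... | false | ()

 same-base : ∀ {x y} → base x ≡ base y → y ≡ x ⊎ y ≡ mir x
 same-base {x} {y} e with bcase (side x) (side y)
  where
  bcase : ∀ a b → b ≡ a ⊎ b ≡ not a
  bcase true true = inl refl
  bcase true false = inr refl
  bcase false true = inr refl
  bcase false false = inl refl
 ... | inl p = inl (cover-≡ (sym e) p)
 ... | inr p = inr (cover-≡ (trans (sym e) (sym (base-mir x))) (trans p (sym (side-mir x))))

-- Reading disjoint paths off a matching of the double cover

data Chain {n : ℕ} (E : Fin n → Fin n → Bool) : Fin n → List (Fin n) → Fin n → Set where
 edge : ∀ {u v} → E u v ! → Chain E u [] v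
 _∷ᶜ_ : ∀ {u x xs v} → E u x ! → Chain E x xs v → Chain E u (x ∷ xs) v

_⊕ᶜ_ : ∀ {n} {E : Fin n → Fin n → Bool} {u xs v ys w} → Chain E u xs v → Chain E v ys w → Chain E u (xs ++ v ∷ ys) w
edge e   ⊕ᶜ d = e ∷ᶜ d
(e ∷ᶜ c) ⊕ᶜ d = e ∷ᶜ (c ⊕ᶜ d)

module Cover {n : ℕ} (E : Fin n → Fin n → Bool) (E-sym : ∀ {u v} → E u v ! → E v u !)
       (Q : Sub n) (τ : Bool) where

 open DC n public

 -- The vertical edges let a vertex of `Q` stay off all paths: its two copies are matched to each
 -- other. With `τ` true all edges change side and the cover is bipartite, as Menger's theorem
 -- wants; with `τ` false only vertical edges do, and sides record parity.
 CAdj : Fin (n + n) → Fin (n + n) → Set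
 CAdj x y = (base x ≡ base y × side x ≢ side y × Q (base x) !)
      ⊎ (E (base x) (base y) ! × side x xor side y ≡ τ)

 cadj-sym : ∀ {x y} → CAdj x y → CAdj y x
 cadj-sym (inl (p , q , r)) = inl (sym p , (λ e → q (sym e)) , subst (λ z → Q z !) p r)
 cadj-sym {x} {y} (inr (p , q)) = inr (E-sym p , trans (xc (side y) (side x)) q)
  where xc : ∀ a b → a xor b ≡ b xor a
        xc true true = refl
        xc true false = refl
        xc false true = refl
        xc false false = refl

 open Matching CAdj cadj-sym public

 -- A matching is turned into disjoint paths by eliminating the vertices of Q one after another:
 -- the partners of the two copies of an eliminated vertex v become partners, through v.
 module Extract (W : Sub (n + n)) (WQ : ∀ v b → Q v ! → W (mk v b) !) where

  term : Sub n → Sub (n + n)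
  term P x = W x ∧ not (P (base x))

  -- Passing through an inner vertex means changing to its other copy. With `m` inner vertices the
  -- side changes `m` times if `τ` is false, and `2 * m + 1` times if `τ` is true, since then the
  -- `m + 1` edges contribute as well.
  Route : (θ : Fin (n + n) → Fin (n + n)) (ints : Fin (n + n) → List (Fin n)) → Fin (n + n) → Set
  Route θ ints x = (base x ≡ base (θ x) × Q (base x) ! × ints x ≡ [])
   ⊎ (Chain E (base x) (ints x) (base (θ x)) × side x xor side (θ x) ≡ (τ ∨ isOdd (length (ints x))))

  -- `P` holds the eliminated vertices. By `disj` an inner vertex is shared only by the two ends of
  -- one route; `lost` keeps the number of unpaired copies below the number missed by the initial
  -- matching.
  record St (P : Sub n) (m : ℕ) : Set where
   field
    θ     : Fin (n + n) → Fin (n + n)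
    ints  : Fin (n + n) → List (Fin n)
    θθ    : ∀ x → θ (θ x) ≡ x
    live  : ∀ x → θ x ≢ x → term P x !
    route : ∀ x → θ x ≢ x → Route θ ints x
    fixed : ∀ x → θ x ≡ x → ints x ≡ []
    inP   : ∀ {x y} → y ∈ ints x → P y !
    uniq  : ∀ x → Uniq (ints x)
    same  : ∀ {x y} → y ∈ ints x → y ∈ ints (θ x)
    disj  : ∀ {x x' y} → y ∈ ints x → y ∈ ints x' → x' ≡ x ⊎ x' ≡ θ x
    lost  : card (λ x → term P x ∧ (θ x == x)) ≤ m

  start : (M : Mat W) → St (λ _ → false) (miss M)
  start M = record
   { θ = μ M ; ints = λ _ → [] ; θθ = inv M ; live = λ x ne → ∧-i (fst (ok M x ne)) refl
   ; route = λ x ne → rt x (snd (ok M x ne)) ; fixed = λ _ _ → refl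
   ; inP = λ () ; uniq = λ _ → tt ; same = λ () ; disj = λ () ; lost = card-mono (λ x p → ∧-i (∧-l (∧-l p)) (∧-r {W x ∧ true} p)) }
   where
   rt : ∀ x → CAdj x (μ M x) → Route (μ M) (λ _ → []) x
   rt x (inl (p , _ , q)) = inl (p , q , refl)
   rt x (inr (p , q)) = inr (edge p , trans q (orf τ))
    where orf : ∀ b → b ≡ b ∨ false
          orf true = refl
          orf false = refl

  module Step {P : Sub n} {m : ℕ} (S : St P m) (v : Fin n) (qv : Q v !) (pv : ¬ (P v !)) where
   open St S

   -- In the case `loose` the route breaks off at `v`, whose other copy is unpaired; `z` becomes
   -- unpaired in its stead.
   data Case (z : Fin (n + n)) : Fin (n + n) → List (Fin n) → Set where
    dead  : base z ≡ v → Case z z []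
    keep  : base z ≢ v → base (θ z) ≢ v → Case z (θ z) (ints z)
    loose : base z ≢ v → base (θ z) ≡ v → θ (mir (θ z)) ≡ mir (θ z) → Case z z []
    join  : base z ≢ v → base (θ z) ≡ v → θ (mir (θ z)) ≢ mir (θ z) →
        Case z (θ (mir (θ z))) (ints z ++ v ∷ ints (mir (θ z)))

   view : ∀ z → Σ[ y ∈ Fin (n + n) ] Σ[ L ∈ List (Fin n) ] Case z y L
   view z with base z ≟F v | base (θ z) ≟F v | θ (mir (θ z)) ≟F mir (θ z)
   ... | yes e | _     | _     = _ , _ , dead e
   ... | no a  | no b  | _     = _ , _ , keep a b
   ... | no a  | yes b | yes c = _ , _ , loose a b c
   ... | no a  | yes b | no c  = _ , _ , join a b c

   θ' : Fin (n + n) → Fin (n + n)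
   θ' z = fst (view z)
   ints' : Fin (n + n) → List (Fin n)
   ints' z = fst (snd (view z))

   case-unique : ∀ {z y L y' L'} → Case z y L → Case z y' L' → y ≡ y' × L ≡ L'
   case-unique (dead _) (dead _) = refl , refl
   case-unique (dead e) (keep a _) = void (a e)
   case-unique (dead e) (loose a _ _) = void (a e)
   case-unique (dead e) (join a _ _) = void (a e)
   case-unique (keep a _) (dead e) = void (a e)
   case-unique (keep _ _) (keep _ _) = refl , refl
   case-unique (keep _ b) (loose _ c _) = void (b c)
   case-unique (keep _ b) (join _ c _) = void (b c)
   case-unique (loose a _ _) (dead e) = void (a e)
   case-unique (loose _ c _) (keep _ b) = void (b c)
   case-unique (loose _ _ _) (loose _ _ _) = refl , refl
   case-unique (loose _ _ c) (join _ _ d) = void (d c)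
   case-unique (join a _ _) (dead e) = void (a e)
   case-unique (join _ c _) (keep _ b) = void (b c)
   case-unique (join _ _ d) (loose _ _ c) = void (d c)
   case-unique (join _ _ _) (join _ _ _) = refl , refl

   swap : ∀ {x y} → θ x ≡ y → x ≡ θ y
   swap {x} e = trans (sym (θθ x)) (cong θ e)

   back : ∀ {z} → base z ≢ v → base (θ z) ≡ v → θ (mir (θ z)) ≢ mir (θ z) →
    Case (θ (mir (θ z))) z (ints (θ (mir (θ z))) ++ v ∷ ints (θ z))
   back {z} a b c = subst₂ (λ p L → Case u p (ints u ++ v ∷ ints L)) e2 e1 (join bu bθu cu)
    where
    t = θ z
    u = θ (mir t)
    θu : θ u ≡ mir t
    θu = θθ (mir t)
    bu : base u ≢ v
    bu e = [ (λ f → a (trans (cong base (trans (swap refl) (trans (cong θ (sym f)) θu))) (trans (base-mir t) b)))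
        , (λ f → c f) ] (same-base {x = t} (trans b (sym e)))
    bθu : base (θ u) ≡ v
    bθu = trans (cong base θu) (trans (base-mir t) b)
    e1 : mir (θ u) ≡ t
    e1 = trans (cong mir θu) (mir-mir t)
    e2 : θ (mir (θ u)) ≡ z
    e2 = trans (cong θ e1) (θθ z)
    cu : θ (mir (θ u)) ≢ mir (θ u)
    cu f = a (trans (cong base (trans (sym e2) (trans f e1))) b)

   case-base : ∀ {u y L} → Case u y L → base u ≢ v ⊎ y ≡ u
   case-base (dead _) = inr refl
   case-base (keep x _) = inl x
   case-base (loose x _ _) = inl x
   case-base (join x _ _) = inl x

   back-base : ∀ {z} → base z ≢ v → base (θ z) ≡ v → θ (mir (θ z)) ≢ mir (θ z) → base (θ (mir (θ z))) ≢ v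
   back-base a b c e = [ (λ x → x e) , (λ f → a (trans (cong base f) e)) ] (case-base (back a b c))

   θ-of : ∀ {z y L} → Case z y L → θ' z ≡ y
   θ-of {z} c = fst (case-unique (snd (snd (view z))) c)

   ints-of : ∀ {z y L} → Case z y L → ints' z ≡ L
   ints-of {z} c = snd (case-unique (snd (snd (view z))) c)

   P' : Sub n
   P' x = P x ∨ (x == v)

   θθ' : ∀ z → θ' (θ' z) ≡ z
   θθ' z with view z
   ... | _ , _ , dead e = θ-of (dead e)
   ... | _ , _ , keep a b = trans (θ-of (keep b (λ e → a (trans (cong base (sym (θθ z))) e)))) (θθ z)
   ... | _ , _ , loose a b c = θ-of (loose a b c)
   ... | _ , _ , join a b c = θ-of (back a b c)

   term' : ∀ {z} → base z ≢ v → term P z ! → term P' z !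
   term' {z} a t = ∧-i (∧-l t) (not-i (λ p → [ not-e (∧-r {W z} t) , (λ e → a (==-e e)) ] (∨-e {P (base z)} p)))

   live' : ∀ z → θ' z ≢ z → term P' z !
   live' z ne with view z
   ... | _ , _ , dead e = void (ne refl)
   ... | _ , _ , keep a b = term' a (live z ne)
   ... | _ , _ , loose a b c = void (ne refl)
   ... | _ , _ , join a b c = term' a (live z (λ f → a (trans (cong base (sym f)) b)))

   chain-of : ∀ x → θ x ≢ x → base x ≢ base (θ x) →
    Chain E (base x) (ints x) (base (θ x)) × side x xor side (θ x) ≡ (τ ∨ isOdd (length (ints x)))
   chain-of x ne d with route x ne
   ... | inl (e , _) = void (d e)
   ... | inr c = c

   par : ∀ t p q → ((t ∨ p) xor true) xor (t ∨ q) ≡ t ∨ not (p xor q)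
   par true p q = refl
   par false true true = refl
   par false true false = refl
   par false false true = refl
   par false false false = refl

   xor3 : ∀ a b c → a xor c ≡ ((a xor b) xor true) xor (not b xor c)
   xor3 true true true = refl
   xor3 true true false = refl
   xor3 true false true = refl
   xor3 true false false = refl
   xor3 false true true = refl
   xor3 false true false = refl
   xor3 false false true = refl
   xor3 false false false = refl

   route' : ∀ z → θ' z ≢ z → Route θ' ints' z
   route' z ne with view z
   ... | _ , _ , dead e = void (ne refl)
   ... | _ , _ , loose a b c = void (ne refl)
   ... | _ , _ , keep a b = route z ne
   ... | _ , _ , join a b c = inr (ch , pr)
    where
    t = θ z
    u = θ (mir t)
    bu : base u ≢ v
    bu = back-base a b c
    c1 = chain-of z (λ f → a (trans (cong base (sym f)) b)) (λ e → a (trans e b))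
    c₂ = chain-of (mir t) c (λ e → bu (trans (sym e) (trans (base-mir t) b)))
    ch : Chain E (base z) (ints z ++ v ∷ ints (mir t)) (base u)
    ch = subst (λ w → Chain E (base z) (ints z) w) b (fst c1) ⊕ᶜ
       subst (λ w → Chain E w (ints (mir t)) (base u)) (trans (base-mir t) b) (fst c₂)
    pr : side z xor side u ≡ (τ ∨ isOdd (length (ints z ++ v ∷ ints (mir t))))
    pr = trans (xor3 (side z) (side t) (side u)) (trans
        (cong₂ (λ p q → (p xor true) xor q) (snd c1) (trans (cong (_xor side u) (sym (side-mir t))) (snd c₂)))
        (trans (par τ (isOdd (length (ints z))) (isOdd (length (ints (mir t)))))
        (cong (τ ∨_) (sym (trans (cong isOdd (length-++ (ints z))) (trans (isOdd-+ (length (ints z)) _) (xn (isOdd (length (ints z))) _)))))))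
     where xn : ∀ p q → p xor not q ≡ not (p xor q)
           xn true true = refl
           xn true false = refl
           xn false true = refl
           xn false false = refl

   v∉ : ∀ {x} → v ∈ ints x → ⊥
   v∉ p = pv (inP p)

   fixed' : ∀ z → θ' z ≡ z → ints' z ≡ []
   fixed' z e with view z
   ... | _ , _ , dead _ = refl
   ... | _ , _ , keep a b = fixed z e
   ... | _ , _ , loose a b c = refl
   ... | _ , _ , join a b c = void (mir-≢ (θ z) (trans (sym (θθ _)) (cong θ e)))

   v∈P' : P' v !
   v∈P' = ∨-r {P v} (==-refl v)

   inP' : ∀ {z y} → y ∈ ints' z → P' y !
   inP' {z} p with view z
   inP' () | _ , _ , dead _
   ... | _ , _ , keep a b = ∨-l (inP p)
   inP' () | _ , _ , loose a b c
   ... | _ , _ , join a b c with ∈⁻ (ints z) p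
   ...   | inl q = ∨-l (inP q)
   ...   | inr (here refl) = v∈P'
   ...   | inr (there q) = ∨-l (inP q)

   uniq' : ∀ z → Uniq (ints' z)
   uniq' z with view z
   ... | _ , _ , dead _ = tt
   ... | _ , _ , keep a b = uniq z
   ... | _ , _ , loose a b c = tt
   ... | _ , _ , join a b c = uniq-++ (ints z) _ (uniq z) (v∉ , uniq _) d
    where
    d : ∀ {x} → x ∈ ints z → x ∈ v ∷ ints (mir (θ z)) → ⊥
    d p (here refl) = v∉ p
    d p (there q) = [ (λ e → a (trans (cong base (sym e)) (trans (base-mir _) b))) , mir-≢ (θ z) ] (disj p q)

   same' : ∀ {z y} → y ∈ ints' z → y ∈ ints' (θ' z)
   same' {z} {y} p with view z
   same' () | _ , _ , dead _
   ... | _ , _ , keep a b = subst (y ∈_) (sym (ints-of (keep b (λ e → a (trans (cong base (sym (θθ z))) e))))) (same p)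
   same' () | _ , _ , loose a b c
   ... | _ , _ , join a b c = subst (y ∈_) (sym (ints-of (back a b c))) (mem (∈⁻ (ints z) p))
    where
    u = θ (mir (θ z))
    mem : y ∈ ints z ⊎ y ∈ v ∷ ints (mir (θ z)) → y ∈ ints u ++ v ∷ ints (θ z)
    mem (inl q) = ∈ʳ (ints u) (there (same q))
    mem (inr (here refl)) = ∈ʳ (ints u) (here refl)
    mem (inr (there q)) = ∈ˡ (same q)

   data Src (z : Fin (n + n)) (y : Fin n) : Set where
    own : base z ≢ v → y ∈ ints z → (base (θ z) ≢ v → θ' z ≡ θ z) → (base (θ z) ≡ v → θ' z ≡ θ (mir (θ z))) → Src z y
    far : base z ≢ v → base (θ z) ≡ v → θ' z ≡ θ (mir (θ z)) → base (θ' z) ≢ v → y ∈ ints (mir (θ z)) → Src z y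
    mid : y ≡ v → base z ≢ v → base (θ z) ≡ v → θ' z ≡ θ (mir (θ z)) → Src z y

   src : ∀ {z y} → y ∈ ints' z → Src z y
   src {z} p with view z in eq
   src () | _ , _ , dead _
   ... | _ , _ , keep a b = own a p (λ _ → cong fst eq) (λ e → void (b e))
   src () | _ , _ , loose a b c
   ... | _ , _ , join a b c with ∈⁻ (ints z) p
   ...   | inl q = own a q (λ n → void (n b)) (λ _ → cong fst eq)
   ...   | inr (here e) = mid e a b (cong fst eq)
   ...   | inr (there q) = far a b (cong fst eq) (λ e → back-base a b c (trans (cong base (sym (cong fst eq))) e)) q

   disj' : ∀ {z z' y} → y ∈ ints' z → y ∈ ints' z' → z' ≡ z ⊎ z' ≡ θ' z
   disj' {z} {z'} p p' with src p | src p'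
   ... | own a q k j | own a' q' _ _ with disj q q'
   ...   | inl e = inl e
   ...   | inr e = inr (trans e (sym (k (λ f → a' (trans (cong base e) f)))))
   disj' p p' | own a q k j | mid refl _ _ _ = void (v∉ q)
   disj' p p' | mid refl _ _ _ | own a q k j = void (v∉ q)
   disj' p p' | far _ _ _ _ q | mid refl _ _ _ = void (v∉ q)
   disj' p p' | mid refl _ _ _ | far _ _ _ _ q = void (v∉ q)
   disj' {z} {z'} p p' | own a q k j | far a' b' e' _ q' with disj q q'
   ...   | inl e = void (a (trans (cong base (sym e)) (trans (base-mir _) b')))
   ...   | inr e = inr (trans (swap (trans (sym (mir-mir _)) (cong mir e))) (sym (j (trans (cong base (sym e)) (trans (base-mir _) b')))))
   disj' {z} {z'} p p' | far a b e _ q | own a' q' _ _ with disj q q'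
   ...   | inl f = void (a' (trans (cong base f) (trans (base-mir _) b)))
   ...   | inr f = inr (trans f (sym e))
   disj' {z} {z'} p p' | far a b e nb q | far a' b' e' _ q' with disj q q'
   ...   | inl f = inl (trans (swap (trans (sym (mir-mir _)) (trans (cong mir f) (mir-mir _)))) (θθ z))
   ...   | inr f = void (nb (trans (cong base (trans e (sym f))) (trans (base-mir _) b')))
   disj' {z} {z'} p p' | mid _ a b e | mid _ a' b' e' with same-base {x = θ z} {y = θ z'} (trans b (sym b'))
   ...   | inl f = inl (trans (swap f) (θθ z))
   ...   | inr f = inr (trans (swap f) (sym e))

   lost' : card (λ z → term P' z ∧ (θ' z == z)) ≤ m
   lost' = ≤-trans (card-inj g into inj) lost
    where
    -- A copy whose route breaks off at `v` is charged to the unpaired copy of `v`, which is no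
    -- longer counted.
    g : Fin (n + n) → Fin (n + n)
    g z with base (θ z) ≟F v
    ... | yes _ = mir (θ z)
    ... | no _ = z
    nv : ∀ z → term P' z ∧ (θ' z == z) ! → base z ≢ v
    nv z h e = not-e (∧-r {W z} (∧-l {term P' z} h)) (subst (λ w → P' w !) (sym e) v∈P')
    tm : ∀ z → term P' z ∧ (θ' z == z) ! → term P z !
    tm z h = ∧-i (∧-l {W z} (∧-l {term P' z} h)) (not-i (λ p → not-e (∧-r {W z} (∧-l {term P' z} h)) (∨-l {P (base z)} p)))
    into' : ∀ z → base z ≢ v → term P z ! → θ' z ≡ z → term P (g z) ∧ (θ (g z) == g z) !
    into' z nb tz e with base (θ z) ≟F v | view z
    ... | _ | _ , _ , dead f = void (nb f)
    ... | yes b | _ , _ , keep _ b' = void (b' b)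
    ... | no _ | _ , _ , keep _ _ = ∧-i tz (==-i e)
    ... | no b' | _ , _ , loose _ b _ = void (b' b)
    ... | yes b | _ , _ , loose _ _ c = ∧-i (∧-i (subst (λ w → W (mk w (not (side (θ z)))) !) (sym b) (WQ v _ qv))
        (not-i (λ p → pv (subst (λ w → P w !) (trans (base-mir _) b) p)))) (==-i c)
    ... | _ | _ , _ , join a b c = void (mir-≢ (θ z) (trans (sym (θθ _)) (cong θ e)))
    into : ∀ z → term P' z ∧ (θ' z == z) ! → term P (g z) ∧ (θ (g z) == g z) !
    into z h = into' z (nv z h) (tm z h) (==-e (∧-r {term P' z} h))
    inj' : ∀ z z' → base z ≢ v → base z' ≢ v → g z ≡ g z' → z ≡ z'
    inj' z z' h h' e with base (θ z) ≟F v | base (θ z') ≟F v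
    ... | yes b | yes b' = trans (swap refl) (trans (cong θ (trans (sym (mir-mir _)) (trans (cong mir e) (mir-mir _)))) (θθ z'))
    ... | yes b | no _ = void (h' (trans (cong base (sym e)) (trans (base-mir _) b)))
    ... | no _ | yes b' = void (h (trans (cong base e) (trans (base-mir _) b')))
    ... | no _ | no _ = e
    inj : ∀ z z' → term P' z ∧ (θ' z == z) ! → term P' z' ∧ (θ' z' == z') ! → g z ≡ g z' → z ≡ z'
    inj z z' h h' = inj' z z' (nv z h) (nv z' h')

   next : St P' m
   next = record { θ = θ' ; ints = ints' ; θθ = θθ' ; live = live' ; route = route' ; fixed = fixed'
          ; inP = λ {x} → inP' {x} ; uniq = uniq' ; same = λ {x} → same' {x} ; disj = disj' ; lost = lost' }

  extract : (M : Mat W) → Σ[ P ∈ Sub n ] (∀ v → P v ! → Q v !) × (∀ v → Q v ! → P v !) × St P (miss M)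
  extract M = go n (λ _ → false) (λ _ ()) (card-≤n _) (start M)
   where
   go : ∀ c P → (∀ v → P v ! → Q v !) → card (λ v → Q v ∧ not (P v)) ≤ c → St P (miss M) →
    Σ[ P ∈ Sub n ] (∀ v → P v ! → Q v !) × (∀ v → Q v ! → P v !) × St P (miss M)
   go c P pq le S with anyb (λ v → Q v ∧ not (P v)) in eq
   ... | false = P , pq , (λ v q → [ (λ p → p) , (λ np → void (t≢f (trans (sym (anyb-i (λ v → Q v ∧ not (P v)) v (∧-i q (not-i np)))) eq))) ] (bool (P v))) , S
   ... | true with anyb-e (λ v → Q v ∧ not (P v)) eq
   go zero P pq le S | true | v , p = void (<⇒≱ (card-pos _ {v} p) le)
   go (suc c) P pq le S | true | v , p = go c (Step.P' S v (∧-l p) (not-e (∧-r {Q v} p)))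
    (λ w h → [ pq w , (λ e → subst (λ z → Q z !) (sym (==-e e)) (∧-l p)) ] (∨-e {P w} h))
    (≤-pred (<-≤-trans (card-strict (λ w h → ∧-i (∧-l {Q w} h) (not-i (λ q → not-e (∧-r {Q w} h) (∨-l {P w} q)))) v p
      (λ h → not-e (∧-r {Q v} h) (∨-r {P v} (==-refl v)))) le))
    (Step.next S v (∧-l p) (not-e (∧-r {Q v} p)))

-- Walks with their list of vertices

Rl : ℕ → Set
Rl n = Fin n → Fin n → Bool

Symm : ∀ {n} → Rl n → Set
Symm E = ∀ {u v} → E u v ! → E v u !

infixr 5 _◂_
data PathL {n : ℕ} (E : Rl n) : Fin n → Fin n → List (Fin n) → Set where
 one : ∀ {a} → PathL E a a (a ∷ [])
 _◂_ : ∀ {a c b L} → E a c ! → PathL E c b L → PathL E a b (a ∷ L)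

module _ {n : ℕ} {E : Rl n} where

 first∈ : ∀ {a b L} → PathL E a b L → a ∈ L
 first∈ one     = here refl
 first∈ (_ ◂ _) = here refl

 last∈ : ∀ {a b L} → PathL E a b L → b ∈ L
 last∈ one     = here refl
 last∈ (_ ◂ p) = there (last∈ p)

 joinP : ∀ {a b c L M} → PathL E a b L → PathL E b c (b ∷ M) → PathL E a c (L ++ M)
 joinP one     q = q
 joinP (e ◂ p) q = e ◂ joinP p q

 shape : ∀ {a b L} → PathL E a b L → Σ[ M ∈ List (Fin n) ] L ≡ a ∷ M
 shape one     = _ , refl
 shape (_ ◂ _) = _ , refl

 joinE : ∀ {a b c d L M} → PathL E a b L → E b c ! → PathL E c d M → PathL E a d (L ++ M)
 joinE one     e q = e ◂ q
 joinE (f ◂ p) e q = f ◂ joinE p e q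

 splitP : ∀ {a b L x} → PathL E a b L → x ∈ L → Σ[ L1 ∈ List (Fin n) ] Σ[ L2 ∈ List (Fin n) ]
  L ≡ L1 ++ x ∷ L2 × PathL E a x (L1 ++ x ∷ []) × PathL E x b (x ∷ L2)
 splitP one     (here refl) = [] , [] , refl , one , one
 splitP (e ◂ p) (here refl) = [] , _ , refl , one , e ◂ p
 splitP (e ◂ p) (there m) with splitP p m
 ... | L1 , L2 , eq , q , r = _ ∷ L1 , L2 , cong (_ ∷_) eq , e ◂ q , r

 revP : Symm E → ∀ {a b L} → PathL E a b L → PathL E b a (reverse L)
 revP s {a} {b} {L} p = go p one
  where
  go : ∀ {a b c L M} → PathL E a b L → PathL E a c (a ∷ M) → PathL E b c (foldl (λ xs x → x ∷ xs) M L)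
  go one     q = q
  go (e ◂ p) q = go p (s e ◂ q)

 firstIn : ∀ (Z : Sub n) {a b L} → PathL E a b L → (∀ y → y ∈ L → ¬ (Z y !)) ⊎
  (Σ[ z ∈ Fin n ] Σ[ L1 ∈ List (Fin n) ] Σ[ L2 ∈ List (Fin n) ] Z z ! × L ≡ L1 ++ z ∷ L2 ×
   PathL E a z (L1 ++ z ∷ []) × PathL E z b (z ∷ L2) × (∀ y → y ∈ L1 → ¬ (Z y !)))
 firstIn Z {a} one with Z a in eq
 ... | true = inr (a , [] , [] , eq , refl , one , one , λ _ ())
 ... | false = inl λ { _ (here refl) h → t≢f (trans (sym h) eq) }
 firstIn Z {a} (e ◂ p) with Z a in eq
 ... | true = inr (a , [] , _ , eq , refl , one , e ◂ p , λ _ ())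
 ... | false with firstIn Z p
 ...   | inl none = inl λ { _ (here refl) h → t≢f (trans (sym h) eq) ; y (there m) → none y m }
 ...   | inr (z , L1 , L2 , zz , eq₂ , q , r , nn) =
     inr (z , a ∷ L1 , L2 , zz , cong (a ∷_) eq₂ , e ◂ q , r , λ { _ (here refl) h → t≢f (trans (sym h) eq) ; y (there m) → nn y m })

 lastIn : ∀ (Z : Sub n) {a b L} → PathL E a b L → (∀ y → y ∈ L → ¬ (Z y !)) ⊎
  (Σ[ z ∈ Fin n ] Σ[ L2 ∈ List (Fin n) ] Z z ! × z ∈ L × (∀ y → y ∈ L2 → y ∈ L) ×
   PathL E z b (z ∷ L2) × (∀ y → y ∈ L2 → ¬ (Z y !)))
 lastIn Z {a} one with Z a in eq
 ... | true = inr (a , [] , eq , here refl , (λ _ ()) , one , λ _ ())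
 ... | false = inl λ { _ (here refl) h → t≢f (trans (sym h) eq) }
 lastIn Z {a} (e ◂ p) with lastIn Z p
 ... | inr (z , L2 , zz , m , sub , q , nn) = inr (z , L2 , zz , there m , (λ y k → there (sub y k)) , q , nn)
 ... | inl none with Z a in eq
 ...   | true = inr (a , _ , eq , here refl , (λ _ → there) , e ◂ p , none)
 ...   | false = inl λ { _ (here refl) h → t≢f (trans (sym h) eq) ; y (there m) → none y m }

 simple : ∀ {a b L} → PathL E a b L → Σ[ M ∈ List (Fin n) ] PathL E a b M × Uniq M × (∀ {y} → y ∈ M → y ∈ L)
 simple one = _ , one , ((λ ()) , tt) , λ m → m
 simple {a} (e ◂ p) with simple p
 ... | M , q , u , sub with anyL a M
  where
  anyL : ∀ (a : Fin n) M → Dec (a ∈ M)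
  anyL a [] = no λ ()
  anyL a (x ∷ M) with a ≟F x | anyL a M
  ... | yes e | _ = yes (here e)
  ... | no _ | yes m = yes (there m)
  ... | no f | no g = no λ { (here e) → f e ; (there m) → g m }
 ...   | no a∉ = a ∷ M , e ◂ q , (a∉ , u) , λ { (here r) → here r ; (there m) → there (sub m) }
 ...   | yes m with splitP q m
 ...     | L1 , L2 , refl , _ , r = a ∷ L2 , r , drop L1 u , λ k → there (sub (∈ʳ L1 k))
  where
  drop : ∀ (L1 : List (Fin n)) {L2} → Uniq (L1 ++ L2) → Uniq L2
  drop [] u = u
  drop (_ ∷ L1) (_ , u) = drop L1 u

 -- The colours of the ends decide the parity of a path in a bipartite graph. The negation comes
 -- from counting vertices, one more than edges.
 bip : ∀ (χ : Fin n → Bool) → (∀ {x y} → E x y ! → χ x ≡ not (χ y)) → ∀ {a b L} → PathL E a b L →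
  isOdd (length L) ≡ not (χ a xor χ b)
 bip χ h {a} one = sym (cong not (xor-self (χ a)))
 bip χ h {a} {b} (_◂_ {c = c} e p) rewrite bip χ h p | h e with χ c | χ b
 ... | true | true = refl
 ... | true | false = refl
 ... | false | true = refl
 ... | false | false = refl

mapP : ∀ {n} {E F : Rl n} {a b L} → (∀ {x y} → x ∈ L → y ∈ L → E x y ! → F x y !) → PathL E a b L → PathL F a b L
mapP f one     = one
mapP f (e ◂ p) = f (here refl) (there (first∈ p)) e ◂ mapP (λ x y → f (there x) (there y)) p

chainP : ∀ {n} {E : Rl n} {u xs v} → Chain E u xs v → PathL E u v (u ∷ xs ++ v ∷ [])
chainP (edge e) = e ◂ one
chainP (e ∷ᶜ c) = e ◂ chainP c

rev-∈ : ∀ {n} {x : Fin n} L → x ∈ reverse L → x ∈ L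
rev-∈ {n} {x} L m = [ (λ ()) , (λ y → y) ] (go L [] m)
 where
 go : ∀ (L M : List (Fin n)) → x ∈ foldl (λ xs x → x ∷ xs) M L → x ∈ M ⊎ x ∈ L
 go []      M m = inl m
 go (y ∷ L) M m with go L (y ∷ M) m
 ... | inl (here e)  = inr (here e)
 ... | inl (there k) = inl k
 ... | inr k         = inr (there k)

-- Menger's theorem

record Paths {n : ℕ} (E : Rl n) (S U : Sub n) : Set where
 field
  tgt  : Fin n → Fin n
  lst  : Fin n → List (Fin n)
  hit  : ∀ s → S s ! → U (tgt s) !
  path : ∀ s → S s ! → PathL E s (tgt s) (lst s)
  only : ∀ s → S s ! → ∀ {y} → y ∈ lst s → U y ! → y ≡ tgt s
  sole : ∀ s → S s ! → ∀ {y} → y ∈ lst s → S y ! → y ≡ s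
  uniq : ∀ s → S s ! → Uniq (lst s)
  disj : ∀ s s' → S s ! → S s' ! → ∀ {y} → y ∈ lst s → y ∈ lst s' → s ≡ s'

Separates : ∀ {n} → Rl n → Sub n → Sub n → Sub n → Set
Separates E S U Z = ∀ {a b L} → S a ! → U b ! → PathL E a b L → Σ[ y ∈ Fin _ ] y ∈ L × Z y !

module Menger {n : ℕ} (E : Rl n) (E-sym : Symm E) (S U : Sub n) where

 Q B : Sub n
 Q v = not (S v) ∧ not (U v)
 B v = S v ∧ U v

 open Cover E E-sym Q true

 -- A vertex of `S` alone keeps only its outgoing copy, a vertex of `U` alone only its incoming one.
 -- A vertex of both is a path by itself and has no copy at all.
 alive : Fin n → Bool → Bool
 alive v b = if S v then (if U v then false else not b) else (if U v then b else true)

 W : Sub (n + n)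
 W x = alive (base x) (side x)

 W-mk : ∀ v b → W (mk v b) ≡ alive v b
 W-mk v b = cong₂ alive (base-mk v b) (side-mk v b)

 alive-Q : ∀ v b → Q v ! → alive v b !
 alive-Q v b q with S v | U v
 ... | false | false = refl
 alive-Q v b () | true | _
 alive-Q v b () | false | true

 sides : ∀ {x y} → CAdj x y → side x ≢ side y
 sides (inl (_ , ne , _)) = ne
 sides {x} {y} (inr (_ , p)) e with side x | side y
 sides (inr (_ , ())) refl | true | _
 sides (inr (_ , ())) refl | false | _

 open Extract W (λ v b q → trans (W-mk v b) (alive-Q v b q))

 module _ (M : Mat W) (mx : IsMax M) (Bar : Barrier W (miss M)) where
  open Barrier Bar

  -- a bipartite component all of whose vertices can be missed is a single vertex
  no-edge : ∀ {x y} → W' x ! → W' y ! → CAdj x y → ⊥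
  no-edge {x} {y} wx wy a = run (compr (Conn W' x) >>= λ { (K , hK) →
    missable x wx >>= λ { (Mx , mxx , ex) → missable y wy >>= λ { (My , mxy , ey) →
    ret (count-x K hK Mx mxx ex My mxy ey) }}})
   where
   x≢y : x ≢ y
   x≢y refl = sides a refl
   module _ (K : Sub (n + n)) (hK : ∀ z → (K z ! → Conn W' x z) × (Conn W' x z → K z !)) where
    cxy : Conn W' x y
    cxy = cons wx a (nil wy)
    -- A maximum matching that misses `z` covers the rest of the component, so it injects the side
    -- opposite to `z` into the side of `z`, avoiding `z`. Used at `x` and at `y`, which lie on
    -- different sides, this is contradictory.
    half : ∀ z (Mz : Mat W') → IsMax Mz → μ Mz z ≡ z → K z ! →
     card (λ t → K t ∧ not (does (side t ≟B side z))) < card (λ t → K t ∧ does (side t ≟B side z))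
    half z Mz mxz ez kz = ≤-<-trans (card-inj {U = λ t → K t ∧ does (side t ≟B side z) ∧ not (t == z)} (μ Mz) into inj)
      (card-strict (λ t h → ∧-i (∧-l {K t} h) (∧-l {does (side t ≟B side z)} (∧-r {K t} h))) z (∧-i kz (same {side z} refl)) (λ h → not-e (∧-r {does (side z ≟B side z)} (∧-r {K z} h)) (==-refl z)))
     where
     same : ∀ {a b} → a ≡ b → does (a ≟B b) !
     same {true} refl = refl
     same {false} refl = refl
     diff : ∀ {a b} → not (does (a ≟B b)) ! → a ≢ b
     diff {true} {false} _ ()
     diff {false} {true} _ ()
     third : ∀ {a b c : Bool} → a ≢ b → b ≢ c → a ≡ c
     third {true} {true} f g = void (f refl)
     third {true} {false} {true} f g = refl
     third {true} {false} {false} f g = void (g refl)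
     third {false} {false} f g = void (f refl)
     third {false} {true} {true} f g = void (g refl)
     third {false} {true} {false} f g = refl
     cov : ∀ t → K t ∧ not (does (side t ≟B side z)) ! → μ Mz t ≢ t
     cov t h e = conn-sim missable (conn-trans (conn-sym (fst (hK z) kz)) (fst (hK t) (∧-l h)))
      (λ f → diff (∧-r {K t} h) (cong side (sym f))) Mz mxz ez e
     into : ∀ t → K t ∧ not (does (side t ≟B side z)) ! →
      K (μ Mz t) ∧ does (side (μ Mz t) ≟B side z) ∧ not (μ Mz t == z) !
     into t h = ∧-i (snd (hK _) (conn-trans (fst (hK t) (∧-l h)) (cons wt at (nil wt'))))
       (∧-i (same (third (λ e → sides at (sym e)) (diff (∧-r {K t} h))))
          (not-i (λ e → cov t h (trans (==-e e) (trans (sym ez) (trans (cong (μ Mz) (sym (==-e e))) (inv Mz t)))))))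
      where
      wt = fst (ok Mz t (cov t h))
      at = snd (ok Mz t (cov t h))
      wt' : W' (μ Mz t) !
      wt' = fst (ok Mz (μ Mz t) (λ e → cov t h (trans (sym e) (inv Mz t))))
     inj : ∀ s t → K s ∧ _ ! → K t ∧ _ ! → μ Mz s ≡ μ Mz t → s ≡ t
     inj s t _ _ e = trans (sym (inv Mz s)) (trans (cong (μ Mz) e) (inv Mz t))
    flip : ∀ a b c → a ≢ b → not (does (c ≟B a)) ≡ does (c ≟B b)
    flip true true c ne = void (ne refl)
    flip false false c ne = void (ne refl)
    flip true false true ne = refl
    flip true false false ne = refl
    flip false true true ne = refl
    flip false true false ne = refl
    count-x : (Mx : Mat W') → IsMax Mx → μ Mx x ≡ x → (My : Mat W') → IsMax My → μ My y ≡ y → ⊥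
    count-x Mx mxx ex My mxy ey = <-asym
     (subst (_< card (λ t → K t ∧ does (side t ≟B side x))) (card-cong (λ t → cong (K t ∧_) (flip (side x) (side y) (side t) (sides a))))
      (half x Mx mxx ex (snd (hK x) (nil wx))))
     (subst (_< card (λ t → K t ∧ does (side t ≟B side y))) (card-cong (λ t → cong (K t ∧_) (flip (side y) (side x) (side t) (λ e → sides a (sym e)))))
      (half y My mxy ey (snd (hK y) cxy)))

  Z : Sub n
  Z v = not (W' (mk v false)) ∧ not (W' (mk v true))

  W'-alive : ∀ {v b} → W' (mk v b) ! → alive v b !
  W'-alive {v} {b} w = trans (sym (W-mk v b)) (W'⊆W _ w)

  vertical : ∀ {v} → Q v ! → CAdj (mk v false) (mk v true)
  vertical {v} q = inl (trans (base-mk v false) (sym (base-mk v true)) ,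
   (λ e → t≢f (sym (trans (sym (side-mk v false)) (trans e (side-mk v true))))) , trans (cong Q (base-mk v false)) q)

  -- The critical vertices are those outside `S` and `U`: with both copies left, the vertical edge
  -- between these would contradict `no-edge`.
  pointwise : ∀ v → 2 * (b2n (W' (mk v false)) + b2n (W' (mk v true))) + 2 * b2n (Z v) ≤
   (b2n (W (mk v false)) + b2n (W (mk v true))) + (b2n (S v) + b2n (U v))
  pointwise v rewrite W-mk v false | W-mk v true
   with S v in es | U v in eu | W' (mk v false) in ef | W' (mk v true) in et
  ... | true  | true  | true  | _     = void (t≢f (sym (trans (sym (dead v false es eu)) (W'-alive ef))))
   where dead : ∀ v b → S v ! → U v ! → alive v b ≡ false
         dead v b p q rewrite p | q = refl
  ... | true  | true  | false | true  = void (t≢f (sym (trans (sym (dead v true es eu)) (W'-alive et))))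
   where dead : ∀ v b → S v ! → U v ! → alive v b ≡ false
         dead v b p q rewrite p | q = refl
  ... | true  | true  | false | false = ≤-refl
  ... | true  | false | _     | true  = void (t≢f (sym (trans (sym (dead v es eu)) (W'-alive et))))
   where dead : ∀ v → S v ! → U v ≡ false → alive v true ≡ false
         dead v p q rewrite p | q = refl
  ... | true  | false | true  | false = ≤-refl
  ... | true  | false | false | false = ≤-refl
  ... | false | true  | true  | _     = void (t≢f (sym (trans (sym (dead v es eu)) (W'-alive ef))))
   where dead : ∀ v → S v ≡ false → U v ! → alive v false ≡ false
         dead v p q rewrite p | q = refl
  ... | false | true  | false | true  = ≤-refl
  ... | false | true  | false | false = ≤-refl
  ... | false | false | true  | true  = void (no-edge ef et (vertical (cong₂ (λ a b → not a ∧ not b) es eu)))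
  ... | false | false | true  | false = ≤-refl
  ... | false | false | false | true  = ≤-refl
  ... | false | false | false | false = ≤-refl

  bound : 2 * card Z + miss M ≤ card S + card U
  bound = lin (1 ∷ 1 ∷ 1 ∷ 1 ∷ []) (card W' ∷ card Z ∷ card W ∷ card S ∷ card U ∷ miss M ∷ miss M' ∷ [])
    (λ w' z w s u m m' → 2 :* w' :+ 2 :* z :≤ w :+ (s :+ u) ⇒ m :+ w :≤ m' :+ w' ⇒ m' :≤ w' ⇒ qed (2 :* z :+ m :≤ s :+ u))
    total count (card-mono (λ x → ∧-l))
   where
   total : 2 * card W' + 2 * card Z ≤ card W + (card S + card U)
   total rewrite card-cover W' | card-cover W | card-def (λ v → W' (mk v false)) | card-def (λ v → W' (mk v true)) | card-def Z
      | card-def (λ v → W (mk v false)) | card-def (λ v → W (mk v true)) | card-def S | card-def U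
      | sym (sum-+ (λ v → b2n (W' (mk v false))) (λ v → b2n (W' (mk v true))))
      | sym (sum-+ (λ v → b2n (W (mk v false))) (λ v → b2n (W (mk v true))))
      | sym (sum-+ (λ v → b2n (S v)) (λ v → b2n (U v)))
      | sym (sum-*ˡ 2 (λ v → b2n (W' (mk v false)) + b2n (W' (mk v true))))
      | sym (sum-*ˡ 2 (λ v → b2n (Z v)))
      | sym (sum-+ (λ v → 2 * (b2n (W' (mk v false)) + b2n (W' (mk v true)))) (λ v → 2 * b2n (Z v)))
      | sym (sum-+ (λ v → b2n (W (mk v false)) + b2n (W (mk v true))) (λ v → b2n (S v) + b2n (U v))) = sum-mono pointwise

  ¬Z : ∀ v → ¬ (Z v !) → W' (mk v false) ! ⊎ W' (mk v true) !
  ¬Z v h with W' (mk v false) | W' (mk v true)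
  ... | true | _ = inl refl
  ... | false | true = inr refl
  ... | false | false = void (h refl)

  -- Along a path that avoids `Z` every vertex has a copy left. In `S` this is the copy `false`, in
  -- `U` the copy `true`; where the copies switch, an edge of the cover joins two vertices of `W'`,
  -- against `no-edge`.
  separates : Separates E S U Z
  separates {L = L} sa ub p = search L p λ none → go p (startf sa (none _ (first∈ p))) none ub
   where
   search : ∀ {a b} L → PathL E a b L → ((∀ y → y ∈ L → ¬ (Z y !)) → ⊥) → Σ[ y ∈ Fin n ] y ∈ L × Z y !
   search L p k with firstIn Z p
   ... | inl none = void (k none)
   ... | inr (z , L1 , L2 , zz , refl , _) = z , ∈ʳ L1 (here refl) , zz
   startf : ∀ {v} → S v ! → ¬ (Z v !) → W' (mk v false) !
   startf {v} s nz with ¬Z v nz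
   ... | inl w = w
   ... | inr w with W'-alive w
   ...   | h rewrite s with U v
   startf {v} s nz | inr w | () | true
   startf {v} s nz | inr w | () | false
   notU : ∀ {v} → W' (mk v false) ! → ¬ (U v !)
   notU {v} w u with W'-alive w
   ... | h rewrite u with S v
   notU {v} w u | () | true
   notU {v} w u | () | false
   go : ∀ {a b L} → PathL E a b L → W' (mk a false) ! → (∀ y → y ∈ L → ¬ (Z y !)) → U b ! → ⊥
   go one w none u = notU w u
   go (_◂_ {a} {c} e p) w none u with ¬Z c (none _ (there (first∈ p)))
   ... | inl w' = go p w' (λ y m → none y (there m)) u
   ... | inr w' = no-edge w w' (inr (trans (cong₂ E (base-mk a false) (base-mk c true)) e , cong₂ _xor_ (side-mk a false) (side-mk c true)))

 module _ {m : ℕ} {P : Sub n} (PQ : ∀ v → P v ! → Q v !) (QP : ∀ v → Q v ! → P v !) (St0 : St P m) where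
  open St St0 using (θ; ints; θθ; live; route; inP; same; lost) renaming (uniq to uniqI; disj to disjI)

  S0 : Sub n
  S0 v = S v ∧ not (U v)

  term-e : ∀ {x} → term P x ! → alive (base x) (side x) ! × ¬ (Q (base x) !)
  term-e {x} t = ∧-l t , λ q → not-e (∧-r {W x} t) (QP _ q)

  covered : ∀ {v} → θ (mk v false) ≢ mk v false → S v ! → (U (base (θ (mk v false))) ! × S (base (θ (mk v false))) ≡ false) ×
   Chain E v (ints (mk v false)) (base (θ (mk v false))) × side (θ (mk v false)) !
  covered {v} ne s with route (mk v false) ne
  ... | inl (_ , q , _) = void (not-e (∧-l q) (trans (cong S (base-mk v false)) s))
  ... | inr (c , pr) rewrite base-mk v false | side-mk v false with live (θ (mk v false)) (λ e → ne (trans (sym e) (θθ _)))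
  ...   | t = lem (S y) (U y) refl refl pr (term-e t) , c , pr
   where
   y = base (θ (mk v false))
   lem : ∀ a b → S y ≡ a → U y ≡ b → side (θ (mk v false)) ! → alive y (side (θ (mk v false))) ! × ¬ (Q y !) → U y ! × S y ≡ false
   lem true true es eu sd (h , _) rewrite es | eu with h
   ... | ()
   lem true false es eu sd (h , _) rewrite es | eu | sd with h
   ... | ()
   lem false true es eu sd _ = eu , es
   lem false false es eu sd (_ , nq) = void (nq (cong₂ (λ a b → not a ∧ not b) es eu))

  toPaths : (∀ v → S0 v ! → θ (mk v false) ≢ mk v false) → Paths E S U
  toPaths cov = record
   { tgt = tgt ; lst = lst ; hit = hit ; path = path ; only = only ; sole = sole ; uniq = uniqP ; disj = disjP }
   where
   S0-i : ∀ {s} → S s ! → U s ≡ false → S0 s !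
   S0-i p q = ∧-i p (cong not q)
   θs : Fin n → Fin (n + n)
   θs s = θ (mk s false)
   tgt : Fin n → Fin n
   tgt s = if U s then s else base (θs s)
   lst : Fin n → List (Fin n)
   lst s = if U s then s ∷ [] else (s ∷ ints (mk s false) ++ base (θs s) ∷ [])
   hit : ∀ s → S s ! → U (tgt s) !
   hit s p with U s in eu
   ... | true = eu
   ... | false = fst (fst (covered (cov s (S0-i p eu)) p))
   path : ∀ s → S s ! → PathL E s (tgt s) (lst s)
   path s p with U s in eu
   ... | true = one
   ... | false = chainP (fst (snd (covered (cov s (S0-i p eu)) p)))
   data Loc (s y : Fin n) : Set where
    at-s : y ≡ s → Loc s y
    at-i : U s ≡ false → y ∈ ints (mk s false) → Loc s y
    at-t : U s ≡ false → y ≡ base (θs s) → Loc s y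
   loc : ∀ s {y} → y ∈ lst s → Loc s y
   loc s m with U s in eu
   loc s (here e) | true = at-s e
   loc s (here e) | false = at-s e
   loc s (there m) | false with ∈⁻ (ints (mk s false)) m
   ... | inl k = at-i eu k
   ... | inr (here e) = at-t eu e
   intQ : ∀ {x y} → y ∈ ints x → ¬ (S y !) × ¬ (U y !)
   intQ {x} {y} m = let q = PQ y (inP m) in not-e (∧-l q) , not-e (∧-r {not (S y)} q)
   only : ∀ s → S s ! → ∀ {y} → y ∈ lst s → U y ! → y ≡ tgt s
   only s p m u with loc s m
   ... | at-i _ k = void (snd (intQ k) u)
   ... | at-s refl rewrite u = refl
   ... | at-t eu e rewrite eu = e
   sole : ∀ s → S s ! → ∀ {y} → y ∈ lst s → S y ! → y ≡ s
   sole s p m q with loc s m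
   ... | at-s e = e
   ... | at-i _ k = void (fst (intQ k) q)
   ... | at-t eu refl = void (t≢f (trans (sym q) (snd (fst (covered (cov s (S0-i p eu)) p)))))
   uniqP : ∀ s → S s ! → Uniq (lst s)
   uniqP s p with U s in eu
   ... | true = (λ ()) , tt
   ... | false = (λ m → [ (λ k → fst (intQ k) p) , (λ { (here e) → t≢f (trans (sym p) (trans (cong S e) (snd (fst C)))) }) ] (∈⁻ (ints (mk s false)) m)) ,
          uniq-++ (ints (mk s false)) _ (uniqI _) ((λ ()) , tt) (λ { k (here e) → snd (intQ k) (subst (λ z → U z !) (sym e) (fst (fst C))) })
    where C = covered (cov s (S0-i p eu)) p
   sideθ : ∀ s → S s ! → U s ≡ false → side (θs s) !
   sideθ s p eu = snd (snd (covered (cov s (S0-i p eu)) p))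
   mk-inj : ∀ {s s' b} → mk s b ≡ mk s' b → s ≡ s'
   mk-inj {s} {s'} {b} e = trans (sym (base-mk s b)) (trans (cong base e) (base-mk s' b))
   disjP : ∀ s s' → S s ! → S s' ! → ∀ {y} → y ∈ lst s → y ∈ lst s' → s ≡ s'
   disjP s s' p p' m m' with loc s m | loc s' m'
   ... | at-s refl | _ = sole s' p' m' p
   ... | _ | at-s refl = sym (sole s p m p')
   ... | at-i _ k | at-t eu refl = void (snd (intQ k) (fst (fst (covered (cov s' (S0-i p' eu)) p'))))
   ... | at-t eu refl | at-i _ k = void (snd (intQ k) (fst (fst (covered (cov s (S0-i p eu)) p))))
   ... | at-t eu e | at-t eu' e' = mk-inj (trans (sym (θθ _)) (trans (cong θ (cover-≡ (trans (sym e) e') (trans (sideθ s p eu) (sym (sideθ s' p' eu'))))) (θθ _)))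
   ... | at-i eu k | at-i eu' k' with disjI k k'
   ...   | inl e = sym (mk-inj e)
   ...   | inr e = void (t≢f (trans (sym (sideθ s p eu)) (trans (cong side (sym e)) (side-mk s' false))))

  -- Every covered copy on the side of `U` has a covered partner on the side of `S`. One uncovered
  -- start vertex thus makes `m` exceed the difference of the two cardinalities, and with `bound`
  -- the separator becomes smaller than `S`.
  missing : ∀ v → S0 v ! → θ (mk v false) ≡ mk v false → card S + card U < m + 2 * card S
  missing v0 s0 e0 = lin (0 ∷ 1 ∷ 1 ∷ 1 ∷ 1 ∷ []) (card S ∷ card U ∷ m ∷ card missS ∷ card missU ∷ card covS ∷ card B ∷ [])
   (λ s u m a b c d → s :≤ a :+ (c :+ d) ⇒ u :≤ b :+ (c :+ d) ⇒ a :+ b :≤ m ⇒ c :+ (d :+ # 1) :≤ s ⇒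
      qed (s :+ u :< m :+ 2 :* s)) sB uB le cS
   where
   missS missU covS covU : Sub n
   missS v = S0 v ∧ (θ (mk v false) == mk v false)
   covS v = S0 v ∧ not (θ (mk v false) == mk v false)
   missU v = (U v ∧ not (S v)) ∧ (θ (mk v true) == mk v true)
   covU v = (U v ∧ not (S v)) ∧ not (θ (mk v true) == mk v true)
   sB : card S ≤ card missS + (card covS + card B)
   sB = ≤-trans (card-∪ {U = missS} {V = λ v → covS v ∨ B v} pt) (+-monoʳ-≤ (card missS) (card-∪ (λ v → ∨-e)))
    where
    pt : ∀ v → S v ! → missS v ! ⊎ (covS v ∨ B v) !
    pt v p with U v in eu | θ (mk v false) == mk v false
    ... | true | _ rewrite p = inr (∨-r {false} refl)
    ... | false | true rewrite p = inl refl
    ... | false | false rewrite p = inr refl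
   covUS : card covU ≤ card covS
   covUS = card-inj (λ v → base (θ (mk v true))) into inj
    where
    facts : ∀ v → covU v ! → θ (mk v true) ≢ mk v true × U v ! × S v ≡ false
    facts v h = (λ e → not-e (∧-r {U v ∧ not (S v)} h) (==-i e)) , ∧-l (∧-l {U v ∧ not (S v)} h) , nt (∧-r {U v} (∧-l {U v ∧ not (S v)} h))
     where nt : ∀ {b} → not b ! → b ≡ false
           nt {false} _ = refl
    sd : ∀ v → covU v ! → side (θ (mk v true)) ≡ false × S (base (θ (mk v true))) ! × U (base (θ (mk v true))) ≡ false
    sd v h with facts v h
    ... | ne , u , s with route (mk v true) ne
    ...   | inl (_ , q , _) = void (not-e (∧-r {not (S (base (mk v true)))} q) (trans (cong U (base-mk v true)) u))
    ...   | inr (_ , pr) rewrite side-mk v true = let s' = ntt pr in s' , lem (S y) (U y) refl refl s' (term-e (live (θ (mk v true)) (λ e → ne (trans (sym e) (θθ _)))))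
     where
     ntt : ∀ {b} → not b ! → b ≡ false
     ntt {false} _ = refl
     y = base (θ (mk v true))
     lem : ∀ a b → S y ≡ a → U y ≡ b → side (θ (mk v true)) ≡ false → alive y (side (θ (mk v true))) ! × ¬ (Q y !) → S y ! × U y ≡ false
     lem true true es eu sd (h , _) rewrite es | eu with h
     ... | ()
     lem true false es eu sd _ = es , eu
     lem false true es eu sd (h , _) rewrite es | eu | sd with h
     ... | ()
     lem false false es eu sd (_ , nq) = void (nq (cong₂ (λ a b → not a ∧ not b) es eu))
    ret-mk : ∀ v h → mk (base (θ (mk v true))) false ≡ θ (mk v true)
    ret-mk v h = cover-≡ (base-mk _ _) (trans (side-mk _ _) (sym (fst (sd v h))))
    into : ∀ v → covU v ! → covS (base (θ (mk v true))) !
    into v h = ∧-i (∧-i (fst (snd (sd v h))) (cong not (snd (snd (sd v h)))))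
     (not-i (λ e → fst (facts v h) (trans (sym (trans (sym (cong θ (ret-mk v h))) (trans (==-e e) (ret-mk v h)))) (θθ _))))
    inj : ∀ v v' → covU v ! → covU v' ! → base (θ (mk v true)) ≡ base (θ (mk v' true)) → v ≡ v'
    inj v v' h h' e = trans (sym (base-mk v true)) (trans (cong base (trans (sym (θθ _)) (trans (cong θ (cover-≡ e (trans (fst (sd v h)) (sym (fst (sd v' h')))))) (θθ _)))) (base-mk v' true))
   uB : card U ≤ card missU + (card covS + card B)
   uB = ≤-trans (card-∪ {U = missU} {V = λ v → covU v ∨ B v} pt) (+-monoʳ-≤ (card missU) (≤-trans (card-∪ {U = covU} {V = B} (λ v → ∨-e)) (+-monoˡ-≤ (card B) covUS)))
    where
    pt : ∀ v → U v ! → missU v ! ⊎ (covU v ∨ B v) !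
    pt v p with S v in es | θ (mk v true) == mk v true
    ... | true | _ rewrite p = inr (∨-r {false} refl)
    ... | false | true rewrite p = inl refl
    ... | false | false rewrite p = inr refl
   le : card missS + card missU ≤ m
   le = ≤-trans (≤-trans (+-mono-≤ (card-mono f1) (card-mono f2)) (≤-eq (sym (card-cover (λ x → term P x ∧ (θ x == x)))))) lost
    where
    f1 : ∀ v → missS v ! → term P (mk v false) ∧ (θ (mk v false) == mk v false) !
    f1 v h = ∧-i (∧-i (trans (W-mk v false) (al (∧-l {S v} (∧-l {S0 v} h)) (∧-r {S v} (∧-l {S0 v} h))))
      (not-i (λ p → not-e (∧-l (PQ v (trans (cong P (sym (base-mk v false))) p))) (∧-l {S v} (∧-l {S0 v} h))))) (∧-r {S0 v} h)
     where al : ∀ {v} → S v ! → not (U v) ! → alive v false !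
           al {v} p q rewrite p with U v
           ... | false = refl
    f2 : ∀ v → missU v ! → term P (mk v true) ∧ (θ (mk v true) == mk v true) !
    f2 v h = ∧-i (∧-i (trans (W-mk v true) (al (∧-l {U v} (∧-l {U v ∧ not (S v)} h)) (∧-r {U v} (∧-l {U v ∧ not (S v)} h))))
      (not-i (λ p → not-e (∧-r {not (S v)} (PQ v (trans (cong P (sym (base-mk v true))) p))) (∧-l {U v} (∧-l {U v ∧ not (S v)} h))))) (∧-r {U v ∧ not (S v)} h)
     where al : ∀ {v} → U v ! → not (S v) ! → alive v true !
           al {v} p q rewrite p with S v
           ... | false = refl
   cS : card covS + (card B + 1) ≤ card S
   cS = subst (_≤ card S) (trans (+-comm 1 _) (+-assoc (card covS) (card B) 1)) (≤-<-trans (card-⊎ {S = λ v → S v ∧ not (v == v0)} {U = covS} {V = B}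
     (λ v h → ∧-i (∧-l {S v} (∧-l {S0 v} h)) (not-i (λ e → not-e (∧-r {S0 v} h) (==-i (subst (λ z → θ (mk z false) ≡ mk z false) (sym (==-e e)) e0)))))
     (λ v h → ∧-i (∧-l h) (not-i (λ e → not-e (∧-r {S v0} s0) (subst (λ z → U z !) (==-e e) (∧-r {S v} h)))))
     (λ v h k → not-e (∧-r {S v} (∧-l {S0 v} h)) (∧-r {S v} k)))
     (card-strict (λ v → ∧-l) v0 (∧-l s0) (λ h → not-e (∧-r {S v0} h) (==-refl v0))))

 menger : NN (Paths E S U ⊎ (Σ[ Z ∈ Sub n ] card Z < card S × Separates E S U Z))
 menger = maxMat W >>= λ { (M , mx) → barrier M mx >>= λ Bar → ret (fin M mx Bar (extract M)) }
  where
  fin : (M : Mat W) → IsMax M → Barrier W (miss M) → Σ[ P ∈ Sub n ] (∀ v → P v ! → Q v !) × (∀ v → Q v ! → P v !) × St P (miss M) →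
   Paths E S U ⊎ (Σ[ Z ∈ Sub n ] card Z < card S × Separates E S U Z)
  fin M mx Bar (P , pq , qp , St0) with anyb (λ v → S0 pq qp St0 v ∧ (St.θ St0 (mk v false) == mk v false)) in eq
  ... | false = inl (toPaths pq qp St0 (λ v s e → t≢f (trans (sym (anyb-i _ v (∧-i s (==-i e)))) eq)))
  ... | true with anyb-e _ eq
  ...   | v , h = inr (Z M mx Bar , lt' , separates M mx Bar)
   where
   lt' : card (Z M mx Bar) < card S
   lt' = lin (1 ∷ 1 ∷ 2 ∷ []) (card (Z M mx Bar) ∷ miss M ∷ card S ∷ card U ∷ []) (λ z m s u → 2 :* z :+ m :≤ s :+ u ⇒ s :+ u :< m :+ 2 :* s ⇒ qed (z :< s))
    (bound M mx Bar) (missing pq qp St0 v (∧-l h) (==-e (∧-r {S0 pq qp St0 v} h)))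

-- Packing parity-breaking paths

-- `pr a ≡ a` marks a vertex without a path. With `m` inner vertices a path has length `m + 1`, so
-- `odd` says that its parity is opposite to that of a path of cross edges with the same ends.
-- `pcount` counts ends, twice the number of paths.
record OddPacking {n : ℕ} (E : Rl n) (A : Sub n) (c : Fin n → Bool) : Set where
 field
  pr    : Fin n → Fin n
  ints  : Fin n → List (Fin n)
  pr-pr : ∀ a → A a ! → pr (pr a) ≡ a
  pr-A  : ∀ a → A a ! → A (pr a) !
  chain : ∀ a → A a ! → pr a ≢ a → Chain E a (ints a) (pr a)
  odd   : ∀ a → A a ! → pr a ≢ a → c a xor c (pr a) ≡ isOdd (length (ints a))
  out   : ∀ a {y} → A a ! → y ∈ ints a → ¬ (A y !)
  uniq  : ∀ a → Uniq (ints a)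
  disj  : ∀ a a' {y} → A a ! → A a' ! → y ∈ ints a → y ∈ ints a' → a' ≡ a ⊎ a' ≡ pr a

 pcount : ℕ
 pcount = card (λ a → A a ∧ not (pr a == a))

module Odd {n : ℕ} (E : Rl n) (E-sym : Symm E) (A : Sub n) (c : Fin n → Bool) where

 Q : Sub n
 Q v = not (A v)

 open Cover E E-sym Q false

 -- A terminal keeps only the copy on its own side of the cut, so that arriving at that copy is the
 -- parity condition.
 alive : Fin n → Bool → Bool
 alive v b = if A v then not (b xor c v) else true

 W : Sub (n + n)
 W x = alive (base x) (side x)

 W-mk : ∀ v b → W (mk v b) ≡ alive v b
 W-mk v b = cong₂ alive (base-mk v b) (side-mk v b)

 alive-Q : ∀ v b → Q v ! → alive v b !
 alive-Q v b q with A v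
 ... | false = refl
 alive-Q v b () | true

 alive-A : ∀ {v b} → A v ! → alive v b ! → b ≡ c v
 alive-A {v} {b} a h rewrite a = lem b (c v) h
  where lem : ∀ b c → not (b xor c) ! → b ≡ c
        lem true true _ = refl
        lem false false _ = refl

 alive-c : ∀ v → alive v (c v) !
 alive-c v with A v
 ... | true rewrite xor-self (c v) = refl
 ... | false = refl

 open Extract W (λ v b q → trans (W-mk v b) (alive-Q v b q))

 cp : Fin n → Fin (n + n)
 cp a = mk a (c a)

 W-A : ∀ {x} → W x ! → A (base x) ! → x ≡ cp (base x)
 W-A {x} w a = cover-≡ (sym (base-mk _ _)) (trans (alive-A a w) (sym (side-mk _ _)))

 module _ {m : ℕ} {P : Sub n} (PQ : ∀ v → P v ! → Q v !) (QP : ∀ v → Q v ! → P v !) (St0 : St P m) where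
  open St St0 using (θ; ints; θθ; live; route; inP; lost) renaming (uniq to uniqI; disj to disjI)

  termA : ∀ {x} → term P x ! → A (base x) ! × x ≡ cp (base x)
  termA {x} t with bool (A (base x))
  ... | inl a = a , W-A (∧-l t) a
  ... | inr na = void (not-e (∧-r {W x} t) (QP _ (not-i na)))

  θ-A : ∀ a → A a ! → A (base (θ (cp a))) ! × θ (cp a) ≡ cp (base (θ (cp a)))
  θ-A a h with θ (cp a) ≟F cp a
  ... | no ne = termA (live _ (λ e → ne (trans (sym e) (θθ _))))
  ... | yes e rewrite e | base-mk a (c a) = h , refl

  packing : OddPacking E A c
  packing = record
   { pr = λ a → base (θ (cp a)) ; ints = λ a → ints (cp a)
   ; pr-pr = λ a h → trans (cong (λ x → base (θ x)) (sym (snd (θ-A a h)))) (trans (cong base (θθ _)) (base-mk _ _))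
   ; pr-A = λ a h → fst (θ-A a h)
   ; chain = λ a h ne → fst (rt a h ne) ; odd = λ a h ne → snd (rt a h ne)
   ; out = λ a h k ay → not-e (PQ _ (inP k)) ay
   ; uniq = λ a → uniqI _
   ; disj = λ a a' h h' k k' → [ (λ e → inl (cpi e)) , (λ e → inr (trans (sym (base-mk a' _)) (cong base e))) ] (disjI k k') }
   where
   cpi : ∀ {a a'} → cp a ≡ cp a' → a ≡ a'
   cpi {a} {a'} e = trans (sym (base-mk a _)) (trans (cong base e) (base-mk a' _))
   rt : ∀ a → A a ! → base (θ (cp a)) ≢ a →
    Chain E a (ints (cp a)) (base (θ (cp a))) × c a xor c (base (θ (cp a))) ≡ isOdd (length (ints (cp a)))
   rt a h ne with route (cp a) (λ e → ne (trans (cong base e) (base-mk _ _)))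
   ... | inl (e , _) = void (ne (trans (sym e) (base-mk _ _)))
   ... | inr (ch , pr) = subst (λ z → Chain E z (ints (cp a)) (base (θ (cp a)))) (base-mk _ _) ch ,
       trans (cong₂ _xor_ (sym (side-mk a (c a))) (sym (trans (cong side (snd (θ-A a h))) (side-mk _ _)))) pr

  covers : card A ≤ m + OddPacking.pcount packing
  covers = ≤-trans (card-∪ {U = λ a → A a ∧ (base (θ (cp a)) == a)} {V = λ a → A a ∧ not (base (θ (cp a)) == a)}
    (λ a h → [ (λ e → inl (∧-i h e)) , (λ ne → inr (∧-i h (not-i ne))) ] (bool (base (θ (cp a)) == a))))
   (+-monoˡ-≤ (OddPacking.pcount packing) (≤-trans (card-inj cp into inj) lost))
   where
   into : ∀ a → A a ∧ (base (θ (cp a)) == a) ! → term P (cp a) ∧ (θ (cp a) == cp a) !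
   into a h = ∧-i (∧-i (trans (W-mk a (c a)) (alive-c a)) (not-i (λ p → not-e (PQ a (trans (cong P (sym (base-mk a _))) p)) (∧-l h))))
    (==-i (trans (snd (θ-A a (∧-l h))) (cong cp (==-e (∧-r {A a} h)))))
   inj : ∀ a b → _ ! → _ ! → cp a ≡ cp b → a ≡ b
   inj a b _ _ e = trans (sym (base-mk a _)) (trans (cong base e) (base-mk b _))

 module _ (M : Mat W) (Bar : Barrier W (miss M)) where
  open Barrier Bar

  W'-alive : ∀ {v b} → W' (mk v b) ! → alive v b !
  W'-alive {v} {b} w = trans (sym (W-mk v b)) (W'⊆W _ w)

  Boundary : Fin (n + n) → Set
  Boundary x = A (base x) ! ⊎ ¬ (W' (mir x) !)

  vertical : ∀ x → ¬ (A (base x) !) → CAdj x (mir x)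
  vertical x na = inl (sym (base-mir x) , (λ e → nb (side x) (trans e (side-mir x))) , not-i na)
   where nb : ∀ b → b ≢ not b
         nb true ()
         nb false ()

  -- otherwise matching every vertex of the component with its mirror image would be better
  boundary : ∀ ρ → missed M' ρ ! → NN (Σ[ β ∈ Fin (n + n) ] Conn W' ρ β × Boundary β)
  boundary ρ mρ none = run (compr (Conn W' ρ) >>= λ { (K , hK) → ret (contra K hK) })
   where
   wρ = fst (missed-e M' mρ)
   module _ (K : Sub (n + n)) (hK : ∀ z → (K z ! → Conn W' ρ z) × (Conn W' ρ z → K z !)) where
    nA : ∀ {z} → K z ! → ¬ (A (base z) !)
    nA {z} k a = none (z , fst (hK z) k , inl a)
    nW : ∀ {z} → K z ! → W' (mir z) !
    nW {z} k with bool (W' (mir z))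
    ... | inl w = w
    ... | inr nw = void (none (z , fst (hK z) k , inr nw))
    Kmir : ∀ {z} → K z ! → K (mir z) !
    Kmir {z} k = snd (hK _) (conn-trans (fst (hK z) k) (cons (conn-r (fst (hK z) k)) (vertical z (nA k)) (nil (nW k))))
    ν : Fin (n + n) → Fin (n + n)
    ν z = if K z then mir z else μ M' z
    ν-K : ∀ {z} → K z ! → ν z ≡ mir z
    ν-K k rewrite k = refl
    ν-o : ∀ {z} → ¬ (K z !) → ν z ≡ μ M' z
    ν-o {z} k with K z
    ... | true = void (k refl)
    ... | false = refl
    oK : ∀ {z} → ¬ (K z !) → ¬ (K (μ M' z) !)
    oK {z} nk k with μ M' z ≟F z
    ... | yes e = nk (subst (λ y → K y !) e k)
    ... | no ne = nk (snd (hK z) (conn-trans (fst (hK _) k) (cons (conn-r (fst (hK _) k)) (cadj-sym (snd (ok M' z ne))) (nil (fst (ok M' z ne))))))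
    better : Mat W'
    better = record { μ = ν ; inv = inv' ; ok = ok' }
     where
     inv' : ∀ z → ν (ν z) ≡ z
     inv' z with bool (K z)
     ... | inl k = trans (cong ν (ν-K k)) (trans (ν-K (Kmir k)) (mir-mir z))
     ... | inr k = trans (cong ν (ν-o k)) (trans (ν-o (oK k)) (inv M' z))
     ok' : ∀ z → ν z ≢ z → W' z ! × CAdj z (ν z)
     ok' z ne with bool (K z)
     ... | inl k = conn-r (fst (hK z) k) , subst (CAdj z) (sym (ν-K k)) (vertical z (nA k))
     ... | inr k = let (a , b) = ok M' z (λ e → ne (trans (ν-o k) e)) in a , subst (CAdj z) (sym (ν-o k)) b
    contra : ⊥
    contra = <⇒≱ (card-strict {S = missed better} {U = missed M'} sub ρ mρ (λ h → mir-≢ ρ (trans (sym (ν-K kρ)) (snd (missed-e better h))))) (max better)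
     where
     kρ : K ρ !
     kρ = snd (hK ρ) (nil wρ)
     sub : ∀ z → missed better z ! → missed M' z !
     sub z h with bool (K z)
     ... | inl k = void (mir-≢ z (trans (sym (ν-K k)) (snd (missed-e better h))))
     ... | inr k = missed-i M' (fst (missed-e better h)) (trans (sym (ν-o k)) (snd (missed-e better h)))

  module _ (β : Fin (n + n) → Fin (n + n)) (hβ : ∀ ρ → missed M' ρ ! → Conn W' ρ (β ρ) × Boundary (β ρ)) where

   kept : Sub n
   kept v = anyb (λ ρ → missed M' ρ ∧ (base (β ρ) == v))

   kept-e : ∀ {v} → kept v ! → Σ[ ρ ∈ Fin (n + n) ] missed M' ρ ! × base (β ρ) ≡ v
   kept-e {v} k = let (ρ , h) = anyb-e _ k in ρ , ∧-l h , ==-e (∧-r {missed M' ρ} h)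

   type0 : Sub n
   type0 v = not (A v) ∧ (W' (mk v false) ∧ W' (mk v true))

   type0-W : ∀ {v} → type0 v ! → ∀ b → W' (mk v b) !
   type0-W {v} t true = ∧-r {W' (mk v false)} (∧-r {not (A v)} t)
   type0-W {v} t false = ∧-l {W' (mk v false)} (∧-r {not (A v)} t)

   -- A boundary vertex is the only copy of its base in `W'`: terminals have just one copy, and for
   -- other vertices the mirror image is gone.
   bd-W : ∀ {x} → W' x ! → Boundary x → ∀ {b} → W' (mk (base x) b) ! → mk (base x) b ≡ x
   bd-W {x} w bd {b} w' with same-base {x = x} {y = mk (base x) b} (sym (base-mk _ _))
   ... | inl e = e
   ... | inr e with bd
   ...   | inl a = trans (W-A (W'⊆W _ w') (trans (cong A (base-mk _ _)) a)) (trans (cong cp (base-mk _ _)) (sym (W-A (W'⊆W _ w) a)))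
   ...   | inr nw = void (nw (subst (λ z → W' z !) e w'))

   kept-type0 : ∀ {v} → kept v ! → type0 v ! → ⊥
   kept-type0 k t with kept-e k
   ... | ρ , m , refl with hβ ρ m
   ...   | cn , bd with bd-W (conn-r cn) bd (type0-W t true) | bd-W (conn-r cn) bd (type0-W t false)
   ...     | p | q = t≢f (trans (sym (side-mk _ _)) (trans (cong side (trans p (sym q))) (side-mk _ _)))

   same-rep : ∀ {ρ ρ'} → missed M' ρ ! → missed M' ρ' ! → Conn W' (β ρ) (β ρ') → ρ ≡ ρ'
   same-rep {ρ} {ρ'} m m' cn with ρ ≟F ρ'
   ... | yes e = e
   ... | no ne = void (conn-sim missable (conn-trans (fst (hβ ρ m)) (conn-trans cn (conn-sym (fst (hβ ρ' m'))))) ne M' max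
       (snd (missed-e M' m)) (snd (missed-e M' m')))

   -- By `bd-W` two representatives with the same base coincide, hence lie in one component, and a
   -- component has only one missed vertex.
   many : miss M' ≤ card kept
   many = card-inj (λ ρ → base (β ρ)) (λ ρ m → anyb-i _ ρ (∧-i m (==-refl _))) inj
    where
    inj : ∀ ρ ρ' → missed M' ρ ! → missed M' ρ' ! → base (β ρ) ≡ base (β ρ') → ρ ≡ ρ'
    inj ρ ρ' m m' e = same-rep m m' (subst (Conn W' (β ρ)) eq (nil (conn-r (fst (hβ ρ m)))))
     where
     w' = conn-r (fst (hβ ρ' m'))
     eq : β ρ ≡ β ρ'
     eq = trans (sym (mk-η _)) (trans (sym (trans (cong (λ b → mk b (side (β ρ))) refl) refl)) (bd-W w' (snd (hβ ρ' m'))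
         (subst (λ z → W' z !) (trans (sym (mk-η (β ρ))) (cong (λ b → mk b (side (β ρ))) e)) (conn-r (fst (hβ ρ m))))
        ▹ cong (λ b → mk b (side (β ρ))) e))
      where
      _▹_ : ∀ {a b c : Fin (n + n)} → a ≡ b → c ≡ a → c ≡ b
      p ▹ q = trans q p

   -- The odd cycle cover in the making. A vertex outside it is kept, and then coloured by its
   -- surviving copy, or satisfies `type0`, which `no-lobe` rules out.
   Y : Sub n
   Y v = not (kept v) ∧ not (type0 v)

   pointwise : ∀ v → (b2n (Y v) + b2n (kept v)) + (b2n (W' (mk v false)) + b2n (W' (mk v true))) ≤
    (b2n (W (mk v false)) + b2n (W (mk v true))) + b2n (A v)
   pointwise v rewrite W-mk v false | W-mk v true with A v in ea | kept v in ek | W' (mk v false) in ef | W' (mk v true) in et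
   ... | false | true | true | true = void (kept-type0 {v} ek (cong₂ _∧_ (cong not ea) (cong₂ _∧_ ef et)))
   ... | false | true | true | false = ≤-refl
   ... | false | true | false | true = ≤-refl
   ... | false | true | false | false = s≤s z≤n
   ... | false | false | true | true = ≤-refl
   ... | false | false | true | false = ≤-refl
   ... | false | false | false | true = ≤-refl
   ... | false | false | false | false = s≤s z≤n
   ... | true | _ | true | true = void (t≢f (trans (alive-A ea (W'-alive et)) (sym (alive-A ea (W'-alive ef)))))
   ... | true | true | true | false = lem (c v)
    where lem : ∀ b → 2 ≤ b2n (not b) + b2n (not (not b)) + 1
          lem true = ≤-refl
          lem false = ≤-refl
   ... | true | false | true | false = lem (c v)
    where lem : ∀ b → 2 ≤ b2n (not b) + b2n (not (not b)) + 1
          lem true = ≤-refl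
          lem false = ≤-refl
   ... | true | true | false | true = lem (c v)
    where lem : ∀ b → 2 ≤ b2n (not b) + b2n (not (not b)) + 1
          lem true = ≤-refl
          lem false = ≤-refl
   ... | true | false | false | true = lem (c v)
    where lem : ∀ b → 2 ≤ b2n (not b) + b2n (not (not b)) + 1
          lem true = ≤-refl
          lem false = ≤-refl
   ... | true | true | false | false = m≤n+m 1 _
   ... | true | false | false | false = m≤n+m 1 _

   bound : card Y + miss M ≤ card A
   bound = lin (1 ∷ 1 ∷ 1 ∷ 1 ∷ []) (card Y ∷ card kept ∷ card W' ∷ card W ∷ card A ∷ miss M ∷ miss M' ∷ [])
     (λ y k w' w a m m' → (y :+ k) :+ w' :≤ w :+ a ⇒ m :+ w :≤ m' :+ w' ⇒ m' :≤ k ⇒ qed (y :+ m :≤ a))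
     total count many
    where
    total : (card Y + card kept) + card W' ≤ card W + card A
    total rewrite card-cover W' | card-cover W | card-def (λ v → W' (mk v false)) | card-def (λ v → W' (mk v true))
       | card-def Y | card-def kept | card-def (λ v → W (mk v false)) | card-def (λ v → W (mk v true)) | card-def A
       | sym (sum-+ (λ v → b2n (W' (mk v false))) (λ v → b2n (W' (mk v true))))
       | sym (sum-+ (λ v → b2n (W (mk v false))) (λ v → b2n (W (mk v true))))
       | sym (sum-+ (λ v → b2n (Y v)) (λ v → b2n (kept v)))
       | sym (sum-+ (λ v → b2n (Y v) + b2n (kept v)) (λ v → b2n (W' (mk v false)) + b2n (W' (mk v true))))
       | sym (sum-+ (λ v → b2n (W (mk v false)) + b2n (W (mk v true))) (λ v → b2n (A v))) = sum-mono pointwise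

   miss≤ : miss M ≤ card kept
   miss≤ = lin (1 ∷ 1 ∷ 1 ∷ 1 ∷ []) (miss M ∷ card W ∷ miss M' ∷ card W' ∷ card kept ∷ []) (λ m w m' w' k →
    m :+ w :≤ m' :+ w' ⇒ w' :≤ w ⇒ m' :≤ k ⇒ qed (m :≤ k)) count (card-mono W'⊆W) many

   cadj : ∀ {u v} b → E u v ! → CAdj (mk u b) (mk v b)
   cadj {u} {v} b e = inr (trans (cong₂ E (base-mk u b) (base-mk v b)) e , trans (cong₂ _xor_ (side-mk u b) (side-mk v b)) (xor-self b))

   module _ (h : ℕ) (conn : ∀ (Z : Sub n) → card Z ≤ h → ∀ u v → ¬ (Z u !) → ¬ (Z v !) →
         Σ[ L ∈ List (Fin n) ] PathL E u v L × (∀ y → y ∈ L → ¬ (Z y !)))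
        (small : card Y + 1 ≤ h) (two : 2 ≤ miss M) where

    InK : Fin n → Fin n → Set
    InK v0 w = Σ[ ρ ∈ Fin (n + n) ] missed M' ρ ! × base (β ρ) ≡ w × Conn W' (mk v0 false) (β ρ)

    -- a vertex with both copies left over would be cut off by Y and one further vertex
    no-lobe : ∀ v0 → type0 v0 ! → ⊥
    no-lobe v0 t0 = run (em (Σ[ k ∈ Fin n ] InK v0 k) >>= λ where
      (no none) → let (w , kw) = card-ex kept (≤-trans (s≤s z≤n) (≤-trans two miss≤)) in
        ret (walk Y (≤-trans (m≤m+n _ 1) small) (λ v h → h) w kw (Y-kept kw) (λ ink → void (none (w , ink))) (λ c ink → void (none (c , ink))) (Y-type0 t0))
      (yes (k , ink)) → let (w , q) = other k in
        ret (walk (λ v → Y v ∨ (v == k)) (≤-trans (≤-trans (card-∪ {U = Y} {V = _== k} (λ v → ∨-e)) (+-monoʳ-≤ (card Y) (≤-eq (card-sing k)))) small)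
         (λ v h → ∨-l h) w (∧-l q) (λ z → [ Y-kept (∧-l q) , not-e (∧-r {kept w} q) ] (∨-e {Y w} z))
         (λ inw → not-e (∧-r {kept w} q) (==-i (unique inw ink))) (λ c inc → ∨-r {Y c} (==-i (unique inc ink)))
         (λ z → [ Y-type0 t0 , (λ e → kept-type0 {v0} (subst (λ y → kept y !) (sym (==-e e)) (inK-kept ink)) t0) ] (∨-e {Y v0} z))))
     where
     Y-kept : ∀ {w} → kept w ! → ¬ (Y w !)
     Y-kept {w} k y = not-e (∧-l y) k
     Y-type0 : ∀ {w} → type0 w ! → ¬ (Y w !)
     Y-type0 {w} t y = not-e (∧-r {not (kept w)} y) t
     inK-kept : ∀ {k} → InK v0 k → kept k !
     inK-kept (ρ , m , e , _) = anyb-i _ ρ (∧-i m (==-i e))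
     unique : ∀ {k k'} → InK v0 k → InK v0 k' → k ≡ k'
     unique (ρ , m , refl , cn) (ρ' , m' , refl , cn') = cong (λ ρ → base (β ρ)) (same-rep m m' (conn-trans (conn-sym cn) cn'))
     other : ∀ k → Σ[ w ∈ Fin n ] kept w ∧ not (w == k) !
     other k = card-ex _ (+-cancelʳ-≤ 1 1 _ (≤-trans two (≤-trans miss≤ (≤-trans (card-∪ {U = λ w → kept w ∧ not (w == k)} {V = _== k}
      (λ w kw → [ inr , (λ ne → inl (∧-i kw (not-i ne))) ] (bool (w == k)))) (+-monoʳ-≤ _ (≤-eq (card-sing k)))))))
     -- While the path runs through vertices of `type0` it remains in the component of `v0`. The
     -- first other vertex lies in `Y` or is the base of the one representative of that component,
     -- and `Z` contains both.
     walk : (Z : Sub n) → card Z ≤ h → (∀ v → Y v ! → Z v !) → ∀ w → kept w ! → ¬ (Z w !) → (InK v0 w → ⊥) →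
      (∀ c → InK v0 c → Z c !) → ¬ (Z v0 !) → ⊥
     walk Z cz YZ w kw zw nw hz z0 with conn Z cz v0 w z0 zw
     ... | L , p , av = go p t0 (nil (type0-W t0 false)) av kw
      where
      go : ∀ {a b L} → PathL E a b L → type0 a ! → Conn W' (mk v0 false) (mk a false) → (∀ y → y ∈ L → ¬ (Z y !)) → kept b ! → ⊥
      go {a} one t _ _ k = kept-type0 {a} k t
      go (_◂_ {a} {c1} e p) t cn av k with bool (type0 c1) | bool (kept c1)
      ... | inl t' | _ = go p t' (conn-trans cn (cons (type0-W t false) (cadj false e) (nil (type0-W t' false)))) (λ y m → av y (there m)) k
      ... | inr nt | inr nk = av c1 (there (first∈ p)) (YZ c1 (∧-i (not-i nk) (not-i nt)))
      ... | inr nt | inl kc with kept-e kc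
      ...   | ρ , m , refl = av c1 (there (first∈ p)) (hz c1 (ρ , m , refl , conn-trans cn (conn-trans (tocopy (side (β ρ)))
           (cons (type0-W t _) (cadj _ e) (subst (λ z → Conn W' z (β ρ)) (sym (mk-η _)) (nil (conn-r (fst (hβ ρ m)))))))))
       where
       tocopy : ∀ b → Conn W' (mk a false) (mk a b)
       tocopy false = nil (type0-W t false)
       tocopy true = cons (type0-W t false) (inl (trans (base-mk _ _) (sym (base-mk _ _)) ,
         (λ e → t≢f (sym (trans (sym (side-mk _ _)) (trans e (side-mk _ _))))) , trans (cong Q (base-mk _ _)) (∧-l t))) (nil (type0-W t true))

    -- The colour of a vertex is its surviving copy. An edge between vertices of equal colour lifts
    -- to an edge of the cover between their representatives, which would then belong to the same
    -- missed vertex.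
    bipartite : (∀ v → E v v ! → ⊥) → Σ[ χ ∈ (Fin n → Bool) ] (∀ u v → ¬ (Y u !) → ¬ (Y v !) → E u v ! → χ u ≢ χ v)
    bipartite irr = (λ v → W' (mk v true)) , λ u v yu yv e eq → lem u v (isKept u yu) (isKept v yv) e eq
     where
     isKept : ∀ v → ¬ (Y v !) → kept v !
     isKept v ny with bool (kept v)
     ... | inl k = k
     ... | inr nk = void (ny (∧-i (not-i nk) (not-i (no-lobe v))))
     copy : ∀ {v ρ} → missed M' ρ ! → base (β ρ) ≡ v → β ρ ≡ mk v (W' (mk v true))
     copy {ρ = ρ} m refl with W' (mk (base (β ρ)) true) in eq
     ... | true = sym (bd-W (conn-r (fst (hβ ρ m))) (snd (hβ ρ m)) eq)
     ... | false with side (β ρ) in es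
     ...   | false = trans (sym (mk-η _)) (cong (mk _) es)
     ...   | true = void (t≢f (trans (sym (conn-r (fst (hβ ρ m)))) (trans (cong W' (trans (sym (mk-η _)) (cong (mk _) es))) eq)))
     lem : ∀ u v → kept u ! → kept v ! → E u v ! → W' (mk u true) ≡ W' (mk v true) → ⊥
     lem u v ku kv e eq with kept-e ku | kept-e kv
     ... | ρ , m , bu | ρ' , m' , bv = irr u (subst (λ z → E u z !) (sym (trans (sym bu) (trans (cong (λ ρ → base (β ρ)) (same-rep m m' cn)) bv))) e)
      where
      cn : Conn W' (β ρ) (β ρ')
      cn = cons (conn-r (fst (hβ ρ m))) (subst₂ CAdj (sym (copy m bu)) (sym (trans (copy m' bv) (cong (mk v) (sym eq)))) (cadj _ e)) (nil (conn-r (fst (hβ ρ' m'))))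

 -- The first condition keeps `Y` with one more vertex within reach of the connectivity `h`; the
 -- second makes at least two missed copies remain, so that a kept vertex is left on the other side.
 PackOrCover : ℕ → Set
 PackOrCover h = Σ[ Pk ∈ OddPacking E A c ] (OddPacking.pcount Pk + 1 ≤ h → OddPacking.pcount Pk + 2 ≤ card A →
   Σ[ Y ∈ Sub n ] card Y ≤ OddPacking.pcount Pk × (Σ[ χ ∈ (Fin n → Bool) ] (∀ u v → ¬ (Y u !) → ¬ (Y v !) → E u v ! → χ u ≢ χ v)))

 oddTheorem : (∀ v → E v v ! → ⊥) → (h : ℕ) →
  (∀ (Z : Sub n) → card Z ≤ h → ∀ u v → ¬ (Z u !) → ¬ (Z v !) → Σ[ L ∈ List (Fin n) ] PathL E u v L × (∀ y → y ∈ L → ¬ (Z y !))) →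
  NN (PackOrCover h)
 oddTheorem irr h conn = maxMat W >>= λ { (M , mx) → barrier M mx >>= λ Bar →
  choose (λ ρ → nnif {x = ρ} (missed (Barrier.M' Bar) ρ) (λ m → boundary M Bar ρ m)) >>= λ f →
  ret (fin M Bar (λ ρ → fst (f ρ)) (λ ρ → snd (f ρ)) (extract M)) }
  where
  nnif : ∀ {P : Fin (n + n) → Set} {x : Fin (n + n)} (b : Bool) → (b ! → NN (Σ[ y ∈ Fin (n + n) ] P y)) → NN (Σ[ y ∈ Fin (n + n) ] (b ! → P y))
  nnif {x = x} false f = ret (x , λ ())
  nnif true  f = f refl >>= λ { (y , p) → ret (y , λ _ → p) }
  fin : (M : Mat W) (Bar : Barrier W (miss M)) (β : Fin (n + n) → Fin (n + n)) →
   (∀ ρ → missed (Barrier.M' Bar) ρ ! → Conn (Barrier.W' Bar) ρ (β ρ) × Boundary M Bar (β ρ)) →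
   Σ[ P ∈ Sub n ] (∀ v → P v ! → Q v !) × (∀ v → Q v ! → P v !) × St P (miss M) → PackOrCover h
  fin M Bar β hβ (P , pq , qp , St0) = packing pq qp St0 , λ small big →
   Y M Bar β hβ , yb , bipartite M Bar β hβ h conn (≤-trans (+-monoˡ-≤ 1 yb) small)
    (+-cancelˡ-≤ (OddPacking.pcount (packing pq qp St0)) 2 (miss M) (≤-trans big (≤-trans (covers pq qp St0) (≤-eq (+-comm (miss M) _))))) irr
   where
   yb : card (Y M Bar β hβ) ≤ OddPacking.pcount (packing pq qp St0)
   yb = +-cancelʳ-≤ (miss M) _ _ (≤-trans (bound M Bar β hβ) (≤-trans (covers pq qp St0) (≤-eq (+-comm (miss M) _))))

-- Sums over disjoint lists of vertices

sumL : ∀ {A : Set} → (A → ℕ) → List A → ℕ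
sumL f []      = 0
sumL f (x ∷ L) = f x + sumL f L

elem : ∀ {n} → Fin n → List (Fin n) → Bool
elem y []      = false
elem y (x ∷ L) = (y == x) ∨ elem y L

elem-i : ∀ {n} {y : Fin n} {L} → y ∈ L → elem y L !
elem-i (here e)  = ∨-l (==-i e)
elem-i {y = y} {x ∷ L} (there m) = ∨-r {y == x} (elem-i m)

elem-e : ∀ {n} {y : Fin n} L → elem y L ! → y ∈ L
elem-e {y = y} (x ∷ L) h with ∨-e {y == x} h
... | inl e = here (==-e e)
... | inr k = there (elem-e L k)

sumL-elem : ∀ {n} (f : Fin n → ℕ) L → Uniq L → sumL f L ≡ sum (λ y → b2n (elem y L) * f y)
sumL-elem {n} f []      u = sym (sum-0 n)
sumL-elem f (x ∷ L) (x∉ , u) = trans (cong₂ _+_ (sym (sum-δ f x)) (sumL-elem f L u))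
 (trans (sym (sum-+ (λ y → b2n (y == x) * f y) (λ y → b2n (elem y L) * f y))) (sum-cong pt))
 where
 pt : ∀ y → b2n (y == x) * f y + b2n (elem y L) * f y ≡ b2n ((y == x) ∨ elem y L) * f y
 pt y with y == x in e | elem y L in k
 ... | true | true = void (x∉ (subst (_∈ L) (==-e e) (elem-e L k)))
 ... | true | false = +-identityʳ _
 ... | false | true = refl
 ... | false | false = refl

wsum : ∀ {n} → (Fin n → ℕ) → Sub n → ℕ
wsum f S = sum (λ y → b2n (S y) * f y)

wsum-1 : ∀ {n} (S : Sub n) → wsum (λ _ → 1) S ≡ card S
wsum-1 S = trans (sum-cong (λ y → *-identityʳ (b2n (S y)))) (sym (card-def S))

sumL-1 : ∀ {A : Set} (L : List A) → sumL (λ _ → 1) L ≡ length L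
sumL-1 []      = refl
sumL-1 (x ∷ L) = cong suc (sumL-1 L)

module _ {n p : ℕ} (f : Fin n → ℕ) (gl : Fin p → List (Fin n)) (gu : ∀ i → Uniq (gl i)) where

 sumGroups : sum (λ i → sumL f (gl i)) ≡ sum (λ y → sum (λ i → b2n (elem y (gl i)) * f y))
 sumGroups = trans (sum-cong (λ i → sumL-elem f (gl i) (gu i))) (sum-swap (λ i y → b2n (elem y (gl i)) * f y))

 wsum-cover : ∀ {S K B : Sub n} → (∀ y → S y ! → K y ! ⊎ B y ! ⊎ (Σ[ i ∈ Fin p ] y ∈ gl i)) →
  wsum f S ≤ wsum f K + (wsum f B + sum (λ i → sumL f (gl i)))
 wsum-cover {S} {K} {B} h rewrite sumGroups
  | sym (sum-+ (λ y → b2n (B y) * f y) (λ y → sum (λ i → b2n (elem y (gl i)) * f y)))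
  | sym (sum-+ (λ y → b2n (K y) * f y) (λ y → b2n (B y) * f y + sum (λ i → b2n (elem y (gl i)) * f y))) = sum-mono pt
  where
  pt : ∀ y → b2n (S y) * f y ≤ b2n (K y) * f y + (b2n (B y) * f y + sum (λ i → b2n (elem y (gl i)) * f y))
  pt y with S y in es
  ... | false = z≤n
  ... | true with h y es
  ...   | inl k rewrite k = m≤m+n _ _
  ...   | inr (inl b) rewrite b = ≤-trans (m≤m+n _ _) (m≤n+m _ (b2n (K y) * f y))
  ...   | inr (inr (i , m)) = ≤-trans (≤-trans (≤-eq (cong (λ z → b2n z * f y) (sym (elem-i m))))
       (sum-≥ (λ i → b2n (elem y (gl i)) * f y) i)) (≤-trans (m≤n+m _ (b2n (B y) * f y)) (m≤n+m _ (b2n (K y) * f y)))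

 wsum-pack : ∀ {S K B : Sub n} → (∀ y → K y ! → S y !) → (∀ y → B y ! → S y !) →
  (∀ i {y} → y ∈ gl i → S y !) → (∀ y → K y ! → B y ! → ⊥) →
  (∀ i {y} → y ∈ gl i → K y ! → ⊥) → (∀ i {y} → y ∈ gl i → B y ! → ⊥) → (∀ i j {y} → y ∈ gl i → y ∈ gl j → i ≡ j) →
  wsum f K + (wsum f B + sum (λ i → sumL f (gl i))) ≤ wsum f S
 wsum-pack {S} {K} {B} hK hB hg dKB dgK dgB dg rewrite sumGroups
  | sym (sum-+ (λ y → b2n (B y) * f y) (λ y → sum (λ i → b2n (elem y (gl i)) * f y)))
  | sym (sum-+ (λ y → b2n (K y) * f y) (λ y → b2n (B y) * f y + sum (λ i → b2n (elem y (gl i)) * f y))) = sum-mono pt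
  where
  none : ∀ y → (∀ i → ¬ (y ∈ gl i)) → sum (λ i → b2n (elem y (gl i)) * f y) ≡ 0
  none y h = trans (sum-cong (λ i → lem i)) (sum-0 p)
   where
   lem : ∀ i → b2n (elem y (gl i)) * f y ≡ 0
   lem i with elem y (gl i) in e
   ... | true = void (h i (elem-e (gl i) e))
   ... | false = refl
  pt : ∀ y → b2n (K y) * f y + (b2n (B y) * f y + sum (λ i → b2n (elem y (gl i)) * f y)) ≤ b2n (S y) * f y
  pt y with K y in ek
  ... | true rewrite hK y ek | none y (λ i m → dgK i m ek) with B y in eb
  ...   | true = void (dKB y ek eb)
  ...   | false = ≤-eq (+-identityʳ _)
  pt y | false with B y in eb
  ... | true rewrite hB y eb | none y (λ i m → dgB i m eb) = ≤-eq (+-identityʳ _)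
  ... | false with anyb (λ i → elem y (gl i)) in eg
  ...   | false rewrite none y (λ i m → t≢f (trans (sym (anyb-i _ i (elem-i m))) eg)) = z≤n
  ...   | true with anyb-e _ eg
  ...     | i , e rewrite hg i (elem-e (gl i) e) = ≤-trans (≤-eq (sum-cong (λ j → only j))) (≤-eq (trans (sum-δ (λ _ → f y) i) (sym (+-identityʳ _))))
   where
   only : ∀ j → b2n (elem y (gl j)) * f y ≡ b2n (j == i) * f y
   only j with elem y (gl j) in ej | j == i in eij
   ... | true | true = refl
   ... | false | false = refl
   ... | true | false = void (t≢f (trans (sym (==-i (dg j i (elem-e (gl j) ej) (elem-e (gl i) e)))) eij))
   ... | false | true = void (t≢f (trans (sym e) (trans (cong (λ k → elem y (gl k)) (sym (==-e eij))) ej)))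

-- Pairs of terminals

record Pairs (n p : ℕ) : Set where
 field
  act : Fin p → Bool
  a b : Fin p → Fin n

-- The two ends of one pair may coincide, as `ab` shows; `Strict` excludes this. Such pairs arise
-- when a tail ends at an end of its own parity-breaking piece.
record Proper {n p : ℕ} (R : Sub n) (Pr : Pairs n p) : Set where
 open Pairs Pr
 field
  inRa : ∀ i → act i ! → R (a i) !
  inRb : ∀ i → act i ! → R (b i) !
  aa   : ∀ i j → act i ! → act j ! → a i ≡ a j → i ≡ j
  bb   : ∀ i j → act i ! → act j ! → b i ≡ b j → i ≡ j
  ab   : ∀ i j → act i ! → act j ! → a i ≡ b j → i ≡ j

-- By `ends` a link avoids all roots but its own, even roots of no active pair. Repetitions within a
-- list are allowed and are cut out only at assembly.
record Linkage {n p : ℕ} (E : Rl n) (R : Sub n) (Pr : Pairs n p) : Set where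
 open Pairs Pr
 field
  lst  : Fin p → List (Fin n)
  path : ∀ i → act i ! → PathL E (a i) (b i) (lst i)
  disj : ∀ i j → act i ! → act j ! → ∀ {y} → y ∈ lst i → y ∈ lst j → i ≡ j
  ends : ∀ i → act i ! → ∀ {y} → y ∈ lst i → R y ! → y ≡ a i ⊎ y ≡ b i

Strict : ∀ {n p} → Pairs n p → Set
Strict Pr = ∀ i → Pairs.act Pr i ! → Pairs.a Pr i ≢ Pairs.b Pr i

endL : ∀ {n p} → Pairs n p → Fin p → List (Fin n)
endL Pr i = if Pairs.act Pr i then Pairs.a Pr i ∷ Pairs.b Pr i ∷ [] else []

-- A dense set in which every vertex has few non-neighbours is linked by paths with at most two inner vertices.

record DenseSet (n p : ℕ) : Set where
 field
  E     : Rl n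
  E-sym : Symm E
  irr   : ∀ v → E v v ! → ⊥
  S     : Sub n
  r     : ℕ
  R     : Sub n
  R⊆S   : ∀ y → R y ! → S y !
  cR    : card R ≤ 2 * r
  Pr    : Pairs n p
  PP    : Proper R Pr
  PS    : Strict Pr
  big   : 3 * r ≤ card S

module DenseS {n p : ℕ} (data-S : DenseSet n p) where
 open DenseSet data-S
 open Pairs Pr
 open Proper PP

 non : Fin n → ℕ
 non v = card (λ y → S y ∧ not (E v y))

 F : Sub n
 F y = S y ∧ not (R y)

 data Lk : Set where
  unl dir : Lk
  mid     : Fin n → Lk
  two     : Fin n → Fin n → Lk

 uses : Lk → List (Fin n)
 uses unl       = []
 uses dir       = []
 uses (mid m)   = m ∷ []
 uses (two y z) = y ∷ z ∷ []

 Good : Fin p → Lk → Set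
 Good i unl       = ⊤
 Good i dir       = act i ! × E (a i) (b i) !
 Good i (mid m)   = act i ! × F m ! × E (a i) m ! × E m (b i) !
 Good i (two y z) = act i ! × F y ! × F z ! × y ≢ z × E (a i) y ! × E y z ! × E z (b i) !

 good-F : ∀ i x → Good i x → ∀ {y} → y ∈ uses x → F y !
 good-F i (mid m) (_ , f , _) (here refl) = f
 good-F i (two y z) (_ , f , _) (here refl) = f
 good-F i (two y z) (_ , _ , f , _) (there (here refl)) = f

 record Sys : Set where
  field
   lk   : Fin p → Lk
   good : ∀ i → Good i (lk i)
   disj : ∀ i j {y} → y ∈ uses (lk i) → y ∈ uses (lk j) → i ≡ j
 open Sys

 short linked : Lk → Bool
 short unl = false
 short dir = true
 short (mid _) = true
 short (two _ _) = false
 linked unl = false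
 linked dir = true
 linked (mid _) = true
 linked (two _ _) = true

 #short #linked : Sys → ℕ
 #short s = sum (λ i → b2n (short (lk s i)))
 #linked s = sum (λ i → b2n (linked (lk s i)))

 clash : Lk → Lk → Bool
 clash unl l = false
 clash dir l = false
 clash (mid m) l = elem m (uses l)
 clash (two y z) l = elem y (uses l) ∨ elem z (uses l)

 clash-i : ∀ x l {y} → y ∈ uses x → y ∈ uses l → clash x l !
 clash-i (mid m) l (here refl) k = elem-i k
 clash-i (two y z) l (here refl) k = ∨-l (elem-i k)
 clash-i (two y z) l (there (here refl)) k = ∨-r {elem y (uses l)} (elem-i k)

 -- Links that share a vertex with the new one are given up. By `count-upd` a count suffers no loss
 -- as long as none of these was counted.
 upd : (s : Sys) (i : Fin p) (x : Lk) → Good i x → Sys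
 upd s i x g = record { lk = lk' ; good = good' ; disj = disj' }
  where
  lk' : Fin p → Lk
  lk' t = if t == i then x else (if clash x (lk s t) then unl else lk s t)
  good' : ∀ t → Good t (lk' t)
  good' t with t == i in e
  ... | true = subst (λ t → Good t x) (sym (==-e e)) g
  ... | false with clash x (lk s t)
  ...   | true = tt
  ...   | false = good s t
  disj' : ∀ t t' {y} → y ∈ uses (lk' t) → y ∈ uses (lk' t') → t ≡ t'
  disj' t t' k k' with t == i in e | t' == i in e'
  ... | true | true = trans (==-e e) (sym (==-e e'))
  ... | true | false with clash x (lk s t') in c
  ...   | false = void (t≢f (trans (sym (clash-i x (lk s t') k k')) c))
  disj' t t' k () | true | false | true
  disj' t t' k k' | false | true with clash x (lk s t) in c
  ...   | false = void (t≢f (trans (sym (clash-i x (lk s t) k' k)) c))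
  disj' t t' () k' | false | true | true
  disj' t t' k k' | false | false with clash x (lk s t) | clash x (lk s t')
  ...   | false | false = disj s t t' k k'
  disj' t t' () k' | false | false | true | _
  disj' t t' k () | false | false | false | true

 upd-at : ∀ s i x g → lk (upd s i x g) i ≡ x
 upd-at s i x g rewrite ==-refl i = refl

 upd-else : ∀ s i x g t → t ≢ i → clash x (lk s t) ≡ false → lk (upd s i x g) t ≡ lk s t
 upd-else s i x g t ne c with t == i in e
 ... | true = void (ne (==-e e))
 ... | false rewrite c = refl

 count-upd : (q : Lk → Bool) → q unl ≡ false → ∀ s i x g → (∀ t → t ≢ i → clash x (lk s t) ! → q (lk s t) ! → ⊥) →
  sum (λ t → b2n (q (lk s t))) + b2n (q x) ≤ sum (λ t → b2n (q (lk (upd s i x g) t))) + b2n (q (lk s i))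
 count-upd q qu s i x g h = subst₂ _≤_ (trans (sum-+ (λ t → b2n (q (lk s t))) (λ t → b2n (t == i) * b2n (q x))) (cong (sum (λ t → b2n (q (lk s t))) +_) (sum-δ (λ _ → b2n (q x)) i)))
   (trans (sum-+ (λ t → b2n (q (lk (upd s i x g) t))) (λ t → b2n (t == i) * b2n (q (lk s i)))) (cong (sum (λ t → b2n (q (lk (upd s i x g) t))) +_) (sum-δ (λ _ → b2n (q (lk s i))) i)))
   (sum-mono pt)
  where
  pt : ∀ t → b2n (q (lk s t)) + b2n (t == i) * b2n (q x) ≤ b2n (q (lk (upd s i x g) t)) + b2n (t == i) * b2n (q (lk s i))
  pt t with t == i in e
  ... | true rewrite ==-e e = ≤-eq (trans (cong (b2n (q (lk s i)) +_) (+-identityʳ _)) (trans (+-comm (b2n (q (lk s i))) (b2n (q x))) (cong (b2n (q x) +_) (sym (+-identityʳ _)))))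
  ... | false with clash x (lk s t) in c
  ...   | false = ≤-refl
  ...   | true with q (lk s t) in eq
  ...     | false = z≤n
  ...     | true = void (h t (λ f → t≢f (trans (sym (==-i f)) e)) c eq)

 no-clash : ∀ s x t {P : Set} → (∀ {y} → y ∈ uses x → y ∈ uses (lk s t) → P) → clash x (lk s t) ! → P
 no-clash s (mid m) t h c = h (here refl) (elem-e (uses (lk s t)) c)
 no-clash s (two y z) t h c with ∨-e {elem y (uses (lk s t))} c
 ... | inl k = h (here refl) (elem-e (uses (lk s t)) k)
 ... | inr k = h (there (here refl)) (elem-e (uses (lk s t)) k)

 -- Together a lexicographic optimum: as many links with at most one inner vertex as possible, and
 -- then as many links as possible.
 MaxF MaxH : Sys → Set
 MaxF s = ∀ s' → #short s' ≤ #short s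
 MaxH s = ∀ s' → #short s ≤ #short s' → #linked s' ≤ #linked s

 -- Inner vertices of two-vertex links are included: sacrificing such a link for a short one
 -- improves the first criterion.
 Avail : Sys → Fin n → Set
 Avail s v = F v ! × (∀ t → v ∈ uses (lk s t) → short (lk s t) ! → ⊥)

 hard-miss : ∀ s → MaxF s → ∀ {v i} → Avail s v → act i ! → short (lk s i) ≡ false → E (a i) v ! → E v (b i) ! → ⊥
 hard-miss s mf {v} {i} (fv , na) ai si ea eb = <⇒≱ (≤-trans (≤-eq (+-comm 1 _)) (≤-trans (count-upd short refl s i (mid v) g
   (λ t _ c sh → no-clash s (mid v) t (λ { (here refl) k → na t k sh }) c)) (≤-eq (trans (cong (#short s' +_) (cong b2n si)) (+-identityʳ _))))) (mf s')
  where
  g : Good i (mid v)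
  g = ai , fv , ea , eb
  s' = upd s i (mid v) g

 -- exchanging the inner vertex m of a short link for v would free m for the unlinked pair i0
 mid-miss : ∀ s → MaxF s → ∀ {v i i0 m} → Avail s v → lk s i ≡ mid m → act i0 ! → lk s i0 ≡ unl →
  E (a i) v ! → E v (b i) ! → E (a i0) m ! → E m (b i0) ! → ⊥
 mid-miss s mf {v} {i} {i0} {m} (fv , na) ei a0 e0 ea eb e1 e2 = <⇒≱ (≤-trans (≤-eq (+-comm 1 _)) (≤-trans step1 step2)) (mf s″)
  where
  gi : Good i (mid m)
  gi = subst (Good i) ei (good s i)
  i≢i0 : i ≢ i0
  i≢i0 refl with trans (sym ei) e0
  ... | ()
  s' = upd s i (mid v) (fst gi , fv , ea , eb)
  lk0 : lk s' i0 ≡ unl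
  lk0 = trans (upd-else s i (mid v) (fst gi , fv , ea , eb) i0 (λ e → i≢i0 (sym e)) (trans (cong (λ l → elem v (uses l)) e0) refl)) e0
  m≢v : m ≢ v
  m≢v refl = na i (subst (λ l → m ∈ uses l) (sym ei) (here refl)) (subst (λ l → short l !) (sym ei) refl)
  g0 : Good i0 (mid m)
  g0 = a0 , fst (snd gi) , e1 , e2
  s″ = upd s' i0 (mid m) g0
  free : ∀ t → m ∈ uses (lk s' t) → ⊥
  free t k with t == i in e
  free t (here f) | true = m≢v f
  ... | false with elem v (uses (lk s t))
  ...   | false = t≢f (trans (sym (==-i (disj s t i k (subst (λ l → m ∈ uses l) (sym ei) (here refl))))) e)
  free t () | false | true
  step1 : #short s + 1 ≤ #short s' + 1
  step1 = ≤-trans (count-upd short refl s i (mid v) (fst gi , fv , ea , eb) (λ t _ c sh → no-clash s (mid v) t (λ { (here refl) k → na t k sh }) c))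
   (≤-eq (cong (λ l → #short s' + b2n (short l)) ei))
  step2 : #short s' + 1 ≤ #short s″
  step2 = ≤-trans (count-upd short refl s' i0 (mid m) g0 (λ t _ c _ → no-clash s' (mid m) t (λ { (here refl) k → free t k }) c))
   (≤-eq (trans (cong (λ l → #short s″ + b2n (short l)) lk0) (+-identityʳ _)))

 used : Sys → Sub n
 used s y = anyb (λ t → elem y (uses (lk s t)))

 K : Sys → Sub n
 K s y = F y ∧ not (used s y)

 K-avail : ∀ s {v} → K s v ! → Avail s v
 K-avail s {v} k = ∧-l k , λ t m _ → not-e (∧-r {F v} k) (anyb-i _ t (elem-i m))

 K-free : ∀ s {v t} → K s v ! → v ∈ uses (lk s t) → ⊥
 K-free s {v} {t} k m = not-e (∧-r {F v} k) (anyb-i _ t (elem-i m))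

 grp : Sys → Fin p → List (Fin n)
 grp s i = endL Pr i ++ uses (lk s i)

 -- What a pair must contribute to the cost in `Count`. The values are made for `balance`: on an
 -- active pair, twice the number of inner vertices is at most the weight plus one, with five units
 -- to spare at the unlinked pair `i0`.
 wt : Sys → Fin p → Fin p → ℕ
 wt s i0 i = if i == i0 then 4 else (if act i then weight (lk s i) else 0)
  where
  weight : Lk → ℕ
  weight unl = 2
  weight dir = 0
  weight (mid _) = 1
  weight (two _ _) = 4

 nE : Fin n → Fin n → ℕ
 nE v y = b2n (not (E v y))

 nE-1 : ∀ {v y} → ¬ (E v y !) → nE v y ≡ 1
 nE-1 h rewrite not-i h = refl

 end∈R : ∀ i {y} → y ∈ endL Pr i → act i ! × R y ! × (y ≡ a i ⊎ y ≡ b i)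
 end∈R i m with act i in e
 end∈R i (here refl) | true = refl , inRa i e , inl refl
 end∈R i (there (here refl)) | true = refl , inRb i e , inr refl

 end-uniq : ∀ i → Uniq (endL Pr i)
 end-uniq i with act i in e
 ... | true = (λ { (here f) → PS i e f }) , (λ ()) , tt
 ... | false = tt

 end-disj : ∀ i j {y} → y ∈ endL Pr i → y ∈ endL Pr j → i ≡ j
 end-disj i j m m' with end∈R i m | end∈R j m'
 ... | ai , _ , inl e | aj , _ , inl f = aa i j ai aj (trans (sym e) f)
 ... | ai , _ , inl e | aj , _ , inr f = ab i j ai aj (trans (sym e) f)
 ... | ai , _ , inr e | aj , _ , inl f = sym (ab j i aj ai (trans (sym f) e))
 ... | ai , _ , inr e | aj , _ , inr f = bb i j ai aj (trans (sym e) f)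

 uses-uniq : ∀ i x → Good i x → Uniq (uses x)
 uses-uniq i unl _ = tt
 uses-uniq i dir _ = tt
 uses-uniq i (mid m) _ = (λ ()) , tt
 uses-uniq i (two y z) (_ , _ , _ , ne , _) = (λ { (here e) → ne e }) , (λ ()) , tt

 uses-F : ∀ s i {y} → y ∈ uses (lk s i) → F y !
 uses-F s i = good-F i (lk s i) (good s i)

 #act : ℕ
 #act = sum (λ i → b2n (act i))

 act≤ : 2 * #act ≤ card R
 act≤ = ≤-trans (≤-trans (≤-eq (trans (sym (sum-*ˡ 2 (λ i → b2n (act i)))) (sum-cong len))) (m≤n+m _ (wsum {n} (λ _ → 1) (λ _ → false) + wsum {n} (λ _ → 1) (λ _ → false))))
  (≤-trans (≤-eq (+-assoc (wsum {n} (λ _ → 1) (λ _ → false)) _ _)) (≤-trans (wsum-pack (λ _ → 1) (endL Pr) end-uniq {S = R} {K = λ _ → false} {B = λ _ → false} (λ _ ()) (λ _ ()) (λ i m → fst (snd (end∈R i m))) (λ _ _ ()) (λ _ _ ()) (λ _ _ ()) end-disj) (≤-eq (wsum-1 R))))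
  where
  len : ∀ i → 2 * b2n (act i) ≡ sumL (λ _ → 1) (endL Pr i)
  len i with act i
  ... | true = refl
  ... | false = refl

 -- The cost of a vertex is the number of those among four test vertices that are not adjacent to
 -- it. Free vertices cost two, up to one unit in total, and pairs their weight. So the four miss
 -- nearly two vertices of `S` each time one is counted, and one of them misses about half of `S`.
 -- The term `5 * r` consists of `4 * r` for the roots and `r` for the active pairs.
 module Count (s : Sys) (i0 : Fin p) (a0 : act i0 !) (l0 : lk s i0 ≡ unl) (v1 v2 v3 v4 : Fin n)
        (cost : Fin n → ℕ) (cost-def : ∀ y → cost y ≡ (nE v1 y + nE v2 y) + (nE v3 y + nE v4 y))
        (kpart : 2 * card (K s) ≤ wsum cost (K s) + 1) (gpart : ∀ i → wt s i0 i ≤ sumL cost (grp s i)) where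

  total : wsum cost (K s) + (wsum cost (λ _ → false) + sum (λ i → sumL cost (grp s i))) ≤ wsum cost S
  total = wsum-pack cost (grp s) (λ i → uniq-++ (endL Pr i) _ (end-uniq i) (uses-uniq i _ (good s i))
       (λ m k → not-e (∧-r {S _} (uses-F s i k)) (fst (snd (end∈R i m))))) {K = K s} {B = λ _ → false}
      (λ y k → ∧-l (∧-l {F y} k)) (λ _ ()) (λ i m → [ (λ e → R⊆S _ (fst (snd (end∈R i e)))) , (λ u → ∧-l (uses-F s i u)) ] (∈⁻ (endL Pr i) m))
      (λ _ _ ()) (λ i m k → [ (λ e → not-e (∧-r {S _} (∧-l {F _} k)) (fst (snd (end∈R i e)))) , (λ u → K-free s k u) ] (∈⁻ (endL Pr i) m))
      (λ _ _ ()) gd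
   where
   gd : ∀ i j {y} → y ∈ grp s i → y ∈ grp s j → i ≡ j
   gd i j m m' with ∈⁻ (endL Pr i) m | ∈⁻ (endL Pr j) m'
   ... | inl e | inl e' = end-disj i j e e'
   ... | inr u | inr u' = disj s i j u u'
   ... | inl e | inr u = void (not-e (∧-r {S _} (uses-F s j u)) (fst (snd (end∈R i e))))
   ... | inr u | inl e = void (not-e (∧-r {S _} (uses-F s i u)) (fst (snd (end∈R j e))))

  wnon : ∀ v → wsum (nE v) S ≡ non v
  wnon v = trans (sum-cong (λ y → mul (S y) (not (E v y)))) (sym (card-def (λ y → S y ∧ not (E v y))))
   where mul : ∀ a b → b2n a * b2n b ≡ b2n (a ∧ b)
         mul true b = +-identityʳ _
         mul false b = refl

  wcost : wsum cost S ≡ (non v1 + non v2) + (non v3 + non v4)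
  wcost = trans (sum-cong (λ y → trans (cong (b2n (S y) *_) (cost-def y)) (dist (b2n (S y)) (nE v1 y) (nE v2 y) (nE v3 y) (nE v4 y))))
   (trans (sum-+ (λ y → b2n (S y) * nE v1 y + b2n (S y) * nE v2 y) (λ y → b2n (S y) * nE v3 y + b2n (S y) * nE v4 y))
   (cong₂ _+_ (trans (sum-+ (λ y → b2n (S y) * nE v1 y) (λ y → b2n (S y) * nE v2 y)) (cong₂ _+_ (wnon v1) (wnon v2)))
         (trans (sum-+ (λ y → b2n (S y) * nE v3 y) (λ y → b2n (S y) * nE v4 y)) (cong₂ _+_ (wnon v3) (wnon v4)))))
   where dist : ∀ k a b c d → k * ((a + b) + (c + d)) ≡ (k * a + k * b) + (k * c + k * d)
         dist k a b c d = trans (*-distribˡ-+ k (a + b) (c + d)) (cong₂ _+_ (*-distribˡ-+ k a b) (*-distribˡ-+ k c d))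

  size : card S ≤ card (K s) + (card R + sum (λ i → length (uses (lk s i))))
  size = subst₂ _≤_ (wsum-1 S) (cong₂ _+_ (wsum-1 (K s)) (cong₂ _+_ (wsum-1 R) (sum-cong (λ i → sumL-1 (uses (lk s i))))))
   (wsum-cover (λ _ → 1) (λ i → uses (lk s i)) (λ i → uses-uniq i _ (good s i)) cov)
   where
   cov : ∀ y → S y ! → K s y ! ⊎ R y ! ⊎ (Σ[ i ∈ Fin p ] y ∈ uses (lk s i))
   cov y h with bool (R y) | bool (used s y)
   ... | inl ry | _ = inr (inl ry)
   ... | inr nr | inr nu = inl (∧-i (∧-i h (not-i nr)) (not-i nu))
   ... | inr nr | inl u = let (t , e) = anyb-e _ u in inr (inr (t , elem-e (uses (lk s t)) e))

  balance : 2 * sum (λ i → length (uses (lk s i))) + 5 ≤ sum (wt s i0) + #act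
  balance = subst₂ _≤_ (trans (sum-+ (λ i → 2 * length (uses (lk s i))) (λ i → b2n (i == i0) * 5)) (cong₂ _+_ (sum-*ˡ 2 (λ i → length (uses (lk s i)))) (sum-δ (λ _ → 5) i0)))
    (sum-+ (wt s i0) (λ i → b2n (act i))) (sum-mono pt)
   where
   pt : ∀ i → 2 * length (uses (lk s i)) + b2n (i == i0) * 5 ≤ wt s i0 i + b2n (act i)
   pt i with i == i0 in e
   ... | true rewrite ==-e e | l0 | a0 = ≤-refl
   ... | false with act i in ea | lk s i | good s i
   ...   | true | unl | _ = z≤n
   ...   | true | dir | _ = z≤n
   ...   | true | mid _ | _ = ≤-refl
   ...   | true | two _ _ | _ = s≤s (s≤s (s≤s (s≤s z≤n)))
   ...   | false | unl | _ = ≤-refl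
   ...   | false | dir | _ = z≤n
   ...   | false | mid _ | (g , _) = void (t≢f (trans (sym g) ea))
   ...   | false | two _ _ | (g , _) = void (t≢f (trans (sym g) ea))

  four : 2 * card S + 4 ≤ ((non v1 + non v2) + (non v3 + non v4)) + 5 * r
  four = lin (2 ∷ 2 ∷ 2 ∷ 2 ∷ 1 ∷ 5 ∷ 4 ∷ 2 ∷ 2 ∷ []) (card S ∷ card R ∷ card (K s) ∷ wsum cost (K s) ∷ sum (λ i → sumL cost (grp s i)) ∷ sum (wt s i0) ∷ wsum cost S ∷
        sum (λ i → length (uses (lk s i))) ∷ #act ∷ ((non v1 + non v2) + (non v3 + non v4)) ∷ r ∷ wsum cost (λ _ → false) ∷ [])
   (λ σ R k wk g w c l α N r z → 2 :* k :≤ wk :+ # 1 ⇒ w :≤ g ⇒ wk :+ (z :+ g) :≤ c ⇒ c :≤ N ⇒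
     2 :* α :≤ R ⇒ R :≤ 2 :* r ⇒ σ :≤ k :+ (R :+ l) ⇒ 2 :* l :+ # 5 :≤ w :+ α ⇒ qed (2 :* σ :+ # 4 :≤ N :+ 5 :* r))
   kpart (sum-mono gpart) total (≤-eq wcost) act≤ cR size balance

  conclude : S v1 ! → S v2 ! → S v3 ! → S v4 ! → Σ[ u ∈ Fin n ] S u ! × 2 * card S + 4 ≤ 4 * non u + 5 * r
  conclude s1 s2 s3 s4 with 2 * card S + 4 ≤? 4 * non v1 + 5 * r | 2 * card S + 4 ≤? 4 * non v2 + 5 * r | 2 * card S + 4 ≤? 4 * non v3 + 5 * r | 2 * card S + 4 ≤? 4 * non v4 + 5 * r
  ... | yes h | _ | _ | _ = v1 , s1 , h
  ... | no _ | yes h | _ | _ = v2 , s2 , h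
  ... | no _ | no _ | yes h | _ = v3 , s3 , h
  ... | no _ | no _ | no _ | yes h = v4 , s4 , h
  ... | no h1 | no h2 | no h3 | no h4 = void (lin (4 ∷ 1 ∷ 1 ∷ 1 ∷ 1 ∷ []) (card S ∷ r ∷ non v1 ∷ non v2 ∷ non v3 ∷ non v4 ∷ [])
   (λ s r a b c d → 2 :* s :+ # 4 :≤ ((a :+ b) :+ (c :+ d)) :+ 5 :* r ⇒
    4 :* a :+ 5 :* r :< 2 :* s :+ # 4 ⇒ 4 :* b :+ 5 :* r :< 2 :* s :+ # 4 ⇒ 4 :* c :+ 5 :* r :< 2 :* s :+ # 4 ⇒ 4 :* d :+ 5 :* r :< 2 :* s :+ # 4 ⇒ absurd)
   four (≰⇒> h1) (≰⇒> h2) (≰⇒> h3) (≰⇒> h4))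

 miss1 : ∀ {u x y} → (E u x ! → E u y ! → ⊥) → 1 ≤ nE u x + nE u y
 miss1 {u} {x} {y} h with E u x in ex | E u y in ey
 ... | false | _ = s≤s z≤n
 ... | true | false = s≤s z≤n
 ... | true | true = void (h refl refl)

 module Unlinked (s : Sys) (mf : MaxF s) (i0 : Fin p) (a0 : act i0 !) (l0 : lk s i0 ≡ unl) where

  x0 y0 : Fin n
  x0 = a i0
  y0 = b i0

  nodir : E x0 y0 ! → ⊥
  nodir e = <⇒≱ (≤-trans (≤-eq (+-comm 1 _)) (≤-trans (count-upd short refl s i0 dir (a0 , e) (λ _ _ ()))
   (≤-eq (trans (cong (λ l → #short (upd s i0 dir (a0 , e)) + b2n (short l)) l0) (+-identityʳ _))))) (mf (upd s i0 dir (a0 , e)))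

  ends4 : ∀ v1 v2 {c : Fin n → ℕ} → (v1 ≡ x0 ⊎ v1 ≡ y0) → (v2 ≡ x0 ⊎ v2 ≡ y0) → (∀ y → nE v1 y + nE v2 y ≤ c y) → 4 ≤ sumL c (grp s i0)
  ends4 v1 v2 {c} h1 h2 hc rewrite a0 | l0 = +-mono-≤ (≤-trans (two≤ x0 (inl refl)) (hc x0)) (≤-trans (≤-trans (two≤ y0 (inr refl)) (hc y0)) (m≤m+n _ 0))
   where
   misses : ∀ {v w} → (v ≡ x0 ⊎ v ≡ y0) → (w ≡ x0 ⊎ w ≡ y0) → nE v w ≡ 1
   misses (inl refl) (inl refl) = nE-1 (irr _)
   misses (inl refl) (inr refl) = nE-1 nodir
   misses (inr refl) (inl refl) = nE-1 (λ e → nodir (E-sym e))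
   misses (inr refl) (inr refl) = nE-1 (irr _)
   two≤ : ∀ w → (w ≡ x0 ⊎ w ≡ y0) → 2 ≤ nE v1 w + nE v2 w
   two≤ w hw = ≤-eq (sym (cong₂ _+_ (misses h1 hw) (misses h2 hw)))

  inner-avail : ∀ {i y z w} → lk s i ≡ two y z → w ∈ uses (two y z) → Avail s w
  inner-avail {i} {y} {z} {w} e m = uses-F s i (subst (λ l → w ∈ uses l) (sym e) m) ,
   λ t k sh → t≢f (trans (sym sh) (subst (λ t → short (lk s t) ≡ false) (disj s i t (subst (λ l → w ∈ uses l) (sym e) m) k) (cong short e)))

  inner-miss : ∀ {w} → Avail s w → 1 ≤ nE x0 w + nE y0 w
  inner-miss {w} av with E x0 w in e1 | E y0 w in e2
  ... | false | _ = s≤s z≤n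
  ... | true | false = s≤s z≤n
  ... | true | true = void (hard-miss s mf av a0 (cong short l0) e1 (E-sym e2))

  end-miss : ∀ {w i} → Avail s w → act i ! → short (lk s i) ≡ false → 1 ≤ nE w (a i) + nE w (b i)
  end-miss av ai sh = miss1 (λ e1 e2 → hard-miss s mf av ai sh (E-sym e1) e2)

  -- two ends of the unlinked pair and two available vertices
  module STAB (u w : Fin n) (au : Avail s u) (aw : Avail s w) where
   cost : Fin n → ℕ
   cost y = (nE x0 y + nE y0 y) + (nE u y + nE w y)

   gpart : ∀ i → wt s i0 i ≤ sumL cost (grp s i)
   gpart i with i == i0 in e
   ... | true rewrite ==-e e = ends4 x0 y0 (inl refl) (inr refl) (λ y → m≤m+n _ _)
   ... | false with act i in ai
   ...   | false = z≤n
   ...   | true with lk s i in li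
   ...     | dir = z≤n
   ...     | unl = L (end-miss au ai (cong short li)) (end-miss aw ai (cong short li))
    where
    L : 1 ≤ nE u (a i) + nE u (b i) → 1 ≤ nE w (a i) + nE w (b i) → 2 ≤ cost (a i) + (cost (b i) + 0)
    L = lin (1 ∷ 1 ∷ 1 ∷ []) (nE x0 (a i) + nE y0 (a i) ∷ nE u (a i) ∷ nE w (a i) ∷ nE x0 (b i) + nE y0 (b i) ∷ nE u (b i) ∷ nE w (b i) ∷ [])
     (λ q c d f g h → # 1 :≤ c :+ g ⇒ # 1 :≤ d :+ h ⇒ qed (# 2 :≤ (q :+ (c :+ d)) :+ ((f :+ (g :+ h)) :+ # 0)))
   ...     | two y z = L (end-miss au ai (cong short li)) (end-miss aw ai (cong short li)) (inner-miss (inner-avail li (here refl))) (inner-miss (inner-avail li (there (here refl))))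
    where
    L : 1 ≤ nE u (a i) + nE u (b i) → 1 ≤ nE w (a i) + nE w (b i) → 1 ≤ nE x0 y + nE y0 y → 1 ≤ nE x0 z + nE y0 z → 4 ≤ cost (a i) + (cost (b i) + (cost y + (cost z + 0)))
    L = lin (1 ∷ 1 ∷ 1 ∷ 1 ∷ 1 ∷ []) (nE x0 (a i) + nE y0 (a i) ∷ nE u (a i) ∷ nE w (a i) ∷ nE x0 (b i) + nE y0 (b i) ∷ nE u (b i) ∷ nE w (b i) ∷ nE x0 y + nE y0 y ∷ nE u y + nE w y ∷ nE x0 z + nE y0 z ∷ nE u z + nE w z ∷ [])
     (λ p c d e g h y y' z z' → # 1 :≤ c :+ g ⇒ # 1 :≤ d :+ h ⇒ # 1 :≤ y ⇒ # 1 :≤ z ⇒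
       qed (# 4 :≤ (p :+ (c :+ d)) :+ ((e :+ (g :+ h)) :+ ((y :+ y') :+ ((z :+ z') :+ # 0)))))
   ...     | mid m = L C
    where
    C : 1 ≤ (nE u (a i) + nE u (b i)) + (nE x0 m + nE y0 m)
    C with E u (a i) in e1 | E u (b i) in e2 | E x0 m in e3 | E y0 m in e4
    ... | false | _ | _ | _ = s≤s z≤n
    ... | true | false | _ | _ = s≤s z≤n
    ... | true | true | false | _ = s≤s z≤n
    ... | true | true | true | false = s≤s z≤n
    ... | true | true | true | true = void (mid-miss s mf au li a0 l0 (E-sym e1) e2 e3 (E-sym e4))
    L : 1 ≤ (nE u (a i) + nE u (b i)) + (nE x0 m + nE y0 m) → 1 ≤ cost (a i) + (cost (b i) + (cost m + 0))
    L = lin (1 ∷ 1 ∷ []) (nE x0 (a i) + nE y0 (a i) ∷ nE u (a i) ∷ nE w (a i) ∷ nE x0 (b i) + nE y0 (b i) ∷ nE u (b i) ∷ nE w (b i) ∷ nE x0 m + nE y0 m ∷ nE u m + nE w m ∷ [])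
     (λ p c d e g h y y' → # 1 :≤ (c :+ g) :+ y ⇒ qed (# 1 :≤ (p :+ (c :+ d)) :+ ((e :+ (g :+ h)) :+ ((y :+ y') :+ # 0))))

  -- one end of the unlinked pair and one available vertex, each counted twice
  module WWVV (q v : Fin n) (hq : q ≡ x0 ⊎ q ≡ y0) (av : Avail s v)
        (sw-mid : ∀ {i m} → lk s i ≡ mid m → E q m ! → E (a i) v ! → E v (b i) ! → ⊥)
        (sw-y : ∀ {i y z} → lk s i ≡ two y z → E q y ! → E (a i) v ! → E v z ! → ⊥)
        (sw-z : ∀ {i y z} → lk s i ≡ two y z → E q z ! → E v (b i) ! → E y v ! → ⊥) where
   cost : Fin n → ℕ
   cost y = (nE q y + nE q y) + (nE v y + nE v y)

   gpart : ∀ i → wt s i0 i ≤ sumL cost (grp s i)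
   gpart i with i == i0 in e
   ... | true rewrite ==-e e = ends4 q q hq hq (λ y → m≤m+n _ _)
   ... | false with act i in ai
   ...   | false = z≤n
   ...   | true with lk s i in li
   ...     | dir = z≤n
   ...     | unl = L (end-miss av ai (cong short li))
    where
    L : 1 ≤ nE v (a i) + nE v (b i) → 2 ≤ cost (a i) + (cost (b i) + 0)
    L = lin (2 ∷ 1 ∷ []) (nE q (a i) ∷ nE v (a i) ∷ nE q (b i) ∷ nE v (b i) ∷ []) (λ p c d e → # 1 :≤ c :+ e ⇒
     qed (# 2 :≤ ((p :+ p) :+ (c :+ c)) :+ (((d :+ d) :+ (e :+ e)) :+ # 0)))
   ...     | mid m = L C
    where
    C : 1 ≤ (nE v (a i) + nE v (b i)) + nE q m
    C with E v (a i) in e1 | E v (b i) in e2 | E q m in e3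
    ... | false | _ | _ = s≤s z≤n
    ... | true | false | _ = s≤s z≤n
    ... | true | true | false = s≤s z≤n
    ... | true | true | true = void (sw-mid li e3 (E-sym e1) e2)
    L : 1 ≤ (nE v (a i) + nE v (b i)) + nE q m → 1 ≤ cost (a i) + (cost (b i) + (cost m + 0))
    L = lin (2 ∷ 1 ∷ []) (nE q (a i) ∷ nE v (a i) ∷ nE q (b i) ∷ nE v (b i) ∷ nE q m ∷ nE v m ∷ []) (λ p c d e f g → # 1 :≤ (c :+ e) :+ f ⇒
     qed (# 1 :≤ ((p :+ p) :+ (c :+ c)) :+ (((d :+ d) :+ (e :+ e)) :+ (((f :+ f) :+ (g :+ g)) :+ # 0))))
   ...     | two y z = L C
    where
    C : 2 ≤ (nE v (a i) + nE v (b i)) + ((nE q y + nE q z) + (nE v y + nE v z))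
    C with E v (a i) in e1 | E v (b i) in e2
    ... | true | true = void (hard-miss s mf av ai (cong short li) (E-sym e1) e2)
    ... | false | false = s≤s (s≤s z≤n)
    ... | true | false with E q y in e3 | E v z in e4
    ...   | false | _ = s≤s (s≤s z≤n)
    ...   | true | false = s≤s (≤-trans (m≤n+m 1 (nE v y)) (m≤n+m _ (nE q z)))
    ...   | true | true = void (sw-y li e3 (E-sym e1) e4)
    C | false | true with E q z in e3 | E v y in e4
    ...   | false | _ = s≤s (≤-trans (m≤n+m 1 (nE q y)) (m≤m+n _ _))
    ...   | true | false = s≤s (≤-trans (m≤m+n 1 (nE v z)) (m≤n+m _ (nE q y + 0)))
    ...   | true | true = void (sw-z li e3 e2 (E-sym e4))
    L : 2 ≤ (nE v (a i) + nE v (b i)) + ((nE q y + nE q z) + (nE v y + nE v z)) → 4 ≤ cost (a i) + (cost (b i) + (cost y + (cost z + 0)))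
    L = lin (2 ∷ 1 ∷ []) (nE q (a i) ∷ nE v (a i) ∷ nE q (b i) ∷ nE v (b i) ∷ nE q y ∷ nE v y ∷ nE q z ∷ nE v z ∷ []) (λ p c d e f g h k →
     # 2 :≤ (c :+ e) :+ ((f :+ h) :+ (g :+ k)) ⇒
     qed (# 4 :≤ ((p :+ p) :+ (c :+ c)) :+ (((d :+ d) :+ (e :+ e)) :+ (((f :+ f) :+ (g :+ g)) :+ (((h :+ h) :+ (k :+ k)) :+ # 0)))))

 Many : Set
 Many = Σ[ u ∈ Fin n ] S u ! × 2 * card S + 4 ≤ 4 * non u + 5 * r

 kpart-of : ∀ s (cost : Fin n → ℕ) → (∀ y → K s y ! → 2 ≤ cost y) → 2 * card (K s) ≤ wsum cost (K s) + 1
 kpart-of s cost h = ≤-trans (≤-trans (≤-eq (trans (cong (2 *_) (card-def (K s))) (sym (sum-*ˡ 2 (λ y → b2n (K s y)))))) (sum-mono pt)) (m≤m+n _ 1)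
  where
  pt : ∀ y → 2 * b2n (K s y) ≤ b2n (K s y) * cost y
  pt y with K s y in e
  ... | true = ≤-trans (h y e) (m≤m+n _ 0)
  ... | false = z≤n

 module Solve (s : Sys) (mf : MaxF s) (mh : MaxH s) (i0 : Fin p) (a0 : act i0 !) (l0 : lk s i0 ≡ unl) where
  open Unlinked s mf i0 a0 l0

  Sx : S x0 !
  Sx = R⊆S _ (inRa i0 a0)
  Sy : S y0 !
  Sy = R⊆S _ (inRb i0 a0)
  SF : ∀ {v} → F v ! → S v !
  SF f = ∧-l f

  noAB : ∀ {u w} → K s u ! → K s w ! → E x0 u ! → E w y0 ! → E u w ! → ⊥
  noAB {u} {w} ku kw eu ew e = <⇒≱ (≤-trans (≤-eq (+-comm 1 _)) (≤-trans (count-upd linked refl s i0 (two u w) g (λ t _ c _ → nc t c))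
    (≤-eq (trans (cong (λ l → #linked s' + b2n (linked l)) l0) (+-identityʳ _)))))
    (mh s' (≤-trans (m≤m+n _ 0) (≤-trans (count-upd short refl s i0 (two u w) g (λ t _ c _ → nc t c)) (≤-eq (trans (cong (λ l → #short s' + b2n (short l)) l0) (+-identityʳ _))))))
   where
   g : Good i0 (two u w)
   g = a0 , ∧-l ku , ∧-l kw , (λ { refl → irr _ e }) , eu , e , ew
   s' = upd s i0 (two u w) g
   nc : ∀ t → clash (two u w) (lk s t) ! → ⊥
   nc t c = no-clash s (two u w) t (λ { (here refl) k → K-free s ku k ; (there (here refl)) k → K-free s kw k }) c

  both : ∀ {u w} → K s u ! → K s w ! → E x0 u ! → E w y0 ! → Many
  both {u} {w} ku kw eu ew = Count.conclude s i0 a0 l0 x0 y0 u w cost (λ _ → refl) (kpart-of s cost kp) gpart Sx Sy (SF (∧-l ku)) (SF (∧-l kw))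
   where
   open STAB u w (K-avail s ku) (K-avail s kw)
   kp : ∀ y → K s y ! → 2 ≤ cost y
   kp y ky with E x0 y in e1 | E y0 y in e2
   ... | true | true = void (hard-miss s mf (K-avail s ky) a0 (cong short l0) e1 (E-sym e2))
   ... | false | false = s≤s (s≤s z≤n)
   ... | true | false rewrite nE-1 {w} {y} (λ e → noAB ky kw e1 ew (E-sym e)) = s≤s (m≤n+m 1 (nE u y))
   ... | false | true rewrite nE-1 {u} {y} (λ e → noAB ku ky eu (E-sym e2) e) = s≤s (s≤s z≤n)

  neither : ∀ v → Avail s v → (∀ y → K s y ! → E x0 y ! → ⊥) → (∀ y → K s y ! → E y y0 ! → ⊥) → Many
  neither v av na nb = Count.conclude s i0 a0 l0 x0 y0 v v cost (λ _ → refl) (kpart-of s cost kp) gpart Sx Sy (SF (fst av)) (SF (fst av))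
   where
   open STAB v v av av
   kp : ∀ y → K s y ! → 2 ≤ cost y
   kp y ky rewrite nE-1 {x0} {y} (na y ky) | nE-1 {y0} {y} (λ e → nb y ky (E-sym e)) = s≤s (s≤s z≤n)

  -- The single free vertex is only known to cost one instead of two; the unit of tolerance in
  -- `kpart` exists for this case.
  lone : ∀ v → K s v ! → (∀ y → K s y ! → y ≡ v) → Many
  lone v kv only = Count.conclude s i0 a0 l0 x0 y0 v v cost (λ _ → refl) kp gpart Sx Sy (SF (∧-l kv)) (SF (∧-l kv))
   where
   open STAB v v (K-avail s kv) (K-avail s kv)
   kp : 2 * card (K s) ≤ wsum cost (K s) + 1
   kp = ≤-trans (*-monoʳ-≤ 2 (card-≤1 (K s) (λ x y p q → trans (only x p) (sym (only y q))))) (+-monoˡ-≤ 1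
    (≤-trans (≤-trans (≤-trans (inner-miss (K-avail s kv)) (m≤m+n _ (nE v v + nE v v))) (≤-eq (trans (sym (+-identityʳ _)) (cong (λ z → b2n z * cost v) (sym kv))))) (sum-≥ (λ y → b2n (K s y) * cost y) v)))

  -- replacing one inner vertex by v keeps the system optimal and frees the vertex f
  swap : ∀ {i x v f} → Good i x → short x ≡ short (lk s i) → linked x ≡ linked (lk s i) → K s v ! → f ∈ uses (lk s i) →
   (∀ {y} → y ∈ uses x → y ≡ v ⊎ (y ∈ uses (lk s i) × y ≢ f)) → ∀ {w} → K s w ! → w ≢ v →
   Σ[ s' ∈ Sys ] #short s ≤ #short s' × #linked s ≤ #linked s' × lk s' i0 ≡ unl × K s' f ! × K s' w !
  swap {i} {x} {v} {f} g es el kv fi ux {w} kw w≢v = s' , cnt short refl es , cnt linked refl el , l0' , kf , kw'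
   where
   s' = upd s i x g
   nc : ∀ t → t ≢ i → clash x (lk s t) ! → ⊥
   nc t ne c = no-clash s x t (λ m k → [ (λ { refl → K-free s kv k }) , (λ h → ne (disj s t i k (fst h))) ] (ux m)) c
   ncf : ∀ t → t ≢ i → clash x (lk s t) ≡ false
   ncf t ne with clash x (lk s t) in c
   ... | true = void (nc t ne c)
   ... | false = refl
   cnt : (q : Lk → Bool) → q unl ≡ false → q x ≡ q (lk s i) → sum (λ t → b2n (q (lk s t))) ≤ sum (λ t → b2n (q (lk s' t)))
   cnt q qu e = +-cancelʳ-≤ (b2n (q x)) _ _ (subst (λ z → sum (λ t → b2n (q (lk s t))) + b2n (q x) ≤ sum (λ t → b2n (q (lk s' t))) + b2n z) (sym e)
    (count-upd q qu s i x g (λ t ne c _ → nc t ne c)))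
   i≢i0 : i0 ≢ i
   i≢i0 refl with subst (λ l → f ∈ uses l) l0 fi
   ... | ()
   l0' : lk s' i0 ≡ unl
   l0' = trans (upd-else s i x g i0 i≢i0 (ncf i0 i≢i0)) l0
   unused : ∀ {z} → F z ! → (z ∈ uses x → ⊥) → (∀ t → t ≢ i → z ∈ uses (lk s t) → ⊥) → K s' z !
   unused {z} fz nx nt = ∧-i fz (not-i (λ h → let (t , e) = anyb-e _ h in at t (elem-e (uses (lk s' t)) e)))
    where
    at : ∀ t → z ∈ uses (lk s' t) → ⊥
    at t m with t ≟F i
    ... | yes refl = nx (subst (λ l → z ∈ uses l) (upd-at s i x g) m)
    ... | no ne = nt t ne (subst (λ l → z ∈ uses l) (upd-else s i x g t ne (ncf t ne)) m)
   kf : K s' f !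
   kf = unused (uses-F s i fi) (λ m → [ (λ { refl → K-free s kv fi }) , (λ h → snd h refl) ] (ux m)) (λ t ne k → ne (disj s t i k fi))
   kw' : K s' w !
   kw' = unused (∧-l kw) (λ m → [ w≢v , (λ h → K-free s kw (fst h)) ] (ux m)) (λ t ne k → K-free s kw k)

  -- `q` sees no free vertex, the other end of its pair sees `w`. By `never` no exchange that brings
  -- in `v` and keeps `w` free can release a neighbour of `q`; these forbidden exchanges are the
  -- three hypotheses of `WWVV`.
  module OneSided (q : Fin n) (hq : q ≡ x0 ⊎ q ≡ y0) (empty : ∀ y → K s y ! → E q y ! → ⊥)
          (v w : Fin n) (kv : K s v !) (kw : K s w !) (w≢v : w ≢ v)
          (never : ∀ s' f → #short s ≤ #short s' → #linked s ≤ #linked s' → lk s' i0 ≡ unl → K s' f ! → K s' w ! → E q f ! → ⊥) where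

   sw-mid : ∀ {i m} → lk s i ≡ mid m → E q m ! → E (a i) v ! → E v (b i) ! → ⊥
   sw-mid {i} {m} e em ea eb with swap {i} {mid v} {v} {m} (fst (subst (Good i) e (good s i)) , ∧-l kv , ea , eb) (sym (cong short e)) (sym (cong linked e)) kv
      (subst (λ l → m ∈ uses l) (sym e) (here refl)) (λ { (here refl) → inl refl }) kw w≢v
   ... | s' , h1 , h2 , h3 , h4 , h₅ = never s' m h1 h2 h3 h4 h₅ em

   sw-y : ∀ {i y z} → lk s i ≡ two y z → E q y ! → E (a i) v ! → E v z ! → ⊥
   sw-y {i} {y} {z} e em ea eb with subst (Good i) e (good s i)
   ... | ga , fy , fz , y≢z , _ , _ , ez with swap {i} {two v z} {v} {y} (ga , ∧-l kv , fz , (λ { refl → K-free s kv (subst (λ l → z ∈ uses l) (sym e) (there (here refl))) }) , ea , eb , ez)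
      (sym (cong short e)) (sym (cong linked e)) kv
      (subst (λ l → y ∈ uses l) (sym e) (here refl))
      (λ { (here refl) → inl refl ; (there (here refl)) → inr (subst (λ l → z ∈ uses l) (sym e) (there (here refl)) , λ f → y≢z (sym f)) }) kw w≢v
   ...   | s' , h1 , h2 , h3 , h4 , h₅ = never s' y h1 h2 h3 h4 h₅ em

   sw-z : ∀ {i y z} → lk s i ≡ two y z → E q z ! → E v (b i) ! → E y v ! → ⊥
   sw-z {i} {y} {z} e em ea eb with subst (Good i) e (good s i)
   ... | ga , fy , fz , y≢z , ey , _ , _ with swap {i} {two y v} {v} {z} (ga , fy , ∧-l kv , (λ { refl → K-free s kv (subst (λ l → y ∈ uses l) (sym e) (here refl)) }) , ey , eb , ea)
      (sym (cong short e)) (sym (cong linked e)) kv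
      (subst (λ l → z ∈ uses l) (sym e) (there (here refl)))
      (λ { (here refl) → inr (subst (λ l → y ∈ uses l) (sym e) (here refl) , y≢z) ; (there (here refl)) → inl refl }) kw w≢v
   ...   | s' , h1 , h2 , h3 , h4 , h₅ = never s' z h1 h2 h3 h4 h₅ em

   many : Many
   many = Count.conclude s i0 a0 l0 q q v v cost (λ _ → refl) (kpart-of s cost kp) gpart Sq Sq (SF (∧-l kv)) (SF (∧-l kv))
    where
    open WWVV q v hq (K-avail s kv) sw-mid sw-y sw-z
    Sq : S q !
    Sq = [ (λ { refl → Sx }) , (λ { refl → Sy }) ] hq
    kp : ∀ y → K s y ! → 2 ≤ cost y
    kp y ky rewrite nE-1 {q} {y} (empty y ky) = s≤s (s≤s z≤n)

 bound-p : ∀ (q : Fin p → Bool) → sum (λ i → b2n (q i)) ≤ p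
 bound-p q = subst (_≤ p) (card-def q) (card-≤n q)

 Solution : Set
 Solution = Σ[ L ∈ Linkage E R Pr ] (∀ i → act i ! → ∀ {y} → y ∈ Linkage.lst L i → S y !)

 toLinkage : (s : Sys) → (∀ i → act i ! → linked (lk s i) !) → Solution
 toLinkage s all = record { lst = lst ; path = path ; disj = disjL ; ends = endsL } , inS
  where
  lst : Fin p → List (Fin n)
  lst i = a i ∷ uses (lk s i) ++ b i ∷ []
  path : ∀ i → act i ! → PathL E (a i) (b i) (lst i)
  path i h with lk s i | good s i | all i h
  ... | dir | (_ , e) | _ = e ◂ one
  ... | mid m | (_ , _ , e1 , e2) | _ = e1 ◂ e2 ◂ one
  ... | two y z | (_ , _ , _ , _ , e1 , e2 , e3) | _ = e1 ◂ e2 ◂ e3 ◂ one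
  ... | unl | _ | ()
  loc : ∀ i → act i ! → ∀ {y} → y ∈ lst i → y ∈ endL Pr i ⊎ y ∈ uses (lk s i)
  loc i h (here e) rewrite h = inl (here e)
  loc i h (there m) with ∈⁻ (uses (lk s i)) m
  ... | inl u = inr u
  ... | inr (here e) rewrite h = inl (there (here e))
  disjL : ∀ i j → act i ! → act j ! → ∀ {y} → y ∈ lst i → y ∈ lst j → i ≡ j
  disjL i j hi hj m m' with loc i hi m | loc j hj m'
  ... | inl e | inl e' = end-disj i j e e'
  ... | inr u | inr u' = disj s i j u u'
  ... | inl e | inr u = void (not-e (∧-r {S _} (uses-F s j u)) (fst (snd (end∈R i e))))
  ... | inr u | inl e = void (not-e (∧-r {S _} (uses-F s i u)) (fst (snd (end∈R j e))))
  endsL : ∀ i → act i ! → ∀ {y} → y ∈ lst i → R y ! → y ≡ a i ⊎ y ≡ b i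
  endsL i h m ry with loc i h m
  ... | inl e = snd (snd (end∈R i e))
  ... | inr u = void (not-e (∧-r {S _} (uses-F s i u)) ry)
  inS : ∀ i → act i ! → ∀ {y} → y ∈ lst i → S y !
  inS i h m with loc i h m
  ... | inl e = R⊆S _ (fst (snd (end∈R i e)))
  ... | inr u = ∧-l (uses-F s i u)

 -- Ranges over all systems at least as good as `s`, because an exchange may be needed before both
 -- ends of the pair see a free vertex.
 Two : Sys → Fin p → Set
 Two s i0 = Σ[ s' ∈ Sys ] #short s ≤ #short s' × #linked s ≤ #linked s' × lk s' i0 ≡ unl ×
  (Σ[ u ∈ Fin n ] K s' u ! × E (a i0) u !) × (Σ[ w ∈ Fin n ] K s' w ! × E w (b i0) !)

 stuck : (s : Sys) → MaxF s → MaxH s → (i0 : Fin p) → act i0 ! → lk s i0 ≡ unl → Dec (Two s i0) → Many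
 stuck s mf mh i0 a0 l0 (yes (s' , hf , hl , l0' , (u , ku , eu) , (w , kw , ew))) =
  Solve.both s' (λ t → ≤-trans (mf t) hf) (λ t ht → ≤-trans (mh t (≤-trans hf ht)) hl) i0 a0 l0' ku kw eu ew
 stuck s mf mh i0 a0 l0 (no none) with anyb (λ y → K s y ∧ E (a i0) y) in ea | anyb (λ y → K s y ∧ E y (b i0)) in eb
 ... | true | true = let (u , hu) = anyb-e _ ea ; (w , hw) = anyb-e _ eb in
    void (none (s , ≤-refl , ≤-refl , l0 , (u , ∧-l hu , ∧-r {K s u} hu) , (w , ∧-l hw , ∧-r {K s w} hw)))
 ... | false | false = Solve.neither s mf mh i0 a0 l0 v av (λ y k e → t≢f (trans (sym (anyb-i _ y (∧-i k e))) ea)) (λ y k e → t≢f (trans (sym (anyb-i _ y (∧-i k e))) eb))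
  where
  mids : Sub n
  mids y = anyb (λ t → elem y (uses (lk s t)) ∧ short (lk s t))
  #sh : card mids + 1 ≤ sum (λ i → b2n (act i))
  #sh = ≤-trans (+-monoˡ-≤ 1 le) lt'
   where
   le : card mids ≤ #short s
   le = ≤-trans (subst₂ _≤_ (wsum-1 mids) (cong₂ _+_ (wsum-1 (λ _ → false)) (cong₂ _+_ (wsum-1 (λ _ → false)) (sum-cong (λ i → sumL-1 (sl i)))))
     (wsum-cover (λ _ → 1) sl su {S = mids} {K = λ _ → false} {B = λ _ → false} cov)) (≤-trans (≤-eq (cong₂ _+_ (card-∅ {n} _ (λ _ ())) (cong (_+ sum (λ i → length (sl i))) (card-∅ {n} _ (λ _ ()))))) (sum-mono ll))
    where
    sl : Fin p → List (Fin n)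
    sl i = if short (lk s i) then uses (lk s i) else []
    su : ∀ i → Uniq (sl i)
    su i with short (lk s i)
    ... | true = uses-uniq i _ (good s i)
    ... | false = tt
    cov : ∀ y → mids y ! → false ! ⊎ false ! ⊎ (Σ[ i ∈ Fin p ] y ∈ sl i)
    cov y h with anyb-e _ h
    ... | t , e = inr (inr (t , sub))
     where sub : y ∈ sl t
           sub rewrite ∧-r {elem y (uses (lk s t))} e = elem-e (uses (lk s t)) (∧-l e)
    ll : ∀ i → length (sl i) ≤ b2n (short (lk s i))
    ll i with lk s i
    ... | unl = z≤n
    ... | dir = z≤n
    ... | mid _ = ≤-refl
    ... | two _ _ = z≤n
   lt' : #short s + 1 ≤ sum (λ i → b2n (act i))
   lt' = subst (_≤ sum (λ i → b2n (act i))) (trans (sum-+ (λ i → b2n (short (lk s i))) (λ i → b2n (i == i0) * 1)) (cong (#short s +_) (sum-δ (λ _ → 1) i0))) (sum-mono pt)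
    where
    pt : ∀ i → b2n (short (lk s i)) + b2n (i == i0) * 1 ≤ b2n (act i)
    pt i with i == i0 in e
    ... | true rewrite ==-e e | l0 | a0 = ≤-refl
    ... | false with lk s i | good s i
    ...   | unl | _ = z≤n
    ...   | two _ _ | _ = z≤n
    ...   | dir | g rewrite fst g = ≤-refl
    ...   | mid _ | g rewrite fst g = ≤-refl
  -- Uses `3 * r ≤ card S`: the roots occupy at most `2 * r` vertices and the short links at most
  -- `r - 1`, as the pair `i0` has none.
  room : 1 ≤ card (λ y → F y ∧ not (mids y))
  room = lin (2 ∷ 2 ∷ 2 ∷ 1 ∷ 3 ∷ 2 ∷ []) (card S ∷ card R ∷ card mids ∷ card (λ y → F y ∧ not (mids y)) ∷ sum (λ i → b2n (act i)) ∷ r ∷ [])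
   (λ σ R m k α r → 3 :* r :≤ σ ⇒ σ :≤ R :+ (m :+ k) ⇒ m :+ # 1 :≤ α ⇒ 2 :* α :≤ R ⇒ R :≤ 2 :* r ⇒ qed (# 1 :≤ k))
   big (≤-trans (card-∪ {U = R} {V = λ y → mids y ∨ (F y ∧ not (mids y))} cov) (+-monoʳ-≤ (card R) (card-∪ (λ y → ∨-e)))) #sh
   act≤ cR
   where
   cov : ∀ y → S y ! → R y ! ⊎ (mids y ∨ (F y ∧ not (mids y))) !
   cov y h with bool (R y) | bool (mids y)
   ... | inl q | _ = inl q
   ... | inr _ | inl q = inr (∨-l q)
   ... | inr nr | inr nm = inr (∨-r {mids y} (∧-i (∧-i h (not-i nr)) (not-i nm)))
  v = fst (card-ex _ room)
  av : Avail s v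
  av = ∧-l (snd (card-ex _ room)) , λ t k sh → not-e (∧-r {F v} (snd (card-ex (λ y → F y ∧ not (mids y)) room))) (anyb-i _ t (∧-i (elem-i k) sh))
 ... | false | true with anyb-e _ eb
 ...   | w , hw with anyb (λ y → K s y ∧ not (y == w)) in ev
 ...     | false = Solve.lone s mf mh i0 a0 l0 w (∧-l hw) (λ y k → onl y k)
  where
  onl : ∀ y → K s y ! → y ≡ w
  onl y k with y ≟F w
  ... | yes e = e
  ... | no ne = void (t≢f (trans (sym (anyb-i (λ y → K s y ∧ not (y == w)) y (∧-i k (not-i (λ e → ne (==-e e)))))) ev))
 ...     | true with anyb-e _ ev
 ...       | v , hv = Solve.OneSided.many s mf mh i0 a0 l0 (a i0) (inl refl) (λ y k e → t≢f (trans (sym (anyb-i (λ y → K s y ∧ E (a i0) y) y (∧-i k e))) ea))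
   v w (∧-l hv) (∧-l hw) (λ e → not-e (∧-r {K s v} hv) (==-i (sym e)))
   (λ s' f h1 h2 h3 h4 h₅ e → none (s' , h1 , h2 , h3 , (f , h4 , e) , (w , h₅ , ∧-r {K s w} hw)))
 stuck s mf mh i0 a0 l0 (no none) | true | false with anyb-e _ ea
 ...   | w , hw with anyb (λ y → K s y ∧ not (y == w)) in ev
 ...     | false = Solve.lone s mf mh i0 a0 l0 w (∧-l hw) (λ y k → onl y k)
  where
  onl : ∀ y → K s y ! → y ≡ w
  onl y k with y ≟F w
  ... | yes e = e
  ... | no ne = void (t≢f (trans (sym (anyb-i (λ y → K s y ∧ not (y == w)) y (∧-i k (not-i (λ e → ne (==-e e)))))) ev))
 ...     | true with anyb-e _ ev
 ...       | v , hv = Solve.OneSided.many s mf mh i0 a0 l0 (b i0) (inr refl) (λ y k e → t≢f (trans (sym (anyb-i (λ y → K s y ∧ E y (b i0)) y (∧-i k (E-sym e)))) eb))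
   v w (∧-l hv) (∧-l hw) (λ e → not-e (∧-r {K s v} hv) (==-i (sym e)))
   (λ s' f h1 h2 h3 h4 h₅ e → none (s' , h1 , h2 , h3 , (w , h₅ , ∧-r {K s w} hw) , (f , h4 , E-sym e)))

 sLevel : NN (Solution ⊎ Many)
 sLevel = argmax #short p (λ s → bound-p (λ i → short (lk s i))) (record { lk = λ _ → unl ; good = λ _ → tt ; disj = λ _ _ () }) >>= λ { (s1 , m₁) →
  argmax {A = Σ[ s ∈ Sys ] #short s1 ≤ #short s} (λ { (s , _) → #linked s }) p (λ { (s , _) → bound-p (λ i → linked (lk s i)) }) (s1 , ≤-refl) >>= λ { ((s , h) , m₂) →
  fin s (λ t → ≤-trans (m₁ t) h) (λ t ht → m₂ (t , ≤-trans h ht)) } }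
  where
  fin : (s : Sys) → MaxF s → MaxH s → NN (Solution ⊎ Many)
  fin s mf mh with anyb (λ i → act i ∧ not (linked (lk s i))) in e
  ... | false = ret (inl (toLinkage s (λ i h → [ (λ l → l) , (λ nl → void (t≢f (trans (sym (anyb-i (λ i → act i ∧ not (linked (lk s i))) i (∧-i h (not-i nl)))) e))) ] (bool (linked (lk s i))))))
  ... | true with anyb-e _ e
  ...   | i0 , h = em (Two s i0) >>= λ d → ret (inr (stuck s mf mh i0 (∧-l h) (un (lk s i0) (∧-r {act i0} h)) d))
   where un : ∀ l → not (linked l) ! → l ≡ unl
         un unl _ = refl

-- Linked sets in a graph whose minimum degree is about half its order

Sol : ∀ {n p} → Rl n → Sub n → Sub n → Pairs n p → Set
Sol {p = p} E S R Pr = Σ[ L ∈ Linkage E R Pr ] (∀ i → Pairs.act Pr i ! → ∀ {y} → y ∈ Linkage.lst L i → S y !)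

RLinked : ∀ {n} → Rl n → ℕ → Sub n → Set
RLinked {n} E r L = ∀ p (R : Sub n) (Pr : Pairs n p) → (∀ y → R y ! → L y !) → card R ≤ 2 * r → Proper R Pr → Strict Pr → NN (Sol E L R Pr)

cnt : ∀ {n} → Sub n → List (Fin n) → ℕ
cnt g = sumL (λ y → b2n (g y))

cnt≤len : ∀ {n} (g : Sub n) L → cnt g L ≤ length L
cnt≤len g []      = z≤n
cnt≤len g (x ∷ L) = +-mono-≤ (b2n≤1 (g x)) (cnt≤len g L)

cnt-none : ∀ {n} (g : Sub n) L → (∀ {y} → y ∈ L → ¬ (g y !)) → cnt g L ≡ 0
cnt-none g []      h = refl
cnt-none g (x ∷ L) h with g x in e
... | true = void (h (here refl) e)
... | false = cnt-none g L (λ m → h (there m))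

-- The condition on the neighbours of an outside vertex along a shortest link: vertices further
-- apart would give a shortcut.
Near : ∀ {n} → Sub n → List (Fin n) → Set
Near g L = ∀ pre x mid y post → L ≡ pre ++ x ∷ mid ++ y ∷ post → g x ! → g y ! → length mid ≤ 1

∈-split : ∀ {A : Set} {y : A} {L} → y ∈ L → Σ[ L1 ∈ List A ] Σ[ L2 ∈ List A ] L ≡ L1 ++ y ∷ L2
∈-split (here refl) = [] , _ , refl
∈-split (there m) = let (L1 , L2 , e) = ∈-split m in _ ∷ L1 , L2 , cong (_ ∷_) e

-- All marked vertices lie among three consecutive positions, starting with the first marked one.
cnt≤3 : ∀ {n} (g : Sub n) L → Near g L → cnt g L ≤ 3
cnt≤3 g []      h = z≤n
cnt≤3 g (x ∷ L) h with g x in e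
... | false = cnt≤3 g L (λ pre x' mid y post eq → h (x ∷ pre) x' mid y post (cong (x ∷_) eq))
... | true = s≤s (rest L refl)
 where
 rest : ∀ M → M ≡ L → cnt g M ≤ 2
 rest []          eq = z≤n
 rest (p ∷ [])    eq = ≤-trans (+-monoˡ-≤ 0 (b2n≤1 (g p))) (s≤s z≤n)
 rest (p ∷ q ∷ M) eq = ≤-trans (≤-eq (cong (λ k → b2n (g p) + (b2n (g q) + k)) (cnt-none g M far))) (+-mono-≤ (b2n≤1 (g p)) (+-monoˡ-≤ 0 (b2n≤1 (g q))))
  where
  far : ∀ {y} → y ∈ M → ¬ (g y !)
  far {y} m gy = let (M1 , M2 , eM) = ∈-split m in
   <⇒≱ (s≤s (s≤s z≤n)) (h [] x (p ∷ q ∷ M1) y M2 (cong (x ∷_) (trans (sym eq) (cong (λ z → p ∷ q ∷ z) eM))) e gy)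

-- From five vertices on, `cnt≤3` for both markings suffices. For three and four vertices the
-- forbidden pattern `g`, `k`, `g` on consecutive positions saves what is missing.
cnt-pair : ∀ {n} (g k : Sub n) L → 2 ≤ length L → Near g L → Near k L →
 (∀ pre x z y post → L ≡ pre ++ x ∷ z ∷ y ∷ post → g x ! → g y ! → k z ! → ⊥) → 2 * (cnt g L + cnt k L) ≤ 7 + length L
cnt-pair g k (_ ∷ []) (s≤s ()) _ _ _
cnt-pair g k (x ∷ y ∷ []) _ _ _ _ = lin (2 ∷ 2 ∷ 2 ∷ 2 ∷ 1 ∷ []) (b2n (g x) ∷ b2n (g y) ∷ b2n (k x) ∷ b2n (k y) ∷ []) (λ a b c d → a :≤ # 1 ⇒ b :≤ # 1 ⇒ c :≤ # 1 ⇒ d :≤ # 1 ⇒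
 qed (2 :* ((a :+ (b :+ # 0)) :+ (c :+ (d :+ # 0))) :≤ # 9)) (b2n≤1 _) (b2n≤1 _) (b2n≤1 _) (b2n≤1 _)
cnt-pair g k (x ∷ y ∷ z ∷ []) _ _ _ h = lin (2 ∷ 2 ∷ 2 ∷ 2 ∷ 1 ∷ []) (b2n (g x) ∷ b2n (g y) ∷ b2n (g z) ∷ b2n (k x) ∷ b2n (k y) ∷ b2n (k z) ∷ [])
 (λ a b c d e f → b :≤ # 1 ⇒ d :≤ # 1 ⇒ f :≤ # 1 ⇒ a :+ (c :+ e) :≤ # 2 ⇒
 qed (2 :* ((a :+ (b :+ (c :+ # 0))) :+ (d :+ (e :+ (f :+ # 0)))) :≤ # 10)) (b2n≤1 _) (b2n≤1 _) (b2n≤1 _) (not3 (λ p q r → h [] x y z [] refl p q r))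
 where
 not3 : ∀ {a b c} → (a ! → b ! → c ! → ⊥) → b2n a + (b2n b + b2n c) ≤ 2
 not3 {false} {b} {c} h = +-mono-≤ (b2n≤1 b) (b2n≤1 c)
 not3 {true} {false} {c} h = s≤s (b2n≤1 c)
 not3 {true} {true} {false} h = ≤-refl
 not3 {true} {true} {true} h = void (h refl refl refl)
cnt-pair g k (x ∷ y ∷ z ∷ w ∷ []) _ ng nk h = lin (2 ∷ 2 ∷ 2 ∷ 1 ∷ []) (b2n (g x) ∷ b2n (g y) ∷ b2n (g z) ∷ b2n (g w) ∷ b2n (k x) ∷ b2n (k y) ∷ b2n (k z) ∷ b2n (k w) ∷ [])
 (λ a b c d e f i j → e :+ j :≤ # 1 ⇒ a :+ (c :+ f) :≤ # 2 ⇒ b :+ (d :+ i) :≤ # 2 ⇒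
 qed (2 :* ((a :+ (b :+ (c :+ (d :+ # 0)))) :+ (e :+ (f :+ (i :+ (j :+ # 0))))) :≤ # 11))
 (not2 (λ p q → <⇒≱ (s≤s (s≤s z≤n)) (nk [] x (y ∷ z ∷ []) w [] refl p q))) (not3 (λ p q r → h [] x y z (w ∷ []) refl p q r)) (not3 (λ p q r → h (x ∷ []) y z w [] refl p q r))
 where
 not2 : ∀ {a b} → (a ! → b ! → ⊥) → b2n a + b2n b ≤ 1
 not2 {false} {b} h = b2n≤1 b
 not2 {true} {false} h = ≤-refl
 not2 {true} {true} h = void (h refl refl)
 not3 : ∀ {a b c} → (a ! → b ! → c ! → ⊥) → b2n a + (b2n b + b2n c) ≤ 2
 not3 {false} {b} {c} h = +-mono-≤ (b2n≤1 b) (b2n≤1 c)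
 not3 {true} {false} {c} h = s≤s (b2n≤1 c)
 not3 {true} {true} {false} h = ≤-refl
 not3 {true} {true} {true} h = void (h refl refl refl)
cnt-pair g k (x ∷ y ∷ z ∷ w ∷ v ∷ L) _ ng nk _ = ≤-trans (*-monoʳ-≤ 2 (+-mono-≤ (cnt≤3 g (x ∷ y ∷ z ∷ w ∷ v ∷ L) ng) (cnt≤3 k (x ∷ y ∷ z ∷ w ∷ v ∷ L) nk))) (m≤m+n 12 (length L))

module _ {n : ℕ} {E : Rl n} where

 suffixP : ∀ {a b} mid {y post} → PathL E a b (mid ++ y ∷ post) → PathL E y b (y ∷ post)
 suffixP [] one = one
 suffixP [] (e ◂ p) = e ◂ p
 suffixP (x ∷ []) (e ◂ p) = suffixP [] p
 suffixP (x ∷ x' ∷ mid) (e ◂ p) = suffixP (x' ∷ mid) p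

 replaceP : ∀ pre {a b x} mid {y post v} → PathL E a b (pre ++ x ∷ mid ++ y ∷ post) → E x v ! → E v y ! →
  PathL E a b (pre ++ x ∷ v ∷ y ∷ post)
 replaceP [] [] (_ ◂ p) e1 e2 = e1 ◂ e2 ◂ suffixP [] p
 replaceP [] (m ∷ mid) (_ ◂ p) e1 e2 = e1 ◂ e2 ◂ suffixP (m ∷ mid) p
 replaceP (q ∷ []) mid (e ◂ p) e1 e2 = e ◂ replaceP [] mid p e1 e2
 replaceP (q ∷ q' ∷ pre) mid (e ◂ p) e1 e2 = e ◂ replaceP (q' ∷ pre) mid p e1 e2

 catP : ∀ {a b c L M} → PathL E a b L → PathL E b c M →
  Σ[ N ∈ List (Fin n) ] PathL E a c N × length N + 1 ≡ length L + length M × (∀ {y} → y ∈ N → y ∈ L ⊎ y ∈ M)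
 catP {L = L} p q with shape q
 ... | M' , refl = L ++ M' , joinP p q , trans (cong (_+ 1) (length-++ L)) (trans (+-assoc (length L) (length M') 1) (cong (length L +_) (+-comm _ 1))) ,
    λ m → [ inl , (λ k → inr (there k)) ] (∈⁻ L m)

 simple-len : ∀ {a b L} → PathL E a b L → Σ[ M ∈ List (Fin n) ] PathL E a b M × Uniq M × (∀ {y} → y ∈ M → y ∈ L) × length M ≤ length L
 simple-len {L = L} p with simple p
 ... | M , q , u , s = M , q , u , s , subst₂ _≤_ (wsumM M u) (wsumM' L) (card-mono {S = λ y → elem y M} {U = λ y → elem y L} (λ y h → elem-i (s (elem-e M h))) ▸)
  where
  wsumM : ∀ M → Uniq M → sumL (λ _ → 1) M ≡ length M
  wsumM M u = sumL-1 M
  wsumM' : ∀ L → length L ≡ length L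
  wsumM' L = refl
  _▸ : card (λ y → elem y M) ≤ card (λ y → elem y L) → sumL (λ _ → 1) M ≤ length L
  h ▸ = ≤-trans (≤-eq (trans (sumL-elem (λ _ → 1) M u) (wsum-1 (λ y → elem y M)))) (≤-trans h (le L))
   where
   le : ∀ L → card (λ y → elem y L) ≤ length L
   le [] = ≤-eq (card-∅ _ (λ _ ()))
   le (x ∷ L) = ≤-trans (card-∪ {U = _== x} {V = λ y → elem y L} (λ y → ∨-e)) (+-mono-≤ (≤-eq (card-sing x)) (le L))

uniq-replace : ∀ {A : Set} pre {x : A} mid {y post v} → Uniq (pre ++ x ∷ mid ++ y ∷ post) → v ∉ (pre ++ x ∷ mid ++ y ∷ post) → Uniq (pre ++ x ∷ v ∷ y ∷ post)
uniq-replace {A} [] {x} mid {y} {post} {v} (x∉ , u) v∉ =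
 (λ { (here refl) → v∉ (here refl) ; (there m) → x∉ (∈ʳ mid m) }) , (λ m → v∉ (there (∈ʳ mid m))) , drop mid u
 where
 drop : ∀ (mid : List A) {M} → Uniq (mid ++ M) → Uniq M
 drop [] u = u
 drop (_ ∷ mid) (_ , u) = drop mid u
uniq-replace (q ∷ pre) mid (q∉ , u) v∉ = (λ m → bad (∈⁻ pre m)) , uniq-replace pre mid u (λ m → v∉ (there m))
 where
 bad : q ∈ pre ⊎ q ∈ _ → ⊥
 bad (inl m) = q∉ (∈ˡ m)
 bad (inr (here refl)) = q∉ (∈ʳ pre (here refl))
 bad (inr (there (here refl))) = v∉ (here refl)
 bad (inr (there (there m))) = q∉ (∈ʳ pre (there (∈ʳ mid m)))

-- `N` will be the closed neighbourhood of a vertex of degree at most `2 * d + 2`.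
record DenseData (n p : ℕ) : Set where
 field
  E     : Rl n
  E-sym : Symm E
  irr   : ∀ v → E v v ! → ⊥
  N     : Sub n
  d r   : ℕ
  deg   : ∀ y → N y ! → d ≤ card (λ z → N z ∧ E y z)
  cN    : card N ≤ 2 * d + 3
  hd    : 6 * r ≤ d
  R     : Sub n
  R⊆N   : ∀ y → R y ! → N y !
  cR    : card R ≤ 2 * r
  Pr    : Pairs n p
  PP    : Proper R Pr
  PS    : Strict Pr

module DenseN {n p : ℕ} (data-N : DenseData n p) where
 open DenseData data-N
 open Pairs Pr
 open Proper PP

 end∈ : ∀ i {y} → y ∈ endL Pr i → act i ! × R y ! × (y ≡ a i ⊎ y ≡ b i)
 end∈ i m with act i in e
 end∈ i (here refl) | true = refl , inRa i e , inl refl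
 end∈ i (there (here refl)) | true = refl , inRb i e , inr refl

 -- Roots that are ends of no active pair; links have to avoid them.
 blk : Sub n
 blk y = R y ∧ not (anyb (λ i → elem y (endL Pr i)))

 α bl : ℕ
 α = sum (λ i → b2n (act i))
 bl = card blk

 end-a : ∀ i → act i ! → a i ∈ endL Pr i
 end-a i h rewrite h = here refl
 end-b : ∀ i → act i ! → b i ∈ endL Pr i
 end-b i h rewrite h = there (here refl)

 endU : ∀ i → Uniq (endL Pr i)
 endU i with act i in e
 ... | true = (λ { (here f) → PS i e f }) , (λ ()) , tt
 ... | false = tt

 endD : ∀ i j {y} → y ∈ endL Pr i → y ∈ endL Pr j → i ≡ j
 endD i j m m' with end∈ i m | end∈ j m'
 ... | ai , _ , inl e | aj , _ , inl f = aa i j ai aj (trans (sym e) f)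
 ... | ai , _ , inl e | aj , _ , inr f = ab i j ai aj (trans (sym e) f)
 ... | ai , _ , inr e | aj , _ , inl f = sym (ab j i aj ai (trans (sym f) e))
 ... | ai , _ , inr e | aj , _ , inr f = bb i j ai aj (trans (sym e) f)

 endLen : ∀ i → length (endL Pr i) ≡ 2 * b2n (act i)
 endLen i with act i
 ... | true = refl
 ... | false = refl

 roots : 2 * α + bl ≤ 2 * r
 roots = ≤-trans (≤-trans (≤-eq (trans (+-comm (2 * α) bl) (cong₂ _+_ (sym (wsum-1 blk)) (trans (sym (sum-*ˡ 2 (λ i → b2n (act i)))) (sum-cong (λ i → trans (sym (endLen i)) (sym (sumL-1 (endL Pr i)))))))))
   (≤-trans (m≤n+m _ (wsum (λ _ → 1) (λ (_ : Fin n) → false))) (wsum-pack (λ _ → 1) (endL Pr) endU {S = R} {K = λ _ → false} {B = blk} (λ _ ()) (λ y → ∧-l) (λ i m → fst (snd (end∈ i m))) (λ _ ()) (λ _ _ ())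
    (λ i {y} m h → not-e (∧-r {R y} h) (anyb-i (λ i → elem y (endL Pr i)) i (elem-i m))) endD)))
  (≤-trans (≤-eq (wsum-1 R)) cR)

 record NS : Set where
  field
   PL    : Fin p → List (Fin n)
   lk    : Fin p → Bool
   lkact : ∀ i → lk i ! → act i !
   pth   : ∀ i → lk i ! → PathL E (a i) (b i) (PL i)
   unl   : ∀ i → lk i ≡ false → PL i ≡ endL Pr i
   inN   : ∀ i {y} → y ∈ PL i → N y !
   nob   : ∀ i {y} → y ∈ PL i → blk y ! → ⊥
   uniq  : ∀ i → Uniq (PL i)
   disj  : ∀ i j {y} → y ∈ PL i → y ∈ PL j → i ≡ j
 open NS

 #lk size : NS → ℕ
 #lk s = sum (λ i → b2n (lk s i))
 size s = sum (λ i → length (PL s i))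

 -- `size` includes the `2 * α` ends, so links may have four inner vertices on average, with
 -- `bl + 2` more in total. The budget is small enough that, while a pair is unlinked, the occupied
 -- vertices number at most `d`; see `small`.
 Feas : NS → Set
 Feas s = size s ≤ 4 * #lk s + (2 * α + (bl + 2))

 J K : NS → Sub n
 J s y = blk y ∨ anyb (λ i → elem y (PL s i))
 K s y = N y ∧ not (J s y)

 K-out : ∀ s {y i} → K s y ! → y ∈ PL s i → ⊥
 K-out s {y} {i} k m = not-e (∧-r {N y} k) (∨-r {blk y} (anyb-i _ i (elem-i m)))

 K-blk : ∀ s {y} → K s y ! → blk y ! → ⊥
 K-blk s {y} k h = not-e (∧-r {N y} k) (∨-l h)

 K-i : ∀ s {y} → N y ! → (blk y ! → ⊥) → (∀ i → y ∈ PL s i → ⊥) → K s y !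
 K-i s {y} ny nb np = ∧-i ny (not-i (λ h → [ nb , (λ q → let (i , e) = anyb-e _ q in np i (elem-e (PL s i) e)) ] (∨-e {blk y} h)))

 ends∈PL : ∀ s i → act i ! → a i ∈ PL s i × b i ∈ PL s i
 ends∈PL s i h with lk s i in e
 ... | true = first∈ (pth s i e) , last∈ (pth s i e)
 ... | false = subst (a i ∈_) (sym (unl s i e)) (end-a i h) , subst (b i ∈_) (sym (unl s i e)) (end-b i h)

 module Set (s : NS) (i : Fin p) (ai : act i !) (L : List (Fin n)) (q : PathL E (a i) (b i) L) (u : Uniq L)
       (sub : ∀ {y} → y ∈ L → y ∈ PL s i ⊎ K s y !) where
  PL' : Fin p → List (Fin n)
  PL' j = if j == i then L else PL s j
  lk' : Fin p → Bool
  lk' j = if j == i then true else lk s j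
  at : PL' i ≡ L
  at rewrite ==-refl i = refl
  off : ∀ {j} → j ≢ i → PL' j ≡ PL s j
  off {j} ne with j == i in e
  ... | true = void (ne (==-e e))
  ... | false = refl
  new : NS
  new = record { PL = PL' ; lk = lk' ; lkact = lkact' ; pth = pth' ; unl = unl' ; inN = inN' ; nob = nob' ; uniq = uniq' ; disj = disj' }
   where
   lkact' : ∀ j → lk' j ! → act j !
   lkact' j h with j == i in e
   ... | true = subst (λ z → act z !) (sym (==-e e)) ai
   ... | false = lkact s j h
   pth' : ∀ j → lk' j ! → PathL E (a j) (b j) (PL' j)
   pth' j h with j == i in e
   ... | true = subst (λ z → PathL E (a z) (b z) L) (sym (==-e e)) q
   ... | false = pth s j h
   unl' : ∀ j → lk' j ≡ false → PL' j ≡ endL Pr j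
   unl' j h with j == i
   ... | false = unl s j h
   unl' j () | true
   inN' : ∀ j {y} → y ∈ PL' j → N y !
   inN' j m with j == i
   ... | true = [ inN s i , (λ k → ∧-l k) ] (sub m)
   ... | false = inN s j m
   nob' : ∀ j {y} → y ∈ PL' j → blk y ! → ⊥
   nob' j m h with j == i
   ... | true = [ (λ k → nob s i k h) , (λ k → K-blk s k h) ] (sub m)
   ... | false = nob s j m h
   uniq' : ∀ j → Uniq (PL' j)
   uniq' j with j == i
   ... | true = u
   ... | false = uniq s j
   disj' : ∀ j k {y} → y ∈ PL' j → y ∈ PL' k → j ≡ k
   disj' j k m m' with j == i in e | k == i in e'
   ... | true | true = trans (==-e e) (sym (==-e e'))
   ... | false | false = disj s j k m m'
   ... | true | false = [ (λ h → trans (==-e e) (disj s i k h m')) , (λ h → void (K-out s h m')) ] (sub m)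
   ... | false | true = [ (λ h → trans (disj s j i m h) (sym (==-e e'))) , (λ h → void (K-out s h m)) ] (sub m')
  mem : ∀ j {y} → y ∈ PL new j → y ∈ L ⊎ (j ≢ i × y ∈ PL s j)
  mem j m with j == i in e
  ... | true = inl m
  ... | false = inr ((λ f → t≢f (trans (sym (==-i f)) e)) , m)
  lk-off : ∀ {j} → j ≢ i → lk new j ≡ lk s j
  lk-off {j} ne with j == i in e
  ... | true = void (ne (==-e e))
  ... | false = refl
  size-eq : size new + length (PL s i) ≡ size s + length L
  size-eq = trans (cong (size new +_) (sym (sum-δ (λ _ → length (PL s i)) i))) (trans (sym (sum-+ (λ j → length (PL' j)) (λ j → b2n (j == i) * length (PL s i))))
   (trans (sum-cong pt) (trans (sum-+ (λ j → length (PL s j)) (λ j → b2n (j == i) * length L)) (cong (size s +_) (sum-δ (λ _ → length L) i)))))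
   where
   pt : ∀ j → length (PL' j) + b2n (j == i) * length (PL s i) ≡ length (PL s j) + b2n (j == i) * length L
   pt j with j == i in e
   ... | true rewrite ==-e e = trans (cong (length L +_) (+-identityʳ _)) (trans (+-comm (length L) _) (cong (length (PL s i) +_) (sym (+-identityʳ _))))
   ... | false = refl
  lk-eq : #lk new + b2n (lk s i) ≡ #lk s + 1
  lk-eq = trans (cong (#lk new +_) (sym (sum-δ (λ _ → b2n (lk s i)) i))) (trans (sym (sum-+ (λ j → b2n (lk' j)) (λ j → b2n (j == i) * b2n (lk s i))))
   (trans (sum-cong pt) (trans (sum-+ (λ j → b2n (lk s j)) (λ j → b2n (j == i) * 1)) (cong (#lk s +_) (sum-δ (λ _ → 1) i)))))
   where
   pt : ∀ j → b2n (lk' j) + b2n (j == i) * b2n (lk s i) ≡ b2n (lk s j) + b2n (j == i) * 1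
   pt j with j == i in e
   ... | true rewrite ==-e e = trans (cong (1 +_) (+-identityʳ _)) (+-comm 1 _)
   ... | false = refl

 see : Fin n → Sub n
 see v y = E v y

 degK degJ : NS → Fin n → ℕ
 degK s v = card (λ y → K s y ∧ E v y)
 degJ s v = bl + sum (λ i → cnt (see v) (PL s i))

 wE : ∀ (S : Sub n) v → wsum (λ y → b2n (E v y)) S ≡ card (λ y → S y ∧ E v y)
 wE S v = trans (sum-cong (λ y → mul (S y) (E v y))) (sym (card-def (λ y → S y ∧ E v y)))
  where mul : ∀ a b → b2n a * b2n b ≡ b2n (a ∧ b)
        mul true b = +-identityʳ _
        mul false b = refl

 cov : ∀ s y → N y ! → K s y ! ⊎ blk y ! ⊎ (Σ[ i ∈ Fin p ] y ∈ PL s i)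
 cov s y ny with bool (blk y) | bool (anyb (λ i → elem y (PL s i)))
 ... | inl h | _ = inr (inl h)
 ... | inr _ | inl q = let (i , e) = anyb-e _ q in inr (inr (i , elem-e (PL s i) e))
 ... | inr nb | inr nq = inl (∧-i ny (not-i (λ h → [ nb , nq ] (∨-e {blk y} h))))

 deg-split : ∀ s v → N v ! → d ≤ degK s v + degJ s v
 deg-split s v nv = ≤-trans (deg v nv) (≤-trans (≤-eq (sym (wE N v))) (≤-trans (wsum-cover (λ y → b2n (E v y)) (PL s) (uniq s) {S = N} {K = K s} {B = blk} (cov s))
  (+-mono-≤ (≤-eq (wE (K s) v)) (+-monoˡ-≤ _ (≤-trans (≤-eq (wE blk v)) (card-mono (λ y → ∧-l)))))))

 count : ∀ s → card (K s) + (bl + size s) ≤ card N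
 count s = subst₂ _≤_ (cong₂ _+_ (wsum-1 (K s)) (cong₂ _+_ (wsum-1 blk) (sum-cong (λ i → sumL-1 (PL s i))))) (wsum-1 N)
  (wsum-pack (λ _ → 1) (PL s) (uniq s) {S = N} {K = K s} {B = blk} (λ y → ∧-l) (λ y h → R⊆N y (∧-l h)) (λ i → inN s i) (λ y → K-blk s) (λ i m k → K-out s k m) (λ i → nob s i) (disj s))

 -- There are at most `d` occupied vertices and `v`, not its own neighbour, is one of them. So they
 -- cannot absorb the `d` neighbours of `v` in `N`.
 see-K : ∀ s v → N v ! → bl + size s ≤ d → J s v ! → Σ[ y ∈ Fin n ] K s y ∧ E v y !
 see-K s v nv le jv = card-ex _ (≰⇒> λ z → <⇒≱ (subst (_≤ bl + size s) refl lt') (≤-trans le (≤-trans (deg v nv) (≤-trans (card-∪ {U = λ y → K s y ∧ E v y} {V = λ y → J s y ∧ E v y} (λ y h →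
   [ (λ j → inr (∧-i j (∧-r {N y} h))) , (λ nj → inl (∧-i (∧-i (∧-l h) (not-i nj)) (∧-r {N y} h))) ] (bool (J s y)))) (+-monoˡ-≤ _ z)))))
  where
  cJ : card (J s) ≤ bl + size s
  cJ = subst₂ _≤_ (wsum-1 (J s)) (trans (cong₂ _+_ (trans (wsum-1 (λ _ → false)) (card-∅ {n} _ (λ _ ()))) refl) (cong₂ _+_ (wsum-1 blk) (sum-cong (λ i → sumL-1 (PL s i)))))
   (wsum-cover (λ _ → 1) (PL s) (uniq s) {S = J s} {K = λ _ → false} {B = blk} (λ y h → [ (λ q → inr (inl q)) , (λ q → let (i , e) = anyb-e _ q in inr (inr (i , elem-e (PL s i) e))) ] (∨-e {blk y} h)))
  lt' : card (λ y → J s y ∧ E v y) < bl + size s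
  lt' = <-≤-trans (card-strict (λ y → ∧-l) v jv (λ h → irr v (∧-r {J s v} h))) cJ

 init : NS
 init = record { PL = endL Pr ; lk = λ _ → false ; lkact = λ _ () ; pth = λ _ () ; unl = λ _ _ → refl ; inN = λ i m → R⊆N _ (fst (snd (end∈ i m)))
  ; nob = λ i {y} m h → not-e (∧-r {R y} h) (anyb-i (λ j → elem y (endL Pr j)) i (elem-i m)) ; uniq = endU ; disj = endD }

 init-feas : Feas init
 init-feas = ≤-trans (≤-eq (trans (sum-cong endLen) (sum-*ˡ 2 (λ i → b2n (act i))))) (≤-trans (m≤m+n (2 * α) (bl + 2)) (m≤n+m _ (4 * #lk init)))

 allLinked : (s : NS) → (∀ i → act i ! → lk s i !) → Sol E N R Pr
 allLinked s h = record { lst = PL s ; path = λ i ai → pth s i (h i ai) ; disj = λ i j _ _ → disj s i j ; ends = ends } , λ i _ → inN s i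
  where
  ends : ∀ i → act i ! → ∀ {y} → y ∈ PL s i → R y ! → y ≡ a i ⊎ y ≡ b i
  ends i ai {y} m ry with bool (anyb (λ j → elem y (endL Pr j)))
  ... | inr none = void (nob s i m (∧-i ry (not-i none)))
  ... | inl q with anyb-e _ q
  ...   | j , e with end∈ j (elem-e (endL Pr j) e)
  ...     | aj , _ , inl refl = inl (cong a (disj s j i (fst (ends∈PL s j aj)) m))
  ...     | aj , _ , inr refl = inr (cong b (disj s j i (snd (ends∈PL s j aj)) m))

 #un : NS → ℕ
 #un s = sum (λ i → b2n (act i ∧ not (lk s i)))

 lk+un : ∀ s → #lk s + #un s ≡ α
 lk+un s = trans (sym (sum-+ (λ i → b2n (lk s i)) (λ i → b2n (act i ∧ not (lk s i))))) (sum-cong pt)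
  where
  pt : ∀ i → b2n (lk s i) + b2n (act i ∧ not (lk s i)) ≡ b2n (act i)
  pt i with lk s i in e | act i in f
  ... | true | true = refl
  ... | true | false = void (t≢f (trans (sym (lkact s i e)) f))
  ... | false | true = refl
  ... | false | false = refl

 closed : NS → Fin n → Sub n
 closed s v y = K s y ∧ ((y == v) ∨ E v y)

 closed-card : ∀ s v → K s v ! → degK s v + 1 ≤ card (closed s v)
 closed-card s v kv = subst (λ z → degK s v + z ≤ card (closed s v)) (card-sing v) (card-⊎ (λ y h → ∧-i (∧-l h) (∨-r {y == v} (∧-r {K s y} h)))
  (λ y h → ∧-i (subst (λ z → K s z !) (sym (==-e h)) kv) (∨-l h)) (λ y h k → irr v (subst (λ z → E v z !) (==-e k) (∧-r {K s y} h))))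

 record OptData : Set where
  field
   h0 m0 : ℕ
   maxh  : ∀ s → Feas s → #lk s ≤ h0
   mins  : ∀ s → Feas s → #lk s ≡ h0 → m0 ≤ size s
   i0    : Fin p
   a0    : act i0 !

 module Opt (opt : OptData) where
  open OptData opt

  record Good (s : NS) : Set where
   field
    fe : Feas s
    eh : #lk s ≡ h0
    em0 : size s ≡ m0
    li : lk s i0 ≡ false
  open Good

  Reach : Sub n → Fin n → Set
  Reach C y = Σ[ z ∈ Fin n ] Σ[ L ∈ List (Fin n) ] PathL E y z L × (∀ {x} → x ∈ L → C x !) × E z (b i0) !

  -- The system varies together with `C`, over all optimal systems that leave `i0` unlinked: the
  -- exchange that enlarges `C` also changes a link.
  record Cand : Set where
   field
    s  : NS
    gd : Good s
    C  : Sub n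
    CK : ∀ {y} → C y ! → K s y !
    re : ∀ {y} → C y ! → Reach C y

  module Sy (s : NS) (g : Good s) where

   un≥1 : 1 ≤ #un s
   un≥1 = ≤-trans (≤-eq (sym (b2n-t {act i0 ∧ not (lk s i0)} (∧-i a0 (cong not (li g)))))) (sum-≥ (λ i → b2n (act i ∧ not (lk s i))) i0)

   -- The new link raises the budget by four and replaces two ends already counted; with the slack
   -- of two in `Feas` this makes eight.
   noadd : ∀ i → act i ! → lk s i ≡ false → ∀ {L} → PathL E (a i) (b i) L → Uniq L → (∀ {y} → y ∈ L → y ∈ PL s i ⊎ K s y !) →
    size s + length L ≤ 4 * #lk s + (2 * α + (bl + 8)) → ⊥
   noadd i ai ui {L} q u sub le = lin (0 ∷ 1 ∷ 1 ∷ 1 ∷ []) (h0 ∷ #lk s ∷ #lk new ∷ []) (λ h k k' → k :≤ h ⇒ h :≤ k ⇒ k' :≤ h ⇒ k :+ # 1 :≤ k' ⇒ absurd)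
     (≤-eq (eh g)) (≤-eq (sym (eh g))) (maxh new fea) (≤-eq (trans (sym lk-eq) lke))
    where
    new : NS
    new = Set.new s i ai L q u sub
    size-eq : size new + length (PL s i) ≡ size s + length L
    size-eq = Set.size-eq s i ai L q u sub
    lk-eq : #lk new + b2n (lk s i) ≡ #lk s + 1
    lk-eq = Set.lk-eq s i ai L q u sub
    lke : #lk new + b2n (lk s i) ≡ #lk new
    lke = trans (cong (λ z → #lk new + b2n z) ui) (+-identityʳ _)
    l2 : length (PL s i) ≡ 2
    l2 = trans (cong length (unl s i ui)) (trans (endLen i) (cong (λ z → 2 * b2n z) ai))
    fea : Feas new
    fea = lin (1 ∷ 1 ∷ 4 ∷ 1 ∷ 1 ∷ []) (size new ∷ length (PL s i) ∷ size s ∷ length L ∷ #lk s ∷ #lk new ∷ α ∷ bl ∷ [])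
     (λ n p s l k k' α bl → n :+ p :≤ s :+ l ⇒ # 2 :≤ p ⇒ k :+ # 1 :≤ k' ⇒ s :+ l :≤ 4 :* k :+ (2 :* α :+ (bl :+ # 8)) ⇒ qed (n :≤ 4 :* k' :+ (2 :* α :+ (bl :+ # 2))))
     (≤-eq size-eq) (≤-eq (sym l2)) (≤-eq (trans (sym lk-eq) lke)) le

   -- Otherwise the detour through `v` shortens the link, against the minimality of the size.
   near : ∀ v i → K s v ! → lk s i ! → Near (see v) (PL s i)
   near v i kv li' pre x mid y post eq ex ey = ≮⇒≥ λ lt → bad lt
    where
    bad : 1 < length mid → ⊥
    bad lt = lin (1 ∷ 1 ∷ 1 ∷ 1 ∷ []) (m0 ∷ size s ∷ size new ∷ length (PL s i) ∷ length L ∷ []) (λ m z w p l → m :≤ w ⇒ z :≤ m ⇒ w :+ p :≤ z :+ l ⇒ l :< p ⇒ absurd)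
      (mins new fea hq) (≤-eq (em0 g)) (≤-eq size-eq) shorter
     where
     L = pre ++ x ∷ v ∷ y ∷ post
     sub : ∀ {z} → z ∈ L → z ∈ PL s i ⊎ K s z !
     sub m with ∈⁻ pre m
     ... | inl k = inl (subst (_ ∈_) (sym eq) (∈ˡ k))
     ... | inr (here refl) = inl (subst (_ ∈_) (sym eq) (∈ʳ pre (here refl)))
     ... | inr (there (here refl)) = inr kv
     ... | inr (there (there k)) = inl (subst (_ ∈_) (sym eq) (∈ʳ pre (there (∈ʳ mid k))))
     q' : PathL E (a i) (b i) L
     q' = replaceP pre mid (subst (PathL E (a i) (b i)) eq (pth s i li')) (E-sym ex) ey
     u' : Uniq L
     u' = uniq-replace pre mid (subst Uniq eq (uniq s i)) (λ m → K-out s kv (subst (v ∈_) (sym eq) m))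
     new : NS
     new = Set.new s i (lkact s i li') L q' u' sub
     size-eq : size new + length (PL s i) ≡ size s + length L
     size-eq = Set.size-eq s i (lkact s i li') L q' u' sub
     lk-eq : #lk new + b2n (lk s i) ≡ #lk s + 1
     lk-eq = Set.lk-eq s i (lkact s i li') L q' u' sub
     shorter : length L < length (PL s i)
     shorter = subst₂ _<_ (sym (length-++ pre)) (sym (trans (cong length eq) (trans (length-++ pre) (cong (λ z → length pre + suc z) (length-++ mid)))))
      (+-monoʳ-< (length pre) (s≤s (subst (_< length mid + suc (length post)) refl (+-monoˡ-≤ (suc (length post)) lt))))
     hq : #lk new ≡ h0
     hq = trans (+-cancelʳ-≡ 1 _ _ (trans (cong (λ z → #lk new + b2n z) (sym li')) lk-eq)) (eh g)
     fea : Feas new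
     fea = lin (1 ∷ 1 ∷ 4 ∷ 1 ∷ 1 ∷ []) (size new ∷ length (PL s i) ∷ size s ∷ length L ∷ #lk s ∷ #lk new ∷ α ∷ bl ∷ [])
      (λ n p s l k k' α bl → n :+ p :≤ s :+ l ⇒ l :< p ⇒ k :≤ k' ⇒ s :≤ 4 :* k :+ (2 :* α :+ (bl :+ # 2)) ⇒ qed (n :≤ 4 :* k' :+ (2 :* α :+ (bl :+ # 2))))
      (≤-eq size-eq) shorter (≤-eq (trans (eh g) (sym hq))) (fe g)

   c : Fin n → Fin p → ℕ
   c v i = cnt (see v) (PL s i)

   endL-t : ∀ i → act i ! → endL Pr i ≡ a i ∷ b i ∷ []
   endL-t i h rewrite h = refl
   endL-f : ∀ i → act i ≡ false → endL Pr i ≡ []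
   endL-f i h rewrite h = refl

   once : ∀ v i → K s v ! → act i ! → lk s i ≡ false → c v i ≤ 1
   once v i kv ai ui = subst (λ L → cnt (see v) L ≤ 1) (sym eq) (not2 (E v (a i)) (E v (b i)) bad)
    where
    eq = trans (unl s i ui) (endL-t i ai)
    not2 : ∀ x y → (x ! → y ! → ⊥) → b2n x + (b2n y + 0) ≤ 1
    not2 false y _ = subst (_≤ 1) (sym (+-identityʳ _)) (b2n≤1 y)
    not2 true false _ = ≤-refl
    not2 true true h = void (h refl refl)
    v∉ : v ∉ PL s i
    v∉ = K-out s kv
    bad : E v (a i) ! → E v (b i) ! → ⊥
    bad e f = noadd i ai ui {a i ∷ v ∷ b i ∷ []} (E-sym e ◂ f ◂ one)
     ((λ { (here q) → v∉ (subst (_∈ PL s i) q (fst (ends∈PL s i ai))) ; (there (here q)) → PS i ai q }) ,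
      (λ { (here q) → v∉ (subst (_∈ PL s i) (sym q) (snd (ends∈PL s i ai))) }) , (λ ()) , tt)
     (λ { (here refl) → inl (fst (ends∈PL s i ai)) ; (there (here refl)) → inr kv ; (there (there (here refl))) → inl (snd (ends∈PL s i ai)) })
     (lin (1 ∷ 1 ∷ []) (size s ∷ #lk s ∷ α ∷ bl ∷ []) (λ s k α bl → s :≤ 4 :* k :+ (2 :* α :+ (bl :+ # 2)) ⇒ qed (s :+ # 3 :≤ 4 :* k :+ (2 :* α :+ (bl :+ # 8)))) (fe g))

   len2 : ∀ i → lk s i ! → 2 ≤ length (PL s i)
   len2 i h = go (pth s i h) (PS i (lkact s i h))
    where
    go : ∀ {x y L} → PathL E x y L → x ≢ y → 2 ≤ length L
    go one ne = void (ne refl)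
    go (_ ◂ one) _ = s≤s (s≤s z≤n)
    go (_ ◂ _ ◂ _) _ = s≤s (s≤s z≤n)

   cA : ∀ v i → K s v ! → c v i ≤ 3 * b2n (lk s i) + b2n (act i ∧ not (lk s i))
   cA v i kv with lk s i in e | act i in f
   ... | true | _ = ≤-trans (cnt≤3 (see v) (PL s i) (near v i kv e)) (m≤m+n 3 _)
   ... | false | true = once v i kv f e
   ... | false | false = subst (λ L → cnt (see v) L ≤ 0) (sym (trans (unl s i e) (endL-f i f))) z≤n

   cB : ∀ v1 v2 v3 i → K s v1 ! → K s v2 ! → K s v3 ! → c v1 i + (c v2 i + c v3 i) ≤ length (PL s i) + (6 * b2n (lk s i) + b2n (act i ∧ not (lk s i)))
   cB v1 v2 v3 i k1 k2 k3 with lk s i in e | act i in f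
   ... | true | x = lin (1 ∷ 1 ∷ 1 ∷ 1 ∷ []) (c v1 i ∷ c v2 i ∷ c v3 i ∷ length (PL s i) ∷ b2n (x ∧ false) ∷ [])
     (λ x y z l w → x :≤ l ⇒ y :≤ # 3 ⇒ z :≤ # 3 ⇒ qed (x :+ (y :+ z) :≤ l :+ (# 6 :+ w)))
     (cnt≤len (see v1) (PL s i)) (cnt≤3 (see v2) (PL s i) (near v2 i k2 e)) (cnt≤3 (see v3) (PL s i) (near v3 i k3 e))
   ... | false | true = ≤-trans (+-mono-≤ (once v1 i k1 f e) (+-mono-≤ (once v2 i k2 f e) (once v3 i k3 f e)))
      (subst (λ L → 3 ≤ length L + 1) (sym (trans (unl s i e) (endL-t i f))) ≤-refl)
   ... | false | false = subst (λ L → cnt (see v1) L + (cnt (see v2) L + cnt (see v3) L) ≤ length L + 0) (sym (trans (unl s i e) (endL-f i f))) z≤n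

   sumA : ∀ v → K s v ! → sum (c v) ≤ 3 * #lk s + #un s
   sumA v kv = ≤-trans (sum-mono (λ i → cA v i kv)) (≤-eq (trans (sum-+ (λ i → 3 * b2n (lk s i)) (λ i → b2n (act i ∧ not (lk s i)))) (cong (_+ #un s) (sum-*ˡ 3 (λ i → b2n (lk s i))))))

   sumB : ∀ v1 v2 v3 → K s v1 ! → K s v2 ! → K s v3 ! → sum (c v1) + (sum (c v2) + sum (c v3)) ≤ size s + (6 * #lk s + #un s)
   sumB v1 v2 v3 k1 k2 k3 = subst₂ _≤_ (trans (sum-+ (c v1) (λ i → c v2 i + c v3 i)) (cong (sum (c v1) +_) (sum-+ (c v2) (c v3))))
    (trans (sum-+ (λ i → length (PL s i)) _) (cong (size s +_) (trans (sum-+ (λ i → 6 * b2n (lk s i)) (λ i → b2n (act i ∧ not (lk s i)))) (cong (_+ #un s) (sum-*ˡ 6 (λ i → b2n (lk s i)))))))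
    (sum-mono (λ i → cB v1 v2 v3 i k1 k2 k3))

   -- The neighbourhoods within `K` are disjoint, and on one link the three vertices see at most its
   -- length plus six. By `6 * r ≤ d` these contacts cannot make up for the difference between
   -- `3 * (d + 1)` and the `2 * d + 3` vertices of `N`.
   three : ∀ v1 v2 v3 → K s v1 ! → K s v2 ! → K s v3 ! → card (closed s v1) + (card (closed s v2) + card (closed s v3)) ≤ card (K s) → ⊥
   three v1 v2 v3 k1 k2 k3 le = lin (1 ∷ 1 ∷ 1 ∷ 3 ∷ 1 ∷ 5 ∷ []) (d ∷ r ∷ card (K s) ∷ card N ∷ size s ∷ bl ∷ #lk s ∷ #un s ∷ [])
     (λ d r k m s bl h u → 3 :* (d :+ # 1) :≤ k :+ (3 :* bl :+ (s :+ (6 :* h :+ u))) ⇒ k :+ (bl :+ s) :≤ m ⇒ m :≤ 2 :* d :+ # 3 ⇒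
     2 :* (h :+ u) :+ bl :≤ 2 :* r ⇒ 6 :* r :≤ d ⇒ # 1 :≤ u ⇒ absurd)
     total (count s) cN (subst (λ z → 2 * z + bl ≤ 2 * r) (sym (lk+un s)) roots) hd un≥1
    where
    one-v : ∀ v → K s v ! → d + 1 ≤ card (closed s v) + (bl + sum (c v))
    one-v v kv = lin (1 ∷ 1 ∷ 1 ∷ []) (d ∷ degK s v ∷ bl + sum (c v) ∷ card (closed s v) ∷ []) (λ d x y z → d :≤ x :+ y ⇒ x :+ # 1 :≤ z ⇒ qed (d :+ # 1 :≤ z :+ y)) (deg-split s v (∧-l kv)) (closed-card s v kv)
    total : 3 * (d + 1) ≤ card (K s) + (3 * bl + (size s + (6 * #lk s + #un s)))
    total = lin (1 ∷ 1 ∷ 1 ∷ 1 ∷ 1 ∷ 1 ∷ []) (d ∷ sum (c v1) ∷ sum (c v2) ∷ sum (c v3) ∷ card (closed s v1) ∷ card (closed s v2) ∷ card (closed s v3) ∷ card (K s) ∷ bl ∷ size s + (6 * #lk s + #un s) ∷ [])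
     (λ d y1 y2 y3 z1 z2 z3 k bl t → d :+ # 1 :≤ z1 :+ (bl :+ y1) ⇒ d :+ # 1 :≤ z2 :+ (bl :+ y2) ⇒ d :+ # 1 :≤ z3 :+ (bl :+ y3) ⇒
     z1 :+ (z2 :+ z3) :≤ k ⇒ y1 :+ (y2 :+ y3) :≤ t ⇒ qed (3 :* (d :+ # 1) :≤ k :+ (3 :* bl :+ t)))
     (one-v v1 k1) (one-v v2 k2) (one-v v3 k3) le (sumB v1 v2 v3 k1 k2 k3)

   -- Two units are gained over `Feas`, which is what a new link with six inner vertices needs
   -- instead of four.
   two+1 : ∀ v1 v2 → K s v1 ! → K s v2 ! → card (closed s v1) + (card (closed s v2) + 1) ≤ card (K s) → size s ≤ 4 * #lk s + (2 * α + bl)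
   two+1 v1 v2 k1 k2 le = lin (1 ∷ 1 ∷ 1 ∷ 1 ∷ 1 ∷ 1 ∷ 1 ∷ 1 ∷ 1 ∷ 2 ∷ 1 ∷ []) (d ∷ degK s v1 ∷ degK s v2 ∷ sum (c v1) ∷ sum (c v2) ∷ card (closed s v1) ∷ card (closed s v2) ∷ card (K s) ∷ card N ∷ size s ∷ bl ∷ #lk s ∷ #un s ∷ α ∷ [])
    (λ d x1 x2 y1 y2 z1 z2 k m s bl h u α → d :≤ x1 :+ (bl :+ y1) ⇒ d :≤ x2 :+ (bl :+ y2) ⇒
     x1 :+ # 1 :≤ z1 ⇒ x2 :+ # 1 :≤ z2 ⇒ z1 :+ (z2 :+ # 1) :≤ k ⇒ k :+ (bl :+ s) :≤ m ⇒ m :≤ 2 :* d :+ # 3 ⇒ y1 :≤ 3 :* h :+ u ⇒ y2 :≤ 3 :* h :+ u ⇒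
     h :+ u :≤ α ⇒ qed (s :≤ 4 :* h :+ (2 :* α :+ bl)))
    (deg-split s v1 (∧-l k1)) (deg-split s v2 (∧-l k2)) (closed-card s v1 k1) (closed-card s v2 k2) le (count s) cN
    (sumA v1 k1) (sumA v2 k2) (≤-eq (lk+un s))

   small : bl + size s ≤ d
   small = lin (1 ∷ 3 ∷ 4 ∷ 4 ∷ 1 ∷ 0 ∷ 1 ∷ []) (d ∷ r ∷ size s ∷ bl ∷ #lk s ∷ #un s ∷ α ∷ []) (λ d r s bl h u α → s :≤ 4 :* h :+ (2 :* α :+ (bl :+ # 2)) ⇒ 2 :* α :+ bl :≤ 2 :* r ⇒ h :+ u :≤ α ⇒ # 1 :≤ u ⇒ 6 :* r :≤ d ⇒ α :≤ h :+ u ⇒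
     qed (bl :+ s :≤ d)) (fe g) roots (≤-eq (lk+un s)) un≥1 hd (≤-eq (sym (lk+un s)))

   t0 s0 : Fin n
   s0 = a i0
   t0 = b i0

   InK : List (Fin n) → Set
   InK L = ∀ {x} → x ∈ L → K s x !

   Walk : ℕ → Set
   Walk m = Σ[ y ∈ Fin n ] Σ[ z ∈ Fin n ] Σ[ L ∈ List (Fin n) ] PathL E y z L × InK L × E s0 y ! × E z t0 ! × length L ≤ m

   noWalk2 : ∀ {y z L} → PathL E y z L → Uniq L → InK L → E s0 y ! → E z t0 ! → size s + (length L + 2) ≤ 4 * #lk s + (2 * α + (bl + 8)) → ⊥
   noWalk2 {L = L} q u k es et le = noadd i0 a0 (li g) {s0 ∷ (L ++ t0 ∷ [])} (es ◂ joinE q et one) (s∉ , uniq-++ L (t0 ∷ []) u ((λ ()) , tt) (λ { m (here refl) → K-out s (k m) (snd (ends∈PL s i0 a0)) }))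
     (λ { (here refl) → inl (fst (ends∈PL s i0 a0)) ; (there m) → [ (λ h → inr (k h)) , (λ { (here refl) → inl (snd (ends∈PL s i0 a0)) }) ] (∈⁻ L m) })
     (subst (λ z → size s + z ≤ 4 * #lk s + (2 * α + (bl + 8))) (trans (trans (+-comm (length L) 2) (cong suc (+-comm 1 (length L)))) (cong suc (sym (length-++ L)))) le)
    where
    s∉ : s0 ∉ (L ++ t0 ∷ [])
    s∉ m = [ (λ h → K-out s (k h) (fst (ends∈PL s i0 a0))) , (λ { (here e) → PS i0 a0 e }) ] (∈⁻ L m)

   lastP : ∀ {x y L} → PathL E x y L → Σ[ M ∈ List (Fin n) ] L ≡ M ++ y ∷ []
   lastP one = [] , refl
   lastP (_ ◂ q) = let (M , e) = lastP q in _ ∷ M , cong (_ ∷_) e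

   skipP : ∀ pre {x0 z0 x} mid {y post} → PathL E x0 z0 (pre ++ x ∷ mid ++ y ∷ post) → E x y ! → PathL E x0 z0 (pre ++ x ∷ y ∷ post)
   skipP [] [] (_ ◂ q) e = e ◂ suffixP [] q
   skipP [] (m ∷ mid) (_ ◂ q) e = e ◂ suffixP (m ∷ mid) q
   skipP (_ ∷ []) mid (f ◂ q) e = f ◂ skipP [] mid q e
   skipP (_ ∷ _ ∷ pre) mid (f ◂ q) e = f ◂ skipP (_ ∷ pre) mid q e

   module Shortest (m : ℕ) {y z : Fin n} {L : List (Fin n)} (q : PathL E y z L) (u : Uniq L) (k : InK L) (es : E s0 y !) (et : E z t0 !)
           (min : ∀ {m} → Walk m → length L ≤ m) where

    len-mid : ∀ (pre : List (Fin n)) {x mid v post} → length (pre ++ x ∷ mid ++ v ∷ post) ≡ length pre + (2 + (length mid + length post))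
    len-mid pre {x} {mid} {v} {post} = trans (length-++ pre) (cong (λ w → length pre + suc w) (trans (length-++ mid) (+-suc (length mid) (length post))))

    noSkip : ∀ pre x mid v post → L ≡ pre ++ x ∷ mid ++ v ∷ post → 1 ≤ length mid → E x v ! → ⊥
    noSkip pre x mid v post eq 1≤ e = <⇒≱ (subst₂ _<_ (sym (len-mid pre {x} {[]})) (sym (trans (cong length eq) (len-mid pre))) (+-monoʳ-< (length pre) (s≤s (s≤s (+-monoˡ-≤ (length post) 1≤)))))
     (min (y , z , pre ++ x ∷ v ∷ post , skipP pre mid (subst (PathL E y z) eq q) e , ink , es , et , ≤-refl))
     where
     ink : InK (pre ++ x ∷ v ∷ post)
     ink m with ∈⁻ pre m
     ... | inl h = k (subst (_ ∈_) (sym eq) (∈ˡ h))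
     ... | inr (here refl) = k (subst (_ ∈_) (sym eq) (∈ʳ pre (here refl)))
     ... | inr (there h) = k (subst (_ ∈_) (sym eq) (∈ʳ pre (there (∈ʳ mid h))))

    apart : ∀ pre x mid v post → L ≡ pre ++ x ∷ mid ++ v ∷ post → x ≢ v
    apart pre x mid v post eq refl = go pre (subst Uniq eq u)
     where
     go : ∀ pre → Uniq (pre ++ x ∷ mid ++ x ∷ post) → ⊥
     go [] (x∉ , _) = x∉ (∈ʳ mid (here refl))
     go (_ ∷ pre) (_ , u) = go pre u

    -- An edge or a common neighbour between vertices that far apart would shorten a shortest walk.
    far : ∀ pre x mid v post → L ≡ pre ++ x ∷ mid ++ v ∷ post → 2 ≤ length mid → ∀ w → closed s x w ! → closed s v w ! → ⊥
    far pre x mid v post eq 2≤ w cx cv with ∨-e {w == x} (∧-r {K s w} cx) | ∨-e {w == v} (∧-r {K s w} cv)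
    ... | inl e | inl f = apart pre x mid v post eq (trans (sym (==-e e)) (==-e f))
    ... | inl e | inr f = noSkip pre x mid v post eq (≤-trans (n≤1+n 1) 2≤) (E-sym (subst (λ z → E v z !) (==-e e) f))
    ... | inr e | inl f = noSkip pre x mid v post eq (≤-trans (n≤1+n 1) 2≤) (subst (λ z → E x z !) (==-e f) e)
    ... | inr e | inr f = <⇒≱ (subst₂ _<_ (sym (len-mid pre {x} {w ∷ []})) (sym (trans (cong length eq) (len-mid pre))) (+-monoʳ-< (length pre) (s≤s (s≤s (+-monoˡ-≤ (length post) 2≤)))))
     (min (y , z , pre ++ x ∷ w ∷ v ∷ post , replaceP pre mid (subst (PathL E y z) eq q) e (E-sym f) , ink , es , et , ≤-refl))
     where
     ink : InK (pre ++ x ∷ w ∷ v ∷ post)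
     ink m with ∈⁻ pre m
     ... | inl h = k (subst (_ ∈_) (sym eq) (∈ˡ h))
     ... | inr (here refl) = k (subst (_ ∈_) (sym eq) (∈ʳ pre (here refl)))
     ... | inr (there (here refl)) = ∧-l cx
     ... | inr (there (there h)) = k (subst (_ ∈_) (sym eq) (∈ʳ pre (there (∈ʳ mid h))))

    ∧K : ∀ {v w} → closed s v w ! → K s w !
    ∧K h = ∧-l h

    -- With seven or more vertices, the first, the fourth and the last have disjoint closed
    -- neighbourhoods, against `three`. With five or six, the first and the last leave out the third
    -- vertex; `two+1` then provides room for the walk as a new link.
    long : ∀ y1 y2 y3 y4 M → L ≡ y1 ∷ y2 ∷ y3 ∷ y4 ∷ (M ++ z ∷ []) → ⊥
    long y1 y2 y3 y4 M eq with 2 ≤? length M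
    ... | yes 2≤ = three y1 y4 z (at (here refl)) (at (there (there (there (here refl))))) (at (there (there (there (there (∈ʳ M (here refl)))))))
      (≤-trans (+-monoʳ-≤ _ (card-⊎ {S = λ w → closed s y4 w ∨ closed s z w} (λ w → ∨-l) (λ w → ∨-r {closed s y4 w}) (far (y1 ∷ y2 ∷ y3 ∷ []) y4 M z [] eq 2≤)))
       (card-⊎ (λ w → ∧K {y1}) (λ w h → [ ∧K {y4} , ∧K {z} ] (∨-e {closed s y4 w} h)) (λ w h h' → [ far [] y1 (y2 ∷ y3 ∷ []) y4 _ eq (s≤s (s≤s z≤n)) w h , far [] y1 (y2 ∷ y3 ∷ y4 ∷ M) z [] eq (s≤s (s≤s z≤n)) w h ] (∨-e {closed s y4 w} h'))))
     where
     at : ∀ {w} → w ∈ (y1 ∷ y2 ∷ y3 ∷ y4 ∷ (M ++ z ∷ [])) → K s w !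
     at m = k (subst (_ ∈_) (sym eq) m)
    ... | no 2≰ = noWalk2 q u k es et (lin (1 ∷ 1 ∷ 1 ∷ 1 ∷ []) (size s ∷ length L ∷ length M ∷ #lk s ∷ α ∷ bl ∷ []) (λ s l m h α bl → s :≤ 4 :* h :+ (2 :* α :+ bl) ⇒ l :≤ m :+ # 5 ⇒ m :< # 2 ⇒
          qed (s :+ (l :+ # 2) :≤ 4 :* h :+ (2 :* α :+ (bl :+ # 8))))
        (two+1 y1 z (at (here refl)) (at (there (there (there (there (∈ʳ M (here refl)))))))
         (subst (λ w → card (closed s y1) + (card (closed s z) + w) ≤ card (K s)) (card-sing y3)
         (≤-trans (+-monoʳ-≤ _ (card-⊎ {S = λ w → closed s z w ∨ (w == y3)} (λ w → ∨-l) (λ w → ∨-r {closed s z w}) (λ w h e → y3z (subst (λ w → closed s z w !) (==-e e) h))))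
          (card-⊎ (λ w → ∧K {y1}) (λ w h → [ ∧K {z} , (λ e → subst (λ w → K s w !) (sym (==-e e)) (at (there (there (here refl))))) ] (∨-e {closed s z w} h))
           (λ w h h' → [ far [] y1 (y2 ∷ y3 ∷ y4 ∷ M) z [] eq (s≤s (s≤s z≤n)) w h , (λ e → y1y3 (subst (λ w → closed s y1 w !) (==-e e) h)) ] (∨-e {closed s z w} h'))))))
        (≤-eq (trans (cong length eq) (trans (cong (4 +_) (length-++ M)) (trans (cong (4 +_) (+-comm (length M) 1)) (+-comm 5 (length M)))))) (≰⇒> 2≰))
     where
     at : ∀ {w} → w ∈ (y1 ∷ y2 ∷ y3 ∷ y4 ∷ (M ++ z ∷ [])) → K s w !
     at m = k (subst (_ ∈_) (sym eq) m)
     y1y3 : closed s y1 y3 ! → ⊥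
     y1y3 h with ∨-e {y3 == y1} (∧-r {K s y3} h)
     ... | inl e = apart [] y1 (y2 ∷ []) y3 _ eq (sym (==-e e))
     ... | inr e = noSkip [] y1 (y2 ∷ []) y3 _ eq (s≤s z≤n) e
     y3z : closed s z y3 ! → ⊥
     y3z h with ∨-e {y3 == z} (∧-r {K s y3} h)
     ... | inl e = apart (y1 ∷ y2 ∷ []) y3 (y4 ∷ M) z [] eq (==-e e)
     ... | inr e = noSkip (y1 ∷ y2 ∷ []) y3 (y4 ∷ M) z [] eq (s≤s z≤n) (E-sym e)

    short : length L ≤ 4 → ⊥
    short le = noWalk2 q u k es et (lin (1 ∷ 1 ∷ 1 ∷ []) (size s ∷ length L ∷ #lk s ∷ α ∷ bl ∷ []) (λ s l h α bl → s :≤ 4 :* h :+ (2 :* α :+ (bl :+ # 2)) ⇒ l :≤ # 4 ⇒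
          qed (s :+ (l :+ # 2) :≤ 4 :* h :+ (2 :* α :+ (bl :+ # 8)))) (fe g) le)

    impossible : ⊥
    impossible = go q refl
     where
     go : ∀ {x M} → PathL E x z M → M ≡ L → ⊥
     go one eq = short (subst (λ M → length M ≤ 4) eq (s≤s z≤n))
     go (_ ◂ one) eq = short (subst (λ M → length M ≤ 4) eq (s≤s (s≤s z≤n)))
     go (_ ◂ _ ◂ one) eq = short (subst (λ M → length M ≤ 4) eq (s≤s (s≤s (s≤s z≤n))))
     go (_ ◂ _ ◂ _ ◂ one) eq = short (subst (λ M → length M ≤ 4) eq (s≤s (s≤s (s≤s (s≤s z≤n)))))
     go (_ ◂ _ ◂ _ ◂ _ ◂ q') eq with lastP q'
     ... | M , refl = long _ _ _ _ M (sym eq)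

   -- Consequently the free vertices fall apart: neighbours of the two ends of the unlinked pair lie
   -- in different pieces. One of the pieces will turn out to be linked.
   noWalk : ∀ {y z L} → PathL E y z L → InK L → E s0 y ! → E z t0 ! → ⊥
   noWalk {y} {z} {L} q k es et = run (argmin {A = Σ ℕ Walk} fst (length L , y , z , L , q , k , es , et , ≤-refl) >>= λ where
    ((m , y , z , L , q , k , es , et , le) , min) → ret (let (M , q' , u , sub , le') = simple-len q in
      Shortest.impossible m q' u (λ x → k (sub x)) es et (λ {m'} w → ≤-trans le' (≤-trans le (min (m' , w))))))

   module Final (C : Sub n) (CK : ∀ {y} → C y ! → K s y !) (re : ∀ {y} → C y ! → Reach C y) (mx : ∀ cd' → card (Cand.C cd') ≤ card C) where

    C1 : Sub n
    C1 y = K s y ∧ not (C y)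

    C1K : ∀ {y} → C1 y ! → K s y !
    C1K h = ∧-l h

    widen : ∀ {C C' : Sub n} {y} → (∀ {x} → C x ! → C' x !) → Reach C y → Reach C' y
    widen f (z , L , q , inC , e) = z , L , q , (λ m → f (inC m)) , e

    grow : ∀ y → K s y ! → (C y ! → ⊥) → Reach (λ x → C x ∨ (x == y)) y → ⊥
    grow y ky ny rc = <⇒≱ (card-strict {S = C} {U = C'} (λ x → ∨-l) y (∨-r {C y} (==-refl y)) ny) (mx (record { s = s ; gd = g ; C = C' ; CK = ck ; re = re' }))
     where
     C' : Sub n
     C' x = C x ∨ (x == y)
     ck : ∀ {x} → C' x ! → K s x !
     ck {x} h = [ CK , (λ e → subst (λ z → K s z !) (sym (==-e e)) ky) ] (∨-e {C x} h)
     re' : ∀ {x} → C' x ! → Reach C' x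
     re' {x} h = [ (λ c → widen ∨-l (re c)) , (λ e → subst (Reach C') (sym (==-e e)) rc) ] (∨-e {C x} h)

    closedC : ∀ {y w} → C1 y ! → C w ! → E y w ! → ⊥
    closedC {y} {w} h cw e = let (z , L , q , inC , et) = re cw in
     grow y (C1K {y} h) (not-e (∧-r {K s y} h)) (z , y ∷ L , e ◂ q , (λ { (here refl) → ∨-r {C y} (==-refl y) ; (there m) → ∨-l (inC m) }) , et)

    sees : ∀ v → v ∈ PL s i0 → Σ[ y ∈ Fin n ] K s y ∧ E v y !
    sees v m = see-K s v (inN s i0 m) small (∨-r {blk v} (anyb-i _ i0 (elem-i m)))

    seeT : Σ[ y ∈ Fin n ] C y !
    seeT = let (y , h) = sees t0 (snd (ends∈PL s i0 a0)) in
     y , [ (λ c → c) , (λ nc → void (grow y (∧-l h) nc (y , y ∷ [] , one , (λ { (here refl) → ∨-r {C y} (==-refl y) }) , E-sym (∧-r {K s y} h)))) ] (bool (C y))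

    seeS : Σ[ y ∈ Fin n ] C1 y !
    seeS = let (y , h) = sees s0 (fst (ends∈PL s i0 a0)) in
     y , ∧-i (∧-l h) (not-i (λ c → let (z , L , q , inC , et) = re c in noWalk q (λ m → CK (inC m)) (∧-r {K s y} h) et))

    exch : ∀ {u w z} → C1 u ! → C w ! → N z ! → (blk z ! → ⊥) → (C z ! → ⊥) → E w z ! → (s' : NS) → Good s' → (∀ j → z ∈ PL s' j → ⊥) →
     (∀ j {v} → v ∈ PL s' j → (Σ[ j' ∈ Fin p ] v ∈ PL s j') ⊎ v ≡ u) → ⊥
    exch {u} {w} {z} cu cw nz bz cz wz s' g' out mem = <⇒≱ (card-strict {S = C} {U = C'} (λ x → ∨-l) z (∨-r {C z} (==-refl z)) cz)
      (mx (record { s = s' ; gd = g' ; C = C' ; CK = ck ; re = re' }))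
     where
     C' : Sub n
     C' v = C v ∨ (v == z)
     ck : ∀ {v} → C' v ! → K s' v !
     ck {v} h = [ (λ cv → K-i s' (∧-l (CK cv)) (K-blk s (CK cv)) (λ j m → [ (λ { (j' , k) → K-out s (CK cv) k }) , (λ { refl → not-e (∧-r {K s u} cu) cv }) ] (mem j m))) ,
       (λ e → subst (λ v → K s' v !) (sym (==-e e)) (K-i s' nz bz out)) ] (∨-e {C v} h)
     rz : Reach C' z
     rz = let (z' , L' , q , inC , et) = re cw in z' , z ∷ L' , E-sym wz ◂ q , (λ { (here refl) → ∨-r {C z} (==-refl z) ; (there m) → ∨-l (inC m) }) , et
     re' : ∀ {v} → C' v ! → Reach C' v
     re' {v} h = [ (λ c → widen ∨-l (re c)) , (λ e → subst (Reach C') (sym (==-e e)) rz) ] (∨-e {C v} h)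

    -- `u` takes the place of `z` on the link, at no cost in size. The released `z` is adjacent to
    -- `w` and joins `C`, which was maximal. This excludes the pattern in `cnt-pair`.
    exchange : ∀ {u w} → C1 u ! → C w ! → ∀ i → lk s i ! → ∀ pre x z y post → PL s i ≡ pre ++ x ∷ z ∷ y ∷ post →
     E u x ! → E u y ! → E w z ! → ⊥
    exchange {u} {w} cu cw i li' pre x z y post eq ex ey wz = exch cu cw (inN s i z∈) (nob s i z∈) (λ c → K-out s (CK c) z∈) wz (Set.new s i ai L q' u' sub)
      (record { fe = subst₂ (λ a b → a ≤ 4 * b + (2 * α + (bl + 2))) (sym sq) (sym hq) (fe g) ; eh = trans hq (eh g) ; em0 = trans sq (em0 g) ; li = trans (Set.lk-off s i ai L q' u' sub i0≢i) (li g) })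
      (λ j m → [ z∉L , (λ { (ne , k) → ne (disj s j i k z∈) }) ] (Set.mem s i ai L q' u' sub j m))
      (λ j m → [ memL , (λ { (ne , k) → inl (j , k) }) ] (Set.mem s i ai L q' u' sub j m))
     where
     ku : K s u !
     ku = C1K {u} cu
     ai : act i !
     ai = lkact s i li'
     L : List (Fin n)
     L = pre ++ x ∷ u ∷ y ∷ post
     z∈ : z ∈ PL s i
     z∈ = subst (z ∈_) (sym eq) (∈ʳ pre (there (here refl)))
     memL : ∀ {v} → v ∈ L → (Σ[ j' ∈ Fin p ] v ∈ PL s j') ⊎ v ≡ u
     memL m with ∈⁻ pre m
     ... | inl k = inl (i , subst (_ ∈_) (sym eq) (∈ˡ k))
     ... | inr (here refl) = inl (i , subst (_ ∈_) (sym eq) (∈ʳ pre (here refl)))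
     ... | inr (there (here refl)) = inr refl
     ... | inr (there (there k)) = inl (i , subst (_ ∈_) (sym eq) (∈ʳ pre (there (there k))))
     sub : ∀ {v} → v ∈ L → v ∈ PL s i ⊎ K s v !
     sub m with ∈⁻ pre m
     ... | inl k = inl (subst (_ ∈_) (sym eq) (∈ˡ k))
     ... | inr (here refl) = inl (subst (_ ∈_) (sym eq) (∈ʳ pre (here refl)))
     ... | inr (there (here refl)) = inr ku
     ... | inr (there (there k)) = inl (subst (_ ∈_) (sym eq) (∈ʳ pre (there (there k))))
     q' : PathL E (a i) (b i) L
     q' = replaceP pre (z ∷ []) (subst (PathL E (a i) (b i)) eq (pth s i li')) (E-sym ex) ey
     u' : Uniq L
     u' = uniq-replace pre (z ∷ []) (subst Uniq eq (uniq s i)) (λ m → K-out s ku (subst (u ∈_) (sym eq) m))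
     sameLen : length L ≡ length (PL s i)
     sameLen = trans (length-++ pre) (sym (trans (cong length eq) (length-++ pre)))
     hq : #lk (Set.new s i ai L q' u' sub) ≡ #lk s
     hq = +-cancelʳ-≡ 1 _ _ (trans (cong (λ z → #lk (Set.new s i ai L q' u' sub) + b2n z) (sym li')) (Set.lk-eq s i ai L q' u' sub))
     sq : size (Set.new s i ai L q' u' sub) ≡ size s
     sq = +-cancelʳ-≡ (length (PL s i)) _ _ (trans (Set.size-eq s i ai L q' u' sub) (cong (size s +_) sameLen))
     i0≢i : i0 ≢ i
     i0≢i e = t≢f (trans (sym li') (trans (cong (lk s) (sym e)) (li g)))
     z∉L : z ∉ L
     z∉L m = go pre (subst Uniq eq (uniq s i)) m
      where
      go : ∀ pre → Uniq (pre ++ x ∷ z ∷ y ∷ post) → z ∈ (pre ++ x ∷ u ∷ y ∷ post) → ⊥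
      go [] (x∉ , _) (here refl) = x∉ (here refl)
      go [] (_ , z∉ , _) (there (here refl)) = K-out s ku z∈
      go [] (_ , z∉ , _) (there (there m)) = z∉ m
      go (p ∷ pre) (p∉ , u) (here refl) = p∉ (∈ʳ pre (there (here refl)))
      go (p ∷ pre) (_ , u) (there m) = go pre u m

    cP : ∀ {u w} → C1 u ! → C w ! → ∀ i → 2 * (c u i + c w i) ≤ length (PL s i) + (7 * b2n (lk s i) + 2 * b2n (act i ∧ not (lk s i)))
    cP {u} {w} cu cw i = go (lk s i) (act i) refl refl
     where
     go : ∀ l x → lk s i ≡ l → act i ≡ x → 2 * (c u i + c w i) ≤ length (PL s i) + (7 * b2n l + 2 * b2n (x ∧ not l))
     go true x e f = ≤-trans (cnt-pair (see u) (see w) (PL s i) (len2 i e) (near u i (C1K {u} cu) e) (near w i (CK cw) e) (exchange cu cw i e))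
      (≤-trans (≤-eq (+-comm 7 _)) (+-monoʳ-≤ (length (PL s i)) (m≤m+n 7 _)))
     go false true e f = ≤-trans (*-monoʳ-≤ 2 (+-mono-≤ (once u i (C1K {u} cu) f e) (once w i (CK cw) f e)))
      (subst (λ L → 4 ≤ length L + 2) (sym (trans (unl s i e) (endL-t i f))) ≤-refl)
     go false false e f = subst (λ L → 2 * (cnt (see u) L + cnt (see w) L) ≤ length L + 0) (sym (trans (unl s i e) (endL-f i f))) z≤n

    sumP : ∀ {u w} → C1 u ! → C w ! → 2 * (sum (c u) + sum (c w)) ≤ size s + (7 * #lk s + 2 * #un s)
    sumP {u} {w} cu cw = subst₂ _≤_ (trans (sum-*ˡ 2 (λ i → c u i + c w i)) (cong (2 *_) (sum-+ (c u) (c w))))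
     (trans (sum-+ (λ i → length (PL s i)) _) (cong (size s +_) (trans (sum-+ (λ i → 7 * b2n (lk s i)) (λ i → 2 * b2n (act i ∧ not (lk s i)))) (cong₂ _+_ (sum-*ˡ 7 (λ i → b2n (lk s i))) (sum-*ˡ 2 (λ i → b2n (act i ∧ not (lk s i))))))))
     (sum-mono (cP cu cw))

    non : Sub n → Fin n → ℕ
    non S v = card (λ y → S y ∧ not (E v y))

    Few : Sub n → Set
    Few S = Σ[ u ∈ Fin n ] S u ! × 2 * card S + 4 ≤ 4 * non S u + 5 * r

    within : ∀ (S : Sub n) v → (∀ y → K s y ! → E v y ! → S y !) → degK s v + non S v ≤ card S
    within S v h = card-⊎ {S = S} {U = λ y → K s y ∧ E v y} {V = λ y → S y ∧ not (E v y)} (λ y q → h y (∧-l q) (∧-r {K s y} q)) (λ y → ∧-l) (λ y q q' → not-e (∧-r {S y} q') (∧-r {K s y} q))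

    in1 : ∀ {v} → C1 v ! → ∀ y → K s y ! → E v y ! → C1 y !
    in1 cv y ky e = ∧-i ky (not-i (λ cy → closedC cv cy e))

    in2 : ∀ {v} → C v ! → ∀ y → K s y ! → E v y ! → C y !
    in2 cv y ky e = [ (λ h → h) , (λ ny → void (closedC (∧-i ky (not-i ny)) cv (E-sym e))) ] (bool (C y))

    big : ∀ (S : Sub n) v → K s v ! → (∀ y → K s y ! → E v y ! → S y !) → 3 * r ≤ card S
    big S v kv h = lin (2 ∷ 2 ∷ 2 ∷ 2 ∷ 3 ∷ 0 ∷ 2 ∷ []) (d ∷ r ∷ degK s v ∷ card S ∷ sum (c v) ∷ bl ∷ #lk s ∷ #un s ∷ [])
     (λ d r x σ y bl h u → 6 :* r :≤ d ⇒ d :≤ x :+ (bl :+ y) ⇒ y :≤ 3 :* h :+ u ⇒ x :≤ σ ⇒ 2 :* (h :+ u) :+ bl :≤ 2 :* r ⇒ # 1 :≤ u ⇒ qed (3 :* r :≤ σ))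
     hd (deg-split s v (∧-l kv)) (sumA v kv) (≤-trans (m≤m+n _ _) (within S v h)) (subst (λ z → 2 * z + bl ≤ 2 * r) (sym (lk+un s)) roots) un≥1

    -- `C1` and `C` share the free vertices and no edge runs between them. Two vertices with that
    -- many non-neighbours on their own sides, and with few neighbours on the links by `sumP`, could
    -- not reach the degree sum `2 * d`.
    clash : Few C1 → Few C → ⊥
    clash (u , cu , fu) (w , cw , fw) = lin (4 ∷ 4 ∷ 1 ∷ 2 ∷ 2 ∷ 7 ∷ 0 ∷ 4 ∷ []) (d ∷ r ∷ card C1 + card C ∷ non C1 u + non C w ∷ degK s u + degK s w ∷ sum (c u) + sum (c w) ∷ size s ∷ bl ∷ #lk s ∷ #un s ∷ [])
      (λ d r σ x k y s bl h u → 2 :* d :≤ k :+ (2 :* bl :+ y) ⇒ k :+ x :≤ σ ⇒ 2 :* σ :+ # 8 :≤ 4 :* x :+ 10 :* r ⇒ σ :+ (bl :+ s) :≤ 2 :* d :+ # 3 ⇒ 2 :* y :≤ s :+ (7 :* h :+ 2 :* u) ⇒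
        2 :* (h :+ u) :+ bl :≤ 2 :* r ⇒ # 1 :≤ u ⇒ 6 :* r :≤ d ⇒ absurd) two-d wi few tot (sumP cu cw) (subst (λ z → 2 * z + bl ≤ 2 * r) (sym (lk+un s)) roots) un≥1 hd
     where
     two-d : 2 * d ≤ (degK s u + degK s w) + (2 * bl + (sum (c u) + sum (c w)))
     two-d = lin (1 ∷ 1 ∷ 1 ∷ []) (d ∷ degK s u ∷ degK s w ∷ bl ∷ sum (c u) ∷ sum (c w) ∷ []) (λ d x y bl z w → d :≤ x :+ (bl :+ z) ⇒ d :≤ y :+ (bl :+ w) ⇒ qed (2 :* d :≤ (x :+ y) :+ (2 :* bl :+ (z :+ w))))
      (deg-split s u (∧-l (C1K {u} cu))) (deg-split s w (∧-l (CK cw)))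
     wi : (degK s u + degK s w) + (non C1 u + non C w) ≤ card C1 + card C
     wi = lin (1 ∷ 1 ∷ 1 ∷ []) (degK s u ∷ degK s w ∷ non C1 u ∷ non C w ∷ card C1 ∷ card C ∷ []) (λ x y z w p q → x :+ z :≤ p ⇒ y :+ w :≤ q ⇒ qed ((x :+ y) :+ (z :+ w) :≤ p :+ q))
      (within C1 u (in1 cu)) (within C w (in2 cw))
     few : 2 * (card C1 + card C) + 8 ≤ 4 * (non C1 u + non C w) + 10 * r
     few = lin (1 ∷ 1 ∷ 1 ∷ []) (card C1 ∷ card C ∷ non C1 u ∷ non C w ∷ r ∷ []) (λ p q z w r → 2 :* p :+ # 4 :≤ 4 :* z :+ 5 :* r ⇒ 2 :* q :+ # 4 :≤ 4 :* w :+ 5 :* r ⇒ qed (2 :* (p :+ q) :+ # 8 :≤ 4 :* (z :+ w) :+ 10 :* r)) fu fw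
     tot : card C1 + card C + (bl + size s) ≤ 2 * d + 3
     tot = ≤-trans (+-monoˡ-≤ _ (card-⊎ {S = K s} {U = C1} {V = C} (λ y → ∧-l) (λ y → CK) (λ y h k → not-e (∧-r {K s y} h) k))) (≤-trans (count s) cN)

    Hub : Set
    Hub = Σ[ L ∈ Sub n ] (∀ y → L y ! → N y !) × RLinked E r L × 2 * r ≤ card L

    hubOr : ∀ (S : Sub n) → (∀ y → S y ! → N y !) → 3 * r ≤ card S → NN (Hub ⊎ Few S)
    hubOr S SN bg = em (Few S) >>= λ where
     (yes f) → ret (inr f)
     (no nf) → ret (inl (S , SN , (λ p R Pr RS cR PP PS → DenseS.sLevel (record { E = E ; E-sym = λ {u} {v} → E-sym {u} {v} ; irr = irr ; S = S ; r = r ; R = R ; R⊆S = RS ; cR = cR ; Pr = Pr ; PP = PP ; PS = PS ; big = bg }) >>= λ { (inl sol) → ret sol ; (inr m) → void (nf m) }) ,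
            ≤-trans (*-monoˡ-≤ r (n≤1+n 2)) bg))

    hub : NN Hub
    hub = hubOr C1 (λ y h → ∧-l (C1K {y} h)) (let (y , cy) = seeS in big C1 y (C1K {y} cy) (in1 cy)) >>= λ where
     (inl h) → ret h
     (inr f) → hubOr C (λ y h → ∧-l (CK h)) (let (y , cy) = seeT in big C y (CK cy) (in2 cy)) >>= λ where
      (inl h) → ret h
      (inr f') → void (clash f f')

 Hub' : Set
 Hub' = Σ[ L ∈ Sub n ] (∀ y → L y ! → N y !) × RLinked E r L × 2 * r ≤ card L

 solOrHub : NN (Sol E N R Pr ⊎ Hub')
 solOrHub = argmax {A = Σ NS Feas} (λ x → #lk (fst x)) p (λ x → ≤-trans (sum-mono (λ i → b2n≤1 (lk (fst x) i))) (≤-eq (ones p))) (init , init-feas) >>= λ { ((s1 , f1) , m₁) →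
   argmin {A = Σ[ s ∈ NS ] Feas s × #lk s ≡ #lk s1} (λ x → size (fst x)) (s1 , f1 , refl) >>= λ { ((s2 , f2 , e2) , m₂) →
   fin s1 m₁ s2 f2 e2 m₂ } }
  where
  ones : ∀ p → sum {p} (λ _ → 1) ≡ p
  ones zero = refl
  ones (suc p) = cong suc (ones p)
  fin : ∀ s1 → (∀ x → #lk (fst x) ≤ #lk s1) → ∀ s2 → Feas s2 → #lk s2 ≡ #lk s1 → (∀ (x : Σ[ s ∈ NS ] Feas s × #lk s ≡ #lk s1) → size s2 ≤ size (fst x)) → NN (Sol E N R Pr ⊎ Hub')
  fin s1 m₁ s2 f2 e2 m₂ with anyb (λ i → act i ∧ not (lk s2 i)) in eq
  ... | false = ret (inl (allLinked s2 (λ i ai → [ (λ h → h) , (λ nl → void (t≢f (trans (sym (anyb-i _ i (∧-i ai (not-i nl)))) eq))) ] (bool (lk s2 i)))))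
  ... | true with anyb-e _ eq
  ...   | i0 , h = argmax {A = Cand'} (λ c → card (Opt.Cand.C c)) n (λ c → card-≤n (Opt.Cand.C c)) (record { s = s2 ; gd = gd0 ; C = λ _ → false ; CK = λ () ; re = λ () }) >>= λ { (cd , mx) →
     Opt.Sy.Final.hub opt (Opt.Cand.s cd) (Opt.Cand.gd cd) (Opt.Cand.C cd) (λ {y} → Opt.Cand.CK cd {y}) (λ {y} → Opt.Cand.re cd {y}) mx >>= λ h → ret (inr h) }
   where
   opt : OptData
   opt = record { h0 = #lk s1 ; m0 = size s2 ; maxh = λ s f → m₁ (s , f) ; mins = λ s f e → m₂ (s , f , e) ; i0 = i0 ; a0 = ∧-l h }
   Cand' : Set
   Cand' = Opt.Cand opt
   nt : ∀ {b} → not b ! → b ≡ false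
   nt {false} _ = refl
   gd0 : Opt.Good opt s2
   gd0 = record { fe = f2 ; eh = e2 ; em0 = refl ; li = nt (∧-r {act i0} h) }

-- Excluded middle on the result: if no proper choice is linked, then every call of `solOrHub` must
-- return a linkage, and this says that `N` itself is linked.
nLevel : ∀ {n} (E : Rl n) → Symm E → (∀ v → E v v ! → ⊥) → (N : Sub n) (d r : ℕ) → (∀ y → N y ! → d ≤ card (λ z → N z ∧ E y z)) → card N ≤ 2 * d + 3 → 6 * r ≤ d →
 (v0 : Fin n) → N v0 ! → NN (Σ[ L ∈ Sub n ] (∀ y → L y ! → N y !) × RLinked E r L × 2 * r ≤ card L)
nLevel E E-sym irr N d r deg cN hd v0 nv = em _ >>= λ where
 (yes h) → ret h
 (no nh) → ret (N , (λ _ h → h) , (λ p R Pr RN cR PP PS → DenseN.solOrHub (record { E = E ; E-sym = λ {u} {v} → E-sym {u} {v} ; irr = irr ; N = N ; d = d ; r = r ; deg = deg ; cN = cN ; hd = hd ; R = R ; R⊆N = RN ; cR = cR ; Pr = Pr ; PP = PP ; PS = PS }) >>= λ { (inl s) → ret s ; (inr h) → void (nh h) }) ,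
       ≤-trans (*-monoˡ-≤ r {2} {6} (s≤s (s≤s z≤n))) (≤-trans hd (≤-trans (deg v0 nv) (card-mono (λ y → ∧-l)))))

-- Massed graphs: the linkage theorem

abstract
 -- Ordered pairs are counted: for symmetric `E` this is twice the number of edges with an end in
 -- `U`, which explains the factor 2 before `D` in the density conditions.
 ρ : ∀ {n} → Rl n → Sub n → ℕ
 ρ E U = sum (λ a → card (λ b → E a b ∧ (U a ∨ U b)))

 ρ-mono : ∀ {n} {E F : Rl n} {U V : Sub n} → (∀ {a b} → E a b ! → U a ∨ U b ! → F a b ∧ (V a ∨ V b) !) → ρ E U ≤ ρ F V
 ρ-mono {E = E} h = sum-mono (λ a → card-mono (λ b q → h (∧-l q) (∧-r {E a b} q)))

 ρ-split : ∀ {n} {E F F' : Rl n} {U V V' : Sub n} →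
  (∀ {a b} → E a b ! → U a ∨ U b ! → F a b ∧ (V a ∨ V b) ! ⊎ F' a b ∧ (V' a ∨ V' b) !) → ρ E U ≤ ρ F V + ρ F' V'
 ρ-split {E = E} {F} {F'} {U} {V} {V'} h = ≤-trans (sum-mono (λ a → card-∪ {U = λ b → F a b ∧ (V a ∨ V b)} {V = λ b → F' a b ∧ (V' a ∨ V' b)} (λ b q → h (∧-l q) (∧-r {E a b} q))))
  (≤-eq (sum-+ (λ a → card (λ b → F a b ∧ (V a ∨ V b))) (λ a → card (λ b → F' a b ∧ (V' a ∨ V' b)))))

 ρ-def : ∀ {n} (E : Rl n) (U : Sub n) → ρ E U ≡ sum (λ a → card (λ b → E a b ∧ (U a ∨ U b)))
 ρ-def E U = refl

∨-map : ∀ {a b c d} → (a ! → c !) → (b ! → d !) → a ∨ b ! → c ∨ d !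
∨-map {a} {c = c} f g h = [ (λ q → ∨-l (f q)) , (λ q → ∨-r {c} (g q)) ] (∨-e {a} h)

pathIn : ∀ {n} {E : Rl n} (S : Sub n) → (∀ {a b} → S a ! → E a b ! → S b !) → ∀ {a b L} → PathL E a b L → S a ! → ∀ {y} → y ∈ L → S y !
pathIn S h one     sa (here refl) = sa
pathIn S h (e ◂ p) sa (here refl) = sa
pathIn S h (e ◂ p) sa (there m)   = pathIn S h p (h sa e) m

record Graphic {n : ℕ} (E : Rl n) (W : Sub n) : Set where
 field
  symm : Symm E
  irr  : ∀ v → E v v ! → ⊥
  inW  : ∀ {a b} → E a b ! → W a !
 inW' : ∀ {a b} → E a b ! → W b !
 inW' e = inW (symm e)

-- `Q` is what lies strictly behind the boundary `Z`; the other side of the separation is everything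
-- in `W` outside `Q`.
record Sep {n : ℕ} (E : Rl n) (W Z Q : Sub n) : Set where
 field
  QW  : ∀ {y} → Q y ! → W y !
  ZW  : ∀ {y} → Z y ! → W y !
  dis : ∀ {y} → Q y ! → Z y ! → ⊥
  bd  : ∀ {a b} → Q a ! → E a b ! → Q b ! ⊎ Z b !

_∖_ : ∀ {n} → Sub n → Sub n → Sub n
(W ∖ X) y = W y ∧ not (X y)

record Viol {n : ℕ} (E : Rl n) (W X : Sub n) (D : ℕ) (Z Q : Sub n) : Set where
 field
  sep : Sep E W Z Q
  QX  : ∀ {y} → Q y ! → X y ! → ⊥
  lt  : card Z < card X
  vi  : 2 * D * card Q < ρ E Q
 open Sep sep public

record Massed {n : ℕ} (E : Rl n) (W X : Sub n) (D : ℕ) : Set where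
 field
  gr : Graphic E W
  XW : ∀ {y} → X y ! → W y !
  m1 : 2 * D * card (W ∖ X) < ρ E (W ∖ X)
  m2 : ∀ Z Q → Viol E W X D Z Q → ⊥
 open Graphic gr public

-- For the purpose of linking vertices outside `Q`, the set `Q` can then be replaced by a complete
-- graph on `Z`.
Rigid : ∀ {n} → Rl n → Sub n → Sub n → Set
Rigid {n} E Z Q = ∀ p (Pr : Pairs n p) → Proper Z Pr → Strict Pr → NN (Sol E (λ y → Q y ∨ Z y) Z Pr)

Linked : ∀ {n} → Rl n → Sub n → Set
Linked {n} E X = ∀ p (Pr : Pairs n p) → Proper X Pr → Strict Pr → NN (Linkage E X Pr)

inSet : ∀ {n p} {E : Rl n} {X : Sub n} {Pr : Pairs n p} (S : Sub n) → (∀ {a b} → S a ! → E a b ! → S b !) → (∀ {y} → X y ! → S y !) →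
 Proper X Pr → Linkage E X Pr → Sol E S X Pr
inSet S h XS PP L = L , λ i ai m → pathIn S h (Linkage.path L i ai) (XS (Proper.inRa PP i ai)) m

-- Rerouting a linkage through a rigid set: the part of each path between its first and its last vertex in Z is replaced.
module Lift {n p : ℕ} (E H : Rl n) (Z Q X S : Sub n) (Pr : Pairs n p) (PP : Proper X Pr)
      (HE : ∀ {x y} → H x y ! → E x y ! ⊎ (Z x ! × Z y ! × x ≢ y)) (SQ : ∀ {y} → S y ! → Q y ! → ⊥)
      (XQ : ∀ {y} → Q y ! → X y ! → ⊥) (E-symm : Symm E) (rigid : Rigid E Z Q) (sol : Sol H S X Pr) where
 open Pairs Pr
 open Linkage (fst sol)

 Thin : List (Fin n) → Set
 Thin L = ∀ {x y} → x ∈ L → y ∈ L → Z x ! → Z y ! → x ≡ y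

 thinP : ∀ {u v L} → Thin L → PathL H u v L → PathL E u v L
 thinP th = mapP (λ mx my h → [ (λ e → e) , (λ { (zx , zy , ne) → void (ne (th mx my zx zy)) }) ] (HE h))

 record Cut (i : Fin p) : Set where
  field
   z z' : Fin n
   zz   : Z z !
   zz'  : Z z' !
   L1 L2 : List (Fin n)
   q1   : PathL E (a i) z L1
   q2   : PathL E z' (b i) L2
   s1   : ∀ {y} → y ∈ L1 → y ∈ lst i
   s2   : ∀ {y} → y ∈ L2 → y ∈ lst i

 data Status (i : Fin p) : Set where
  off  : ¬ (act i !) → Status i
  free : PathL E (a i) (b i) (lst i) → Status i
  via  : Cut i → Status i

 status : ∀ i → Status i
 status i with T? (act i)
 ... | no ¬a = off ¬a
 ... | yes ai with firstIn Z (path i ai) | lastIn Z (path i ai)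
 ...   | inl none | _ = free (thinP (λ m _ z _ → void (none _ m z)) (path i ai))
 ...   | inr _ | inl none = free (thinP (λ m _ z _ → void (none _ m z)) (path i ai))
 ...   | inr (z , L1 , L2 , zz , eq , q , _ , no1) | inr (z' , L3 , zz' , m , sub , q' , no2) = via (record { z = z ; z' = z' ; zz = zz ; zz' = zz' ; L1 = L1 ++ z ∷ [] ; L2 = z' ∷ L3
   ; q1 = thinP th1 q ; q2 = thinP th2 q' ; s1 = λ k → subst (_ ∈_) (sym eq) ([ ∈ˡ , (λ { (here refl) → ∈ʳ L1 (here refl) }) ] (∈⁻ L1 k)) ; s2 = λ { (here refl) → m ; (there k) → sub _ k } })
  where
  th1 : Thin (L1 ++ z ∷ [])
  th1 mx my zx zy = trans (is mx zx) (sym (is my zy))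
   where is : ∀ {x} → x ∈ (L1 ++ z ∷ []) → Z x ! → x ≡ z
         is k zx = [ (λ k → void (no1 _ k zx)) , (λ { (here e) → e }) ] (∈⁻ L1 k)
  th2 : Thin (z' ∷ L3)
  th2 mx my zx zy = trans (is mx zx) (sym (is my zy))
   where is : ∀ {x} → x ∈ (z' ∷ L3) → Z x ! → x ≡ z'
         is (here e) _ = e
         is (there k) zx = void (no2 _ k zx)

 actC : ∀ {i} → Status i → Bool
 actC (off _)  = false
 actC (free _) = false
 actC (via c)  = not (Cut.z c == Cut.z' c)

 aC bC : ∀ {i} → Status i → Fin n
 aC {i} (off _)  = a i
 aC {i} (free _) = a i
 aC     (via c)  = Cut.z c
 bC {i} (off _)  = a i
 bC {i} (free _) = a i
 bC     (via c)  = Cut.z' c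

 Pr' : Pairs n p
 Pr' = record { act = λ i → act i ∧ actC (status i) ; a = λ i → aC (status i) ; b = λ i → bC (status i) }

 aIn : ∀ {i} (σ : Status i) → actC σ ! → Z (aC σ) ! × aC σ ∈ lst i
 aIn (via c) _ = Cut.zz c , Cut.s1 c (last∈ (Cut.q1 c))
 bIn : ∀ {i} (σ : Status i) → actC σ ! → Z (bC σ) ! × bC σ ∈ lst i
 bIn (via c) _ = Cut.zz' c , Cut.s2 c (first∈ (Cut.q2 c))
 abNe : ∀ {i} (σ : Status i) → actC σ ! → aC σ ≢ bC σ
 abNe (via c) h e = not-e h (==-i e)

 PP' : Proper Z Pr'
 PP' = record
  { inRa = λ i h → fst (aIn (status i) (∧-r {act i} h))
  ; inRb = λ i h → fst (bIn (status i) (∧-r {act i} h))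
  ; aa = λ i j h k e → disj i j (∧-l h) (∧-l k) (snd (aIn (status i) (∧-r {act i} h))) (subst (_∈ lst j) (sym e) (snd (aIn (status j) (∧-r {act j} k))))
  ; bb = λ i j h k e → disj i j (∧-l h) (∧-l k) (snd (bIn (status i) (∧-r {act i} h))) (subst (_∈ lst j) (sym e) (snd (bIn (status j) (∧-r {act j} k))))
  ; ab = λ i j h k e → disj i j (∧-l h) (∧-l k) (snd (aIn (status i) (∧-r {act i} h))) (subst (_∈ lst j) (sym e) (snd (bIn (status j) (∧-r {act j} k)))) }

 lifted : NN (Sol E (λ y → S y ∨ Q y) X Pr)
 lifted = rigid p Pr' PP' (λ i h → abNe (status i) (∧-r {act i} h)) >>= λ s → ret (build s)
  where
  build : Sol E (λ y → Q y ∨ Z y) Z Pr' → Sol E (λ y → S y ∨ Q y) X Pr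
  build (K , inQZ) = record { lst = λ i → fst (new i) ; path = λ i ai → fst (snd (new i)) ai ; disj = disj' ; ends = ends' } , λ i ai m → inS i ai m
   where
   module K = Linkage K
   New : Fin p → Set
   New i = Σ[ N ∈ List (Fin n) ] (act i ! → PathL E (a i) (b i) N) × (∀ {y} → y ∈ N → y ∈ lst i ⊎ (act i ∧ actC (status i) ! × y ∈ K.lst i))
   go : ∀ i (σ : Status i) → act i ! → (actC σ ! → PathL E (aC σ) (bC σ) (K.lst i)) →
    Σ[ N ∈ List (Fin n) ] PathL E (a i) (b i) N × (∀ {y} → y ∈ N → y ∈ lst i ⊎ (actC σ ! × y ∈ K.lst i))
   go i (off ¬a) ai _ = void (¬a ai)
   go i (free q) ai _ = lst i , q , inl
   go i (via c) ai f with Cut.z c == Cut.z' c in e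
   ... | true with catP (Cut.q1 c) (subst (λ z → PathL E z (b i) (Cut.L2 c)) (sym (==-e e)) (Cut.q2 c))
   ...   | N , q , _ , sub = N , q , λ m → inl ([ Cut.s1 c , Cut.s2 c ] (sub m))
   go i (via c) ai f | false with catP (f refl) (Cut.q2 c)
   ... | M , q , _ , sub with catP (Cut.q1 c) q
   ...   | N , q' , _ , sub' = N , q' , λ m → [ (λ k → inl (Cut.s1 c k)) , (λ k → [ (λ k' → inr (refl , k')) , (λ k' → inl (Cut.s2 c k')) ] (sub k)) ] (sub' m)
   new : ∀ i → New i
   new i = pick (T? (act i))
    where
    pick : Dec (act i !) → New i
    pick (no ¬a) = lst i , (λ ai → void (¬a ai)) , inl
    pick (yes ai) = let (N , q , sub) = go i (status i) ai (λ h → K.path i (∧-i ai h)) in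
     N , (λ _ → q) , λ m → [ inl , (λ { (h , k) → inr (∧-i ai h , k) }) ] (sub m)
   old : ∀ i → act i ∧ actC (status i) ! → ∀ {y} → y ∈ K.lst i → Q y ! ⊎ y ∈ lst i
   old i h {y} m with ∨-e {Q y} (inQZ i h m)
   ... | inl q = inl q
   ... | inr z with K.ends i h m z
   ...   | inl refl = inr (snd (aIn (status i) (∧-r {act i} h)))
   ...   | inr refl = inr (snd (bIn (status i) (∧-r {act i} h)))
   inS : ∀ i → act i ! → ∀ {y} → y ∈ fst (new i) → S y ∨ Q y !
   inS i ai {y} m with snd (snd (new i)) m
   ... | inl k = ∨-l (snd sol i ai k)
   ... | inr (h , k) with old i h k
   ...   | inl q = ∨-r {S y} q
   ...   | inr k' = ∨-l (snd sol i ai k')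
   ends' : ∀ i → act i ! → ∀ {y} → y ∈ fst (new i) → X y ! → y ≡ a i ⊎ y ≡ b i
   ends' i ai m x with snd (snd (new i)) m
   ... | inl k = ends i ai k x
   ... | inr (h , k) with old i h k
   ...   | inl q = void (XQ q x)
   ...   | inr k' = ends i ai k' x
   disj' : ∀ i j → act i ! → act j ! → ∀ {y} → y ∈ fst (new i) → y ∈ fst (new j) → i ≡ j
   disj' i j ai aj m m' with snd (snd (new i)) m | snd (snd (new j)) m'
   ... | inl k | inl k' = disj i j ai aj k k'
   ... | inr (h , k) | inr (h' , k') = K.disj i j h h' k k'
   ... | inl k | inr (h' , k') = [ (λ q → void (SQ (snd sol i ai k) q)) , (λ k″ → disj i j ai aj k k″) ] (old j h' k')
   ... | inr (h , k) | inl k' = [ (λ q → void (SQ (snd sol j aj k') q)) , (λ k″ → disj i j ai aj k″ k') ] (old i h k)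

solMono : ∀ {n p} {E : Rl n} {S S' R : Sub n} {Pr : Pairs n p} → (∀ {y} → S y ! → S' y !) → Sol E S R Pr → Sol E S' R Pr
solMono f (L , h) = L , λ i ai m → f (h i ai m)

tail≢head : ∀ {A : Set} L1 {x y z : A} {M L2} → Uniq (L1 ++ y ∷ L2) → x ∷ M ≡ L1 ++ y ∷ L2 → z ∈ L2 → z ≡ x → ⊥
tail≢head []       (y∉ , _) refl m refl = y∉ m
tail≢head (_ ∷ L1) (c∉ , _) refl m refl = c∉ (∈ʳ L1 (there m))

-- The induction hypothesis, rigid separations and hubs

Below : ℕ → ℕ → Set
Below r m = ∀ {n} (E : Rl n) (W X : Sub n) D → Massed E W X D → card W ≤ m → card X ≤ 2 * r → 6 * r ≤ D → Linked E X

record Setting (r m n : ℕ) : Set where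
 field
  E   : Rl n
  W X : Sub n
  D   : ℕ
  M   : Massed E W X D
  cW  : card W ≤ suc m
  cX  : card X ≤ 2 * r
  hD  : 6 * r ≤ D

module _ (r m : ℕ) (IH : Below r m) {n : ℕ} where

 -- A violation inside `Q` and `Z` relative to the roots `Z` would have a boundary smaller than `Z`
 -- and would violate the whole graph too. Minimality of `card Z` thus makes this part massed, and
 -- the induction hypothesis links `Z` in it.
 restrict : ∀ (E : Rl n) (W X : Sub n) D → Graphic E W → card X ≤ 2 * r → 6 * r ≤ D → ∀ Z Q → Sep E W Z Q → (∀ {y} → Q y ! → X y ! → ⊥) → card Z ≤ card X →
  2 * D * card Q < ρ E Q → card (λ y → Q y ∨ Z y) ≤ m → (∀ Z' Q' → Viol E W X D Z' Q' → card Z ≤ card Z') → Rigid E Z Q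
 restrict E W X D gr cX hD Z Q sep QX lt vi cW min p Pr PP PS = IH E' S Z D ms cW (≤-trans lt cX) hD p Pr PP PS >>= λ L →
   ret (let (L' , inS) = inSet S (λ {a} {b} sa e → ∧-r {S a} (∧-r {E a b} e)) (λ {y} → ∨-r {Q y}) PP L in
    record { lst = Linkage.lst L' ; path = λ i ai → mapP (λ _ _ → ∧-l) (Linkage.path L' i ai) ; disj = Linkage.disj L' ; ends = Linkage.ends L' } , inS)
  where
  module V = Sep sep
  module gr = Graphic gr
  S : Sub n
  S y = Q y ∨ Z y
  E' : Rl n
  E' x y = E x y ∧ (S x ∧ S y)
  SZ : ∀ {y} → S y ! → (Z y ! → ⊥) → Q y !
  SZ {y} s nz = [ (λ q → q) , (λ z → void (nz z)) ] (∨-e {Q y} s)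
  QS : ∀ {y} → Q y ! → (S ∖ Z) y !
  QS {y} q = ∧-i (∨-l q) (not-i (V.dis q))
  up : ∀ {a b} → Q a ! → E a b ! → E' a b !
  up {a} {b} qa e = ∧-i e (∧-i (∨-l qa) ([ ∨-l , ∨-r {Q b} ] (V.bd qa e)))
  flip : ∀ {a b} → E' a b ! → E' b a !
  flip {a} {b} h = ∧-i (gr.symm (∧-l h)) (∧-i (∧-r {S a} (∧-r {E a b} h)) (∧-l (∧-r {E a b} h)))
  ms : Massed E' S Z D
  ms = record
   { gr = record { symm = flip ; irr = λ v h → gr.irr v (∧-l h) ; inW = λ {a} {b} h → ∧-l (∧-r {E a b} h) }
   ; XW = λ {y} → ∨-r {Q y}
   ; m1 = <-≤-trans (≤-<-trans (*-monoʳ-≤ (2 * D) (card-mono (λ y h → SZ (∧-l h) (not-e (∧-r {S y} h))))) vi)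
     (ρ-mono (λ {a} {b} e u → ∧-i ([ (λ qa → up qa e) , (λ qb → flip (up qb (gr.symm e))) ] (∨-e {Q a} u)) (∨-map QS QS u)))
   ; m2 = λ Z2 Q2 v → let module v = Viol v in
     <⇒≱ v.lt (min Z2 Q2 (record
      { sep = record { QW = λ q → V.QW (SZ (v.QW q) (v.QX q)) ; ZW = λ {y} z → [ V.QW , V.ZW ] (∨-e {Q y} (v.ZW z)) ; dis = v.dis ; bd = λ q e → v.bd q (up (SZ (v.QW q) (v.QX q)) e) }
      ; QX = λ q x → QX (SZ (v.QW q) (v.QX q)) x ; lt = <-≤-trans v.lt lt ; vi = <-≤-trans v.vi (ρ-mono (λ e u → ∧-i (∧-l e) u)) })) }

 lemmaV : ∀ (E : Rl n) (W X : Sub n) D → Graphic E W → card W ≤ m → card X ≤ 2 * r → 6 * r ≤ D → ∀ Z Q → Viol E W X D Z Q →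
  NN (Σ[ Z ∈ Sub n ] Σ[ Q ∈ Sub n ] Viol E W X D Z Q × Rigid E Z Q)
 lemmaV E W X D gr cW cX hD Z Q V = argmin {A = Σ[ Z ∈ Sub n ] Σ[ Q ∈ Sub n ] Viol E W X D Z Q} (λ x → card (fst x)) (Z , Q , V) >>= λ { ((Z , Q , V) , min) →
  ret (Z , Q , V , restrict E W X D gr cX hD Z Q (Viol.sep V) (Viol.QX V) (<⇒≤ (Viol.lt V)) (Viol.vi V) (≤-trans (card-mono (λ y h → [ Viol.QW V , Viol.ZW V ] (∨-e {Q y} h))) cW) (λ Z' Q' V' → min (Z' , Q' , V'))) }

 module Current (st : Setting r m n) where
  open Setting st
  open Massed M

  record RSep (Z Q : Sub n) : Set where
   field
    sep   : Sep E W Z Q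
    QX    : ∀ {y} → Q y ! → X y ! → ⊥
    lt    : card Z < card X
    rigid : Rigid E Z Q
    some  : Σ[ y ∈ Fin n ] Q y !
   open Sep sep public

  -- `Q` is deleted and `Z` made complete. A rigid violation of the smaller graph would either
  -- violate `E` or, if it reaches behind `Z`, absorb `Q` into a larger rigid separation; maximality
  -- of `Q` excludes the latter.
  module Reduce (Z Q : Sub n) (rs : RSep Z Q) (max : ∀ Z' Q' → RSep Z' Q' → card Q' ≤ card Q) where
   open RSep rs

   H : Rl n
   H x y = (E x y ∧ (not (Q x) ∧ not (Q y))) ∨ (Z x ∧ (Z y ∧ not (x == y)))

   W' : Sub n
   W' = W ∖ Q

   H-e : ∀ {x y} → H x y ! → (E x y ! × (Q x ! → ⊥) × (Q y ! → ⊥)) ⊎ (Z x ! × Z y ! × x ≢ y)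
   H-e {x} {y} h = [ (λ q → inl (∧-l q , not-e (∧-l (∧-r {E x y} q)) , not-e (∧-r {not (Q x)} (∧-r {E x y} q)))) ,
    (λ q → inr (∧-l q , ∧-l (∧-r {Z x} q) , λ e → not-e (∧-r {Z y} (∧-r {Z x} q)) (==-i e))) ] (∨-e {E x y ∧ (not (Q x) ∧ not (Q y))} h)

   H-i : ∀ {x y} → E x y ! → (Q x ! → ⊥) → (Q y ! → ⊥) → H x y !
   H-i e nx ny = ∨-l (∧-i e (∧-i (not-i nx) (not-i ny)))

   H-z : ∀ {x y} → Z x ! → Z y ! → x ≢ y → H x y !
   H-z {x} {y} zx zy ne = ∨-r {E x y ∧ (not (Q x) ∧ not (Q y))} (∧-i zx (∧-i zy (not-i (λ e → ne (==-e e)))))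

   notQ : ∀ {y} → W' y ! → Q y ! → ⊥
   notQ {y} w = not-e (∧-r {W y} w)

   grH : Graphic H W'
   grH = record
    { symm = λ {x} {y} h → [ (λ { (e , nx , ny) → H-i (symm e) ny nx }) , (λ { (zx , zy , ne) → H-z zy zx (λ e → ne (sym e)) }) ] (H-e {x} {y} h)
    ; irr = λ v h → [ (λ { (e , _) → irr v e }) , (λ { (_ , _ , ne) → ne refl }) ] (H-e {v} {v} h)
    ; inW = λ {x} {y} h → [ (λ { (e , nx , _) → ∧-i (inW e) (not-i nx) }) , (λ { (zx , _) → ∧-i (ZW zx) (not-i (λ q → dis q zx)) }) ] (H-e {x} {y} h) }

   HE : ∀ {x y} → H x y ! → E x y ! ⊎ (Z x ! × Z y ! × x ≢ y)
   HE {x} {y} h = [ (λ { (e , _) → inl e }) , inr ] (H-e {x} {y} h)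

   cW' : card W' ≤ m
   cW' = ≤-pred (<-≤-trans (card-strict {S = W'} {U = W} (λ y → ∧-l) (fst some) (QW (snd some)) (λ w → notQ w (snd some))) cW)

   XW' : ∀ {y} → X y ! → W' y !
   XW' x = ∧-i (XW x) (not-i (λ q → QX q x))

   m1H : 2 * D * card (W' ∖ X) < ρ H (W' ∖ X)
   m1H = +-cancelʳ-< (2 * D * card Q) _ _ (begin-strict
     2 * D * card (W' ∖ X) + 2 * D * card Q ≡⟨ *-distribˡ-+ (2 * D) (card (W' ∖ X)) (card Q) ⟨
     2 * D * (card (W' ∖ X) + card Q)       ≤⟨ *-monoʳ-≤ (2 * D) (card-⊎ {S = W ∖ X} {U = W' ∖ X} {V = Q} (λ y h → ∧-i (∧-l (∧-l {W' y} h)) (∧-r {W' y} h)) (λ y q → ∧-i (QW q) (not-i (QX q)))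
                          (λ y h q → notQ {y} (∧-l h) q)) ⟩
     2 * D * card (W ∖ X)                   <⟨ m1 ⟩
     ρ E (W ∖ X)                            ≤⟨ ρ-split {F = H} {F' = E} {V = W' ∖ X} {V' = Q} sp ⟩
     -- As `E` is massed, `(Z , Q)` is no violation, so few edges are lost with `Q`.
     ρ H (W' ∖ X) + ρ E Q                   ≤⟨ +-monoʳ-≤ (ρ H (W' ∖ X)) (≮⇒≥ (λ v → m2 Z Q (record { sep = sep ; QX = QX ; lt = lt ; vi = v }))) ⟩
     ρ H (W' ∖ X) + 2 * D * card Q          ∎)
    where
    open ≤-Reasoning
    sp : ∀ {a b} → E a b ! → (W ∖ X) a ∨ (W ∖ X) b ! → H a b ∧ ((W' ∖ X) a ∨ (W' ∖ X) b) ! ⊎ E a b ∧ (Q a ∨ Q b) !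
    sp {a} {b} e u = [ (λ q → inr (∧-i e q)) , (λ nq → let na = λ q → nq (∨-l q) ; nb = λ q → nq (∨-r {Q a} q) in
      inl (∧-i (H-i e na nb) (∨-map {(W ∖ X) a} {(W ∖ X) b} {(W' ∖ X) a} {(W' ∖ X) b} (λ h → ∧-i (∧-i (∧-l {W a} h) (not-i na)) (∧-r {W a} h)) (λ h → ∧-i (∧-i (∧-l {W b} h) (not-i nb)) (∧-r {W b} h)) u))) ] (bool (Q a ∨ Q b))

   -- a violation in H would enlarge Q
   noViol : ∀ Z1 Q1 → Viol H W' X D Z1 Q1 → Rigid H Z1 Q1 → ⊥
   noViol Z1 Q1 V rg = [ meets , misses ] (bool (anyb (λ y → Z y ∧ Q1 y)))
    where
    module V = Viol V
    out : ∀ {a b} → Q1 a ! → E a b ! → (Q b ! → ⊥) → Q1 b ! ⊎ Z1 b !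
    out {a} q e nb = V.bd q (H-i e (notQ {a} (V.QW q)) nb)
    misses : ¬ (anyb (λ y → Z y ∧ Q1 y) !) → ⊥
    misses none = m2 Z1 Q1 (record { sep = record { QW = λ q → ∧-l (V.QW q) ; ZW = λ z → ∧-l (V.ZW z) ; dis = V.dis ; bd = λ {a} q e → out q e (λ qb →
        [ notQ {a} (V.QW q) , (λ za → none (anyb-i _ a (∧-i za q))) ] (bd qb (symm e))) } ; QX = V.QX ; lt = V.lt
      ; vi = <-≤-trans V.vi (ρ-mono (λ {a} {b} h u → ∧-i ([ (λ e → e) , (λ { (za , zb , _) → void ([ (λ q → none (anyb-i _ a (∧-i za q))) , (λ q → none (anyb-i _ b (∧-i zb q))) ] (∨-e {Q1 a} u)) }) ] (HE {a} {b} h)) u)) })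
    meets : anyb (λ y → Z y ∧ Q1 y) ! → ⊥
    meets h = <⇒≱ (card-strict {S = Q} {U = Q2} (λ y q → ∨-r {Q1 y} q) z (∨-l qz) (notQ {z} (V.QW qz))) (max Z1 Q2 (record
      { sep = record { QW = λ {y} q → [ (λ q1 → ∧-l (V.QW q1)) , QW ] (∨-e {Q1 y} q) ; ZW = λ k → ∧-l (V.ZW k)
              ; dis = λ {y} q k → [ (λ q1 → V.dis q1 k) , (λ q1 → notQ {y} (V.ZW k) q1) ] (∨-e {Q1 y} q) ; bd = bd2 }
      ; QX = λ {y} q x → [ (λ q1 → V.QX q1 x) , (λ q1 → QX q1 x) ] (∨-e {Q1 y} q) ; lt = V.lt ; rigid = rg2 ; some = z , ∨-l qz }))
     where
     z = fst (anyb-e _ h)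
     zz : Z z !
     zz = ∧-l (snd (anyb-e (λ y → Z y ∧ Q1 y) h))
     qz : Q1 z !
     qz = ∧-r {Z z} (snd (anyb-e (λ y → Z y ∧ Q1 y) h))
     Q2 : Sub n
     Q2 y = Q1 y ∨ Q y
     -- `Z` is complete in `H`, so as soon as one of its vertices lies in `Q1`, all lie in `Q1` or
     -- its boundary.
     Zin : ∀ {y} → Z y ! → Q1 y ! ⊎ Z1 y !
     Zin {y} zy = [ (λ e → inl (subst (λ k → Q1 k !) (==-e e) qz)) , (λ ne → V.bd qz (H-z zz zy (λ e → ne (==-i e)))) ] (bool (z == y))
     bd2 : ∀ {a b} → Q2 a ! → E a b ! → Q2 b ! ⊎ Z1 b !
     bd2 {a} {b} q e = [ (λ qb → inl (∨-r {Q1 b} qb)) , (λ nb → [ (λ qa → lift (out qa e nb)) , (λ qa → [ (λ qb → void (nb qb)) , (λ zb → lift (Zin zb)) ] (bd qa e)) ] (∨-e {Q1 a} q)) ] (bool (Q b))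
      where lift : Q1 b ! ⊎ Z1 b ! → Q2 b ! ⊎ Z1 b !
            lift = [ (λ q → inl (∨-l q)) , inr ]
     rg2 : Rigid E Z1 Q2
     rg2 p Pr PP PS = rg p Pr PP PS >>= λ sol → Lift.lifted E H Z Q Z1 (λ y → Q1 y ∨ Z1 y) Pr PP (λ {x} {y} → HE {x} {y})
       (λ {y} s q → [ (λ q1 → notQ {y} (V.QW q1) q) , (λ k → notQ {y} (V.ZW k) q) ] (∨-e {Q1 y} s)) (λ {y} q k → notQ {y} (V.ZW k) q) symm rigid sol >>= λ s →
      ret (solMono (λ {y} h → [ (λ k → [ (λ q → ∨-l (∨-l q)) , (λ k → ∨-r {Q2 y} k) ] (∨-e {Q1 y} k)) , (λ q → ∨-l (∨-r {Q1 y} q)) ] (∨-e {Q1 y ∨ Z1 y} h)) s)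

   linked : Linked E X
   linked p Pr PP PS = em (Σ[ Z1 ∈ Sub n ] Σ[ Q1 ∈ Sub n ] Viol H W' X D Z1 Q1) >>= λ where
    (yes (Z1 , Q1 , V)) → lemmaV H W' X D grH cW' cX hD Z1 Q1 V >>= λ { (Z2 , Q2 , V2 , rg) → void (noViol Z2 Q2 V2 rg) }
    (no none) → IH H W' X D (record { gr = grH ; XW = XW' ; m1 = m1H ; m2 = λ Z Q V → none (Z , Q , V) }) cW' cX hD p Pr PP PS >>= λ L →
     Lift.lifted E H Z Q X W' Pr PP (λ {x} {y} → HE {x} {y}) (λ {y} → notQ {y}) QX symm rigid (inSet W' (λ _ e → Graphic.inW' grH e) XW' PP L) >>= λ s → ret (fst s)

  lemmaR : ∀ Z Q → RSep Z Q → Linked E X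
  lemmaR Z Q rs p Pr PP PS = argmax {A = Σ[ Z ∈ Sub n ] Σ[ Q ∈ Sub n ] RSep Z Q} (λ x → card (fst (snd x))) n (λ x → card-≤n (fst (snd x))) (Z , Q , rs) >>= λ { ((Z , Q , rs) , max) →
   Reduce.linked Z Q rs (λ Z' Q' rs' → max (Z' , Q' , rs')) p Pr PP PS }

 -- The paths avoid `Q` and meet `T` only in their last vertex, the links of the hub stay in `Q` and
 -- `T` and avoid the roots of other pairs. Hence a path and a link meet only where they are to be
 -- joined.
 module Combine (E : Rl n) (E-symm : Symm E) (Y T S Q : Sub n) (cY : card Y ≤ 2 * r) (ps : Paths E Y T)
         (hub : ∀ p (R : Sub n) (Pr : Pairs n p) → (∀ y → R y ! → T y !) → card R ≤ 2 * r → Proper R Pr → Strict Pr → NN (Sol E S R Pr))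
         (ST : ∀ {y} → S y ! → Q y ! ⊎ T y !) (avoid : ∀ s → Y s ! → ∀ {y} → y ∈ Paths.lst ps s → Q y ! → ⊥)
         {p : ℕ} (Pr : Pairs n p) (PP : Proper Y Pr) (PS : Strict Pr) where
  open Paths ps
  open Pairs Pr
  open Proper PP

  R : Sub n
  R y = anyb (λ s → Y s ∧ (tgt s == y))

  R-i : ∀ {s} → Y s ! → R (tgt s) !
  R-i {s} h = anyb-i _ s (∧-i h (==-refl (tgt s)))

  tgt∈ : ∀ {s} → Y s ! → tgt s ∈ lst s
  tgt∈ h = last∈ (path _ h)

  tgt-inj : ∀ {s s'} → Y s ! → Y s' ! → tgt s ≡ tgt s' → s ≡ s'
  tgt-inj {s} {s'} h h' e = disj s s' h h' (tgt∈ h) (subst (_∈ lst s') (sym e) (tgt∈ h'))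

  R⊆T : ∀ y → R y ! → T y !
  R⊆T y h = let (s , q) = anyb-e (λ s → Y s ∧ (tgt s == y)) h in subst (λ z → T z !) (==-e (∧-r {Y s} q)) (hit s (∧-l q))

  cR : card R ≤ 2 * r
  cR = ≤-trans (card-inj {S = R} {U = Y} back (λ y h → fst (good y h)) (λ x y hx hy e → trans (sym (snd (good x hx))) (trans (cong tgt e) (snd (good y hy))))) cY
   where
   pre : ∀ y → Dec (R y !) → Fin n
   pre y (yes h) = fst (anyb-e (λ s → Y s ∧ (tgt s == y)) h)
   pre y (no _) = y
   back : Fin n → Fin n
   back y = pre y (T? (R y))
   good' : ∀ y (d : Dec (R y !)) → R y ! → Y (pre y d) ! × tgt (pre y d) ≡ y
   good' y (yes h) _ = let (s , q) = anyb-e (λ s → Y s ∧ (tgt s == y)) h in ∧-l q , ==-e (∧-r {Y s} q)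
   good' y (no nh) h = void (nh h)
   good : ∀ y → R y ! → Y (back y) ! × tgt (back y) ≡ y
   good y = good' y (T? (R y))

  Pr' : Pairs n p
  Pr' = record { act = act ; a = λ i → tgt (a i) ; b = λ i → tgt (b i) }

  PP' : Proper R Pr'
  PP' = record { inRa = λ i ai → R-i (inRa i ai) ; inRb = λ i ai → R-i (inRb i ai)
   ; aa = λ i j ai aj e → aa i j ai aj (tgt-inj (inRa i ai) (inRa j aj) e) ; bb = λ i j ai aj e → bb i j ai aj (tgt-inj (inRb i ai) (inRb j aj) e)
   ; ab = λ i j ai aj e → ab i j ai aj (tgt-inj (inRa i ai) (inRb j aj) e) }

  combined : NN (Sol E (λ y → S y ∨ anyb (λ s → Y s ∧ elem y (lst s))) Y Pr)
  combined = hub p R Pr' R⊆T cR PP' (λ i ai e → PS i ai (tgt-inj (inRa i ai) (inRb i ai) e)) >>= λ s → ret (build s)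
   where
   build : Sol E S R Pr' → Sol E (λ y → S y ∨ anyb (λ s → Y s ∧ elem y (lst s))) Y Pr
   build (K , inS) = record { lst = λ i → fst (new i) ; path = λ i ai → fst (snd (new i)) ai ; disj = disj' ; ends = ends' } , inS'
    where
    module K = Linkage K
    data Loc (i : Fin p) (y : Fin n) : Set where
     la : y ∈ lst (a i) → Loc i y
     lb : y ∈ lst (b i) → Loc i y
     lk : y ∈ K.lst i → Loc i y
    New : Fin p → Set
    New i = Σ[ N ∈ List (Fin n) ] (act i ! → PathL E (a i) (b i) N) × (∀ {y} → y ∈ N → act i ! → Loc i y)
    new : ∀ i → New i
    new i = pick (T? (act i))
     where
     pick : Dec (act i !) → New i
     pick (no ¬a) = [] , (λ ai → void (¬a ai)) , λ ()
     pick (yes ai) = let (M , q , _ , sub) = catP (K.path i ai) (revP E-symm (path (b i) (inRb i ai)))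
                         (N , q' , _ , sub') = catP (path (a i) (inRa i ai)) q in
      N , (λ _ → q') , λ m _ → [ la , (λ k → [ lk , (λ k' → lb (rev-∈ (lst (b i)) k')) ] (sub k)) ] (sub' m)
    loc : ∀ i → act i ! → ∀ {y} → y ∈ fst (new i) → Loc i y
    loc i ai m = snd (snd (new i)) m ai
    inS' : ∀ i → act i ! → ∀ {y} → y ∈ fst (new i) → S y ∨ anyb (λ s → Y s ∧ elem y (lst s)) !
    inS' i ai {y} m with loc i ai m
    ... | la k = ∨-r {S y} (anyb-i _ (a i) (∧-i (inRa i ai) (elem-i k)))
    ... | lb k = ∨-r {S y} (anyb-i _ (b i) (∧-i (inRb i ai) (elem-i k)))
    ... | lk k = ∨-l (inS i ai k)
    onLink : ∀ s j → Y s ! → act j ! → ∀ {y} → y ∈ lst s → y ∈ K.lst j → s ≡ a j ⊎ s ≡ b j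
    onLink s j ys aj {y} m k with ST (inS j aj k)
    ... | inl q = void (avoid s ys m q)
    ... | inr t with only s ys m t
    ...   | refl with K.ends j aj k (R-i ys)
    ...     | inl e = inl (tgt-inj ys (inRa j aj) e)
    ...     | inr e = inr (tgt-inj ys (inRb j aj) e)
    ends' : ∀ i → act i ! → ∀ {y} → y ∈ fst (new i) → Y y ! → y ≡ a i ⊎ y ≡ b i
    ends' i ai {y} m yy with loc i ai m
    ... | la k = inl (sole (a i) (inRa i ai) k yy)
    ... | lb k = inr (sole (b i) (inRb i ai) k yy)
    ... | lk k = onLink y i yy ai (first∈ (path y yy)) k
    disj' : ∀ i j → act i ! → act j ! → ∀ {y} → y ∈ fst (new i) → y ∈ fst (new j) → i ≡ j
    disj' i j ai aj m m' with loc i ai m | loc j aj m'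
    ... | la k | la k' = aa i j ai aj (disj _ _ (inRa i ai) (inRa j aj) k k')
    ... | la k | lb k' = ab i j ai aj (disj _ _ (inRa i ai) (inRb j aj) k k')
    ... | lb k | la k' = sym (ab j i aj ai (disj _ _ (inRa j aj) (inRb i ai) k' k))
    ... | lb k | lb k' = bb i j ai aj (disj _ _ (inRb i ai) (inRb j aj) k k')
    ... | lk k | lk k' = K.disj i j ai aj k k'
    ... | la k | lk k' = [ aa i j ai aj , ab i j ai aj ] (onLink (a i) j (inRa i ai) aj k k')
    ... | lb k | lk k' = [ (λ e → sym (ab j i aj ai (sym e))) , bb i j ai aj ] (onLink (b i) j (inRb i ai) aj k k')
    ... | lk k | la k' = [ (λ e → sym (aa j i aj ai e)) , (λ e → sym (ab j i aj ai e)) ] (onLink (a j) i (inRa j aj) ai k' k)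
    ... | lk k | lb k' = [ (λ e → ab i j ai aj (sym e)) , (λ e → sym (bb j i aj ai e)) ] (onLink (b j) i (inRb j aj) ai k' k)

 -- `Q` is a region behind `T` through which links may run. It is empty if `T` is a dense set, and
 -- it is the part cut off by a violation in the contraction step.
 record Hub (st : Setting r m n) : Set where
  open Setting st
  field
   T Q : Sub n
   TW  : ∀ {y} → T y ! → W y !
   QX  : ∀ {y} → Q y ! → X y ! → ⊥
   QT  : ∀ {y} → Q y ! → T y ! → ⊥
   QW  : ∀ {y} → Q y ! → W y !
   bd  : ∀ {a b} → Q a ! → E a b ! → Q b ! ⊎ T b !
   hub : ∀ p (R : Sub n) (Pr : Pairs n p) → (∀ y → R y ! → T y !) → card R ≤ 2 * r → Proper R Pr → Strict Pr → NN (Sol E (λ y → Q y ∨ T y) R Pr)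
   big : card X ≤ card T

 module LemmaH (st : Setting r m n) (hb : Hub st) where
  open Setting st
  open Hub hb
  open Massed M

  avoidU : ∀ {x t L} → PathL E x t L → Uniq L → (∀ {y} → y ∈ L → T y ! → y ≡ t) → (Q x ! → ⊥) → ∀ {y} → y ∈ L → Q y ! → ⊥
  avoidU one u on nq (here refl) q = nq q
  avoidU (e ◂ p) u on nq (here refl) q = nq q
  avoidU (_◂_ {a = x} e p) (x∉ , u) on nq (there k) q = avoidU p u (λ h → on (there h)) (λ qc → [ nq , (λ tx → x∉ (subst (_∈ _) (sym (on (here refl) tx)) (last∈ p))) ] (bd qc (symm e))) k q

  avoidT : ∀ {x z L} L1 → PathL E x z L → L ≡ L1 ++ z ∷ [] → (∀ y → y ∈ L1 → ¬ (T y !)) → T z ! → (Q x ! → ⊥) → ∀ {y} → y ∈ L → Q y ! → ⊥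
  avoidT L1 one eq no1 tz nq (here refl) q = QT q tz
  avoidT L1 (e ◂ p) eq no1 tz nq (here refl) q = nq q
  avoidT (._ ∷ L1) (e ◂ p) refl no1 tz nq (there k) q = avoidT L1 p refl (λ y h → no1 y (there h)) tz (λ qc → [ nq , no1 _ (here refl) ] (bd qc (symm e))) k q
  avoidT [] (e ◂ ()) refl no1 tz nq (there k) q

  -- Still separating, because a path from `X`, up to its first vertex in `T`, remains in `W` and
  -- cannot enter `Q`.
  clean : Sub n → Sub n
  clean Y y = Y y ∧ (W y ∧ not (Q y))

  cleanSep : ∀ Y → Separates E X T Y → Separates E X T (clean Y)
  cleanSep Y sp xa tb q with firstIn T q
  ... | inl none = void (none _ (last∈ q) tb)
  ... | inr (z , L1 , L2 , tz , refl , q1 , _ , no1) with sp xa tz q1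
  ...   | y , k , yy = y , [ ∈ˡ , (λ { (here refl) → ∈ʳ L1 (here refl) }) ] (∈⁻ L1 k) ,
      ∧-i yy (∧-i (pathIn W (λ _ e → inW' e) q1 (XW xa) k) (not-i (avoidT L1 q1 refl no1 tz (λ qa → QX qa xa) k)))

  record SepSet : Set where
   field
    Y  : Sub n
    YW : ∀ {y} → Y y ! → W y !
    YQ : ∀ {y} → Y y ! → Q y ! → ⊥
    sp : Separates E X T Y

  mkSep : ∀ Y → Separates E X T Y → SepSet
  mkSep Y sp = record { Y = clean Y ; YW = λ {y} h → ∧-l (∧-r {Y y} h) ; YQ = λ {y} h → not-e (∧-r {W y} (∧-r {Y y} h)) ; sp = cleanSep Y sp }

  combineX : Paths E X T → Linked E X
  combineX ps p Pr PP PS = Combine.combined E symm X T (λ y → Q y ∨ T y) Q cX ps hub (λ {y} → ∨-e {Q y})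
   (λ s xs → avoidU (Paths.path ps s xs) (Paths.uniq ps s xs) (Paths.only ps s xs) (λ q → QX q xs)) Pr PP PS >>= λ s → ret (fst s)

  -- The separator is joined to the hub by disjoint paths, so it is linked through the part that `X`
  -- does not reach without crossing it. This part is a rigid separation, to which `lemmaR` applies.
  module MinSep (ss : SepSet) (lt : card (SepSet.Y ss) < card X) (ps : Paths E (SepSet.Y ss) T) where
   open SepSet ss

   Reached : Fin n → Set
   Reached y = Σ[ x ∈ Fin n ] Σ[ L ∈ List (Fin n) ] X x ! × PathL E x y L × (∀ {z} → z ∈ L → Y z ! → ⊥)

   module _ (Re : Sub n) (re : ∀ x → (Re x ! → Reached x) × (Reached x → Re x !)) where

    Q1 : Sub n
    Q1 y = (W y ∧ not (Y y)) ∧ not (Re y)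

    Q1-i : ∀ {y} → W y ! → (Y y ! → ⊥) → (Reached y → ⊥) → Q1 y !
    Q1-i {y} w ny nr = ∧-i (∧-i w (not-i ny)) (not-i (λ h → nr (fst (re y) h)))

    Q1Y : ∀ {y} → Q1 y ! → Y y ! → ⊥
    Q1Y {y} h = not-e (∧-r {W y} (∧-l h))

    extend : ∀ {a b} → Reached a → E a b ! → (Y b ! → ⊥) → Reached b
    extend (x , L , xx , q , av) e nb = x , L ++ _ ∷ [] , xx , joinE q e one , λ k y → [ (λ k → av k y) , (λ { (here refl) → nb y }) ] (∈⁻ L k)

    noT : ∀ {y} → T y ! → Reached y → ⊥
    noT t (x , L , xx , q , av) = let (z , k , y) = sp xx t q in av k y

    noQ : ∀ {y} → Q y ! → Reached y → ⊥
    noQ {y} qy (x , L , xx , q , av) = go q (λ qx → QX qx xx) av (λ z k tz → noT tz k) (x , x ∷ [] , xx , one , λ { (here refl) → av (first∈ q) }) qy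
     where
     go : ∀ {u L} → PathL E u y L → (Q u ! → ⊥) → (∀ {z} → z ∈ L → Y z ! → ⊥) → (∀ z → Reached z → T z ! → ⊥) → Reached u → Q y ! → ⊥
     go one nq av nt ru qy = nq qy
     go (e ◂ p) nq av nt ru qy = go p (λ qc → [ nq , nt _ ru ] (bd qc (symm e))) (λ k → av (there k)) nt (extend ru e (av (there (first∈ p)))) qy

    sepQ1 : Sep E W Y Q1
    sepQ1 = record { QW = λ h → ∧-l (∧-l h) ; ZW = YW ; dis = Q1Y ; bd = λ {a} {b} qa e → [ inr , (λ ny → inl (Q1-i (inW' e) ny
      (λ rb → not-e (∧-r {W a ∧ not (Y a)} qa) (snd (re a) (extend rb (symm e) (Q1Y qa)))))) ] (bool (Y b)) }

    onPath : ∀ s → Y s ! → ∀ {y} → y ∈ Paths.lst ps s → Q1 y ∨ Y y !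
    onPath s ys {y} k = [ (λ yy → ∨-r {Q1 y} yy) , (λ ny → ∨-l (Q1-i (pathIn W (λ _ e → inW' e) (path s ys) (YW ys) k) ny (λ ry → stuck k ny ry))) ] (bool (Y y))
     where
     open Paths ps
     stuck : ∀ {y} → y ∈ lst s → (Y y ! → ⊥) → Reached y → ⊥
     stuck {y} k ny ry = let (L1 , L2 , eq , _ , q) = splitP (path s ys) k in
       noT (hit s ys) (go q (λ m zz → tl L1 L2 eq m zz) ry)
      where
      tl : ∀ L1 L2 → lst s ≡ L1 ++ y ∷ L2 → ∀ {z} → z ∈ (y ∷ L2) → Y z ! → ⊥
      tl L1 L2 eq (here refl) zz = ny zz
      tl L1 L2 eq {z} (there m) zz = let (M , e) = shape (path s ys) in
       tail≢head L1 (subst Uniq eq (uniq s ys)) (trans (sym e) eq) m (sole s ys (subst (z ∈_) (sym eq) (∈ʳ L1 (there m))) zz)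
      go : ∀ {u t L} → PathL E u t L → (∀ {z} → z ∈ L → Y z ! → ⊥) → Reached u → Reached t
      go one av ru = ru
      go (e ◂ p) av ru = go p (λ m → av (there m)) (extend ru e (av (there (first∈ p))))

    rigidY : Rigid E Y Q1
    rigidY p Pr PP PS = Combine.combined E symm Y T (λ y → Q y ∨ T y) Q (≤-trans (<⇒≤ lt) cX) ps hub (λ {y} → ∨-e {Q y})
      (λ s ys → avoidU (Paths.path ps s ys) (Paths.uniq ps s ys) (Paths.only ps s ys) (YQ ys)) Pr PP PS >>= λ s →
     ret (solMono (λ {y} h → [ (λ k → [ (λ q → ∨-l (Q1-i (QW q) (λ yy → YQ yy q) (noQ q))) , (λ t → [ (λ yy → ∨-r {Q1 y} yy) , (λ ny → ∨-l (Q1-i (TW t) ny (noT t))) ] (bool (Y y))) ] (∨-e {Q y} k)) ,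
      (λ k → let (s , q) = anyb-e (λ s → Y s ∧ elem y (Paths.lst ps s)) k in onPath s (∧-l q) (elem-e _ (∧-r {Y s} q))) ] (∨-e {Q y ∨ T y} h)) s)

    rsep : Current.RSep st Y Q1
    rsep = record { sep = sepQ1 ; QX = λ {y} q x → not-e (∧-r {W y ∧ not (Y y)} q) (snd (re y) (y , y ∷ [] , x , one , λ { (here refl) → Q1Y q })) ; lt = lt ; rigid = rigidY
           ; some = let (y , h) = card-ex (T ∖ Y) pos in y , Q1-i (TW (∧-l h)) (not-e (∧-r {T y} h)) (noT (∧-l h)) }
     where
     pos : 1 ≤ card (T ∖ Y)
     pos = +-cancelʳ-≤ (card Y) 1 _ (≤-trans lt (≤-trans big (card-∪ {U = T ∖ Y} {V = Y} (λ y t → [ inr , (λ ny → inl (∧-i t (not-i ny))) ] (bool (Y y))))))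

  through : ∀ {Y Z'} → Separates E X T Y → Separates E Y T Z' → Separates E X T Z'
  through sp sp' xa tb q with sp xa tb q
  ... | y , k , yy with splitP q k
  ...   | L1 , L2 , eq , _ , q' with sp' yy tb q'
  ...     | z , k' , zz = z , subst (z ∈_) (sym eq) (∈ʳ L1 k') , zz

  linked : Linked E X
  linked p Pr PP PS = Menger.menger E symm X T >>= λ where
   (inl ps) → combineX ps p Pr PP PS
   (inr (Z , ltZ , spZ)) → argmin {A = SepSet} (λ s → card (SepSet.Y s)) (mkSep Z spZ) >>= λ { (ss , min) →
    Menger.menger E symm (SepSet.Y ss) T >>= λ where
     (inr (Z' , lt' , sp')) → void (<⇒≱ lt' (≤-trans (min (mkSep Z' (through (SepSet.sp ss) sp'))) (card-mono (λ y → ∧-l))))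
     (inl ps) → let lt1 = ≤-<-trans (min (mkSep Z spZ)) (≤-<-trans (card-mono (λ y → ∧-l)) ltZ) in
      compr (MinSep.Reached ss lt1 ps) >>= λ { (Re , re) →
       Current.lemmaR st (SepSet.Y ss) (MinSep.Q1 ss lt1 ps Re re) (MinSep.rsep ss lt1 ps Re re) p Pr PP PS } }

-- Contracting an edge

excl : ∀ {p q s k} → (p ! → q ! → ⊥) → (p ! → s ! → ⊥) → (q ! → s ! → ⊥) →
 (p ! → 1 ≤ k) → (q ! → 1 ≤ k) → (s ! → 1 ≤ k) → b2n p + (b2n q + b2n s) ≤ k
excl {true} {true} pq ps qs hp hq hs = void (pq refl refl)
excl {true} {false} {true} pq ps qs hp hq hs = void (ps refl refl)
excl {true} {false} {false} pq ps qs hp hq hs = hp refl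
excl {false} {true} {true} pq ps qs hp hq hs = void (qs refl refl)
excl {false} {true} {false} pq ps qs hp hq hs = hq refl
excl {false} {false} {true} pq ps qs hp hq hs = hs refl
excl {false} {false} {false} pq ps qs hp hq hs = z≤n

one-of : ∀ {p q s} → (p ! ⊎ q ! ⊎ s !) → 1 ≤ b2n p + (b2n q + b2n s)
one-of (inl refl) = s≤s z≤n
one-of {p} (inr (inl refl)) = ≤-trans (s≤s z≤n) (m≤n+m _ (b2n p))
one-of {p} {q} (inr (inr refl)) = ≤-trans (m≤n+m 1 (b2n q)) (m≤n+m _ (b2n p))

b2n-∧ : ∀ a b → b2n (a ∧ b) ≡ b2n a * b2n b
b2n-∧ true b = sym (+-identityʳ _)
b2n-∧ false b = refl

module _ {n : ℕ} where

 ρ-sum : ∀ (E : Rl n) (U : Sub n) → ρ E U ≡ sum (λ a → sum (λ b → b2n (E a b ∧ (U a ∨ U b))))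
 ρ-sum E U = trans (ρ-def E U) (sum-cong (λ a → card-def (λ b → E a b ∧ (U a ∨ U b))))

 rowSum : ∀ (x : Fin n) (f : Sub n) → sum (λ a → sum (λ b → b2n ((a == x) ∧ f b))) ≡ card f
 rowSum x f = trans (sum-cong (λ a → trans (sum-cong (λ b → b2n-∧ (a == x) (f b))) (trans (sum-*ˡ (b2n (a == x)) (λ b → b2n (f b))) (cong (b2n (a == x) *_) (sym (card-def f)))))) (sum-δ (λ _ → card f) x)

 colSum : ∀ (x : Fin n) (f : Sub n) → sum (λ a → sum (λ b → b2n ((b == x) ∧ f a))) ≡ card f
 colSum x f = trans (sum-cong (λ a → trans (sum-cong (λ b → b2n-∧ (b == x) (f a))) (sum-δ (λ _ → b2n (f a)) x))) (sym (card-def f))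

 -- Reduces the comparison of two edge counts, in which a star at `x` is traded for a star at `y`,
 -- to a check on single ordered pairs. Stars count twice because both orders occur.
 move : ∀ (e e' : Rl n) (x y : Fin n) (f g : Sub n) →
  (∀ a b → b2n (e a b) + (b2n ((a == x) ∧ f b) + b2n ((b == x) ∧ f a)) ≤ b2n (e' a b) + (b2n ((a == y) ∧ g b) + b2n ((b == y) ∧ g a))) →
  sum (λ a → sum (λ b → b2n (e a b))) + (card f + card f) ≤ sum (λ a → sum (λ b → b2n (e' a b))) + (card g + card g)
 move e e' x y f g h = subst₂ _≤_ (side e x f) (side e' y g) (sum-mono (λ a → sum-mono (h a)))
  where
  side : ∀ (e : Rl n) (x : Fin n) (f : Sub n) → sum (λ a → sum (λ b → b2n (e a b) + (b2n ((a == x) ∧ f b) + b2n ((b == x) ∧ f a)))) ≡ sum (λ a → sum (λ b → b2n (e a b))) + (card f + card f)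
  side e x f = trans (sum-cong (λ a → trans (sum-+ (λ b → b2n (e a b)) (λ b → b2n ((a == x) ∧ f b) + b2n ((b == x) ∧ f a))) (cong (sum (λ b → b2n (e a b)) +_) (sum-+ (λ b → b2n ((a == x) ∧ f b)) (λ b → b2n ((b == x) ∧ f a))))))
   (trans (sum-+ (λ a → sum (λ b → b2n (e a b))) (λ a → sum (λ b → b2n ((a == x) ∧ f b)) + sum (λ b → b2n ((b == x) ∧ f a)))) (cong (sum (λ a → sum (λ b → b2n (e a b))) +_) (trans (sum-+ (λ a → sum (λ b → b2n ((a == x) ∧ f b))) (λ a → sum (λ b → b2n ((b == x) ∧ f a)))) (cong₂ _+_ (rowSum x f) (colSum x f)))))

 ρ-some : ∀ {E : Rl n} {U : Sub n} {k} → k < ρ E U → Σ[ y ∈ Fin n ] U y !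
 ρ-some {E} {U} {k} lt = fromU (sum-ex _ (subst (1 ≤_) (ρ-def E U) (≤-trans (s≤s z≤n) lt)))
  where
  fromU : Σ[ a ∈ Fin n ] 1 ≤ card (λ b → E a b ∧ (U a ∨ U b)) → Σ[ y ∈ Fin n ] U y !
  fromU (a , h) = let (b , q) = card-ex _ h in [ (λ u → a , u) , (λ u → b , u) ] (∨-e {U a} (∧-r {E a b} q))

module Contract {n : ℕ} (E : Rl n) (W X : Sub n) (gr : Graphic E W) (XW : ∀ {y} → X y ! → W y !) (u v : Fin n) (vu : E v u !) (v∉X : X v ! → ⊥) where
 open Graphic gr

 E' : Rl n
 E' x y = (E x y ∧ (not (x == v) ∧ not (y == v))) ∨ (((x == u) ∧ (E v y ∧ not (y == u))) ∨ ((y == u) ∧ (E v x ∧ not (x == u))))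

 W' : Sub n
 W' y = W y ∧ not (y == v)

 neq : ∀ {x y : Fin n} → not (x == y) ! → x ≢ y
 neq h e = not-e h (==-i e)
 neqi : ∀ {x y : Fin n} → x ≢ y → not (x == y) !
 neqi h = not-i (λ e → h (==-e e))

 u≢v : u ≢ v
 u≢v refl = irr u vu

 data Kind (x y : Fin n) : Set where
  real : E x y ! → x ≢ v → y ≢ v → Kind x y
  out  : x ≡ u → E v y ! → y ≢ u → Kind x y
  into : y ≡ u → E v x ! → x ≢ u → Kind x y

 kind : ∀ {x y} → E' x y ! → Kind x y
 kind {x} {y} h with ∨-e {E x y ∧ (not (x == v) ∧ not (y == v))} h
 ... | inl q = real (∧-l q) (neq {x} {v} (∧-l (∧-r {E x y} q))) (neq {y} {v} (∧-r {not (x == v)} (∧-r {E x y} q)))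
 ... | inr q with ∨-e {(x == u) ∧ (E v y ∧ not (y == u))} q
 ...   | inl q = out (==-e {x = x} (∧-l q)) (∧-l (∧-r {x == u} q)) (neq {y} {u} (∧-r {E v y} (∧-r {x == u} q)))
 ...   | inr q = into (==-e {x = y} (∧-l q)) (∧-l (∧-r {y == u} q)) (neq {x} {u} (∧-r {E v x} (∧-r {y == u} q)))

 unkind : ∀ {x y} → Kind x y → E' x y !
 unkind (real e a b) = ∨-l (∧-i e (∧-i (neqi a) (neqi b)))
 unkind {x} {y} (out a e b) = ∨-r {E x y ∧ (not (x == v) ∧ not (y == v))} (∨-l (∧-i (==-i a) (∧-i e (neqi b))))
 unkind {x} {y} (into a e b) = ∨-r {E x y ∧ (not (x == v) ∧ not (y == v))} (∨-r {(x == u) ∧ (E v y ∧ not (y == u))} (∧-i (==-i a) (∧-i e (neqi b))))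

 v≢ : ∀ {y} → E v y ! → y ≢ v
 v≢ e refl = irr v e

 left : ∀ {x y} → E' x y ! → W' x !
 left h with kind h
 ... | real e a b = ∧-i (inW e) (neqi a)
 ... | out refl e b = ∧-i (inW' vu) (neqi u≢v)
 ... | into refl e b = ∧-i (inW' e) (neqi (v≢ e))

 flip : ∀ {x y} → E' x y ! → E' y x !
 flip {x} {y} h with kind h
 ... | real e a b = unkind (real (symm e) b a)
 ... | out p e b = unkind (into p e b)
 ... | into p e b = unkind (out p e b)

 gr' : Graphic E' W'
 gr' = record { symm = flip ; irr = ir ; inW = left }
  where
  ir : ∀ y → E' y y ! → ⊥
  ir y h with kind {y} {y} h
  ... | real e _ _ = irr y e
  ... | out p _ b = b p
  ... | into p _ b = b p

 XW' : ∀ {y} → X y ! → W' y !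
 XW' x = ∧-i (XW x) (neqi (λ { refl → v∉X x }))

 W'v : ∀ {y} → W' y ! → y ≢ v
 W'v {y} w = neq {y} {v} (∧-r {W y} w)

 -- The neighbours of `v` that yield no new edge at `u`. Two roots are treated as adjacent, since
 -- edges between roots do not count in the density.
 common : Sub n
 common w = E v w ∧ (not (w == u) ∧ (E u w ∨ (X u ∧ X w)))

 fresh : Sub n
 fresh w = E v w ∧ (not (w == u) ∧ not (E u w ∨ (X u ∧ X w)))

 U U' : Sub n
 U = W ∖ X
 U' = W' ∖ X

 -- The edges at `v` disappear and the `fresh` ones appear at `u`; the balance is the contracted
 -- edge and one edge for every vertex of `common`.
 loss : ρ E U ≤ ρ E' U' + 2 * (1 + card common)
 loss = lin (1 ∷ 2 ∷ 1 ∷ []) (ρ E U ∷ ρ E' U' ∷ card fresh ∷ card (E v) ∷ card common ∷ []) (λ r r' f d c → r :+ (f :+ f) :≤ r' :+ (d :+ d) ⇒ d :≤ # 1 :+ (c :+ f) ⇒ qed (r :≤ r' :+ 2 :* (# 1 :+ c)))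
   (subst₂ _≤_ (cong (_+ (card fresh + card fresh)) (sym (ρ-sum E U))) (cong (_+ (card (E v) + card (E v))) (sym (ρ-sum E' U')))
    (move (λ a b → E a b ∧ (U a ∨ U b)) (λ a b → E' a b ∧ (U' a ∨ U' b)) u v fresh (E v) pt)) dg
  where
  dg : card (E v) ≤ 1 + (card common + card fresh)
  dg = ≤-trans (card-∪ {U = _== u} {V = λ w → common w ∨ fresh w} (λ w e → [ inl , (λ ne → inr ([ (λ q → ∨-l (∧-i e (∧-i (not-i ne) q))) , (λ q → ∨-r {common w} (∧-i e (∧-i (not-i ne) (not-i q)))) ]
    (bool (E u w ∨ (X u ∧ X w))))) ] (bool (w == u)))) (+-mono-≤ (≤-eq (card-sing u)) (card-∪ (λ w → ∨-e)))
  fr : ∀ {w} → fresh w ! → E v w ! × w ≢ u × (E u w ∨ (X u ∧ X w) ! → ⊥)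
  fr {w} h = ∧-l h , neq {w} {u} (∧-l (∧-r {E v w} h)) , not-e (∧-r {not (w == u)} (∧-r {E v w} h))
  U-i : ∀ {y} → W y ! → y ≢ v → (X y ! → ⊥) → U' y !
  U-i w ne nx = ∧-i (∧-i w (neqi ne)) (not-i nx)
  freshE : ∀ {w} → fresh w ! → E' u w ! × U' u ∨ U' w !
  freshE {w} h = let (e , ne , nq) = fr h in unkind (out refl e ne) ,
   [ (λ xu → ∨-r {U' u} (U-i (inW' e) (v≢ e) (λ xw → nq (∨-r {E u w} (∧-i xu xw))))) , (λ nx → ∨-l (U-i (inW' vu) u≢v nx)) ] (bool (X u))
  keep : ∀ {y} → y ≢ v → U y ! → U' y !
  keep {y} ne h = U-i (∧-l h) ne (not-e (∧-r {W y} h))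
  ∨-swap : ∀ {a b} → a ∨ b ! → b ∨ a !
  ∨-swap {a} {b} h = [ ∨-r {b} , ∨-l ] (∨-e {a} h)
  pt : ∀ a b → b2n (E a b ∧ (U a ∨ U b)) + (b2n ((a == u) ∧ fresh b) + b2n ((b == u) ∧ fresh a)) ≤ b2n (E' a b ∧ (U' a ∨ U' b)) + (b2n ((a == v) ∧ E v b) + b2n ((b == v) ∧ E v a))
  pt a b = excl (λ e q → fa (∧-l q) (∧-r {a == u} q) (∧-l e)) (λ e q → fa (∧-l q) (∧-r {b == u} q) (symm (∧-l e))) (λ q q' → fst (snd (fr (∧-r {a == u} q))) (==-e (∧-l q')))
    (λ e → one-of {E' a b ∧ (U' a ∨ U' b)} {(a == v) ∧ E v b} (old e)) (λ q → one-of {E' a b ∧ (U' a ∨ U' b)} {(a == v) ∧ E v b} (inl (nw (∧-l q) (∧-r {a == u} q))))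
    (λ q → one-of {E' a b ∧ (U' a ∨ U' b)} {(a == v) ∧ E v b} (inl (nw' (∧-l q) (∧-r {b == u} q))))
   where
   fa : ∀ {x y} → (x == u) ! → fresh y ! → E x y ! → ⊥
   fa {x} {y} xu f e = snd (snd (fr f)) (∨-l (subst (λ z → E z y !) (==-e xu) e))
   nw : (a == u) ! → fresh b ! → E' a b ∧ (U' a ∨ U' b) !
   nw au f = subst (λ z → E' z b ∧ (U' z ∨ U' b) !) (sym (==-e au)) (∧-i (fst (freshE f)) (snd (freshE f)))
   nw' : (b == u) ! → fresh a ! → E' a b ∧ (U' a ∨ U' b) !
   nw' bu f = subst (λ z → E' a z ∧ (U' a ∨ U' z) !) (sym (==-e bu)) (∧-i (flip (fst (freshE f))) (∨-swap {U' u} (snd (freshE f))))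
   old : E a b ∧ (U a ∨ U b) ! → E' a b ∧ (U' a ∨ U' b) ! ⊎ (a == v) ∧ E v b ! ⊎ (b == v) ∧ E v a !
   old h = [ (λ av → inr (inl (∧-i av (subst (λ z → E z b !) (==-e av) (∧-l h))))) ,
    (λ na → [ (λ bv → inr (inr (∧-i bv (subst (λ z → E z a !) (==-e bv) (symm (∧-l h)))))) ,
     (λ nb → inl (∧-i (unkind (real (∧-l h) (λ e → na (==-i e)) (λ e → nb (==-i e)))) (∨-map {U a} {U b} (keep (λ e → na (==-i e))) (keep (λ e → nb (==-i e))) (∧-r {E a b} h)))) ] (bool (b == v))) ] (bool (a == v))

 m1' : ∀ D → 2 * D * card U < ρ E U → U v ! → card common < D → 2 * D * card U' < ρ E' U'
 m1' D m1 uv lt = +-cancelʳ-< (2 * D) _ _ (begin-strict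
   2 * D * card U' + 2 * D ≡⟨ trans (+-comm _ (2 * D)) (sym (*-suc (2 * D) (card U'))) ⟩
   2 * D * suc (card U')   ≤⟨ *-monoʳ-≤ (2 * D) (card-strict {S = U'} {U = U} (λ y h → ∧-i (∧-l (∧-l {W' y} h)) (∧-r {W' y} h)) v uv (λ h → W'v {v} (∧-l h) refl)) ⟩
   2 * D * card U          <⟨ m1 ⟩
   ρ E U                   ≤⟨ loss ⟩
   ρ E' U' + 2 * (1 + card common) ≤⟨ +-monoʳ-≤ (ρ E' U') (*-monoʳ-≤ 2 lt) ⟩
   ρ E' U' + 2 * D         ∎)
  where open ≤-Reasoning

 -- An edge from `u` into `Q` that the contraction creates stems from an edge from `v` into `Q`,
 -- which no longer counts after the contraction.
 gain : ∀ Q → (∀ {y} → Q y ! → W' y !) → (Q u ! → ⊥) → ρ E' Q ≤ ρ E Q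
 gain Q QW nu = +-cancelʳ-≤ (card g + card g) _ _ (subst₂ _≤_ (cong (_+ (card g + card g)) (sym (ρ-sum E' Q))) (cong (_+ (card g + card g)) (sym (ρ-sum E Q)))
   (move (λ a b → E' a b ∧ (Q a ∨ Q b)) (λ a b → E a b ∧ (Q a ∨ Q b)) v u g g pt))
  where
  g : Sub n
  g w = E v w ∧ Q w
  nv : ∀ {x y} → E' x y ! → x ≢ v
  nv {x} h = W'v {x} (left h)
  pt : ∀ a b → b2n (E' a b ∧ (Q a ∨ Q b)) + (b2n ((a == v) ∧ g b) + b2n ((b == v) ∧ g a)) ≤ b2n (E a b ∧ (Q a ∨ Q b)) + (b2n ((a == u) ∧ g b) + b2n ((b == u) ∧ g a))
  pt a b = excl (λ e q → nv (∧-l e) (==-e (∧-l q))) (λ e q → nv (flip (∧-l e)) (==-e (∧-l q))) (λ q q' → irr v (subst (λ z → E v z !) (==-e (∧-l q')) (∧-l (∧-r {a == v} q))))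
    (λ e → one-of {E a b ∧ (Q a ∨ Q b)} {(a == u) ∧ g b} (old (kind (∧-l e)) (∧-r {E' a b} e)))
    (λ q → one-of {E a b ∧ (Q a ∨ Q b)} {(a == u) ∧ g b} (inl (∧-i (subst (λ z → E z b !) (sym (==-e (∧-l q))) (∧-l (∧-r {a == v} q))) (∨-r {Q a} (∧-r {E v b} (∧-r {a == v} q))))))
    (λ q → one-of {E a b ∧ (Q a ∨ Q b)} {(a == u) ∧ g b} (inl (∧-i (symm (subst (λ z → E z a !) (sym (==-e (∧-l q))) (∧-l (∧-r {b == v} q)))) (∨-l (∧-r {E v a} (∧-r {b == v} q))))))
   where
   old : Kind a b → Q a ∨ Q b ! → E a b ∧ (Q a ∨ Q b) ! ⊎ (a == u) ∧ g b ! ⊎ (b == u) ∧ g a !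
   old (real e _ _) h = inl (∧-i e h)
   old (out refl e _) h = inr (inl (∧-i (==-refl a) (∧-i e ([ (λ q → void (nu q)) , (λ q → q) ] (∨-e {Q a} h)))))
   old (into refl e _) h = inr (inr (∧-i (==-refl b) (∧-i e ([ (λ q → q) , (λ q → void (nu q)) ] (∨-e {Q a} h)))))

 -- `v` is inserted wherever an edge at `u` is inherited from it, possibly on both sides of `u`. The
 -- repetition does no harm, as links need not be simple.
 expand : ∀ {x y L} → PathL E' x y L → Σ[ N ∈ List (Fin n) ] PathL E x y N × (∀ {z} → z ∈ N → z ∈ L ⊎ (z ≡ v × u ∈ L))
 expand one = _ , one , inl
 expand (_◂_ {a = x} {c = c} e p) with expand p | kind e
 ... | N , q , sub | real f _ _ = x ∷ N , f ◂ q , λ { (here r) → inl (here r) ; (there k) → [ (λ k → inl (there k)) , (λ { (e , k) → inr (e , there k) }) ] (sub k) }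
 ... | N , q , sub | out refl f _ = x ∷ v ∷ N , symm vu ◂ f ◂ q , λ { (here r) → inl (here r) ; (there (here r)) → inr (r , here refl) ; (there (there k)) → [ (λ k → inl (there k)) , (λ { (e , k) → inr (e , there k) }) ] (sub k) }
 ... | N , q , sub | into refl f _ = x ∷ v ∷ N , symm f ◂ vu ◂ q , λ { (here r) → inl (here r) ; (there (here r)) → inr (r , there (first∈ p)) ; (there (there k)) → [ (λ k → inl (there k)) , (λ { (e , k) → inr (e , there k) }) ] (sub k) }

 uncontract : ∀ {p} (S Z : Sub n) (Pr : Pairs n p) → Proper Z Pr → (∀ {y} → Z y ! → W' y !) → Sol E' S Z Pr → Sol E (λ y → S y ∨ (S u ∧ (y == v))) Z Pr
 uncontract {p} S Z Pr PP ZW (L , inS) = record { lst = λ i → fst (new i) ; path = λ i ai → fst (snd (new i)) ai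
   ; disj = λ i j ai aj m m' → dj i j ai aj (snd (snd (new i)) m) (snd (snd (new j)) m')
   ; ends = λ i ai m z → [ (λ k → ends i ai k z) , (λ { (refl , _) → void (W'v {v} (ZW z) refl) }) ] (snd (snd (new i)) m) } ,
   λ i ai {y} m → [ (λ k → ∨-l (inS i ai k)) , (λ { (refl , k) → ∨-r {S y} (∧-i (inS i ai k) (==-refl v)) }) ] (snd (snd (new i)) m)
  where
  open Pairs Pr
  open Linkage L
  new : ∀ i → Σ[ N ∈ List (Fin n) ] (act i ! → PathL E (a i) (b i) N) × (∀ {z} → z ∈ N → z ∈ lst i ⊎ (z ≡ v × u ∈ lst i))
  new i = pick (T? (act i))
   where
   pick : Dec (act i !) → Σ[ N ∈ List (Fin n) ] (act i ! → PathL E (a i) (b i) N) × (∀ {z} → z ∈ N → z ∈ lst i ⊎ (z ≡ v × u ∈ lst i))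
   pick (no ¬a) = [] , (λ ai → void (¬a ai)) , λ ()
   pick (yes ai) = let (N , q , sub) = expand (path i ai) in N , (λ _ → q) , sub
  noV : ∀ i → act i ! → v ∈ lst i → ⊥
  noV i ai m = W'v {v} (pathIn W' (λ _ e → left (flip e)) (path i ai) (ZW (Proper.inRa PP i ai)) m) refl
  dj : ∀ i j → act i ! → act j ! → ∀ {y} → y ∈ lst i ⊎ (y ≡ v × u ∈ lst i) → y ∈ lst j ⊎ (y ≡ v × u ∈ lst j) → i ≡ j
  dj i j ai aj (inl k) (inl k') = disj i j ai aj k k'
  dj i j ai aj (inl k) (inr (refl , _)) = void (noV i ai k)
  dj i j ai aj (inr (refl , _)) (inl k) = void (noV j aj k)
  dj i j ai aj (inr (_ , k)) (inr (_ , k')) = disj i j ai aj k k'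

module Step (r m : ℕ) (IH : Below r m) {n : ℕ} (st : Setting r m n) (pos : 1 ≤ card (Setting.X st)) (v : Fin n) (Wv : Setting.W st v !) (v∉X : Setting.X st v ! → ⊥) where
 open Setting st
 open Massed M

 -- If the contracted graph has a violation with `u` on its boundary, undoing the contraction adds
 -- `v` to the boundary and produces a hub. Otherwise the violation, with `v` added to it if it
 -- contains `u`, is a rigid separation of the original graph.
 contractLinked : ∀ u (vu : E v u !) → card (Contract.common E W X gr XW u v vu v∉X) < D → Linked E X
 contractLinked u vu few p Pr PP PS = em (Σ[ Z ∈ Sub n ] Σ[ Q ∈ Sub n ] Viol E' W' X D Z Q) >>= λ where
   (no none) → IH E' W' X D (record { gr = gr' ; XW = XW' ; m1 = m1' D m1 (∧-i Wv (not-i v∉X)) few ; m2 = λ Z Q V → none (Z , Q , V) }) cW' cX hD p Pr PP PS >>= λ L →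
    ret (fst (uncontract W' X Pr PP XW' (inSet W' (λ _ e → left (flip e)) XW' PP L)))
   (yes (Z , Q , V)) → lemmaV r m IH E' W' X D gr' cW' cX hD Z Q V >>= λ { (Z , Q , V , rg) → [ uZ Z Q V , notZ Z Q V rg ] (bool (Z u)) p Pr PP PS }
  where
  open Contract E W X gr XW u v vu v∉X
  cW' : card W' ≤ m
  cW' = ≤-pred (<-≤-trans (card-strict {S = W'} {U = W} (λ y → ∧-l) v Wv (λ h → W'v {v} h refl)) cW)
  E'-i : ∀ {a b} → W' a ! → E a b ! → b ≢ v → E' a b !
  E'-i {a} wa e nb = unkind (real e (W'v {a} wa) nb)

  notZ : ∀ Z Q → Viol E' W' X D Z Q → Rigid E' Z Q → ¬ (Z u !) → Linked E X
  notZ Z Q V rg nz = Current.lemmaR r m IH st Z Q2 (record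
    { sep = record { QW = λ {y} q → [ (λ q → ∧-l (V.QW q)) , (λ q → subst (λ z → W z !) (sym (==-e (∧-r {Q u} q))) Wv) ] (∨-e {Q y} q) ; ZW = λ z → ∧-l (V.ZW z)
            ; dis = λ {y} q z → [ (λ q → V.dis q z) , (λ q → W'v {y} (V.ZW z) (==-e (∧-r {Q u} q))) ] (∨-e {Q y} q) ; bd = bd2 }
    ; QX = λ {y} q x → [ (λ q → V.QX q x) , (λ q → v∉X (subst (λ z → X z !) (==-e (∧-r {Q u} q)) x)) ] (∨-e {Q y} q) ; lt = V.lt
    ; rigid = λ p Pr PP PS → rg p Pr PP PS >>= λ s → ret (solMono (λ {y} h → [ (λ k → [ (λ q → ∨-l (∨-l q)) , ∨-r {Q2 y} ] (∨-e {Q y} k)) ,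
      (λ k → ∨-l (∨-r {Q y} (∧-i ([ (λ q → q) , (λ z → void (nz z)) ] (∨-e {Q u} (∧-l k))) (∧-r {Q u ∨ Z u} k)))) ] (∨-e {Q y ∨ Z y} h)) (uncontract (λ y → Q y ∨ Z y) Z Pr PP V.ZW s))
    ; some = let (y , q) = ρ-some V.vi in y , ∨-l q })
   where
   module V = Viol V
   Q2 : Sub n
   Q2 y = Q y ∨ (Q u ∧ (y == v))
   toQ2 : ∀ {y} → Q y ! ⊎ Z y ! → Q2 y ! ⊎ Z y !
   toQ2 = [ (λ q → inl (∨-l q)) , inr ]
   bd2 : ∀ {a b} → Q2 a ! → E a b ! → Q2 b ! ⊎ Z b !
   bd2 {a} {b} q e = [ fromQ , (λ q → fromV (∧-l q) (subst (λ z → E z b !) (==-e (∧-r {Q u} q)) e)) ] (∨-e {Q a} q)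
    where
    fromV : Q u ! → E v b ! → Q2 b ! ⊎ Z b !
    fromV qu e = [ (λ bu → inl (∨-l (subst (λ z → Q z !) (sym (==-e bu)) qu))) , (λ nb → toQ2 (V.bd qu (unkind (out refl e (λ f → nb (==-i f)))))) ] (bool (b == u))
    isV : Q a ! → b ≡ v → Q u !
    isV qa refl = [ (λ au → subst (λ z → Q z !) (==-e au) qa) , (λ na → [ (λ q → q) , (λ z → void (nz z)) ] (V.bd qa (unkind (into refl (symm e) (λ f → na (==-i f)))))) ] (bool (a == u))
    fromQ : Q a ! → Q2 b ! ⊎ Z b !
    fromQ qa = [ (λ bv → inl (∨-r {Q b} (∧-i (isV qa (==-e bv)) bv))) , (λ nb → toQ2 (V.bd qa (E'-i (V.QW qa) e (λ f → nb (==-i f))))) ] (bool (b == v))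

  uZ : ∀ Z Q → Viol E' W' X D Z Q → Z u ! → Linked E X
  uZ Z Q V zu = LemmaH.linked r m IH st (record { T = T ; Q = Q ; TW = λ {y} → TW {y} ; QX = V.QX ; QT = λ {y} → QT {y} ; QW = λ q → ∧-l (V.QW q) ; bd = bd2 ; hub = hub ; big = big })
   where
   module V = Viol V
   T : Sub n
   T y = Z y ∨ (y == v)
   TW : ∀ {y} → T y ! → W y !
   TW {y} t = [ (λ z → ∧-l (V.ZW z)) , (λ e → subst (λ z → W z !) (sym (==-e e)) Wv) ] (∨-e {Z y} t)
   QT : ∀ {y} → Q y ! → T y ! → ⊥
   QT {y} q t = [ V.dis q , (λ e → W'v {y} (V.QW q) (==-e e)) ] (∨-e {Z y} t)
   bd2 : ∀ {a b} → Q a ! → E a b ! → Q b ! ⊎ T b !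
   bd2 {a} {b} q e = [ (λ bv → inr (∨-r {Z b} bv)) , (λ nb → [ inl , (λ z → inr (∨-l z)) ] (V.bd q (E'-i (V.QW q) e (λ f → nb (==-i f))))) ] (bool (b == v))
   sepT : Sep E W T Q
   sepT = record { QW = λ q → ∧-l (V.QW q) ; ZW = λ {y} → TW {y} ; dis = λ {y} → QT {y} ; bd = bd2 }
   vi : 2 * D * card Q < ρ E Q
   vi = <-≤-trans V.vi (gain Q V.QW (λ qu → V.dis qu zu))
   big : card X ≤ card T
   big = ≮⇒≥ (λ lt → m2 T Q (record { sep = sepT ; QX = V.QX ; lt = lt ; vi = vi }))
   cT : card T ≤ card X
   cT = ≤-trans (card-∪ {U = Z} {V = _== v} (λ y → ∨-e)) (≤-trans (≤-eq (trans (cong (card Z +_) (card-sing v)) (+-comm _ 1))) V.lt)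
   outside : Σ[ x ∈ Fin n ] X x ! × (Z x ! → ⊥)
   outside = let (x , h) = card-ex (X ∖ Z) (+-cancelʳ-≤ (card Z) 1 _ (≤-trans V.lt (card-∪ {U = X ∖ Z} {V = Z} (λ y x → [ inr , (λ nz → inl (∧-i x (not-i nz))) ] (bool (Z y)))))) in
    x , ∧-l h , not-e (∧-r {X x} h)
   small : card (λ y → Q y ∨ T y) ≤ m
   small = let (x , xx , nz) = outside in ≤-pred (<-≤-trans (card-strict {S = λ y → Q y ∨ T y} {U = W} (λ y h → [ (λ q → ∧-l (V.QW q)) , TW {y} ] (∨-e {Q y} h)) x (XW xx)
    (λ h → [ (λ q → V.QX q xx) , (λ t → [ nz , (λ e → v∉X (subst (λ z → X z !) (==-e e) xx)) ] (∨-e {Z x} t)) ] (∨-e {Q x} h))) cW)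
   -- In the original graph there are no violations at all, so the minimality that `restrict` asks
   -- for is vacuous.
   rigid : Rigid E T Q
   rigid = restrict r m IH E W X D gr cX hD T Q sepT V.QX cT vi small (λ Z' Q' V' → void (m2 Z' Q' V'))
   hub : ∀ p (R : Sub n) (Pr : Pairs n p) → (∀ y → R y ! → T y !) → card R ≤ 2 * r → Proper R Pr → Strict Pr → NN (Sol E (λ y → Q y ∨ T y) R Pr)
   hub p R Pr RT _ PP PS = rigid p Pr (record { inRa = λ i ai → RT _ (inRa i ai) ; inRb = λ i ai → RT _ (inRb i ai) ; aa = aa ; bb = bb ; ab = ab }) PS >>= λ { (L , inS) →
     ret (record { lst = Linkage.lst L ; path = Linkage.path L ; disj = Linkage.disj L ; ends = λ i ai k ry → Linkage.ends L i ai k (RT _ ry) } , inS) }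
    where open Proper PP

 -- An isolated vertex is a rigid separation with empty boundary.
 isolated : (∀ u → E v u ! → ⊥) → Linked E X
 isolated none = Current.lemmaR r m IH st (λ _ → false) (_== v) (record
  { sep = record { QW = λ e → subst (λ z → W z !) (sym (==-e e)) Wv ; ZW = λ () ; dis = λ _ () ; bd = λ {a} {b} e f → void (none b (subst (λ z → E z b !) (==-e e) f)) }
  ; QX = λ e x → v∉X (subst (λ z → X z !) (==-e e) x) ; lt = subst (_< card X) (sym (card-∅ {n} (λ _ → false) (λ _ ()))) pos
  ; rigid = λ p Pr PP PS → ret (record { lst = λ _ → [] ; path = λ i ai → void (t≢f (sym (Proper.inRa PP i ai))) ; disj = λ _ _ _ _ () ; ends = λ _ _ () } , λ _ _ ())
  ; some = v , ==-refl v })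

 module Dense (partner : Rl n) (full : ∀ {x y} → X x ! → X y ! → x ≢ y → ¬ (partner x y !) → E x y !)
        (uni : ∀ {x y z} → partner x y ! → partner x z ! → y ≡ z) (dv : card (E v) ≤ 2 * D + 2) where

  N : Sub n
  N y = (y == v) ∨ E v y

  dense : (u0 : Fin n) → E v u0 ! → (∀ u (vu : E v u !) → D ≤ card (Contract.common E W X gr XW u v vu v∉X)) → Linked E X
  dense u0 vu0 many p Pr PP PS = nLevel E symm irr N D r deg cN hD v (∨-l (==-refl v)) >>= λ { (L , LN , RL , big) →
    LemmaH.linked r m IH st (record { T = L ; Q = λ _ → false ; TW = λ {y} l → NW (LN y l) ; QX = λ () ; QT = λ () ; QW = λ () ; bd = λ () ; hub = RL ; big = ≤-trans cX big }) p Pr PP PS }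
   where
   NW : ∀ {y} → N y ! → W y !
   NW {y} h = [ (λ e → subst (λ z → W z !) (sym (==-e e)) Wv) , inW' ] (∨-e {y == v} h)
   cN : card N ≤ 2 * D + 3
   cN = ≤-trans (card-∪ {U = _== v} {V = E v} (λ y → ∨-e)) (≤-trans (+-mono-≤ (≤-eq (card-sing v)) dv) (≤-eq (trans (+-comm 1 _) (+-assoc (2 * D) 2 1))))
   -- Among the vertices of `common` at most one is not a true neighbour of `u`, namely its partner
   -- if `u` is a root. The neighbour `v` makes up for it.
   degU : ∀ u → E v u ! → D ≤ card (λ z → N z ∧ E u z)
   degU u vu = +-cancelˡ-≤ 1 _ _ (≤-trans (s≤s (many u vu)) (≤-trans (+-monoʳ-≤ 1 (card-∪ {U = λ w → E v w ∧ E u w} {V = partner u} cover))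
     (≤-trans (+-monoʳ-≤ 1 (+-monoʳ-≤ _ (card-≤1 (partner u) (λ _ _ → uni)))) (≤-trans (≤-eq (cong suc (+-comm _ 1))) (+-monoʳ-≤ 1 (subst (λ k → k + card (λ w → E v w ∧ E u w) ≤ card (λ z → N z ∧ E u z)) (card-sing v)
      (card-⊎ (λ w e → subst (λ z → N z ∧ E u z !) (sym (==-e e)) (∧-i (∨-l (==-refl v)) (symm vu))) (λ w h → ∧-i (∨-r {w == v} (∧-l h)) (∧-r {E v w} h))
       (λ w e h → irr v (subst (λ z → E v z !) (==-e e) (∧-l h))))))))))
    where
    cover : ∀ w → Contract.common E W X gr XW u v vu v∉X w ! → E v w ∧ E u w ! ⊎ partner u w !
    cover w h = [ (λ e → inl (∧-i (∧-l h) e)) , (λ xx → [ inr , (λ np → inl (∧-i (∧-l h) (full (∧-l xx) (∧-r {X u} xx) (λ e → not-e (∧-l {not (w == u)} (∧-r {E v w} h)) (==-i (sym e))) np))) ] (bool (partner u w))) ]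
     (∨-e {E u w} (∧-r {not (w == u)} (∧-r {E v w} h)))
   deg : ∀ y → N y ! → D ≤ card (λ z → N z ∧ E y z)
   deg y h = [ (λ e → subst (λ y → D ≤ card (λ z → N z ∧ E y z)) (sym (==-e e)) (≤-trans (many u0 vu0) (card-mono (λ w q → ∧-i (∨-r {w == v} (∧-l q)) (∧-l q))))) , degU y ] (∨-e {y == v} h)

-- Completing the roots and closing the induction

module Complete {n p : ℕ} (E : Rl n) (W X : Sub n) (D : ℕ) (M : Massed E W X D) (Pr : Pairs n p) (PP : Proper X Pr) (PS : Strict Pr) where
 open Massed M
 open Pairs Pr
 open Proper PP

 partner : Rl n
 partner x y = anyb (λ i → act i ∧ (((x == a i) ∧ (y == b i)) ∨ ((x == b i) ∧ (y == a i))))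

 partner-e : ∀ {x y} → partner x y ! → Σ[ i ∈ Fin p ] act i ! × ((x ≡ a i × y ≡ b i) ⊎ (x ≡ b i × y ≡ a i))
 partner-e {x} {y} h = let (i , q) = anyb-e _ h in i , ∧-l q , [ (λ k → inl (==-e (∧-l k) , ==-e (∧-r {x == a i} k))) , (λ k → inr (==-e (∧-l k) , ==-e (∧-r {x == b i} k))) ]
  (∨-e {(x == a i) ∧ (y == b i)} (∧-r {act i} q))

 partner-i : ∀ {x y} i → act i ! → (x ≡ a i × y ≡ b i) ⊎ (x ≡ b i × y ≡ a i) → partner x y !
 partner-i {x} {y} i ai h = anyb-i _ i (∧-i ai ([ (λ { (e , f) → ∨-l (∧-i (==-i e) (==-i f)) }) , (λ { (e , f) → ∨-r {(x == a i) ∧ (y == b i)} (∧-i (==-i e) (==-i f)) }) ] h))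

 partner-uni : ∀ {x y z} → partner x y ! → partner x z ! → y ≡ z
 partner-uni {x} {y} {z} h k = go (partner-e h) (partner-e k)
  where
  go : Σ[ i ∈ Fin p ] act i ! × ((x ≡ a i × y ≡ b i) ⊎ (x ≡ b i × y ≡ a i)) → Σ[ i ∈ Fin p ] act i ! × ((x ≡ a i × z ≡ b i) ⊎ (x ≡ b i × z ≡ a i)) → y ≡ z
  go (i , ai , inl (e , f)) (j , aj , inl (e' , f')) = trans f (trans (cong b (aa i j ai aj (trans (sym e) e'))) (sym f'))
  go (i , ai , inr (e , f)) (j , aj , inr (e' , f')) = trans f (trans (cong a (bb i j ai aj (trans (sym e) e'))) (sym f'))
  go (i , ai , inl (e , f)) (j , aj , inr (e' , f')) with ab i j ai aj (trans (sym e) e')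
  ... | refl = void (PS i ai (trans (sym e) e'))
  go (i , ai , inr (e , f)) (j , aj , inl (e' , f')) with ab j i aj ai (trans (sym e') e)
  ... | refl = void (PS i ai (trans (sym e') e))

 partner-sym : ∀ {x y} → partner x y ! → partner y x !
 partner-sym h = let (i , ai , q) = partner-e h in partner-i i ai ([ (λ { (e , f) → inr (f , e) }) , (λ { (e , f) → inl (f , e) }) ] q)

 -- Makes roots that `common` treats as adjacent truly adjacent, except partners. Partners are left
 -- out because a link could use an edge between them.
 extra E⁺ : Rl n
 extra x y = X x ∧ (X y ∧ (not (x == y) ∧ not (partner x y)))
 E⁺ x y = E x y ∨ extra x y

 extra-e : ∀ {x y} → extra x y ! → X x ! × X y ! × x ≢ y × (partner x y ! → ⊥)
 extra-e {x} {y} h = ∧-l h , ∧-l (∧-r {X x} h) , (λ e → not-e (∧-l (∧-r {X y} (∧-r {X x} h))) (==-i e)) , not-e (∧-r {not (x == y)} (∧-r {X y} (∧-r {X x} h)))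

 extra-i : ∀ {x y} → X x ! → X y ! → x ≢ y → ¬ (partner x y !) → E⁺ x y !
 extra-i {x} {y} h k ne np = ∨-r {E x y} (∧-i h (∧-i k (∧-i (not-i (λ e → ne (==-e e))) (not-i np))))

 real⁺ : ∀ {Q : Sub n} → (∀ {y} → Q y ! → X y ! → ⊥) → ∀ {x y} → Q x ∨ Q y ! → E⁺ x y ! → E x y !
 real⁺ {Q} QX {x} {y} q h = [ (λ e → e) , (λ k → let (xx , xy , _) = extra-e k in void ([ (λ q → QX q xx) , (λ q → QX q xy) ] (∨-e {Q x} q))) ] (∨-e {E x y} h)

 massed⁺ : Massed E⁺ W X D
 massed⁺ = record
  { gr = record { symm = λ {x} {y} h → [ (λ e → ∨-l (symm e)) , (λ k → let (xx , xy , ne , np) = extra-e k in extra-i xy xx (λ e → ne (sym e)) (λ q → np (partner-sym q))) ] (∨-e {E x y} h)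
         ; irr = λ v h → [ irr v , (λ k → let (_ , _ , ne , _) = extra-e k in ne refl) ] (∨-e {E v v} h)
         ; inW = λ {x} {y} h → [ inW , (λ k → XW (∧-l k)) ] (∨-e {E x y} h) }
  ; XW = XW ; m1 = <-≤-trans m1 (ρ-mono (λ e u → ∧-i (∨-l e) u))
  ; m2 = λ Z Q V → let module V = Viol V in m2 Z Q (record { sep = record { QW = V.QW ; ZW = V.ZW ; dis = V.dis ; bd = λ q e → V.bd q (∨-l e) } ; QX = V.QX ; lt = V.lt
    ; vi = <-≤-trans V.vi (ρ-mono (λ h u → ∧-i (real⁺ V.QX u h) u)) }) }

 -- A link contains no roots but its two ends, and these are partners, so it uses none of the added
 -- edges.
 back : Linkage E⁺ X Pr → Linkage E X Pr
 back L = record { lst = lst ; path = λ i ai → mapP (λ {x} {y} mx my h → [ (λ e → e) , (λ k → bad i ai mx my (extra-e k)) ] (∨-e {E x y} h)) (path i ai) ; disj = disj ; ends = ends }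
  where
  open Linkage L
  bad : ∀ i → act i ! → ∀ {x y} {A : Set} → x ∈ lst i → y ∈ lst i → X x ! × X y ! × x ≢ y × (partner x y ! → ⊥) → A
  bad i ai mx my (xx , xy , ne , np) with ends i ai mx xx | ends i ai my xy
  ... | inl e | inl f = void (ne (trans e (sym f)))
  ... | inl e | inr f = void (np (partner-i i ai (inl (e , f))))
  ... | inr e | inl f = void (np (partner-i i ai (inr (e , f))))
  ... | inr e | inr f = void (ne (trans e (sym f)))

degree-sum : ∀ {n} (E : Rl n) (U : Sub n) → sum (λ v → b2n (U v) * card (E v)) ≤ ρ E U
degree-sum E U = ≤-trans (sum-mono (λ v → go v (U v) refl)) (≤-eq (sym (ρ-def E U)))
 where
 go : ∀ v b → U v ≡ b → b2n b * card (E v) ≤ card (λ w → E v w ∧ (U v ∨ U w))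
 go v false e = z≤n
 go v true e = ≤-trans (≤-eq (+-identityʳ _)) (card-mono (λ w h → ∧-i h (∨-l e)))

low-degree : ∀ {n} (E : Rl n) (U : Sub n) k → 1 ≤ card U → ρ E U ≤ k * card U → NN (Σ[ v ∈ Fin n ] U v ! × card (E v) ≤ k)
low-degree E U k pos le = em _ >>= λ where
  (yes h) → ret h
  (no none) → void (<-irrefl refl (begin-strict
   suc k * card U                     ≡⟨ cong (suc k *_) (card-def U) ⟩
   suc k * sum (λ v → b2n (U v))      ≡⟨ sum-*ˡ (suc k) (λ v → b2n (U v)) ⟨
   sum (λ v → suc k * b2n (U v))      ≤⟨ sum-mono (λ v → pt v (U v) (λ h → ≰⇒> (λ l → none (v , h , l)))) ⟩
   sum (λ v → b2n (U v) * card (E v)) ≤⟨ degree-sum E U ⟩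
   ρ E U                              ≤⟨ le ⟩
   k * card U                         <⟨ m<n+m (k * card U) pos ⟩
   card U + k * card U                ∎))
 where
 open ≤-Reasoning
 pt : ∀ v b → (b ! → k < card (E v)) → suc k * b2n b ≤ b2n b * card (E v)
 pt v false h = ≤-eq (*-zeroʳ k)
 pt v true h = ≤-trans (≤-eq (*-identityʳ (suc k))) (≤-trans (h refl) (≤-eq (sym (+-identityʳ _))))

below : ∀ r m → Below r m
below r zero E W X D M cW cX hD p Pr PP PS = let (y , h) = ρ-some (Massed.m1 M) in void (<⇒≱ (card-pos W (∧-l h)) cW)
below r (suc m) {n} E0 W X D0 M0 cW cX hD0 p Pr PP PS with 1 ≤? card X
... | no none = ret (record { lst = λ _ → [] ; path = λ i ai → void (none (card-pos X (Proper.inRa PP i ai))) ; disj = λ _ _ _ _ () ; ends = λ _ _ () })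
-- Raising `D` as far as possible makes the density condition tight: an average argument then gives
-- a vertex outside `X` of degree at most `2 * D + 2`.
... | yes pos = argmax {A = Σ[ D ∈ ℕ ] Massed E W X D × 6 * r ≤ D} fst (ρ E U) bound (D0 , massed⁺ , hD0) >>= λ { ((D , M , hD) , max) →
   low-degree E U (2 * D + 2) (uPos M) (tight D M hD max) >>= λ { (v , uv , dv) → em (Σ[ u ∈ Fin n ] E v u !) >>= λ where
    (no none) → finish (Step.isolated r m (below r m) (record { E = E ; W = W ; X = X ; D = D ; M = M ; cW = cW ; cX = cX ; hD = hD }) pos v (∧-l uv) (not-e (∧-r {W v} uv)) (λ u e → none (u , e)))
    (yes (u0 , vu0)) → em (Σ[ u ∈ Fin n ] Σ[ vu ∈ E v u ! ] card (Contract.common E W X (Massed.gr M) (Massed.XW M) u v vu (not-e (∧-r {W v} uv))) < D) >>= λ where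
     (yes (u , vu , few)) → finish (Step.contractLinked r m (below r m) (record { E = E ; W = W ; X = X ; D = D ; M = M ; cW = cW ; cX = cX ; hD = hD }) pos v (∧-l uv) (not-e (∧-r {W v} uv)) u vu few)
     (no none) → finish (Step.Dense.dense r m (below r m) (record { E = E ; W = W ; X = X ; D = D ; M = M ; cW = cW ; cX = cX ; hD = hD }) pos v (∧-l uv) (not-e (∧-r {W v} uv)) partner extra-i partner-uni dv u0 vu0 (λ u vu → ≮⇒≥ (λ lt → none (u , vu , lt)))) } }
 where
 open Complete E0 W X D0 M0 Pr PP PS renaming (E⁺ to E)
 U : Sub n
 U = W ∖ X
 finish : Linked E X → NN (Linkage E0 X Pr)
 finish L = L p Pr PP PS >>= λ l → ret (back l)
 uPos : ∀ {D} → Massed E W X D → 1 ≤ card U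
 uPos M = let (y , h) = ρ-some (Massed.m1 M) in card-pos U h
 bound : ∀ (x : Σ[ D ∈ ℕ ] Massed E W X D × 6 * r ≤ D) → fst x ≤ ρ E U
 bound (D , M , _) = ≤-trans (m≤m+n D (D + 0)) (≤-trans (≤-eq (sym (*-identityʳ (2 * D)))) (≤-trans (*-monoʳ-≤ (2 * D) (uPos M)) (<⇒≤ (Massed.m1 M))))
 tight : ∀ D → Massed E W X D → 6 * r ≤ D → (∀ (x : Σ[ D ∈ ℕ ] Massed E W X D × 6 * r ≤ D) → fst x ≤ D) → ρ E U ≤ (2 * D + 2) * card U
 tight D M hD max = ≮⇒≥ (λ lt → <-irrefl refl (max (suc D , record { gr = Massed.gr M ; XW = Massed.XW M ; m1 = subst (λ k → k * card U < ρ E U) two lt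
   ; m2 = λ Z Q V → let module V = Viol V in Massed.m2 M Z Q (record { sep = V.sep ; QX = V.QX ; lt = V.lt ; vi = ≤-<-trans (*-monoˡ-≤ (card Q) (*-monoʳ-≤ 2 (n≤1+n D))) V.vi }) } , m≤n⇒m≤1+n hD)))
  where
  two : 2 * D + 2 ≡ 2 * suc D
  two = trans (+-comm (2 * D) 2) (sym (*-suc 2 D))

-- the pairs with equal ends are served by one-vertex paths
linkage : ∀ r {n} (E : Rl n) (W X : Sub n) D → Massed E W X D → card X ≤ 2 * r → 6 * r ≤ D → ∀ {p} (Pr : Pairs n p) → Proper X Pr → NN (Linkage E X Pr)
linkage r {n} E W X D M cX hD {p} Pr PP = below r (card W) E W X D M ≤-refl cX hD p Pr' PP' (λ i h e → not-e (∧-r {act i} h) (==-i e)) >>= λ L → ret (build L)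
 where
 open Pairs Pr
 open Proper PP
 Pr' : Pairs n p
 Pr' = record { act = λ i → act i ∧ not (a i == b i) ; a = a ; b = b }
 PP' : Proper X Pr'
 PP' = record { inRa = λ i h → inRa i (∧-l h) ; inRb = λ i h → inRb i (∧-l h) ; aa = λ i j h k → aa i j (∧-l h) (∧-l k) ; bb = λ i j h k → bb i j (∧-l h) (∧-l k) ; ab = λ i j h k → ab i j (∧-l h) (∧-l k) }
 build : Linkage E X Pr' → Linkage E X Pr
 build L = record { lst = λ i → fst (new i) ; path = λ i ai → fst (snd (new i)) ai ; disj = λ i j ai aj m m' → dj i j ai aj (snd (snd (new i)) m) (snd (snd (new j)) m')
   ; ends = λ i ai m x → [ inl , (λ { (h , k) → L.ends i (∧-i ai h) k x }) ] (snd (snd (new i)) m) }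
  where
  module L = Linkage L
  New : Fin p → Set
  New i = Σ[ N ∈ List (Fin n) ] (act i ! → PathL E (a i) (b i) N) × (∀ {y} → y ∈ N → y ≡ a i ⊎ (not (a i == b i) ! × y ∈ L.lst i))
  new : ∀ i → New i
  new i = pick (T? (a i == b i))
   where
   pick : Dec ((a i == b i) !) → New i
   pick (yes e) = a i ∷ [] , (λ _ → subst (λ z → PathL E (a i) z (a i ∷ [])) (==-e e) one) , λ { (here e) → inl e }
   pick (no ne) = L.lst i , (λ ai → L.path i (∧-i ai (not-i ne))) , λ m → inr (not-i ne , m)
  at : ∀ i j → act i ! → act j ! → not (a j == b j) ! → a i ∈ L.lst j → i ≡ j
  at i j ai aj h m = [ aa i j ai aj , ab i j ai aj ] (L.ends j (∧-i aj h) m (inRa i ai))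
  dj : ∀ i j → act i ! → act j ! → ∀ {y} → y ≡ a i ⊎ (not (a i == b i) ! × y ∈ L.lst i) → y ≡ a j ⊎ (not (a j == b j) ! × y ∈ L.lst j) → i ≡ j
  dj i j ai aj (inl e) (inl f) = aa i j ai aj (trans (sym e) f)
  dj i j ai aj (inl refl) (inr (h , k)) = at i j ai aj h k
  dj i j ai aj (inr (h , k)) (inl refl) = sym (at j i aj ai h k)
  dj i j ai aj (inr (h , k)) (inr (h' , k')) = L.disj i j (∧-i ai h) (∧-i aj h') k k'

private module 𝔹 = xor-∧-Solver

-- Assembling the paths from tails, links and parity-breaking pieces

uniq-reverse : ∀ {A : Set} (L : List A) → Uniq L → Uniq (reverse L)
uniq-reverse {A} L u = go L [] u tt (λ _ ())
 where
 go : ∀ (L M : List A) → Uniq L → Uniq M → (∀ {x} → x ∈ L → x ∈ M → ⊥) → Uniq (foldl (λ xs x → x ∷ xs) M L)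
 go []      M u w d = w
 go (x ∷ L) M (x∉ , u) w d = go L (x ∷ M) u ((λ m → d (here refl) m) , w) (λ { m (here refl) → x∉ m ; m (there k) → d (there m) k })

record Route {n : ℕ} (E : Rl n) (a b : Fin n) (P : Fin n → Set) (o : Bool) : Set where
 constructor route
 field
  lst  : List (Fin n)
  path : PathL E a b lst
  uniq : Uniq lst
  mem  : ∀ {y} → y ∈ lst → P y
  odd  : isOdd (length lst) ≡ o

-- The parities are those of numbers of vertices. The common vertex `b` counts once, hence the
-- negation.
catR : ∀ {n} {E : Rl n} {a b c P Q o o'} → Route E a b P o → Route E b c Q o' → (∀ {y} → P y → Q y → y ≡ b) → Route E a c (λ y → P y ⊎ Q y) (not (o xor o'))
catR {n} {E} {a} {b} {c} {P} {Q} {o} {o'} (route L p u m e) (route M q w k f) d = go (shape q)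
 where
 go : Σ[ M' ∈ List (Fin n) ] M ≡ b ∷ M' → Route E a c (λ y → P y ⊎ Q y) (not (o xor o'))
 go (M' , refl) = route (L ++ M') (joinP p q) (uniq-++ L M' u (snd w) (λ x y → fst w (subst (_∈ M') (d (m x) (k (there y))) y)))
  (λ x → [ (λ y → inl (m y)) , (λ y → inr (k (there y))) ] (∈⁻ L x))
  (trans (cong isOdd (length-++ L)) (trans (isOdd-+ (length L) (length M')) (par (isOdd (length L)) (isOdd (length M')) o o' e f)))
  where
  par : ∀ x y o o' → x ≡ o → not y ≡ o' → x xor y ≡ not (o xor o')
  par true true _ _ refl refl = refl
  par true false _ _ refl refl = refl
  par false true _ _ refl refl = refl
  par false false _ _ refl refl = refl

record Tails {n k : ℕ} (E : Rl n) (W : Sub n) (s t : Fin k → Fin n) : Set where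
 field
  TS TT : Fin k → List (Fin n)
  τs τt : Fin k → Fin n
  pS : ∀ i → PathL E (s i) (τs i) (TS i)
  pT : ∀ i → PathL E (t i) (τt i) (TT i)
  uS : ∀ i → Uniq (TS i)
  uT : ∀ i → Uniq (TT i)
  dSS : ∀ {i j y} → y ∈ TS i → y ∈ TS j → i ≡ j
  dTT : ∀ {i j y} → y ∈ TT i → y ∈ TT j → i ≡ j
  dST : ∀ {i j y} → y ∈ TS i → y ∈ TT j → ⊥
  oS : ∀ {i y} → y ∈ TS i → W y ! → y ≡ τs i
  oT : ∀ {i y} → y ∈ TT i → W y ! → y ≡ τt i
  wS : ∀ i → W (τs i) !
  wT : ∀ i → W (τt i) !

-- A breaker may touch only its own tails, at `f i` the tail of `s i` and at `g i` the tail of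
-- `t i`. The missing negation in `odd`, compared with `bip`, is the break of parity.
record Breakers {n k : ℕ} (E : Rl n) (W : Sub n) (col : Fin n → Bool) {s t : Fin k → Fin n} (Tl : Tails E W s t) (flip : Sub k) : Set where
 open Tails Tl
 field
  f g : Fin k → Fin n
  FL  : Fin k → List (Fin n)
  pF  : ∀ {i} → flip i ! → PathL E (f i) (g i) (FL i)
  uF  : ∀ {i} → flip i ! → Uniq (FL i)
  dFF : ∀ {i j y} → flip i ! → flip j ! → y ∈ FL i → y ∈ FL j → i ≡ j
  oF  : ∀ {i y} → flip i ! → y ∈ FL i → W y ! → y ≡ f i ⊎ y ≡ g i
  wF  : ∀ {i} → flip i ! → W (f i) !
  wG  : ∀ {i} → flip i ! → W (g i) !
  fS  : ∀ {i j y} → flip i ! → y ∈ FL i → y ∈ TS j → i ≡ j × y ≡ f i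
  fT  : ∀ {i j y} → flip i ! → y ∈ FL i → y ∈ TT j → i ≡ j × y ≡ g i
  fg  : ∀ {i} → flip i ! → f i ≢ g i
  odd : ∀ {i} → flip i ! → isOdd (length (FL i)) ≡ col (f i) xor col (g i)

record Parts (n k : ℕ) : Set where
 field
  E H    : Rl n
  E-symm : Symm E
  HE     : ∀ {x y} → H x y ! → E x y !
  col    : Fin n → Bool
  W X    : Sub n
  bipH   : ∀ {x y} → H x y ! → col x ≡ not (col y)
  HW     : ∀ {x y} → H x y ! → W y !
  s t    : Fin k → Fin n
  Tl     : Tails E W s t
  flip   : Sub k
  Br     : Breakers E W col Tl flip
  xS     : ∀ i → X (Tails.τs Tl i) !
  xT     : ∀ i → X (Tails.τt Tl i) !
  xF     : ∀ i → flip i ! → X (Breakers.f Br i) !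
  xG     : ∀ i → flip i ! → X (Breakers.g Br i) !

module Assembly {n k : ℕ} (parts : Parts n k) where
 open Parts parts
 open Tails Tl
 open Breakers Br
 open DC k

 -- Every index has two slots for links. The slot `false` runs from the tail of `s i` to the breaker
 -- or straight to the other tail; the slot `true` is active only behind a breaker.
 aF bF : Bool → Fin k → Fin n
 aF false i = τs i
 aF true  i = g i
 bF false i = if flip i then f i else τt i
 bF true  i = τt i

 actF : Bool → Fin k → Bool
 actF false i = true
 actF true  i = flip i

 f∈ : ∀ {i} → flip i ! → f i ∈ FL i
 f∈ h = first∈ (pF h)
 g∈ : ∀ {i} → flip i ! → g i ∈ FL i
 g∈ h = last∈ (pF h)
 s∈ : ∀ i → τs i ∈ TS i
 s∈ i = last∈ (pS i)
 t∈ : ∀ i → τt i ∈ TT i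
 t∈ i = last∈ (pT i)

 s≢g : ∀ {i j} → flip j ! → τs i ≡ g j → ⊥
 s≢g {i} {j} h e = fg h (sym (snd (fS h (g∈ h) (subst (_∈ TS i) e (s∈ i)))))
 f≢t : ∀ {i j} → flip i ! → f i ≡ τt j → ⊥
 f≢t {i} {j} h e = fg h (snd (fT h (f∈ h) (subst (_∈ TT j) (sym e) (t∈ j))))
 s≢t : ∀ {i j} → τs i ≡ τt j → ⊥
 s≢t {i} {j} e = dST (s∈ i) (subst (_∈ TT j) (sym e) (t∈ j))
 g=t : ∀ {i j} → flip i ! → g i ≡ τt j → i ≡ j
 g=t {i} {j} h e = fst (fT h (g∈ h) (subst (_∈ TT j) (sym e) (t∈ j)))
 s=f : ∀ {i j} → flip j ! → τs i ≡ f j → i ≡ j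
 s=f {i} {j} h e = sym (fst (fS h (f∈ h) (subst (_∈ TS i) e (s∈ i))))
 t=t : ∀ {i j} → τt i ≡ τt j → i ≡ j
 t=t {i} {j} e = dTT (t∈ i) (subst (_∈ TT j) (sym e) (t∈ j))
 f=f : ∀ {i j} → flip i ! → flip j ! → f i ≡ f j → i ≡ j
 f=f {i} {j} h h' e = dFF h h' (f∈ h) (subst (_∈ FL j) (sym e) (f∈ h'))
 g=g : ∀ {i j} → flip i ! → flip j ! → g i ≡ g j → i ≡ j
 g=g {i} {j} h h' e = dFF h h' (g∈ h) (subst (_∈ FL j) (sym e) (g∈ h'))
 g≢f : ∀ {i j} → flip i ! → flip j ! → g i ≡ f j → ⊥
 g≢f {i} {j} h h' e with dFF h h' (g∈ h) (subst (_∈ FL j) (sym e) (f∈ h'))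
 ... | refl = fg h (sym e)

 clashB : ∀ {b : Bool} {A : Set} → b ! → b ≡ false → A
 clashB refl ()

 data BF (i : Fin k) : Bool → Set where
  viaF : flip i ! → bF false i ≡ f i → BF i false
  viaT : flip i ≡ false → bF false i ≡ τt i → BF i false
  lastT : BF i true

 bf : ∀ β i → BF i β
 bf true i = lastT
 bf false i = go (flip i) refl
  where
  go : ∀ x → flip i ≡ x → BF i false
  go true e = viaF e (cong (if_then f i else τt i) e)
  go false e = viaT e (cong (if_then f i else τt i) e)

 aaF : ∀ β β' i j → actF β i ! → actF β' j ! → aF β i ≡ aF β' j → β ≡ β' × i ≡ j
 aaF false false i j h k e = refl , dSS (s∈ i) (subst (_∈ TS j) (sym e) (s∈ j))
 aaF false true i j h k e = void (s≢g k e)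
 aaF true false i j h k e = void (s≢g h (sym e))
 aaF true true i j h k e = refl , g=g h k e

 bbF : ∀ β β' i j → actF β i ! → actF β' j ! → bF β i ≡ bF β' j → β ≡ β' × i ≡ j
 bbF true true i j h k e = refl , t=t e
 bbF false true i j h k e with bf false i
 ... | viaF fi q = void (f≢t fi (trans (sym q) e))
 ... | viaT fi q with t=t {i} {j} (trans (sym q) e)
 ...   | refl = clashB k fi
 bbF true false i j h k e with bf false j
 ... | viaF fj q = void (f≢t fj (trans (sym q) (sym e)))
 ... | viaT fj q with t=t {j} {i} (trans (sym q) (sym e))
 ...   | refl = clashB h fj
 bbF false false i j h k e with bf false i | bf false j
 ... | viaF fi q | viaF fj q' = refl , f=f fi fj (trans (sym q) (trans e q'))
 ... | viaF fi q | viaT fj q' = void (f≢t fi (trans (sym q) (trans e q')))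
 ... | viaT fi q | viaF fj q' = void (f≢t fj (trans (sym q') (trans (sym e) q)))
 ... | viaT fi q | viaT fj q' = refl , t=t (trans (sym q) (trans e q'))

 abF : ∀ β β' i j → actF β i ! → actF β' j ! → aF β i ≡ bF β' j → β ≡ β' × i ≡ j
 abF false true i j h k e = void (s≢t e)
 abF true true i j h k e = refl , g=t h e
 abF false false i j h k e with bf false j
 ... | viaF fj q = refl , s=f fj (trans e q)
 ... | viaT fj q = void (s≢t (trans e q))
 abF true false i j h k e with bf false j
 ... | viaF fj q = void (g≢f h fj (trans e q))
 ... | viaT fj q with g=t {i} {j} h (trans e q)
 ...   | refl = clashB h fj

 Pr : Pairs n (k + k)
 Pr = record { act = λ e → actF (side e) (base e) ; a = λ e → aF (side e) (base e) ; b = λ e → bF (side e) (base e) }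

 eq : ∀ {e e'} → side e ≡ side e' × base e ≡ base e' → e ≡ e'
 eq {e} {e'} (p , q) = trans (sym (mk-η e)) (trans (cong₂ mk q p) (mk-η e'))

 XaF : ∀ β i → actF β i ! → X (aF β i) !
 XaF false i h = xS i
 XaF true i h = xG i h
 XbF : ∀ β i → actF β i ! → X (bF β i) !
 XbF true i h = xT i
 XbF false i h with bf false i
 ... | viaF fi q = trans (cong X q) (xF i fi)
 ... | viaT fi q = trans (cong X q) (xT i)
 WaF : ∀ β i → actF β i ! → W (aF β i) !
 WaF false i h = wS i
 WaF true i h = wG h

 proper : Proper X Pr
 proper = record { inRa = λ e h → XaF (side e) (base e) h ; inRb = λ e h → XbF (side e) (base e) h
  ; aa = λ e e' h k q → eq (aaF (side e) (side e') (base e) (base e') h k q) ; bb = λ e e' h k q → eq (bbF (side e) (side e') (base e) (base e') h k q)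
  ; ab = λ e e' h k q → eq (abF (side e) (side e') (base e) (base e') h k q) }

 record Root (y : Fin n) (i : Fin k) (β : Bool) : Set where
  constructor rt
  field
   on : actF β i !
   at : y ≡ aF β i ⊎ y ≡ bF β i

 rootU : ∀ {y i j β β'} → Root y i β → Root y j β' → β ≡ β' × i ≡ j
 rootU {y} {i} {j} {β} {β'} (rt h (inl e)) (rt h' (inl e')) = aaF β β' i j h h' (trans (sym e) e')
 rootU {y} {i} {j} {β} {β'} (rt h (inl e)) (rt h' (inr e')) = abF β β' i j h h' (trans (sym e) e')
 rootU {y} {i} {j} {β} {β'} (rt h (inr e)) (rt h' (inl e')) = let (p , q) = abF β' β j i h' h (trans (sym e') e) in sym p , sym q
 rootU {y} {i} {j} {β} {β'} (rt h (inr e)) (rt h' (inr e')) = bbF β β' i j h h' (trans (sym e) e')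

 rootX : ∀ {y i β} → Root y i β → X y !
 rootX {i = i} {β} (rt h (inl refl)) = XaF β i h
 rootX {i = i} {β} (rt h (inr refl)) = XbF β i h

 rootS : ∀ i → Root (τs i) i false
 rootS i = rt refl (inl refl)
 rootG : ∀ {i} → flip i ! → Root (g i) i true
 rootG h = rt h (inl refl)
 rootF : ∀ {i} → flip i ! → Root (f i) i false
 rootF {i} h with bf false i
 ... | viaF _ q = rt refl (inr (sym q))
 ... | viaT h' q = clashB h h'
 rootT : ∀ i → Root (τt i) i (flip i)
 rootT i = go (flip i) refl
  where
  go : ∀ x → flip i ≡ x → Root (τt i) i x
  go true h = rt h (inr refl)
  go false h with bf false i
  ... | viaF h' _ = clashB h' h
  ... | viaT _ q = rt refl (inr (sym q))

 -- The parity of the number of vertices that the path has without a breaker.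
 π : Fin k → Bool
 π i = isOdd (length (TS i)) xor (isOdd (length (TT i)) xor not (col (τs i) xor col (τt i)))

 module Build (L : Linkage H X Pr) where
  module L = Linkage L

  On : Bool → Fin k → Fin n → Set
  On β i y = actF β i ! × y ∈ L.lst (mk i β)

  act-mk : ∀ β i → actF β i ! → Pairs.act Pr (mk i β) !
  act-mk β i h = trans (cong₂ actF (side-mk i β) (base-mk i β)) h

  onX : ∀ {β i y} → On β i y → X y ! → Root y i β
  onX {β} {i} {y} (h , m) x = rt h ([ (λ e → inl (trans e (cong₂ aF (side-mk i β) (base-mk i β)))) , (λ e → inr (trans e (cong₂ bF (side-mk i β) (base-mk i β)))) ] (L.ends (mk i β) (act-mk β i h) m x))

  linkP : ∀ β i → actF β i ! → PathL H (aF β i) (bF β i) (L.lst (mk i β))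
  linkP β i h = subst₂ (λ x y → PathL H x y (L.lst (mk i β))) (cong₂ aF (side-mk i β) (base-mk i β)) (cong₂ bF (side-mk i β) (base-mk i β)) (L.path (mk i β) (act-mk β i h))

  onW : ∀ {β i y} → On β i y → W y !
  onW {β} {i} (h , m) = pathIn1 (linkP β i h) (WaF β i h) m
   where
   pathIn1 : ∀ {x z L y} → PathL H x z L → W x ! → y ∈ L → W y !
   pathIn1 one w (here refl) = w
   pathIn1 (e ◂ p) w (here refl) = w
   pathIn1 (e ◂ p) w (there m) = pathIn1 p (HW e) m

  onDisj : ∀ {β β' i j y} → On β i y → On β' j y → β ≡ β' × i ≡ j
  onDisj {β} {β'} {i} {j} (h , m) (h' , m') = let e = L.disj (mk i β) (mk j β') (act-mk β i h) (act-mk β' j h') m m' in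
   trans (sym (side-mk i β)) (trans (cong side e) (side-mk j β')) , trans (sym (base-mk i β)) (trans (cong base e) (base-mk j β'))

  onRoot : ∀ {β β' i j y} → On β i y → Root y j β' → β ≡ β' × i ≡ j
  onRoot o ro = rootU (onX o (rootX ro)) ro

  link : ∀ β i → actF β i ! → Route E (aF β i) (bF β i) (On β i) (not (col (aF β i) xor col (bF β i)))
  link β i h = let (M , q , u , sub) = simple (linkP β i h) in route M (mapP (λ _ _ → HE) q) u (λ m → h , sub m) (bip col bipH q)

  tailS : ∀ i → Route E (s i) (τs i) (_∈ TS i) (isOdd (length (TS i)))
  tailS i = route (TS i) (pS i) (uS i) (λ m → m) refl

  tailT : ∀ i → Route E (τt i) (t i) (_∈ TT i) (isOdd (length (TT i)))
  tailT i = route (reverse (TT i)) (revP E-symm (pT i)) (uniq-reverse (TT i) (uT i)) (rev-∈ (TT i)) (cong isOdd (length-reverse (TT i)))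

  data Loc (i : Fin k) (y : Fin n) : Set where
   inS : y ∈ TS i → Loc i y
   inT : y ∈ TT i → Loc i y
   inF : flip i ! → y ∈ FL i → Loc i y
   inL : ∀ β → On β i y → Loc i y

  weaken : ∀ {x z P Q o o'} → Route E x z P o → (∀ {y} → P y → Q y) → o ≡ o' → Route E x z Q o'
  weaken (route L p u m e) h q = route L p u (λ k → h (m k)) (trans e q)

  tOn : ∀ {i j β y} → y ∈ TT i → On β j y → Root y i (flip i)
  tOn {i} m o = subst (λ z → Root z i (flip i)) (sym (oT m (onW o))) (rootT i)
  sOn : ∀ {i j β y} → y ∈ TS i → On β j y → Root y i false
  sOn {i} m o = subst (λ z → Root z i false) (sym (oS m (onW o))) (rootS i)

  plain : ∀ i → flip i ≡ false → Route E (s i) (t i) (Loc i) (π i xor flip i)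
  plain i h = go (bf false i)
   where
   go : BF i false → Route E (s i) (t i) (Loc i) (π i xor flip i)
   go (viaF h' _) = clashB h' h
   go (viaT _ q) = weaken (catR (catR (tailS i) lnk (λ m o → oS m (onW o))) (tailT i) (λ x m → [ (λ m' → void (dST m' m)) , (λ o → oT m (onW o)) ] x))
     [ [ inS , inL false ] , inT ] (trans (alg (isOdd (length (TS i))) (isOdd (length (TT i))) (col (τs i) xor col (τt i))) (cong (π i xor_) (sym h)))
    where
    lnk : Route E (τs i) (τt i) (On false i) (not (col (τs i) xor col (τt i)))
    lnk = subst (λ z → Route E (τs i) z (On false i) (not (col (τs i) xor col z))) q (link false i refl)
    alg : ∀ a b c → not (not (a xor not c) xor b) ≡ (a xor (b xor not c)) xor false
    alg = 𝔹.solve 3 (λ a b c → (𝔹.con true 𝔹.:+ ((𝔹.con true 𝔹.:+ (a 𝔹.:+ (𝔹.con true 𝔹.:+ c))) 𝔹.:+ b)) 𝔹.:= ((a 𝔹.:+ (b 𝔹.:+ (𝔹.con true 𝔹.:+ c))) 𝔹.:+ 𝔹.con false)) refl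

  broken : ∀ i → flip i ! → Route E (s i) (t i) (Loc i) (π i xor flip i)
  broken i h = go (bf false i)
   where
   go : BF i false → Route E (s i) (t i) (Loc i) (π i xor flip i)
   go (viaT h' _) = clashB h h'
   go (viaF _ q) = weaken (catR r3 (tailT i) d4) [ [ [ [ inS , inL false ] , inF h ] , inL true ] , inT ]
     (trans (alg (isOdd (length (TS i))) (isOdd (length (TT i))) (col (τs i)) (col (f i)) (col (g i)) (col (τt i))) (cong (π i xor_) (sym h)))
    where
    lnk : Route E (τs i) (f i) (On false i) (not (col (τs i) xor col (f i)))
    lnk = subst (λ z → Route E (τs i) z (On false i) (not (col (τs i) xor col z))) q (link false i refl)
    brk : Route E (f i) (g i) (_∈ FL i) (col (f i) xor col (g i))
    brk = route (FL i) (pF h) (uF h) (λ m → m) (odd h)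
    t≢ : false ! → ⊥
    t≢ ()
    r1 = catR (tailS i) lnk (λ m o → oS m (onW o))
    d2 : ∀ {y} → y ∈ TS i ⊎ On false i y → y ∈ FL i → y ≡ f i
    d2 (inl m) k = snd (fS h k m)
    d2 (inr o) k = [ (λ e → e) , (λ { refl → void (t≢ (fst (onRoot o (rootG h)))) }) ] (oF h k (onW o))
    r2 = catR r1 brk d2
    d3 : ∀ {y} → (y ∈ TS i ⊎ On false i y) ⊎ y ∈ FL i → On true i y → y ≡ g i
    d3 (inl (inl m)) o = void (t≢ (sym (fst (onRoot o (sOn m o)))))
    d3 (inl (inr o')) o = void (t≢ (fst (onDisj o' o)))
    d3 (inr k) o = [ (λ { refl → void (t≢ (sym (fst (onRoot o (rootF h))))) }) , (λ e → e) ] (oF h k (onW o))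
    r3 = catR r2 (link true i h) d3
    d4 : ∀ {y} → ((y ∈ TS i ⊎ On false i y) ⊎ y ∈ FL i) ⊎ On true i y → y ∈ TT i → y ≡ τt i
    d4 (inl (inl (inl k))) m = void (dST k m)
    d4 (inl (inl (inr o))) m = oT m (onW o)
    d4 (inl (inr k)) m = oT m (subst (λ z → W z !) (sym (snd (fT h k m))) (wG h))
    d4 (inr o) m = oT m (onW o)
    alg : ∀ a b u f g t → not (not (not (not (a xor not (u xor f)) xor (f xor g)) xor not (g xor t)) xor b) ≡ (a xor (b xor not (u xor t))) xor true
    alg = 𝔹.solve 6 (λ a b u f g t → (𝔹.con true 𝔹.:+ ((𝔹.con true 𝔹.:+ ((𝔹.con true 𝔹.:+ ((𝔹.con true 𝔹.:+ (a 𝔹.:+ (𝔹.con true 𝔹.:+ (u 𝔹.:+ f)))) 𝔹.:+ (f 𝔹.:+ g))) 𝔹.:+ (𝔹.con true 𝔹.:+ (g 𝔹.:+ t)))) 𝔹.:+ b)) 𝔹.:=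
        ((a 𝔹.:+ (b 𝔹.:+ (𝔹.con true 𝔹.:+ (u 𝔹.:+ t)))) 𝔹.:+ 𝔹.con true)) refl

  final : ∀ i → Route E (s i) (t i) (Loc i) (π i xor flip i)
  final i = go (flip i) refl
   where
   go : ∀ x → flip i ≡ x → Route E (s i) (t i) (Loc i) (π i xor flip i)
   go true h = broken i h
   go false h = plain i h

  fOn : ∀ {i j β y} → flip i ! → y ∈ FL i → On β j y → j ≡ i
  fOn {i} h m o = [ (λ e → snd (onRoot o (subst (λ z → Root z i false) (sym e) (rootF h)))) , (λ e → snd (onRoot o (subst (λ z → Root z i true) (sym e) (rootG h)))) ] (oF h m (onW o))

  locU : ∀ {i j y} → Loc i y → Loc j y → i ≡ j
  locU (inS m) (inS m') = dSS m m'
  locU (inS m) (inT m') = void (dST m m')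
  locU (inS m) (inF h k) = sym (fst (fS h k m))
  locU (inS m) (inL β o) = sym (snd (onRoot o (sOn m o)))
  locU (inT m) (inS m') = void (dST m' m)
  locU (inT m) (inT m') = dTT m m'
  locU (inT m) (inF h k) = sym (fst (fT h k m))
  locU (inT m) (inL β o) = sym (snd (onRoot o (tOn m o)))
  locU (inF h k) (inS m) = fst (fS h k m)
  locU (inF h k) (inT m) = fst (fT h k m)
  locU (inF h k) (inF h' k') = dFF h h' k k'
  locU (inF h k) (inL β o) = sym (fOn h k o)
  locU (inL β o) (inS m) = snd (onRoot o (sOn m o))
  locU (inL β o) (inT m) = snd (onRoot o (tOn m o))
  locU (inL β o) (inF h k) = fOn h k o
  locU (inL β o) (inL β' o') = snd (onDisj o o')

-- A linked set in a dense bipartite subgraph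

-- Twice the number of edges inside `U` when `H` is symmetric.
ê : ∀ {n} → Rl n → Sub n → ℕ
ê H U = sum (λ a → card (λ b → H a b ∧ (U a ∧ U b)))

xor-comm : ∀ a b → a xor b ≡ b xor a
xor-comm true true = refl
xor-comm true false = refl
xor-comm false true = refl
xor-comm false false = refl

module MaxCut {n : ℕ} (E : Rl n) (symm : Symm E) (irr : ∀ v → E v v ! → ⊥) where

 crossing : (Fin n → Bool) → Rl n
 crossing c a b = E a b ∧ (c a xor c b)

 cut : (Fin n → Bool) → ℕ
 cut c = sum (λ a → sum (λ b → b2n (crossing c a b)))

 -- A vertex with more neighbours on its own side could be moved to the other side, which would
 -- enlarge the cut.
 maxCut : NN (Σ[ c ∈ (Fin n → Bool) ] (∀ v → card (E v) ≤ 2 * card (crossing c v)))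
 maxCut = argmax cut (n * n) bound (λ _ → true) >>= λ { (c , mx) → ret (c , λ v → half c mx v) }
  where
  const : ∀ m k → sum {m} (λ _ → k) ≡ m * k
  const zero k = refl
  const (suc m) k = cong (k +_) (const m k)
  bound : ∀ c → cut c ≤ n * n
  bound c = ≤-trans (sum-mono (λ a → ≤-trans (≤-eq (sym (card-def (crossing c a)))) (card-≤n (crossing c a)))) (≤-eq (const n n))
  half : ∀ c → (∀ c' → cut c' ≤ cut c) → ∀ v → card (E v) ≤ 2 * card (crossing c v)
  half c mx v = lin (2 ∷ 1 ∷ 1 ∷ 2 ∷ []) (card (E v) ∷ card same ∷ card (crossing c v) ∷ cut c ∷ cut c' ∷ []) (λ e s x k k' → e :≤ x :+ s ⇒ k' :≤ k ⇒ k :+ (s :+ s) :≤ k' :+ (x :+ x) ⇒ qed (e :≤ 2 :* x))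
    (card-∪ (λ b e → [ (λ q → inl (∧-i e q)) , (λ q → inr (∧-i e (not-i q))) ] (bool (c v xor c b)))) (mx c')
    (move (crossing c) (crossing c') v v same (crossing c v) pt)
   where
   same : Sub n
   same b = E v b ∧ not (c v xor c b)
   c' : Fin n → Bool
   c' y = if y == v then not (c y) else c y
   c'v : ∀ {y} → (y == v) ! → c' y ≡ not (c y)
   c'v h rewrite h = refl
   c'o : ∀ {y} → ¬ ((y == v) !) → c' y ≡ c y
   c'o {y} h with y == v
   ... | true = void (h refl)
   ... | false = refl
   tog : ∀ a b → not (a xor b) ! → not a xor b !
   tog true true _ = refl
   tog false false _ = refl
   nw : ∀ {a b} → (a == v) ! → same b ! → crossing c' a b !
   nw {a} {b} av h = subst (λ z → crossing c' z b !) (sym (==-e av)) (∧-i (∧-l h) (trans (cong₂ _xor_ (c'v (==-refl v)) (c'o (λ bv → irr v (subst (λ z → E v z !) (==-e bv) (∧-l h))))) (tog (c v) (c b) (∧-r {E v b} h))))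
   swap : ∀ {a b} → crossing c' a b ! → crossing c' b a !
   swap {a} {b} h = ∧-i (symm (∧-l h)) (trans (xor-comm (c' b) (c' a)) (∧-r {E a b} h))
   ex : ∀ {a b} → crossing c a b ! → (a == v) ∧ same b ! → ⊥
   ex {a} {b} h q = not-e (∧-r {E v b} (∧-r {a == v} q)) (subst (λ z → c z xor c b !) (==-e (∧-l q)) (∧-r {E a b} h))
   pt : ∀ a b → b2n (crossing c a b) + (b2n ((a == v) ∧ same b) + b2n ((b == v) ∧ same a)) ≤ b2n (crossing c' a b) + (b2n ((a == v) ∧ crossing c v b) + b2n ((b == v) ∧ crossing c v a))
   pt a b = excl (λ h q → ex {a} {b} h q) (λ h q → ex {b} {a} (∧-i (symm (∧-l h)) (trans (xor-comm (c b) (c a)) (∧-r {E a b} h))) q)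
     (λ q q' → irr v (subst (λ z → E v z !) (==-e (∧-l q')) (∧-l (∧-r {a == v} q))))
     (λ h → one-of {crossing c' a b} {(a == v) ∧ crossing c v b} (old h)) (λ q → one-of {crossing c' a b} {(a == v) ∧ crossing c v b} (inl (nw {a} {b} (∧-l q) (∧-r {a == v} q))))
     (λ q → one-of {crossing c' a b} {(a == v) ∧ crossing c v b} (inl (swap {b} {a} (nw {b} {a} (∧-l q) (∧-r {b == v} q)))))
    where
    old : crossing c a b ! → crossing c' a b ! ⊎ (a == v) ∧ crossing c v b ! ⊎ (b == v) ∧ crossing c v a !
    old h = [ (λ av → inr (inl (∧-i av (subst (λ z → crossing c z b !) (==-e av) h)))) ,
     (λ na → [ (λ bv → inr (inr (∧-i bv (subst (λ z → crossing c z a !) (==-e bv) (∧-i (symm (∧-l h)) (trans (xor-comm (c b) (c a)) (∧-r {E a b} h))))))) ,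
      (λ nb → inl (∧-i (∧-l h) (trans (cong₂ _xor_ (c'o na) (c'o nb)) (∧-r {E a b} h)))) ] (bool (b == v))) ] (bool (a == v))

record BipData (n : ℕ) : Set where
 field
  H     : Rl n
  symm  : Symm H
  irr   : ∀ v → H v v ! → ⊥
  col   : Fin n → Bool
  bipH  : ∀ {x y} → H x y ! → col x ≡ not (col y)
  r k q : ℕ
  rq    : q + 1 ≡ 2 * r
  rk    : r ≤ 2 * k
  r≥1   : 1 ≤ r
  deg   : ∀ v → 24 * r + 2 * k ≤ 2 * card (H v)
  n≥    : 6 * r ≤ n

module DenseBip {n : ℕ} (data-B : BipData n) where
 open BipData data-B

 κ : ℕ
 κ = 24 * r + 2 * k

 -- Mader's potential: at least `κ / 4` edges for each vertex beyond the first `q`. A smallest set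
 -- of this kind has large minimum degree and no separation of order at most `q`.
 record Heavy (U : Sub n) : Set where
  field
   size : 6 * r ≤ card U
   mass : κ * card U ≤ 2 * ê H U + κ * q

 all : Sub n
 all _ = true

 heavyAll : Heavy all
 heavyAll = record { size = ≤-trans n≥ (≤-eq (sym (card-full n))) ; mass = ≤-trans (≤-trans (≤-eq (trans (cong (κ *_) (trans (card-def all) refl)) (sym (sum-*ˡ {n} κ (λ v → 1)))))
  (≤-trans (sum-mono (λ v → ≤-trans (≤-eq (*-identityʳ κ)) (≤-trans (deg v) (*-monoʳ-≤ 2 (card-mono (λ b h → ∧-i h refl)))))) (≤-eq (sum-*ˡ 2 (λ a → card (λ b → H a b ∧ true)))))) (m≤m+n _ _) }

 ê-split : ∀ {U V V'} → (∀ {a b} → H a b ! → U a ! → U b ! → V a ∧ V b ! ⊎ V' a ∧ V' b !) → ê H U ≤ ê H V + ê H V'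
 ê-split {U} {V} {V'} h = ≤-trans (sum-mono (λ a → card-∪ {U = λ b → H a b ∧ (V a ∧ V b)} {V = λ b → H a b ∧ (V' a ∧ V' b)} (λ b e →
   [ (λ p → inl (∧-i (∧-l {H a b} e) p)) , (λ p → inr (∧-i (∧-l {H a b} e) p)) ] (h (∧-l {H a b} e) (∧-l (∧-r {H a b} e)) (∧-r {U a} (∧-r {H a b} e))))))
  (≤-eq (sum-+ (λ a → card (λ b → H a b ∧ (V a ∧ V b))) (λ a → card (λ b → H a b ∧ (V' a ∧ V' b)))))

 wcard : ∀ (U : Sub n) m → sum (λ a → b2n (U a) * m) ≡ m * card U
 wcard U m = trans (sum-cong (λ a → *-comm (b2n (U a)) m)) (trans (sum-*ˡ m (λ a → b2n (U a))) (cong (m *_) (sym (card-def U))))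

 ê-sq : ∀ U → ê H U ≤ card U * card U
 ê-sq U = ≤-trans (sum-mono (λ a → pt a (U a) refl)) (≤-eq (wcard U (card U)))
  where
  pt : ∀ a x → U a ≡ x → card (λ b → H a b ∧ (U a ∧ U b)) ≤ b2n x * card U
  pt a true e = ≤-trans (card-mono (λ b h → ∧-r {U a} (∧-r {H a b} h))) (≤-eq (sym (+-identityʳ _)))
  pt a false e = ≤-eq (card-∅ _ (λ b h → t≢f (trans (sym (∧-l (∧-r {H a b} h))) e)))

 ê-bip : ∀ U → ê H U ≤ 2 * (card (λ y → U y ∧ col y) * card (λ y → U y ∧ not (col y)))
 ê-bip U = ≤-trans (sum-mono (λ a → pt a (U a) (col a) refl refl)) (≤-eq (trans (sum-+ (λ a → b2n (U a ∧ col a) * card Y) (λ a → b2n (U a ∧ not (col a)) * card X))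
   (trans (cong₂ _+_ (wcard X (card Y)) (trans (wcard Y (card X)) (sym (+-identityʳ _)))) (cong (λ z → z + (card X * card Y + 0)) (*-comm (card Y) (card X))))))
  where
  X Y : Sub n
  X y = U y ∧ col y
  Y y = U y ∧ not (col y)
  pt : ∀ a x c → U a ≡ x → col a ≡ c → card (λ b → H a b ∧ (U a ∧ U b)) ≤ b2n (x ∧ c) * card Y + b2n (x ∧ not c) * card X
  pt a false c e f = ≤-eq (card-∅ _ (λ b h → t≢f (trans (sym (∧-l (∧-r {H a b} h))) e)))
  pt a true true e f = ≤-trans (card-mono {U = Y} (λ b h → ∧-i (∧-r {U a} (∧-r {H a b} h)) (trans (sym (bipH (∧-l h))) f))) (≤-trans (≤-eq (sym (+-identityʳ _))) (m≤m+n _ _))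
  pt a true false e f = ≤-trans (card-mono {U = X} (λ b h → ∧-i (∧-r {U a} (∧-r {H a b} h)) (nt (trans (sym (bipH (∧-l h))) f)))) (≤-eq (sym (+-identityʳ _)))
   where nt : ∀ {b} → not b ≡ false → b !
         nt {true} _ = refl

 am-gm : ∀ a b → 4 * (a * b) ≤ (a + b) * (a + b)
 am-gm a b = [ go a b , (λ h → subst₂ (λ x y → 4 * x ≤ y * y) (*-comm b a) (+-comm b a) (go b a h)) ] (≤-total a b)
  where
  go : ∀ a b → a ≤ b → 4 * (a * b) ≤ (a + b) * (a + b)
  go a b h with m≤n⇒∃[o]m+o≡n h
  ... | d , refl = ≤-trans (m≤m+n _ (d * d)) (≤-eq (+-*-Solver.solve 2 (λ a d → con 4 :*' (a :*' (a :+' d)) :+' d :*' d :=' (a :+' (a :+' d)) :*' (a :+' (a :+' d))) refl a d))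
   where open +-*-Solver using (con) renaming (_:*_ to _:*'_; _:+_ to _:+'_; _:=_ to _:='_)

 Result : Set
 Result = Σ[ W ∈ Sub n ] 6 * r ≤ card W × (∀ R → (∀ y → R y ! → W y !) → card R ≤ 2 * r →
  Σ[ X ∈ Sub n ] (∀ y → R y ! → X y !) × (∀ p (Pr : Pairs n p) → Proper X Pr → NN (Linkage (λ x y → H x y ∧ (W x ∧ W y)) X Pr)))

 module Min (W : Sub n) (hv : Heavy W) (min : ∀ U → Heavy U → card W ≤ card U) where
  open Heavy hv

  light : ∀ U → card U < card W → 6 * r ≤ card U → 2 * ê H U + κ * q < κ * card U
  light U lt sz = ≰⇒> (λ le → <⇒≱ lt (min U (record { size = sz ; mass = le })))

  -- A set of exactly `6 * r` vertices cannot hold the edges that `mass` requires, even by the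
  -- trivial bound `ê-sq`.
  big : 6 * r < card W
  big = ≤∧≢⇒< size (λ e → bad (trans (cong (λ c → c * c) (sym e)) (+-*-Solver.solve 1 (λ r → (con 6 :*' r) :*' (con 6 :*' r) :=' con 36 :*' (r :*' r)) refl r)) e)
   where
   open +-*-Solver using (con) renaming (_:*_ to _:*'_; _:+_ to _:+'_; _:=_ to _:='_)
   bad : card W * card W ≡ 36 * (r * r) → 6 * r ≡ card W → ⊥
   bad sq e = lin (1 ∷ 2 ∷ 36 ∷ 3 ∷ 36 ∷ []) (r ∷ k ∷ r * r ∷ k * r ∷ r * q ∷ k * q ∷ ê H W ∷ []) (λ r k rr kr rq kq e → 144 :* rr :+ 12 :* kr :≤ 2 :* e :+ (24 :* rq :+ 2 :* kq) ⇒ e :≤ 36 :* rr ⇒ rq :+ r :≤ 2 :* rr ⇒ kq :+ k :≤ 2 :* kr ⇒ # 1 :≤ r ⇒ absurd)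
     (subst₂ _≤_ (trans (cong (κ *_) (sym e)) (+-*-Solver.solve 2 (λ r k → (con 24 :*' r :+' con 2 :*' k) :*' (con 6 :*' r) :=' con 144 :*' (r :*' r) :+' con 12 :*' (k :*' r)) refl r k))
      (cong (2 * ê H W +_) (+-*-Solver.solve 3 (λ r k q → (con 24 :*' r :+' con 2 :*' k) :*' q :=' con 24 :*' (r :*' q) :+' con 2 :*' (k :*' q)) refl r k q)) mass)
     (≤-trans (ê-sq W) (≤-eq sq)) (≤-eq (mulq r)) (≤-eq (mulq k)) r≥1
    where
    mulq : ∀ x → x * q + x ≡ 2 * (x * r)
    mulq x = trans (+-*-Solver.solve 2 (λ x q → x :*' q :+' x :=' x :*' (q :+' con 1)) refl x q) (trans (cong (x *_) rq) (+-*-Solver.solve 2 (λ x r → x :*' (con 2 :*' r) :=' con 2 :*' (x :*' r)) refl x r))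

  dW : Fin n → ℕ
  dW v = card (λ b → H v b ∧ W b)

  -- Removing a vertex of smaller degree would leave a smaller heavy set; `big` ensures that the
  -- remaining set still meets the bound on the size.
  minDeg : ∀ v → W v ! → 6 * r ≤ dW v
  minDeg v wv = lin (1 ∷ 1 ∷ 2 ∷ 1 ∷ 4 ∷ []) (r ∷ k ∷ dW v ∷ ê H W ∷ ê H W' ∷ κ * card W' ∷ κ * card W ∷ κ * q ∷ []) (λ r k d e e' kw' kw kq → kw :≤ 2 :* e :+ kq ⇒ 2 :* e' :+ kq :< kw' ⇒ e :≤ e' :+ (d :+ d) ⇒ kw' :+ (24 :* r :+ 2 :* k) :≤ kw ⇒ qed (6 :* r :≤ d))
    mass (light W' sm (≤-pred (≤-trans big c1))) spl (≤-trans (≤-eq (trans (+-comm (κ * card W') κ) (sym (*-suc κ (card W'))))) (*-monoʳ-≤ κ sm))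
   where
   W' : Sub n
   W' y = W y ∧ not (y == v)
   sm : card W' < card W
   sm = card-strict {S = W'} {U = W} (λ y → ∧-l) v wv (λ h → not-e (∧-r {W v} h) (==-refl v))
   c1 : card W ≤ suc (card W')
   c1 = ≤-trans (card-∪ {U = _== v} {V = W'} (λ y w → [ inl , (λ ne → inr (∧-i w (not-i ne))) ] (bool (y == v)))) (≤-eq (cong (_+ card W') (card-sing v)))
   nb : Sub n
   nb b = H v b ∧ W b
   dbl : Rl n → ℕ
   dbl e = sum (λ a → sum (λ b → b2n (e a b)))
   asSum : ∀ U → ê H U ≡ dbl (λ a b → H a b ∧ (U a ∧ U b))
   asSum U = sum-cong (λ a → card-def (λ b → H a b ∧ (U a ∧ U b)))
   spl : ê H W ≤ ê H W' + (dW v + dW v)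
   spl = subst₂ _≤_ (trans (cong₂ _+_ (sym (asSum W)) (cong₂ _+_ (card-∅ {n} (λ _ → false) (λ _ ())) (card-∅ {n} (λ _ → false) (λ _ ())))) (+-identityʳ _)) (cong (_+ (dW v + dW v)) (sym (asSum W')))
     (move (λ a b → H a b ∧ (W a ∧ W b)) (λ a b → H a b ∧ (W' a ∧ W' b)) v v (λ _ → false) nb pt)
    where
    pt : ∀ a b → b2n (H a b ∧ (W a ∧ W b)) + (b2n ((a == v) ∧ false) + b2n ((b == v) ∧ false)) ≤ b2n (H a b ∧ (W' a ∧ W' b)) + (b2n ((a == v) ∧ nb b) + b2n ((b == v) ∧ nb a))
    pt a b = excl (λ _ h → t≢f (sym (∧-r {a == v} h))) (λ _ h → t≢f (sym (∧-r {b == v} h))) (λ _ h → t≢f (sym (∧-r {b == v} h)))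
     (λ h → one-of {H a b ∧ (W' a ∧ W' b)} {(a == v) ∧ nb b} (old h)) (λ h → void (t≢f (sym (∧-r {a == v} h)))) (λ h → void (t≢f (sym (∧-r {b == v} h))))
     where
     old : H a b ∧ (W a ∧ W b) ! → H a b ∧ (W' a ∧ W' b) ! ⊎ (a == v) ∧ nb b ! ⊎ (b == v) ∧ nb a !
     old h = [ (λ av → inr (inl (∧-i av (∧-i (subst (λ z → H z b !) (==-e av) (∧-l h)) (∧-r {W a} (∧-r {H a b} h)))))) ,
      (λ na → [ (λ bv → inr (inr (∧-i bv (∧-i (subst (λ z → H z a !) (==-e bv) (symm (∧-l h))) (∧-l (∧-r {H a b} h)))))) ,
       (λ nb → inl (∧-i (∧-l {H a b} h) (∧-i (∧-i (∧-l {W a} (∧-r {H a b} h)) (not-i na)) (∧-i (∧-r {W a} (∧-r {H a b} h)) (not-i nb))))) ] (bool (b == v))) ] (bool (a == v))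

  Hw : Rl n
  Hw x y = H x y ∧ (W x ∧ W y)

  -- Both sides, each taken with its boundary, are smaller than `W` and, by `minDeg`, large enough;
  -- hence neither has enough edges. Adding the two deficits contradicts `mass`, because the sides
  -- overlap in at most `q` vertices.
  noSep : ∀ Z Q → Sep Hw W Z Q → card Z ≤ q → ∀ q0 w0 → Q q0 ! → W w0 ! → (Q w0 ! → ⊥) → (Z w0 ! → ⊥) → ⊥
  noSep Z Q sp cZ q0 w0 qq ww nq nz = lin (1 ∷ 1 ∷ 1 ∷ 2 ∷ 1 ∷ 1 ∷ []) (κ * card P ∷ κ * card P' ∷ κ * card W ∷ κ * card Z ∷ κ * q ∷ ê H W ∷ ê H P ∷ ê H P' ∷ [])
    (λ p p' w z q e f f' → w :≤ 2 :* e :+ q ⇒ 2 :* f :+ q :< p ⇒ 2 :* f' :+ q :< p' ⇒ e :≤ f :+ f' ⇒ p :+ p' :≤ w :+ z ⇒ z :≤ q ⇒ absurd)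
    mass (light P pw p6) (light P' pw' p6') (ê-split {W} {P} {P'} spl) cards (*-monoʳ-≤ κ cZ)
   where
   open Sep sp
   P P' : Sub n
   P y = Q y ∨ Z y
   P' y = W y ∧ not (Q y)
   PW : ∀ y → P y ! → W y !
   PW y h = [ QW , ZW ] (∨-e {Q y} h)
   pw : card P < card W
   pw = card-strict {S = P} {U = W} PW w0 ww (λ h → [ nq , nz ] (∨-e {Q w0} h))
   pw' : card P' < card W
   pw' = card-strict {S = P'} {U = W} (λ y → ∧-l) q0 (QW qq) (λ h → not-e (∧-r {W q0} h) qq)
   p6 : 6 * r ≤ card P
   p6 = ≤-trans (minDeg q0 (QW qq)) (card-mono (λ y h → [ ∨-l , ∨-r {Q y} ] (bd qq (∧-i (∧-l {H q0 y} h) (∧-i (QW qq) (∧-r {H q0 y} h))))))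
   p6' : 6 * r ≤ card P'
   p6' = ≤-trans (minDeg w0 ww) (card-mono (λ y h → ∧-i (∧-r {H w0 y} h) (not-i (λ qy → [ nq , nz ] (bd qy (∧-i (symm (∧-l h)) (∧-i (∧-r {H w0 y} h) ww)))))))
   spl : ∀ {a b} → H a b ! → W a ! → W b ! → P a ∧ P b ! ⊎ P' a ∧ P' b !
   spl {a} {b} e wa wb = [ (λ qa → inl (∧-i (∨-l qa) ([ ∨-l , ∨-r {Q b} ] (bd qa (∧-i e (∧-i wa wb)))))) ,
    (λ na → [ (λ qb → inl (∧-i ([ ∨-l , ∨-r {Q a} ] (bd qb (∧-i (symm e) (∧-i wb wa)))) (∨-l qb))) , (λ nb → inr (∧-i (∧-i wa (not-i na)) (∧-i wb (not-i nb)))) ] (bool (Q b))) ] (bool (Q a))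
   cards : κ * card P + κ * card P' ≤ κ * card W + κ * card Z
   cards = ≤-trans (≤-eq (sym (*-distribˡ-+ κ (card P) (card P')))) (≤-trans (*-monoʳ-≤ κ (lin (1 ∷ 1 ∷ 1 ∷ []) (card P ∷ card P' ∷ card Q ∷ card Z ∷ card W ∷ []) (λ p p' q z w → p :≤ q :+ z ⇒ q :+ p' :≤ w ⇒ qed (p :+ p' :≤ w :+ z))
    (card-∪ (λ y → ∨-e)) (card-⊎ (λ y → QW) (λ y → ∧-l) (λ y h h' → not-e (∧-r {W y} h') h)))) (≤-eq (*-distribˡ-+ κ (card W) (card Z))))

  massed : ∀ X → (∀ y → X y ! → W y !) → card X ≡ 2 * r → Massed Hw W X (6 * r)
  massed X XW cX = record
   { gr = record { symm = λ {a} {b} h → ∧-i (symm (∧-l h)) (∧-i (∧-r {W a} (∧-r {H a b} h)) (∧-l (∧-r {H a b} h))) ; irr = λ v h → irr v (∧-l h) ; inW = λ {a} {b} h → ∧-l (∧-r {H a b} h) }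
   ; XW = λ {y} → XW y ; m1 = mass1
   ; m2 = λ Z Q V → let module V = Viol V
                        (q0 , qq) = ρ-some V.vi
                        (w0 , h) = card-ex (X ∖ Z) (+-cancelʳ-≤ (card Z) 1 _ (≤-trans V.lt (card-∪ {U = X ∖ Z} {V = Z} (λ y x → [ inr , (λ nz → inl (∧-i x (not-i nz))) ] (bool (Z y)))))) in
     noSep Z Q V.sep (≤-pred (≤-trans V.lt (≤-eq (trans cX (trans (sym rq) (+-comm q 1)))))) q0 w0 qq (XW w0 (∧-l h)) (λ q → V.QX q (∧-l h)) (not-e (∧-r {X w0} h)) }
   where
   open +-*-Solver using (con) renaming (_:*_ to _:*'_; _:+_ to _:+'_; _:=_ to _:='_)
   w = card (W ∖ X)
   eSplit : ê H W ≤ ρ Hw (W ∖ X) + ê H X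
   eSplit = ≤-trans (sum-mono (λ a → card-∪ {U = λ b → Hw a b ∧ ((W ∖ X) a ∨ (W ∖ X) b)} {V = λ b → H a b ∧ (X a ∧ X b)} (λ b h → pt a b h)))
     (≤-eq (trans (sum-+ (λ a → card (λ b → Hw a b ∧ ((W ∖ X) a ∨ (W ∖ X) b))) (λ a → card (λ b → H a b ∧ (X a ∧ X b)))) (cong (_+ ê H X) (sym (ρ-def Hw (W ∖ X))))))
    where
    pt : ∀ a b → H a b ∧ (W a ∧ W b) ! → Hw a b ∧ ((W ∖ X) a ∨ (W ∖ X) b) ! ⊎ H a b ∧ (X a ∧ X b) !
    pt a b h = [ (λ xx → inr (∧-i (∧-l {H a b} h) xx)) , (λ nx → inl (∧-i h ([ (λ xa → ∨-r {(W ∖ X) a} (∧-i (∧-r {W a} (∧-r {H a b} h)) (not-i (λ xb → nx (∧-i xa xb))))) , (λ na → ∨-l (∧-i (∧-l {W a} (∧-r {H a b} h)) (not-i na))) ] (bool (X a))))) ] (bool (X a ∧ X b))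
   -- `2 * r` vertices of a bipartite graph span at most `r * r` edges.
   eX : 2 * ê H X ≤ 4 * (r * r)
   eX = ≤-trans (*-monoʳ-≤ 2 (ê-bip X)) (≤-trans (≤-eq (sym (*-assoc 2 2 (card (λ y → X y ∧ col y) * card (λ y → X y ∧ not (col y)))))) (≤-trans (am-gm (card (λ y → X y ∧ col y)) (card (λ y → X y ∧ not (col y)))) (≤-trans (*-mono-≤ c2 c2)
     (≤-eq (+-*-Solver.solve 1 (λ r → (con 2 :*' r) :*' (con 2 :*' r) :=' con 4 :*' (r :*' r)) refl r)))))
    where
    c2 : card (λ y → X y ∧ col y) + card (λ y → X y ∧ not (col y)) ≤ 2 * r
    c2 = ≤-trans (card-⊎ {S = X} (λ y → ∧-l) (λ y → ∧-l) (λ y h h' → not-e (∧-r {X y} h') (∧-r {X y} h))) (≤-eq cX)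
   cW : w + 2 * r ≡ card W
   cW = ≤-antisym (subst (λ z → w + z ≤ card W) cX (card-⊎ (λ y → ∧-l) XW (λ y h x → not-e (∧-r {W y} h) x)))
    (subst (λ z → card W ≤ w + z) cX (card-∪ {U = W ∖ X} {V = X} (λ y wy → [ inr , (λ nx → inl (∧-i wy (not-i nx))) ] (bool (X y)))))
   w≥ : 4 * r + 1 ≤ w
   w≥ = lin (1 ∷ 1 ∷ 1 ∷ []) (r ∷ w ∷ card W ∷ []) (λ r w c → 6 :* r :< c ⇒ c :≤ w :+ 2 :* r ⇒ qed (4 :* r :+ # 1 :≤ w)) big (≤-eq (sym cW))
   rw : 4 * (r * r) ≤ r * w
   rw = ≤-trans (≤-eq (+-*-Solver.solve 1 (λ r → con 4 :*' (r :*' r) :=' r :*' (con 4 :*' r)) refl r)) (*-monoʳ-≤ r (≤-trans (m≤m+n (4 * r) 1) w≥))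
   kw : r * w ≤ 2 * (k * w)
   kw = ≤-trans (*-monoˡ-≤ w rk) (≤-eq (*-assoc 2 k w))
   κw : κ * card W ≡ 24 * (r * w) + 2 * (k * w) + (κ * q + κ)
   κw = trans (cong (κ *_) (sym cW)) (trans (*-distribˡ-+ κ w (2 * r)) (cong₂ _+_ (+-*-Solver.solve 3 (λ r k w → (con 24 :*' r :+' con 2 :*' k) :*' w :=' con 24 :*' (r :*' w) :+' con 2 :*' (k :*' w)) refl r k w)
    (trans (cong (κ *_) (sym rq)) (trans (*-distribˡ-+ κ q 1) (cong (κ * q +_) (*-identityʳ κ))))))
   -- Here the term `2 * k` of `κ` is spent: `4 * (r * r) ≤ r * w ≤ 2 * (k * w)` covers the edges
   -- among the roots.
   mass1 : 2 * (6 * r) * w < ρ Hw (W ∖ X)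
   mass1 = subst (_< ρ Hw (W ∖ X)) (+-*-Solver.solve 2 (λ r w → con 12 :*' (r :*' w) :=' con 2 :*' (con 6 :*' r) :*' w) refl r w)
    (lin (1 ∷ 2 ∷ 1 ∷ 1 ∷ 1 ∷ 24 ∷ 2 ∷ []) (r * w ∷ k * w ∷ r * r ∷ κ * q ∷ r ∷ k ∷ ê H W ∷ ê H X ∷ ρ Hw (W ∖ X) ∷ [])
     (λ rw kw rr kq r k e x ρ → 24 :* rw :+ 2 :* kw :+ (kq :+ (24 :* r :+ 2 :* k)) :≤ 2 :* e :+ kq ⇒ e :≤ ρ :+ x ⇒ 2 :* x :≤ 4 :* rr ⇒ 4 :* rr :≤ rw ⇒ rw :≤ 2 :* kw ⇒ # 1 :≤ r ⇒ qed (12 :* rw :< ρ))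
     (subst (_≤ 2 * ê H W + κ * q) κw mass) eSplit eX rw kw r≥1)

  result : Result
  result = W , size , λ R RW cR →
   let (X , RX , XW , cX) = pad R W (2 * r) RW cR (≤-trans (*-monoˡ-≤ r {2} {6} (s≤s (s≤s z≤n))) size) in
   X , RX , λ p Pr PP → linkage r Hw W X (6 * r) (massed X XW cX) (≤-eq cX) ≤-refl Pr PP

 dense : NN Result
 dense = argmin {A = Σ (Sub n) Heavy} (λ x → card (fst x)) (all , heavyAll) >>= λ { ((W , hv) , min) → ret (Min.result W hv (λ U h → min (U , h))) }

-- Prescribing parities, and choosing the tails

record Answer {n k : ℕ} (E : Rl n) (s t : Fin k → Fin n) (inI : Sub k) (want : Fin k → Bool) : Set where
 field
  lst  : Fin k → List (Fin n)
  path : ∀ i → PathL E (s i) (t i) (lst i)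
  uniq : ∀ i → Uniq (lst i)
  disj : ∀ {i j y} → y ∈ lst i → y ∈ lst j → i ≡ j
  par  : ∀ i → inI i ! → isOdd (length (lst i)) ≡ want i

natural : ∀ {n k} {E : Rl n} {W : Sub n} {s t : Fin k → Fin n} → (Fin n → Bool) → Tails E W s t → Fin k → Bool
natural col Tl i = isOdd (length (TS i)) xor (isOdd (length (TT i)) xor not (col (τs i) xor col (τt i)))
 where open Tails Tl

flipped : ∀ {n k} {E : Rl n} {W : Sub n} {s t : Fin k → Fin n} → (Fin n → Bool) → Tails E W s t → Sub k → (Fin k → Bool) → Sub k
flipped col Tl inI want i = inI i ∧ (natural col Tl i xor want i)

module _ {n k : ℕ} (E H : Rl n) (E-symm : Symm E) (HE : ∀ {x y} → H x y ! → E x y !) (col : Fin n → Bool) (W X : Sub n)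
     (bipH : ∀ {x y} → H x y ! → col x ≡ not (col y)) (HW : ∀ {x y} → H x y ! → W y !)
     {s t : Fin k → Fin n} (Tl : Tails E W s t) (inI : Sub k) (want : Fin k → Bool) where

 answer : (Br : Breakers E W col Tl (flipped col Tl inI want)) →
  (∀ i → X (Tails.τs Tl i) !) → (∀ i → X (Tails.τt Tl i) !) → (∀ i → flipped col Tl inI want i ! → X (Breakers.f Br i) !) → (∀ i → flipped col Tl inI want i ! → X (Breakers.g Br i) !) →
  (∀ p (Pr : Pairs n p) → Proper X Pr → NN (Linkage H X Pr)) → NN (Answer E s t inI want)
 answer Br xS xT xF xG lk = lk (k + k) (Assembly.Pr parts) (Assembly.proper parts) >>= λ L → ret (build L)
  where
  parts : Parts n k
  parts = record { E = E ; H = H ; E-symm = λ {u} {v} → E-symm {u} {v} ; HE = HE ; col = col ; W = W ; X = X ; bipH = bipH ; HW = HW ; s = s ; t = t ; Tl = Tl ; flip = flipped col Tl inI want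
   ; Br = Br ; xS = xS ; xT = xT ; xF = xF ; xG = xG }
  build : Linkage H X (Assembly.Pr parts) → Answer E s t inI want
  build L = record { lst = λ i → Route.lst (final i) ; path = λ i → Route.path (final i) ; uniq = λ i → Route.uniq (final i)
    ; disj = λ {i} {j} m m' → Assembly.Build.locU parts L (Route.mem (final i) m) (Route.mem (final j) m')
    ; par = λ i h → trans (Route.odd (final i)) (trans (cong (λ b → natural col Tl i xor (b ∧ (natural col Tl i xor want i))) h) (cancel (natural col Tl i) (want i))) }
   where
   final : ∀ i → Route E (s i) (t i) (Assembly.Build.Loc parts L i) (natural col Tl i xor flipped col Tl inI want i)
   final = Assembly.Build.final parts L
   cancel : ∀ a b → a xor (a xor b) ≡ b
   cancel true true = refl
   cancel true false = refl
   cancel false b = refl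

card-suc : ∀ {k} (S : Sub (suc k)) → card S ≡ b2n (S zero) + card (λ i → S (suc i))
card-suc S = trans (card-def S) (cong (b2n (S zero) +_) (sym (card-def (λ i → S (suc i)))))

inject : ∀ {k n} (S : Sub k) (U : Sub n) → Fin n → card S ≤ card U →
 Σ[ f ∈ (Fin k → Fin n) ] (∀ i → S i ! → U (f i) !) × (∀ i j → S i ! → S j ! → f i ≡ f j → i ≡ j)
inject {zero} S U d le = (λ ()) , (λ ()) , λ ()
inject {suc k} {n} S U d le = go (S zero) refl
 where
 go : ∀ b → S zero ≡ b → Σ[ f ∈ (Fin (suc k) → Fin n) ] (∀ i → S i ! → U (f i) !) × (∀ i j → S i ! → S j ! → f i ≡ f j → i ≡ j)
 go false e = let (f , h , inj) = inject (λ i → S (suc i)) U d (≤-trans (m≤n+m _ (b2n (S zero))) (≤-trans (≤-eq (sym (card-suc S))) le)) in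
  (λ { zero → d ; (suc i) → f i }) , (λ { zero q → void (t≢f (trans (sym q) e)) ; (suc i) q → h i q }) ,
  λ { zero _ q _ _ → void (t≢f (trans (sym q) e)) ; (suc i) zero _ q _ → void (t≢f (trans (sym q) e)) ; (suc i) (suc j) p q r → cong suc (inj i j p q r) }
 go true e = let le' : suc (card (λ i → S (suc i))) ≤ card U
                 le' = ≤-trans (≤-eq (sym (trans (card-suc S) (cong (λ b → b2n b + card (λ i → S (suc i))) e)))) le
                 (u , hu) = card-ex U (≤-trans (s≤s z≤n) le')
                 (f , h , inj) = inject (λ i → S (suc i)) (λ y → U y ∧ not (y == u)) d (≤-pred (≤-trans le' (≤-trans (card-∪ {U = _== u} {V = λ y → U y ∧ not (y == u)} (λ y p → [ inl , (λ ne → inr (∧-i p (not-i ne))) ] (bool (y == u))))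
                                   (≤-eq (cong (_+ card (λ y → U y ∧ not (y == u))) (card-sing u))))))
                 away : ∀ i → S (suc i) ! → f i ≢ u
                 away = λ i p q → not-e (∧-r {U (f i)} (h i p)) (==-i q)
  in (λ { zero → u ; (suc i) → f i }) , (λ { zero _ → hu ; (suc i) q → ∧-l (h i q) }) ,
    λ { zero zero _ _ _ → refl ; zero (suc j) _ q r → void (away j q (sym r)) ; (suc i) zero p _ r → void (away i p r) ; (suc i) (suc j) p q r → cong suc (inj i j p q r) }

anyb-sum : ∀ {k} (S : Sub k) → b2n (anyb S) ≤ sum (λ i → b2n (S i))
anyb-sum {zero} S = z≤n
anyb-sum {suc k} S = ≤-trans (b2n-∨ (S zero) _) (+-monoʳ-≤ (b2n (S zero)) (anyb-sum (λ i → S (suc i))))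
 where b2n-∨ : ∀ a b → b2n (a ∨ b) ≤ b2n a + b2n b
       b2n-∨ true b = s≤s z≤n
       b2n-∨ false b = ≤-refl

image : ∀ {k n} → Sub k → (Fin k → Fin n) → Sub n
image P h y = anyb (λ i → P i ∧ (h i == y))

card-image : ∀ {k n} (P : Sub k) (h : Fin k → Fin n) → card (image P h) ≤ card P
card-image {k} {n} P h = begin
  card (image P h)                                       ≡⟨ card-def (image P h) ⟩
  sum (λ y → b2n (image P h y))                          ≤⟨ sum-mono (λ y → anyb-sum (λ i → P i ∧ (h i == y))) ⟩
  sum (λ y → sum (λ i → b2n (P i ∧ (h i == y))))         ≡⟨ sum-swap (λ y i → b2n (P i ∧ (h i == y))) ⟩
  sum (λ i → sum (λ y → b2n (P i ∧ (h i == y))))         ≡⟨ sum-cong (λ i → card-def (λ y → P i ∧ (h i == y))) ⟨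
  sum (λ i → card (λ y → P i ∧ (h i == y)))              ≤⟨ sum-mono (λ i → pt i (P i) refl) ⟩
  sum (λ i → b2n (P i))                                  ≡⟨ card-def P ⟨
  card P                                                 ∎
 where
 open ≤-Reasoning
 pt : ∀ i b → P i ≡ b → card (λ y → P i ∧ (h i == y)) ≤ b2n b
 pt i true e = card-≤1 _ (λ x y p q → trans (sym (==-e (∧-r {P i} p))) (==-e (∧-r {P i} q)))
 pt i false e = ≤-eq (card-∅ _ (λ y p → t≢f (trans (sym (∧-l p)) e)))

image-i : ∀ {k n} (P : Sub k) (h : Fin k → Fin n) i → P i ! → image P h (h i) !
image-i P h i p = anyb-i _ i (∧-i p (==-refl (h i)))

image-e : ∀ {k n} (P : Sub k) (h : Fin k → Fin n) {y} → image P h y ! → Σ[ i ∈ Fin k ] P i ! × h i ≡ y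
image-e P h {y} q = let (i , e) = anyb-e (λ i → P i ∧ (h i == y)) q in i , ∧-l e , ==-e (∧-r {P i} e)

uniq-prefix : ∀ {A : Set} L {y : A} {M} → Uniq (L ++ y ∷ M) → Uniq (L ++ y ∷ [])
uniq-prefix []      u = (λ ()) , tt
uniq-prefix (x ∷ L) (x∉ , u) = (λ m → x∉ ([ ∈ˡ , (λ { (here e) → ∈ʳ L (here e) }) ] (∈⁻ L m))) , uniq-prefix L u

uniq-apart : ∀ {A : Set} L {M : List A} {y} → Uniq (L ++ M) → y ∈ L → y ∈ M → ⊥
uniq-apart (x ∷ L) (x∉ , u) (here refl) k = x∉ (∈ʳ L k)
uniq-apart (x ∷ L) (x∉ , u) (there m) k = uniq-apart L u m k

uniq-left : ∀ {A : Set} L {M : List A} → Uniq (L ++ M) → Uniq L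
uniq-left []      u = tt
uniq-left (x ∷ L) (x∉ , u) = (λ m → x∉ (∈ˡ m)) , uniq-left L u

-- Tails chosen with as few edges as possible outside the parity-breaking paths meet at most one such path each.
module Tailing {n : ℕ} (E : Rl n) (E-symm : Symm E) (W Tm : Sub n) (col : Fin n → Bool) (Pk : OddPacking E W col) where
 open OddPacking Pk renaming (uniq to uniqI; disj to disjI)

 -- One of the two ends of each path in the packing, so that paths can be counted.
 rep : Sub n
 rep a = W a ∧ (not (pr a == a) ∧ does (toℕ a <? toℕ (pr a)))

 rep-e : ∀ {a} → rep a ! → W a ! × pr a ≢ a × toℕ a < toℕ (pr a)
 rep-e {a} h = ∧-l h , (λ e → not-e (∧-l (∧-r {W a} h)) (==-i e)) , lem (toℕ a <? toℕ (pr a)) (∧-r {not (pr a == a)} (∧-r {W a} h))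
  where lem : ∀ {A : Set} (d : Dec A) → does d ! → A
        lem (yes p) _ = p

 rep-i : ∀ {a} → W a ! → pr a ≢ a → toℕ a < toℕ (pr a) → rep a !
 rep-i {a} w ne lt = ∧-i w (∧-i (not-i (λ e → ne (==-e e))) (lem (toℕ a <? toℕ (pr a)) lt))
  where lem : ∀ {A : Set} (d : Dec A) → A → does d !
        lem (yes p) _ = refl
        lem (no np) p = void (np p)

 one-rep : ∀ {a a'} → rep a ! → rep a' ! → a' ≡ pr a → ⊥
 one-rep {a} {a'} h h' refl = <-asym (snd (snd (rep-e h))) (subst (λ z → toℕ (pr a) < toℕ z) (pr-pr a (fst (rep-e h))) (snd (snd (rep-e h'))))

 count : ∀ N → 2 * N ≤ pcount → N ≤ card rep
 count N le = *-cancelˡ-≤ 2 (≤-trans le (≤-trans (card-∪ {U = rep} {V = λ a → (W a ∧ not (pr a == a)) ∧ not (rep a)} (λ a h → [ inl , (λ nr → inr (∧-i h (not-i nr))) ] (bool (rep a))))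
   (≤-trans (+-monoʳ-≤ (card rep) (card-inj {U = rep} pr into inj)) (≤-eq (cong (card rep +_) (sym (+-identityʳ _)))))))
  where
  dat : ∀ a → (W a ∧ not (pr a == a)) ∧ not (rep a) ! → W a ! × pr a ≢ a × ¬ (rep a !)
  dat a h = ∧-l (∧-l {W a ∧ not (pr a == a)} h) , (λ e → not-e (∧-r {W a} (∧-l {W a ∧ not (pr a == a)} h)) (==-i e)) , not-e (∧-r {W a ∧ not (pr a == a)} h)
  into : ∀ a → (W a ∧ not (pr a == a)) ∧ not (rep a) ! → rep (pr a) !
  into a h = let (w , ne , nr) = dat a h in rep-i (pr-A a w) (λ e → ne (sym (trans (sym (pr-pr a w)) e)))
   (subst (λ z → toℕ (pr a) < toℕ z) (sym (pr-pr a w)) (≤∧≢⇒< (≮⇒≥ (λ lt → nr (rep-i w ne lt))) (λ e → ne (toℕ-injective e))))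
  inj : ∀ a a' → (W a ∧ not (pr a == a)) ∧ not (rep a) ! → (W a' ∧ not (pr a' == a')) ∧ not (rep a') ! → pr a ≡ pr a' → a ≡ a'
  inj a a' h h' e = trans (sym (pr-pr a (fst (dat a h)))) (trans (cong pr e) (pr-pr a' (fst (dat a' h'))))

 FL : Fin n → List (Fin n)
 FL a = a ∷ ints a ++ pr a ∷ []

 FP : ∀ {a} → rep a ! → PathL E a (pr a) (FL a)
 FP h = let (w , ne , _) = rep-e h in chainP (chain _ w ne)

 FU : ∀ {a} → rep a ! → Uniq (FL a)
 FU {a} h = let (w , ne , _) = rep-e h in
  (λ m → [ (λ k → out a w k w) , (λ { (here e) → ne (sym e) }) ] (∈⁻ (ints a) m)) , uniq-++ (ints a) _ (uniqI a) ((λ ()) , tt) (λ { k (here refl) → out a w k (pr-A a w) })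

 F-W : ∀ {a y} → rep a ! → y ∈ FL a → W y ! → y ≡ a ⊎ y ≡ pr a
 F-W h (here e) wy = inl e
 F-W {a} h (there m) wy = [ (λ k → void (out a (fst (rep-e h)) k wy)) , (λ { (here e) → inr e }) ] (∈⁻ (ints a) m)

 F-disj : ∀ {a a' y} → rep a ! → rep a' ! → y ∈ FL a → y ∈ FL a' → a ≡ a'
 F-disj {a} {a'} {y} h h' m m' with T? (W y)
 ... | yes wy with F-W h m wy | F-W h' m' wy
 ...   | inl e | inl e' = trans (sym e) e'
 ...   | inl e | inr e' = void (one-rep h' h (trans (sym e) e'))
 ...   | inr e | inl e' = void (one-rep h h' (trans (sym e') e))
 ...   | inr e | inr e' = trans (sym (pr-pr a (fst (rep-e h)))) (trans (cong pr (trans (sym e) e')) (pr-pr a' (fst (rep-e h'))))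
 F-disj {a} {a'} {y} h h' m m' | no nw with disjI a a' (fst (rep-e h)) (fst (rep-e h')) (inner h m) (inner h' m')
  where
  inner : ∀ {a} → rep a ! → y ∈ FL a → y ∈ ints a
  inner h (here refl) = void (nw (fst (rep-e h)))
  inner {a} h (there m) = [ (λ k → k) , (λ { (here refl) → void (nw (pr-A a (fst (rep-e h)))) }) ] (∈⁻ (ints a) m)
 ... | inl e = sym e
 ... | inr e = void (one-rep h h' e)

 onF : Fin n → Fin n → Bool
 onF a u = rep a ∧ elem u (FL a)

 -- An edge is free of charge if both its ends lie on one path of the packing, whether or not the
 -- path uses it.
 Fe : Rl n
 Fe u v = anyb (λ a → onF a u ∧ onF a v)

 nf : List (Fin n) → ℕ
 nf []          = 0
 nf (x ∷ [])    = 0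
 nf (x ∷ y ∷ L) = b2n (not (Fe x y)) + nf (y ∷ L)

 nf-split : ∀ L y M → nf (L ++ y ∷ M) ≡ nf (L ++ y ∷ []) + nf (y ∷ M)
 nf-split []          y M = refl
 nf-split (x ∷ [])    y M = cong (_+ nf (y ∷ M)) (sym (+-identityʳ _))
 nf-split (x ∷ z ∷ L) y M = trans (cong (b2n (not (Fe x z)) +_) (nf-split (z ∷ L) y M)) (sym (+-assoc (b2n (not (Fe x z))) _ _))

 nf-on : ∀ {a} L → (∀ {y} → y ∈ L → onF a y !) → nf L ≡ 0
 nf-on []          h = refl
 nf-on (x ∷ [])    h = refl
 nf-on {a} (x ∷ y ∷ L) h = cong₂ _+_ (cong (λ b → b2n (not b)) (anyb-i (λ a → onF a x ∧ onF a y) a (∧-i (h (here refl)) (h (there (here refl)))))) (nf-on (y ∷ L) (λ m → h (there m)))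

 onF-uni : ∀ {a a' u} → onF a u ! → onF a' u ! → a ≡ a'
 onF-uni {a} {a'} h h' = F-disj (∧-l h) (∧-l h') (elem-e (FL a) (∧-r {rep a} h)) (elem-e (FL a') (∧-r {rep a'} h'))

 nf-stay : ∀ {a} z M → nf (z ∷ M) ≡ 0 → onF a z ! → ∀ {y} → y ∈ (z ∷ M) → onF a y !
 nf-stay z M e h (here refl) = h
 nf-stay {a} z (w ∷ M) e h (there m) = nf-stay w M (m+n≡0⇒n≡0 (b2n (not (Fe z w))) e) next m
  where
  fe : Fe z w !
  fe = lem (Fe z w) (m+n≡0⇒m≡0 (b2n (not (Fe z w))) e)
   where lem : ∀ b → b2n (not b) ≡ 0 → b !
         lem true _ = refl
  next : onF a w !
  next = let (a' , q) = anyb-e (λ a → onF a z ∧ onF a w) fe in subst (λ x → onF x w !) (sym (onF-uni h (∧-l q))) (∧-r {onF a' z} q)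

 μ : Paths E Tm W → ℕ
 μ ps = sum (λ x → b2n (Tm x) * nf (Paths.lst ps x))

 module Minimal (ps : Paths E Tm W) (min : ∀ ps' → μ ps ≤ μ ps') where
  open Paths ps

  Tl : Sub n
  Tl u = anyb (λ x → Tm x ∧ elem u (lst x))

  Tl-i : ∀ {x u} → Tm x ! → u ∈ lst x → Tl u !
  Tl-i {x} h m = anyb-i _ x (∧-i h (elem-i m))

  Tl-e : ∀ {u} → Tl u ! → Σ[ x ∈ Fin n ] Tm x ! × u ∈ lst x
  Tl-e {u} h = let (x , q) = anyb-e (λ x → Tm x ∧ elem u (lst x)) h in x , ∧-l q , elem-e (lst x) (∧-r {Tm x} q)

  hit? : Fin n → Bool
  hit? a = rep a ∧ anyb (λ u → elem u (FL a) ∧ Tl u)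

  -- Seen from `a`, `z` is the first vertex of the packing path on a tail. That tail could turn at
  -- `z` and run to `a` free of charge, so by minimality its actual remainder costs nothing either.
  -- Hence it never leaves the packing path and ends at `a` or `pr a`.
  module Reroute (a : Fin n) (ra : rep a !) (x z : Fin n) (tx : Tm x !) (nz : W z ! → ⊥) (L1 L2 M1 M2 : List (Fin n)) (eF : FL a ≡ L1 ++ z ∷ L2)
          (free : ∀ y → y ∈ L1 → ¬ (Tl y !)) (pz : PathL E a z (L1 ++ z ∷ [])) (eT : lst x ≡ M1 ++ z ∷ M2) (pM : PathL E x z (M1 ++ z ∷ [])) (pR : PathL E z (tgt x) (z ∷ M2)) where

   N : List (Fin n)
   N = M1 ++ z ∷ reverse L1

   pN : PathL E x a N
   pN = subst (PathL E x a) (++-assoc M1 (z ∷ []) (reverse L1)) (joinP pM (subst (PathL E z a) (reverse-++ L1 (z ∷ [])) (revP E-symm pz)))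

   uT : Uniq (M1 ++ z ∷ M2)
   uT = subst Uniq eT (uniq x tx)

   N∈ : ∀ {y} → y ∈ N → (y ∈ lst x × (y ∈ M1 ⊎ y ≡ z)) ⊎ y ∈ L1
   N∈ m with ∈⁻ M1 m
   ... | inl k = inl (subst (_ ∈_) (sym eT) (∈ˡ k) , inl k)
   ... | inr (here e) = inl (subst (_ ∈_) (sym eT) (∈ʳ M1 (here e)) , inr e)
   ... | inr (there k) = inr (rev-∈ L1 k)

   L1F : ∀ {y} → y ∈ L1 → y ∈ FL a
   L1F m = subst (_ ∈_) (sym eF) (∈ˡ m)

   prz : pr a ∈ (z ∷ L2)
   prz = last∈ (suffixP L1 (subst (PathL E a (pr a)) eF (FP ra)))

   only-N : ∀ {y} → y ∈ N → W y ! → y ≡ a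
   only-N m w with N∈ m
   ... | inl (k , inr refl) = void (nz w)
   ... | inl (k , inl k') = void (uniq-apart M1 uT k' (subst (_∈ (z ∷ M2)) (sym (only x tx k w)) (last∈ pR)))
   ... | inr k with F-W ra (L1F k) w
   ...   | inl e = e
   ...   | inr refl = void (uniq-apart L1 (subst Uniq eF (FU ra)) k prz)

   uN : Uniq N
   uN = subst Uniq (++-assoc M1 (z ∷ []) (reverse L1)) (uniq-++ (M1 ++ z ∷ []) (reverse L1) (uniq-prefix M1 uT) (uniq-reverse L1 (uniq-left L1 (subst Uniq eF (FU ra))))
    (λ {y} m k → free y (rev-∈ L1 k) (Tl-i tx (subst (y ∈_) (sym eT) ([ ∈ˡ , (λ { (here e) → ∈ʳ M1 (here e) }) ] (∈⁻ M1 m))))))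

   lst' : Fin n → List (Fin n)
   lst' y = if y == x then N else lst y

   new : Paths E Tm W
   new = record { tgt = λ y → if y == x then a else tgt y ; lst = lst' ; hit = hit' ; path = path' ; only = only' ; sole = sole' ; uniq = uniq' ; disj = disj' }
    where
    hit' : ∀ y → Tm y ! → W (if y == x then a else tgt y) !
    hit' y h with y == x
    ... | true = fst (rep-e ra)
    ... | false = hit y h
    path' : ∀ y → Tm y ! → PathL E y (if y == x then a else tgt y) (lst' y)
    path' y h with y == x in e
    ... | true = subst (λ y → PathL E y a N) (sym (==-e e)) pN
    ... | false = path y h
    only' : ∀ y → Tm y ! → ∀ {w} → w ∈ lst' y → W w ! → w ≡ (if y == x then a else tgt y)
    only' y h m ww with y == x
    ... | true = only-N m ww
    ... | false = only y h m ww
    sole-N : ∀ {w} → w ∈ N → Tm w ! → w ≡ x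
    sole-N m tw = [ (λ { (k , _) → sole x tx k tw }) , (λ k → void (free _ k (Tl-i tw (first∈ (path _ tw))))) ] (N∈ m)
    sole' : ∀ y → Tm y ! → ∀ {w} → w ∈ lst' y → Tm w ! → w ≡ y
    sole' y h m tw with y == x in e
    ... | true = trans (sole-N m tw) (sym (==-e e))
    ... | false = sole y h m tw
    uniq' : ∀ y → Tm y ! → Uniq (lst' y)
    uniq' y h with y == x
    ... | true = uN
    ... | false = uniq y h
    other : ∀ {y w} → Tm y ! → w ∈ N → w ∈ lst y → x ≡ y
    other h m k = [ (λ { (k' , _) → disj _ _ tx h k' k }) , (λ k' → void (free _ k' (Tl-i h k))) ] (N∈ m)
    disj' : ∀ y y' → Tm y ! → Tm y' ! → ∀ {w} → w ∈ lst' y → w ∈ lst' y' → y ≡ y'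
    disj' y y' h h' m m' with y == x in e | y' == x in e'
    ... | true | true = trans (==-e e) (sym (==-e e'))
    ... | true | false = trans (==-e e) (other h' m m')
    ... | false | true = trans (sym (other h m' m)) (sym (==-e e'))
    ... | false | false = disj y y' h h' m m'

   μ-eq : μ new + nf (lst x) ≡ μ ps + nf N
   μ-eq = trans (cong (μ new +_) (sym (sum-δ (λ _ → nf (lst x)) x))) (trans (sym (sum-+ (λ y → b2n (Tm y) * nf (lst' y)) (λ y → b2n (y == x) * nf (lst x))))
     (trans (sum-cong pt) (trans (sum-+ (λ y → b2n (Tm y) * nf (lst y)) (λ y → b2n (y == x) * nf N)) (cong (μ ps +_) (sum-δ (λ _ → nf N) x)))))
    where
    pt : ∀ y → b2n (Tm y) * nf (lst' y) + b2n (y == x) * nf (lst x) ≡ b2n (Tm y) * nf (lst y) + b2n (y == x) * nf N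
    pt y with y == x in e
    ... | false = refl
    ... | true rewrite ==-e e | tx = trans (cong₂ _+_ (+-identityʳ (nf N)) (+-identityʳ (nf (lst x)))) (trans (+-comm (nf N) (nf (lst x))) (sym (cong₂ _+_ (+-identityʳ (nf (lst x))) (+-identityʳ (nf N)))))

   onRev : ∀ {y} → y ∈ (z ∷ reverse L1) → onF a y !
   onRev (here refl) = ∧-i ra (elem-i (subst (z ∈_) (sym eF) (∈ʳ L1 (here refl))))
   onRev (there m) = ∧-i ra (elem-i (L1F (rev-∈ L1 m)))

   stay : nf (z ∷ M2) ≡ 0
   stay = n≤0⇒n≡0 (lin (1 ∷ 1 ∷ 1 ∷ 1 ∷ 1 ∷ []) (μ ps ∷ μ new ∷ nf (lst x) ∷ nf N ∷ nf (M1 ++ z ∷ []) ∷ nf (z ∷ M2) ∷ [])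
    (λ m m' l b p q → m :≤ m' ⇒ m' :+ l :≤ m :+ b ⇒ b :≤ p ⇒ p :+ q :≤ l ⇒ qed (q :≤ # 0)) (min new) (≤-eq μ-eq)
    (≤-eq (trans (nf-split M1 z (reverse L1)) (trans (cong (nf (M1 ++ z ∷ []) +_) (nf-on {a} (z ∷ reverse L1) onRev)) (+-identityʳ _)))) (≤-eq (sym (trans (cong nf eT) (nf-split M1 z M2)))))

   ends : tgt x ≡ a ⊎ tgt x ≡ pr a
   ends = F-W ra (elem-e (FL a) (∧-r {rep a} (nf-stay z M2 stay (onRev (here refl)) (last∈ pR)))) (hit x tx)

  served : ∀ a → hit? a ! → Σ[ x ∈ Fin n ] Tm x ! × (tgt x ≡ a ⊎ tgt x ≡ pr a)
  served a h with firstIn Tl (FP (∧-l {rep a} h))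
  ... | inl none = let (u , q) = anyb-e (λ u → elem u (FL a) ∧ Tl u) (∧-r {rep a} h) in void (none u (elem-e (FL a) (∧-l q)) (∧-r {elem u (FL a)} q))
  ... | inr (z , L1 , L2 , tz , eF , pz , _ , free) with Tl-e tz
  ...   | x , tx , mz with T? (W z)
  ...     | yes wz = x , tx , subst (λ y → y ≡ a ⊎ y ≡ pr a) (only x tx mz wz) (F-W (∧-l {rep a} h) (subst (z ∈_) (sym eF) (∈ʳ L1 (here refl))) wz)
  ...     | no nz with splitP (path x tx) mz
  ...       | M1 , M2 , eT , pM , pR = x , tx , Reroute.ends a (∧-l {rep a} h) x z tx nz L1 L2 M1 M2 eF free pz eT pM pR

  -- Each packing path that is met contains the end of some tail, and distinct packing paths are
  -- disjoint.
  few-hit : card hit? ≤ card Tm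
  few-hit = card-inj {S = hit?} {U = Tm} (λ a → pick a (T? (hit? a))) (λ a h → fst (good a (T? (hit? a)) h)) inj
   where
   pick : ∀ a → Dec (hit? a !) → Fin n
   pick a (yes h) = fst (served a h)
   pick a (no _) = a
   good : ∀ a (d : Dec (hit? a !)) → hit? a ! → Tm (pick a d) ! × (tgt (pick a d) ≡ a ⊎ tgt (pick a d) ≡ pr a)
   good a (yes h) _ = snd (served a h)
   good a (no nh) h = void (nh h)
   same : ∀ a a' {y} → rep a ! → rep a' ! → y ≡ a ⊎ y ≡ pr a → y ≡ a' ⊎ y ≡ pr a' → a ≡ a'
   same a a' h h' p p' = F-disj h h' (in-F p) (in-F p')
    where
    in-F : ∀ {a y} → y ≡ a ⊎ y ≡ pr a → y ∈ FL a
    in-F (inl refl) = here refl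
    in-F {a} (inr refl) = there (∈ʳ (ints a) (here refl))
   inj : ∀ a a' → hit? a ! → hit? a' ! → pick a (T? (hit? a)) ≡ pick a' (T? (hit? a')) → a ≡ a'
   inj a a' h h' e = same a a' (∧-l h) (∧-l h') (snd (good a (T? (hit? a)) h)) (subst (λ y → tgt y ≡ a' ⊎ tgt y ≡ pr a') (sym e) (snd (good a' (T? (hit? a')) h')))

  unhit : Sub n
  unhit a = rep a ∧ not (hit? a)

  unhit-e : ∀ {a} → unhit a ! → rep a ! × (∀ {x u} → Tm x ! → u ∈ FL a → u ∈ lst x → ⊥)
  unhit-e {a} h = ∧-l h , λ {x} {u} tx m k → not-e (∧-r {rep a} h) (∧-i (∧-l h) (anyb-i (λ u → elem u (FL a) ∧ Tl u) u (∧-i (elem-i m) (Tl-i tx k))))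

  unhit-many : ∀ ℓ → card Tm + ℓ ≤ card rep → ℓ ≤ card unhit
  unhit-many ℓ le = +-cancelˡ-≤ (card Tm) _ _ (≤-trans le (≤-trans (card-∪ {U = hit?} {V = unhit} (λ a h → [ inl , (λ nh → inr (∧-i h (not-i nh))) ] (bool (hit? a)))) (+-monoˡ-≤ (card unhit) few-hit)))

-- The two cases of the theorem

record Instance (n k : ℕ) : Set where
 field
  k≥1   : 1 ≤ k
  inI   : Sub k
  E     : Rl n
  symm  : Symm E
  irr   : ∀ v → E v v ! → ⊥
  κ<n   : 26 * k + 24 * card inI < n
  conn  : ∀ (Z : Sub n) → card Z < 26 * k + 24 * card inI → ∀ u v → ¬ (Z u !) → ¬ (Z v !) →
   Σ[ L ∈ List (Fin n) ] PathL E u v L × (∀ y → y ∈ L → ¬ (Z y !))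
  s t   : Fin k → Fin n
  s-inj : ∀ {i j} → s i ≡ s j → i ≡ j
  t-inj : ∀ {i j} → t i ≡ t j → i ≡ j
  s≢t   : ∀ i j → s i ≢ t j
  want  : Fin k → Bool

module Main {n k : ℕ} (inst : Instance n k) where
 open Instance inst

 -- One link for each path, and one more behind the breaker for each index in `I`.
 ℓ r : ℕ
 ℓ = card inI
 r = k + ℓ

 ℓ≤k : ℓ ≤ k
 ℓ≤k = card-≤n inI

 -- A smaller neighbourhood would separate `v` from some vertex outside it, against the
 -- connectivity.
 minDegree : ∀ v → 26 * k + 24 * ℓ ≤ card (E v)
 minDegree v = ≮⇒≥ (λ lt → bad lt (card-ex (λ y → not (E v y ∨ (y == v))) (other lt)))
  where
  other : card (E v) < 26 * k + 24 * ℓ → 1 ≤ card (λ y → not (E v y ∨ (y == v)))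
  other lt = +-cancelˡ-≤ (26 * k + 24 * ℓ) _ _ (≤-trans (≤-eq (+-comm _ 1)) (≤-trans κ<n (≤-trans (≤-eq (sym (card-full n)))
   (≤-trans (card-∪ {U = λ y → E v y ∨ (y == v)} {V = λ y → not (E v y ∨ (y == v))} (λ y _ → [ inl , (λ h → inr (not-i h)) ] (bool (E v y ∨ (y == v)))))
    (+-monoˡ-≤ _ (≤-trans (card-∪ {U = E v} {V = _== v} (λ y → ∨-e)) (≤-trans (≤-eq (trans (cong (card (E v) +_) (card-sing v)) (+-comm _ 1))) lt)))))))
  bad : card (E v) < 26 * k + 24 * ℓ → Σ[ u ∈ Fin n ] not (E v u ∨ (u == v)) ! → ⊥
  bad lt (u , h) = let (L , p , av) = conn (E v) lt v u (irr v) (λ e → not-e h (∨-l e)) in go p av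
   where
   go : ∀ {L} → PathL E v u L → (∀ y → y ∈ L → ¬ (E v y !)) → ⊥
   go one av = not-e h (∨-r {E v v} (==-refl v))
   go (e ◂ p) av = av _ (there (first∈ p)) e

 yes! : Sub k
 yes! _ = true

 card-yes! : card yes! ≡ k
 card-yes! = card-full k

 roots : (a b f g : Fin k → Fin n) → Sub n
 roots a b f g y = (image yes! a y ∨ image yes! b y) ∨ (image inI f y ∨ image inI g y)

 roots-card : ∀ a b f g → card (roots a b f g) ≤ 2 * r
 roots-card a b f g = ≤-trans (card-∪ {U = λ y → image yes! a y ∨ image yes! b y} {V = λ y → image inI f y ∨ image inI g y} (λ y → ∨-e))
  (≤-trans (+-mono-≤ (≤-trans (card-∪ {U = image yes! a} {V = image yes! b} (λ y → ∨-e)) (+-mono-≤ (≤-trans (card-image yes! a) (≤-eq card-yes!)) (≤-trans (card-image yes! b) (≤-eq card-yes!))))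
            (≤-trans (card-∪ {U = image inI f} {V = image inI g} (λ y → ∨-e)) (+-mono-≤ (card-image inI f) (card-image inI g))))
   (lin (1 ∷ []) (k ∷ ℓ ∷ []) (λ k l → qed ((k :+ k) :+ (l :+ l) :≤ 2 :* (k :+ l)))))

 roots-a : ∀ a b f g i → roots a b f g (a i) !
 roots-a a b f g i = ∨-l (∨-l (image-i yes! a i refl))
 roots-b : ∀ a b f g i → roots a b f g (b i) !
 roots-b a b f g i = ∨-l (∨-r {image yes! a (b i)} (image-i yes! b i refl))
 roots-f : ∀ a b f g i → inI i ! → roots a b f g (f i) !
 roots-f a b f g i h = ∨-r {image yes! a (f i) ∨ image yes! b (f i)} (∨-l (image-i inI f i h))
 roots-g : ∀ a b f g i → inI i ! → roots a b f g (g i) !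
 roots-g a b f g i h = ∨-r {image yes! a (g i) ∨ image yes! b (g i)} (∨-r {image inI f (g i)} (image-i inI g i h))

 roots-in : ∀ a b f g {P : Sub n} → (∀ i → P (a i) !) → (∀ i → P (b i) !) → (∀ i → inI i ! → P (f i) !) → (∀ i → inI i ! → P (g i) !) → ∀ y → roots a b f g y ! → P y !
 roots-in a b f g {P} pa pb pf pg y h = [ (λ h → [ (λ q → let (i , _ , e) = image-e yes! a q in at e (pa i)) , (λ q → let (i , _ , e) = image-e yes! b q in at e (pb i)) ] (∨-e {image yes! a y} h)) ,
   (λ h → [ (λ q → let (i , p , e) = image-e inI f q in at e (pf i p)) , (λ q → let (i , p , e) = image-e inI g q in at e (pg i p)) ] (∨-e {image inI f y} h)) ] (∨-e {image yes! a y ∨ image yes! b y} h)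
  where at : ∀ {x} → x ≡ y → P x ! → P y !
        at refl p = p

 xor-not : ∀ {a b} → a xor b ! → a ≡ not b
 xor-not {true} {false} _ = refl
 xor-not {false} {true} _ = refl

 xor-ne : ∀ {a b} → a ≢ b → a xor b !
 xor-ne {true} {true} h = void (h refl)
 xor-ne {true} {false} h = refl
 xor-ne {false} {true} h = refl
 xor-ne {false} {false} h = void (h refl)

 -- Few vertices meet all odd cycles: the graph is nearly bipartite, and the matching edges break parity.
 record NearBipartite : Set where
  field
   side  : Sub n
   X     : Sub n
   bipX  : ∀ u v → ¬ (X u !) → ¬ (X v !) → E u v ! → side u ≢ side v
   nice  : ∀ x → X x ! → card (λ y → (E x y ∧ not (X y)) ∧ not (side x xor side y)) ≤ card (λ y → (E x y ∧ not (X y)) ∧ (side x xor side y))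
   small : card X < 4 * k + 2 * ℓ
   f g   : Fin k → Fin n
   fgE   : ∀ i → inI i ! → E (f i) (g i) !
   fgS   : ∀ i → inI i ! → side (f i) ≡ side (g i)
   ff    : ∀ {i j} → inI i ! → inI j ! → f i ≡ f j → i ≡ j
   gg    : ∀ {i j} → inI i ! → inI j ! → g i ≡ g j → i ≡ j
   fg'   : ∀ {i j} → inI i ! → inI j ! → f i ≡ g j → i ≡ j
   fs    : ∀ {i j} → inI i ! → f i ≡ s j → i ≡ j
   gt    : ∀ {i j} → inI i ! → g i ≡ t j → i ≡ j
   f≢t   : ∀ {i j} → inI i ! → f i ≢ t j
   g≢s   : ∀ {i j} → inI i ! → g i ≢ s j

 module Small (near : NearBipartite) where
  open NearBipartite near

  -- Vertices of the cover are dropped unless they are roots. Between the remaining non-cover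
  -- vertices all edges are cross edges and survive, so those keep a large degree.
  R W : Sub n
  R = roots s t f g
  W y = not (X y) ∨ R y

  H : Rl n
  H x y = E x y ∧ ((side x xor side y) ∧ (W x ∧ W y))

  H-i : ∀ {x y} → E x y ! → side x xor side y ! → W x ! → W y ! → H x y !
  H-i e q a b = ∧-i e (∧-i q (∧-i a b))

  H-x : ∀ {x y} → H x y ! → side x xor side y !
  H-x {x} {y} h = ∧-l (∧-r {E x y} h)
  H-w : ∀ {x y} → H x y ! → W x ∧ W y !
  H-w {x} {y} h = ∧-r {side x xor side y} (∧-r {E x y} h)

  cR : card R ≤ 2 * r
  cR = roots-card s t f g

  free : ∀ {v w} → ¬ (X v !) → E v w ! → ¬ (X w !) → H v w !
  free nv e nw = H-i e (xor-ne (bipX _ _ nv nw e)) (∨-l (not-i nv)) (∨-l (not-i nw))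

  notX : ∀ {v} → W v ! → ¬ (R v !) → ¬ (X v !)
  notX {v} w nr x = [ (λ nx → not-e nx x) , nr ] (∨-e {not (X v)} w)

  degH : ∀ v → ¬ (X v !) → suc (12 * r) ≤ card (H v)
  degH v nx = lin (6 ∷ 6 ∷ 6 ∷ 0 ∷ 11 ∷ []) (k ∷ ℓ ∷ card (E v) ∷ card X ∷ card (H v) ∷ []) (λ k l e x h → 26 :* k :+ 24 :* l :≤ e ⇒ x :< 4 :* k :+ 2 :* l ⇒ e :≤ h :+ x ⇒ # 1 :≤ k ⇒ qed (# 1 :+ 12 :* (k :+ l) :≤ h))
   (minDegree v) small (card-∪ (λ w e → [ inr , (λ nw → inl (free nx e nw)) ] (bool (X w)))) k≥1

  m1 : 2 * (6 * r) * card (W ∖ R) < ρ H (W ∖ R)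
  m1 = begin-strict
    2 * (6 * r) * card (W ∖ R)                       ≡⟨ cong (_* card (W ∖ R)) (sym (*-assoc 2 6 r)) ⟩
    12 * r * card (W ∖ R)                            <⟨ m<n+m (12 * r * card (W ∖ R)) pos ⟩
    suc (12 * r) * card (W ∖ R)                      ≡⟨ cong (suc (12 * r) *_) (card-def (W ∖ R)) ⟩
    suc (12 * r) * sum (λ v → b2n ((W ∖ R) v))       ≡⟨ sum-*ˡ (suc (12 * r)) (λ v → b2n ((W ∖ R) v)) ⟨
    sum (λ v → suc (12 * r) * b2n ((W ∖ R) v))       ≤⟨ sum-mono (λ v → pt v ((W ∖ R) v) refl) ⟩
    sum (λ v → b2n ((W ∖ R) v) * card (H v))         ≤⟨ degree-sum H (W ∖ R) ⟩
    ρ H (W ∖ R)                                      ∎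
   where
   open ≤-Reasoning
   pt : ∀ v b → (W ∖ R) v ≡ b → suc (12 * r) * b2n b ≤ b2n b * card (H v)
   pt v false e = ≤-eq (*-zeroʳ (12 * r))
   pt v true e = ≤-trans (≤-eq (*-identityʳ _)) (≤-trans (degH v (notX {v} (∧-l e) (not-e (∧-r {W v} e)))) (≤-eq (sym (+-identityʳ _))))
   pos : 1 ≤ card (W ∖ R)
   pos = lin (1 ∷ 1 ∷ 11 ∷ 1 ∷ 1 ∷ []) (k ∷ ℓ ∷ n ∷ card X ∷ card R ∷ card (W ∖ R) ∷ []) (λ k l n x r w → 26 :* k :+ 24 :* l :< n ⇒ x :< 4 :* k :+ 2 :* l ⇒ r :≤ 2 :* (k :+ l) ⇒ n :≤ w :+ (x :+ r) ⇒ qed (# 1 :≤ w))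
    κ<n small cR (≤-trans (≤-eq (sym (card-full n))) (≤-trans (card-∪ {U = W ∖ R} {V = λ y → X y ∨ R y} (λ y _ → [ inr , (λ h → inl (∧-i (∨-l {not (X y)} (not-i (λ x → h (∨-l {X y} x)))) (not-i (λ q → h (∨-r {X y} q))))) ] (bool (X y ∨ R y))))
     (+-monoʳ-≤ _ (card-∪ (λ y → ∨-e)))))

  -- By connectivity `Z` with the cover cannot separate the graph, so everything outside them lies
  -- in `Q`. A root outside `Z` is therefore in the cover, and its cross neighbours outside the
  -- cover all lie in `Z`. By niceness these are at least half of its neighbours outside the cover,
  -- too many for `Z`.
  m2 : ∀ Z Q → Viol H W R (6 * r) Z Q → ⊥
  m2 Z Q V = lin (1 ∷ 1 ∷ 1 ∷ 1 ∷ 2 ∷ 2 ∷ 11 ∷ []) (k ∷ ℓ ∷ card X ∷ card Z ∷ card A1 ∷ card A2 ∷ card (E x0) ∷ card R ∷ [])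
    (λ k l x z a b e r → 26 :* k :+ 24 :* l :≤ e ⇒ x :< 4 :* k :+ 2 :* l ⇒ e :≤ x :+ (a :+ b) ⇒ b :≤ a ⇒ a :≤ z ⇒ z :< r ⇒ r :≤ 2 :* (k :+ l) ⇒ absurd)
    (minDegree x0) small nbrs (nice x0 xX) (card-mono A1Z) V.lt cR
   where
   module V = Viol V
   q0 : Fin n
   q0 = fst (ρ-some V.vi)
   qq : Q q0 !
   qq = snd (ρ-some V.vi)
   QnX : ∀ {y} → Q y ! → ¬ (X y !)
   QnX {y} q = notX {y} (V.QW q) (V.QX q)
   S : Sub n
   S y = Z y ∨ X y
   cover : ∀ w → ¬ (Q w !) → S w !
   cover w nq = [ (λ h → h) , (λ nS → void (go nS)) ] (bool (S w))
    where
    cS : card S < 26 * k + 24 * ℓ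
    cS = lin (1 ∷ 1 ∷ 11 ∷ 1 ∷ 1 ∷ []) (k ∷ ℓ ∷ card X ∷ card Z ∷ card R ∷ card S ∷ []) (λ k l x z r s → x :< 4 :* k :+ 2 :* l ⇒ z :< r ⇒ r :≤ 2 :* (k :+ l) ⇒ s :≤ z :+ x ⇒ qed (s :< 26 :* k :+ 24 :* l)) small V.lt cR (card-∪ (λ y → ∨-e))
    stay : ∀ {a b L} → PathL E a b L → (∀ y → y ∈ L → ¬ (S y !)) → Q a ! → Q b !
    stay one av qa = qa
    stay (_◂_ {c = c} e p) av qa = stay p (λ y m → av y (there m)) ([ (λ q → q) , (λ z → void (av c (there (first∈ p)) (∨-l z))) ] (V.bd qa (free (QnX qa) e (λ x → av c (there (first∈ p)) (∨-r {Z c} x)))))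
    go : ¬ (S w !) → ⊥
    go nS = let (L , p , av) = conn S cS q0 w (λ h → [ V.dis qq , QnX qq ] (∨-e {Z q0} h)) nS in nq (stay p av qq)
   outside : Σ[ x ∈ Fin n ] (R ∖ Z) x !
   outside = card-ex (R ∖ Z) (+-cancelʳ-≤ (card Z) 1 _ (≤-trans V.lt (card-∪ {U = R ∖ Z} {V = Z} (λ y x → [ inr , (λ nz → inl (∧-i x (not-i nz))) ] (bool (Z y))))))
   x0 : Fin n
   x0 = fst outside
   xR : R x0 !
   xR = ∧-l (snd outside)
   xZ : ¬ (Z x0 !)
   xZ = not-e (∧-r {R x0} (snd outside))
   xQ : ¬ (Q x0 !)
   xQ q = V.QX q xR
   xX : X x0 !
   xX = [ (λ z → void (xZ z)) , (λ x → x) ] (∨-e {Z x0} (cover x0 xQ))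
   xW : W x0 !
   xW = ∨-r {not (X x0)} xR
   A1 A2 : Sub n
   A1 y = (E x0 y ∧ not (X y)) ∧ (side x0 xor side y)
   A2 y = (E x0 y ∧ not (X y)) ∧ not (side x0 xor side y)
   nbrs : card (E x0) ≤ card X + (card A1 + card A2)
   nbrs = ≤-trans (card-∪ {U = X} {V = λ y → A1 y ∨ A2 y} (λ y e → [ inl , (λ nx → inr ([ (λ q → ∨-l (∧-i (∧-i e (not-i nx)) q)) , (λ q → ∨-r {A1 y} (∧-i (∧-i e (not-i nx)) (not-i q))) ] (bool (side x0 xor side y)))) ] (bool (X y))))
    (+-monoʳ-≤ (card X) (card-∪ (λ y → ∨-e)))
   A1Z : ∀ y → A1 y ! → Z y !
   A1Z y h = [ (λ z → z) , (λ x → void (nx x)) ] (∨-e {Z y} (cover y nq))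
    where
    e : E x0 y !
    e = ∧-l (∧-l {E x0 y ∧ not (X y)} h)
    nx : ¬ (X y !)
    nx = not-e (∧-r {E x0 y} (∧-l {E x0 y ∧ not (X y)} h))
    nq : ¬ (Q y !)
    nq q = [ xQ , xZ ] (V.bd q (H-i (symm e) (trans (xor-comm (side y) (side x0)) (∧-r {E x0 y ∧ not (X y)} h)) (V.QW q) xW))

  massed : Massed H W R (6 * r)
  massed = record
   { gr = record { symm = λ {x} {y} h → H-i (symm (∧-l h)) (trans (xor-comm (side y) (side x)) (H-x {x} {y} h)) (∧-r {W x} (H-w {x} {y} h)) (∧-l (H-w {x} {y} h))
          ; irr = λ v h → irr v (∧-l h) ; inW = λ {x} {y} h → ∧-l (H-w {x} {y} h) }
   ; XW = λ {y} → ∨-r {not (X y)} ; m1 = m1 ; m2 = m2 }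

  tails : Tails E W s t
  tails = record { TS = λ i → s i ∷ [] ; TT = λ i → t i ∷ [] ; τs = s ; τt = t ; pS = λ _ → one ; pT = λ _ → one ; uS = λ _ → (λ ()) , tt ; uT = λ _ → (λ ()) , tt
   ; dSS = λ { (here e) (here e') → s-inj (trans (sym e) e') } ; dTT = λ { (here e) (here e') → t-inj (trans (sym e) e') } ; dST = λ { {i} {j} (here e) (here e') → s≢t i j (trans (sym e) e') }
   ; oS = λ { (here e) _ → e } ; oT = λ { (here e) _ → e } ; wS = λ i → ∨-r {not (X (s i))} (roots-a s t f g i) ; wT = λ i → ∨-r {not (X (t i))} (roots-b s t f g i) }

  flip : Sub k
  flip = flipped side tails inI want

  fl : ∀ {i} → flip i ! → inI i !
  fl h = ∧-l h

  breakers : Breakers E W side tails flip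
  breakers = record { f = f ; g = g ; FL = λ i → f i ∷ g i ∷ [] ; pF = λ {i} h → fgE i (fl {i} h) ◂ one
   ; uF = λ {i} h → (λ { (here e) → ne (fl {i} h) e }) , (λ ()) , tt
   ; dFF = λ {i} {j} h h' → dj (fl {i} h) (fl {j} h')
   ; oF = λ { _ (here e) _ → inl e ; _ (there (here e)) _ → inr e }
   ; wF = λ {i} h → ∨-r {not (X (f i))} (roots-f s t f g i (fl {i} h)) ; wG = λ {i} h → ∨-r {not (X (g i))} (roots-g s t f g i (fl {i} h))
   ; fS = λ { {i} h (here refl) (here e) → fs (fl {i} h) e , refl ; {i} {j} h (there (here refl)) (here e) → void (g≢s {i} {j} (fl {i} h) e) }
   ; fT = λ { {i} {j} h (here refl) (here e) → void (f≢t {i} {j} (fl {i} h) e) ; {i} h (there (here refl)) (here e) → gt (fl {i} h) e , refl }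
   ; fg = λ {i} h → ne (fl {i} h) ; odd = λ {i} h → trans (sym (xor-self (side (f i)))) (cong (side (f i) xor_) (fgS i (fl {i} h))) }
   where
   ne : ∀ {i} → inI i ! → f i ≢ g i
   ne {i} h e = irr (f i) (subst (λ z → E (f i) z !) (sym e) (fgE i h))
   dj : ∀ {i j y} → inI i ! → inI j ! → y ∈ (f i ∷ g i ∷ []) → y ∈ (f j ∷ g j ∷ []) → i ≡ j
   dj h h' (here e) (here e') = ff h h' (trans (sym e) e')
   dj h h' (here e) (there (here e')) = fg' h h' (trans (sym e) e')
   dj h h' (there (here e)) (here e') = sym (fg' h' h (trans (sym e') e))
   dj h h' (there (here e)) (there (here e')) = gg h h' (trans (sym e) e')

  smallCase : NN (Answer E s t inI want)
  smallCase = answer E H symm ∧-l side W R (λ {x} {y} h → xor-not (H-x {x} {y} h)) (λ {x} {y} h → ∧-r {W x} (H-w {x} {y} h)) tails inI want breakers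
   (roots-a s t f g) (roots-b s t f g) (λ i h → roots-f s t f g i (fl {i} h)) (λ i h → roots-g s t f g i (fl {i} h)) (λ p Pr PP → linkage r H W R (6 * r) massed cR ≤-refl Pr PP)

 -- Every odd cycle cover is large: there are many disjoint parity-breaking paths.
 module Large (large : ∀ (Y : Sub n) (χ : Fin n → Bool) → (∀ u v → ¬ (Y u !) → ¬ (Y v !) → E u v ! → χ u ≢ χ v) → 4 * k + 2 * ℓ ≤ card Y) where

  Tm : Sub n
  Tm y = image yes! s y ∨ image yes! t y

  cT : card Tm ≤ 2 * k
  cT = ≤-trans (card-∪ {U = image yes! s} {V = image yes! t} (λ y → ∨-e)) (≤-trans (+-mono-≤ (≤-trans (card-image yes! s) (≤-eq card-yes!)) (≤-trans (card-image yes! t) (≤-eq card-yes!)))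
   (≤-eq (cong (k +_) (sym (+-identityʳ k)))))

  Ts : ∀ i → Tm (s i) !
  Ts i = ∨-l (image-i yes! s i refl)
  Tt : ∀ i → Tm (t i) !
  Tt i = ∨-r {image yes! s (t i)} (image-i yes! t i refl)

  module Cut (c : Fin n → Bool) (half : ∀ v → card (E v) ≤ 2 * card (MaxCut.crossing E symm irr c v)) where

   H : Rl n
   H = MaxCut.crossing E symm irr c

   bipH : ∀ {x y} → H x y ! → c x ≡ not (c y)
   bipH {x} {y} h = xor-not (∧-r {E x y} h)

   q : ℕ
   q = pred (2 * r)
   r≥1 : 1 ≤ r
   r≥1 = ≤-trans k≥1 (m≤m+n k ℓ)
   rq : q + 1 ≡ 2 * r
   rq = trans (+-comm q 1) (suc-pred (2 * r) {{>-nonZero (≤-trans r≥1 (m≤m+n r (r + 0)))}})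

   Hsymm : Symm H
   Hsymm {x} {y} h = ∧-i (symm (∧-l h)) (trans (xor-comm (c y) (c x)) (∧-r {E x y} h))
   Hirr : ∀ v → H v v ! → ⊥
   Hirr v h = irr v (∧-l h)
   rk : r ≤ 2 * k
   rk = +-mono-≤ ≤-refl (≤-trans ℓ≤k (≤-eq (sym (+-identityʳ k))))
   degH : ∀ v → 24 * r + 2 * k ≤ 2 * card (H v)
   degH v = lin (1 ∷ 1 ∷ 1 ∷ []) (k ∷ ℓ ∷ card (E v) ∷ card (H v) ∷ []) (λ k l e h → 26 :* k :+ 24 :* l :≤ e ⇒ e :≤ 2 :* h ⇒ qed (24 :* (k :+ l) :+ 2 :* k :≤ 2 :* h)) (minDegree v) (half v)
   n≥ : 6 * r ≤ n
   n≥ = lin (1 ∷ 4 ∷ []) (k ∷ ℓ ∷ n ∷ []) (λ k l n → 26 :* k :+ 24 :* l :< n ⇒ qed (6 :* (k :+ l) :≤ n)) κ<n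

   bipData : BipData n
   bipData = record { H = H ; symm = λ {x} {y} → Hsymm {x} {y} ; irr = Hirr ; col = c ; bipH = bipH ; r = r ; k = k ; q = q ; rq = rq ; rk = rk ; r≥1 = r≥1 ; deg = degH ; n≥ = n≥ }

   dense : NN (DenseBip.Result bipData)
   dense = DenseBip.dense bipData

   module Linking (W : Sub n) (cW : 6 * r ≤ card W)
           (lk : ∀ R → (∀ y → R y ! → W y !) → card R ≤ 2 * r → Σ[ X ∈ Sub n ] (∀ y → R y ! → X y !) × (∀ p (Pr : Pairs n p) → Proper X Pr → NN (Linkage (λ x y → H x y ∧ (W x ∧ W y)) X Pr)))
           (Pk : OddPacking E W c) (many : 2 * (2 * k + ℓ) ≤ OddPacking.pcount Pk) (ps : Paths E Tm W) (min : ∀ ps' → Tailing.μ E symm W Tm c Pk ps ≤ Tailing.μ E symm W Tm c Pk ps') where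
    open Paths ps
    open OddPacking Pk using (pr; pr-A)

    unhit rep : Sub n
    unhit = Tailing.Minimal.unhit E symm W Tm c Pk ps min
    rep = Tailing.rep E symm W Tm c Pk

    FL : Fin n → List (Fin n)
    FL = Tailing.FL E symm W Tm c Pk

    enough : ℓ ≤ card unhit
    enough = Tailing.Minimal.unhit-many E symm W Tm c Pk ps min ℓ (≤-trans (+-monoˡ-≤ ℓ cT) (Tailing.count E symm W Tm c Pk (2 * k + ℓ) many))

    chosen : Σ[ F ∈ (Fin k → Fin n) ] (∀ i → inI i ! → unhit (F i) !) × (∀ i j → inI i ! → inI j ! → F i ≡ F j → i ≡ j)
    chosen = inject inI unhit (s (inhabit k≥1)) enough
     where inhabit : ∀ {k} → 1 ≤ k → Fin k
           inhabit {suc k} _ = zero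

    F : Fin k → Fin n
    F = fst chosen
    repF : ∀ {i} → inI i ! → rep (F i) !
    repF {i} h = fst (Tailing.Minimal.unhit-e E symm W Tm c Pk ps min (fst (snd chosen) i h))
    apart : ∀ {i x u} → inI i ! → Tm x ! → u ∈ FL (F i) → u ∈ lst x → ⊥
    apart {i} h = snd (Tailing.Minimal.unhit-e E symm W Tm c Pk ps min (fst (snd chosen) i h))
    datF : ∀ {i} → inI i ! → W (F i) ! × pr (F i) ≢ F i × _
    datF {i} h = Tailing.rep-e E symm W Tm c Pk {F i} (repF h)

    tails : Tails E W s t
    tails = record { TS = λ i → lst (s i) ; TT = λ i → lst (t i) ; τs = λ i → tgt (s i) ; τt = λ i → tgt (t i) ; pS = λ i → path (s i) (Ts i) ; pT = λ i → path (t i) (Tt i)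
     ; uS = λ i → uniq (s i) (Ts i) ; uT = λ i → uniq (t i) (Tt i) ; dSS = λ {i} {j} m m' → s-inj (disj _ _ (Ts i) (Ts j) m m') ; dTT = λ {i} {j} m m' → t-inj (disj _ _ (Tt i) (Tt j) m m')
     ; dST = λ {i} {j} m m' → s≢t i j (disj _ _ (Ts i) (Tt j) m m') ; oS = λ {i} → only (s i) (Ts i) ; oT = λ {i} → only (t i) (Tt i) ; wS = λ i → hit (s i) (Ts i) ; wT = λ i → hit (t i) (Tt i) }

    flip : Sub k
    flip = flipped c tails inI want
    fl : ∀ {i} → flip i ! → inI i !
    fl h = ∧-l h

    breakers : Breakers E W c tails flip
    breakers = record { f = F ; g = λ i → pr (F i) ; FL = λ i → FL (F i) ; pF = λ {i} h → Tailing.FP E symm W Tm c Pk (repF (fl {i} h)) ; uF = λ {i} h → Tailing.FU E symm W Tm c Pk (repF (fl {i} h))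
     ; dFF = λ {i} {j} h h' m m' → snd (snd chosen) i j (fl {i} h) (fl {j} h') (Tailing.F-disj E symm W Tm c Pk (repF (fl {i} h)) (repF (fl {j} h')) m m')
     ; oF = λ {i} h → Tailing.F-W E symm W Tm c Pk (repF (fl {i} h)) ; wF = λ {i} h → fst (datF (fl {i} h)) ; wG = λ {i} h → pr-A (F i) (fst (datF (fl {i} h)))
     ; fS = λ {i} {j} h m m' → void (apart (fl {i} h) (Ts j) m m') ; fT = λ {i} {j} h m m' → void (apart (fl {i} h) (Tt j) m m')
     ; fg = λ {i} h e → fst (snd (datF (fl {i} h))) (sym e)
     ; odd = λ {i} h → par (F i) (fst (datF (fl {i} h))) (fst (snd (datF (fl {i} h)))) }
     where
     par : ∀ a → W a ! → pr a ≢ a → isOdd (length (FL a)) ≡ c a xor c (pr a)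
     par a w ne = trans (cong (λ m → not (isOdd m)) (trans (length-++ (OddPacking.ints Pk a)) (+-comm _ 1))) (trans (nn (isOdd (length (OddPacking.ints Pk a)))) (sym (OddPacking.odd Pk a w ne)))
      where nn : ∀ b → not (not b) ≡ b
            nn true = refl
            nn false = refl

    τs τt G : Fin k → Fin n
    τs i = tgt (s i)
    τt i = tgt (t i)
    G i = pr (F i)

    linked : Σ[ X ∈ Sub n ] (∀ y → roots τs τt F G y ! → X y !) × (∀ p (Pr : Pairs n p) → Proper X Pr → NN (Linkage (λ x y → H x y ∧ (W x ∧ W y)) X Pr))
    linked = lk (roots τs τt F G) (roots-in τs τt F G {W} (λ i → hit (s i) (Ts i)) (λ i → hit (t i) (Tt i)) (λ i h → fst (datF h)) (λ i h → pr-A (F i) (fst (datF h)))) (roots-card τs τt F G)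

    finished : NN (Answer E s t inI want)
    finished = answer E (λ x y → H x y ∧ (W x ∧ W y)) symm (λ h → ∧-l (∧-l h)) c W (fst linked) (λ h → bipH (∧-l h)) (λ {x} {y} h → ∧-r {W x} (∧-r {H x y} h)) tails inI want breakers
     (λ i → fst (snd linked) _ (roots-a τs τt F G i)) (λ i → fst (snd linked) _ (roots-b τs τt F G i))
     (λ i h → fst (snd linked) _ (roots-f τs τt F G i (fl {i} h))) (λ i h → fst (snd linked) _ (roots-g τs τt F G i (fl {i} h))) (snd (snd linked))

  -- The largest number of vertices whose deletion the connectivity tolerates.
  hκ : ℕ
  hκ = pred (26 * k + 24 * ℓ)
  hκ-eq : suc hκ ≡ 26 * k + 24 * ℓ
  hκ-eq = suc-pred (26 * k + 24 * ℓ) {{>-nonZero (lin (26 ∷ 1 ∷ []) (k ∷ ℓ ∷ []) (λ k l → # 1 :≤ k ⇒ qed (# 0 :< 26 :* k :+ 24 :* l)) k≥1)}}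

  -- A packing with fewer ends would come with an odd cycle cover of at most as many vertices as
  -- there are ends, fewer than `large` permits. Counting ends instead of paths is the origin of the
  -- threshold `4 * k + 2 * ℓ`.
  manyPaths : ∀ (W : Sub n) (c : Fin n → Bool) → 6 * r ≤ card W → Odd.PackOrCover E symm W c hκ → Σ[ Pk ∈ OddPacking E W c ] 2 * (2 * k + ℓ) ≤ OddPacking.pcount Pk
  manyPaths W c cW (Pk , cov) = Pk , ≮⇒≥ (λ lt → bad lt (cov (h1 lt) (h2 lt)))
   where
   h1 : OddPacking.pcount Pk < 2 * (2 * k + ℓ) → OddPacking.pcount Pk + 1 ≤ hκ
   h1 lt = ≤-pred (≤-trans (lin (13 ∷ 0 ∷ 2 ∷ []) (k ∷ ℓ ∷ OddPacking.pcount Pk ∷ []) (λ k l p → p :< 2 :* (2 :* k :+ l) ⇒ # 1 :≤ k ⇒ qed (# 1 :+ (p :+ # 1) :≤ 26 :* k :+ 24 :* l)) lt k≥1) (≤-eq (sym hκ-eq)))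
   h2 : OddPacking.pcount Pk < 2 * (2 * k + ℓ) → OddPacking.pcount Pk + 2 ≤ card W
   h2 lt = ≤-trans (lin (3 ∷ 0 ∷ 2 ∷ []) (k ∷ ℓ ∷ OddPacking.pcount Pk ∷ []) (λ k l p → p :< 2 :* (2 :* k :+ l) ⇒ # 1 :≤ k ⇒ qed (p :+ # 2 :≤ 6 :* (k :+ l))) lt k≥1) cW
   bad : OddPacking.pcount Pk < 2 * (2 * k + ℓ) → Σ[ Y ∈ Sub n ] card Y ≤ OddPacking.pcount Pk × (Σ[ χ ∈ (Fin n → Bool) ] (∀ u v → ¬ (Y u !) → ¬ (Y v !) → E u v ! → χ u ≢ χ v)) → ⊥
   bad lt (Y , cY , χ , pr) = lin (1 ∷ 1 ∷ 1 ∷ []) (k ∷ ℓ ∷ OddPacking.pcount Pk ∷ card Y ∷ []) (λ k l p y → p :< 2 :* (2 :* k :+ l) ⇒ y :≤ p ⇒ 4 :* k :+ 2 :* l :≤ y ⇒ absurd) lt cY (large Y χ pr)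

  -- A separator given by Menger's theorem would have fewer than `2 * k` vertices and leave a vertex
  -- on either side, which the connectivity forbids.
  toW : ∀ (W : Sub n) → 6 * r ≤ card W → NN (Paths E Tm W)
  toW W cW = Menger.menger E symm Tm W >>= λ where
    (inl ps) → ret ps
    (inr (Z , lt , sp)) → void (bad Z lt sp)
   where
   bad : ∀ Z → card Z < card Tm → Separates E Tm W Z → ⊥
   bad Z lt sp = let (x , hx) = pick Tm lt
                     (w , hw) = pick W (<-≤-trans lt (≤-trans cT (≤-trans (lin (1 ∷ []) (k ∷ ℓ ∷ []) (λ k l → qed (2 :* k :≤ 6 :* (k :+ l)))) cW)))
                     (L , p , av) = conn Z (≤-trans lt (≤-trans cT (lin (1 ∷ []) (k ∷ ℓ ∷ []) (λ k l → qed (2 :* k :≤ 26 :* k :+ 24 :* l))))) x w (not-e (∧-r {Tm x} hx)) (not-e (∧-r {W w} hw))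
                     (y , m , z) = sp (∧-l hx) (∧-l hw) p in av y m z
    where
    pick : ∀ S → card Z < card S → Σ[ x ∈ Fin n ] (S ∖ Z) x !
    pick S lt = card-ex (S ∖ Z) (+-cancelʳ-≤ (card Z) 1 _ (≤-trans lt (card-∪ {U = S ∖ Z} {V = Z} (λ y x → [ inr , (λ nz → inl (∧-i x (not-i nz))) ] (bool (Z y))))))

  largeCase : NN (Answer E s t inI want)
  largeCase = MaxCut.maxCut E symm irr >>= λ { (c , half) → Cut.dense c half >>= λ { (W , cW , lk) →
   Odd.oddTheorem E symm W c irr hκ (λ Z le → conn Z (≤-trans (s≤s le) (≤-eq hκ-eq))) >>= λ poc → toW W cW >>= λ ps0 →
   argmin (Tailing.μ E symm W Tm c (fst (manyPaths W c cW poc))) ps0 >>= λ { (ps , min) →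
   Cut.Linking.finished c half W cW lk (fst (manyPaths W c cW poc)) (snd (manyPaths W c cW poc)) ps min } } }

open import Defs using (Graph; adj; Edge; Path; len; vert; KConnected; Nice; HasParityBreakingMatching; Parity; HasParity)
import Defs

-- Bounded search

Search : Set → Set₁
Search A = ∀ (P : A → Set) → (∀ a → Dec (P a)) → Dec (Σ A P)

searchL : ∀ {n} m → Search (Σ[ L ∈ List (Fin n) ] length L ≤ m)
searchL m P P? with P? ([] , z≤n)
... | yes p = yes (([] , z≤n) , p)
searchL zero P P? | no ¬p = no λ { (([] , z≤n) , p) → ¬p p }
searchL (suc m) P P? | no ¬p with anyF? (λ x → searchL m (λ { (L , le) → P (x ∷ L , s≤s le) }) (λ { (L , le) → P? (x ∷ L , s≤s le) }))
... | yes (x , (L , le) , p) = yes ((x ∷ L , s≤s le) , p)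
... | no ¬q = no λ { (([] , z≤n) , p) → ¬p p ; ((x ∷ L , s≤s le) , p) → ¬q (x , (L , le) , p) }

searchV : ∀ {A} → Search A → ∀ k → Search (Vec A k)
searchV S zero P P? with P? []
... | yes p = yes ([] , p)
... | no ¬p = no λ { ([] , p) → ¬p p }
searchV S (suc k) P P? with S (λ a → Σ[ v ∈ Vec _ k ] P (a ∷ v)) (λ a → searchV S k (λ v → P (a ∷ v)) (λ v → P? (a ∷ v)))
... | yes (a , v , p) = yes (a ∷ v , p)
... | no ¬p = no λ { (a ∷ v , p) → ¬p (a , v , p) }

both : ∀ {A B : Set} → Dec A → Dec B → Dec (A × B)
both (yes a) (yes b) = yes (a , b)
both (no na) _ = no λ { (a , _) → na a }
both _ (no nb) = no λ { (_ , b) → nb b }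

either : ∀ {A B : Set} → Dec A → Dec B → Dec (A ⊎ B)
either (yes a) _ = yes (inl a)
either _ (yes b) = yes (inr b)
either (no na) (no nb) = no [ na , nb ]

implies : ∀ {A B : Set} → Dec A → Dec B → Dec (A → B)
implies (yes a) (yes b) = yes (λ _ → b)
implies (yes a) (no nb) = no (λ f → nb (f a))
implies (no na) _ = yes (λ a → void (na a))

∈? : ∀ {n} (y : Fin n) L → Dec (y ∈ L)
∈? y L with T? (elem y L)
... | yes h = yes (elem-e L h)
... | no h = no (λ m → h (elem-i m))

uniq? : ∀ {n} (L : List (Fin n)) → Dec (Uniq L)
uniq? [] = yes tt
uniq? (x ∷ L) = both (implies (∈? x L) (no λ ())) (uniq? L)

path? : ∀ {n} (E : Rl n) a b L → Dec (PathL E a b L)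
path? E a b [] = no λ ()
path? E a b (x ∷ []) with a ≟F x | b ≟F x
... | yes refl | yes refl = yes one
... | no ne | _ = no λ { one → ne refl ; (_ ◂ ()) }
... | yes refl | no ne = no λ { one → ne refl ; (_ ◂ ()) }
path? E a b (x ∷ y ∷ L) with a ≟F x | T? (E x y) | path? E y b (y ∷ L)
... | yes refl | yes e | yes p = yes (e ◂ p)
... | no ne | _ | _ = no λ { (_ ◂ _) → ne refl }
... | yes refl | no ne | _ = no λ { (_◂_ {c = c} e p) → ne (subst (λ z → E x z !) (first= p) e) }
 where first= : ∀ {c b M} → PathL E c b (y ∷ M) → c ≡ y
       first= one = refl
       first= (_ ◂ _) = refl
... | yes refl | yes _ | no np = no λ { (_◂_ {c = c} e p) → np (subst (λ z → PathL E z b (y ∷ L)) (first= p) p) }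
 where first= : ∀ {c b M} → PathL E c b (y ∷ M) → c ≡ y
       first= one = refl
       first= (_ ◂ _) = refl

uniq-length : ∀ {n} (L : List (Fin n)) → Uniq L → length L ≤ n
uniq-length L u = ≤-trans (≤-eq (trans (sym (sumL-1 L)) (trans (sumL-elem (λ _ → 1) L u) (wsum-1 (λ y → elem y L))))) (card-≤n (λ y → elem y L))

module _ {n k : ℕ} (E : Rl n) (s t : Fin k → Fin n) (inI : Sub k) (want : Fin k → Bool) where

 Lists : Set
 Lists = Σ[ L ∈ List (Fin n) ] length L ≤ n

 Fine : Vec Lists k → Set
 Fine v = ∀ i → PathL E (s i) (t i) (at i) × (Uniq (at i) × ((inI i ! → isOdd (length (at i)) ≡ want i) × (∀ j → i ≡ j ⊎ (∀ y → ¬ (y ∈ at i × y ∈ at j)))))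
  where at : Fin k → List (Fin n)
        at i = fst (lookup v i)

 fine? : ∀ v → Dec (Fine v)
 fine? v = allF? (λ i → both (path? E (s i) (t i) (at i)) (both (uniq? (at i)) (both (implies (T? (inI i)) (isOdd (length (at i)) ≟B want i))
   (allF? (λ j → either (i ≟F j) (allF? (λ y → implies (both (∈? y (at i)) (∈? y (at j))) (no λ ()))))))))
  where at : Fin k → List (Fin n)
        at i = fst (lookup v i)

 -- Repetition-free lists have length at most `n`, so an answer can be sought among finitely many
 -- tuples of lists. That search decides existence and removes the double negation.
 extractAnswer : NN (Answer E s t inI want) → Answer E s t inI want
 extractAnswer m = toAnswer (stable (searchV (searchL n) k Fine fine?) (m >>= λ a → ret (code a)))
  where
  code : Answer E s t inI want → Σ (Vec Lists k) Fine
  code a = v , λ i → subst (PathL E (s i) (t i)) (sym (at i)) (path i) , subst Uniq (sym (at i)) (uniq i) , (λ h → trans (cong (λ L → isOdd (length L)) (at i)) (par i h)) , λ j → dj i j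
   where
   open Answer a
   v : Vec Lists k
   v = tabulate (λ i → lst i , uniq-length (lst i) (uniq i))
   at : ∀ i → fst (lookup v i) ≡ lst i
   at i = cong fst (lookup∘tabulate (λ i → lst i , uniq-length (lst i) (uniq i)) i)
   dj : ∀ i j → i ≡ j ⊎ (∀ y → ¬ (y ∈ fst (lookup v i) × y ∈ fst (lookup v j)))
   dj i j with i ≟F j
   ... | yes e = inl e
   ... | no ne = inr λ { y (m , m') → ne (disj (subst (y ∈_) (at i) m) (subst (y ∈_) (at j) m')) }
  toAnswer : Σ (Vec Lists k) Fine → Answer E s t inI want
  toAnswer (v , ok) = record { lst = λ i → fst (lookup v i) ; path = λ i → fst (ok i) ; uniq = λ i → fst (snd (ok i)) ; par = λ i → fst (snd (snd (ok i)))
   ; disj = λ {i} {j} {y} m m' → [ (λ e → e) , (λ none → void (none y (m , m'))) ] (snd (snd (snd (ok i))) j) }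

-- Translation to the graphs, paths and subsets of the theorem

module _ {n : ℕ} (G : Graph n) where

 record AsPath {a b : Fin n} (L : List (Fin n)) : Set where
  field
   P   : Path G a b
   ln  : length L ≡ suc (len P)
   mem : ∀ i → vert P i ∈ L

 toPath : ∀ {a b L} → PathL (adj G) a b L → Uniq L → AsPath {a} {b} L
 toPath {a} one u = record { P = record { len = 0 ; vert = λ _ → a ; inj = λ { {zero} {zero} _ → refl } ; start = refl ; end = refl ; step = λ () } ; ln = refl ; mem = λ _ → here refl }
 toPath {a} {b} (_◂_ {c = c} {L = L} e p) (a∉ , u) = record { P = record { len = suc (len P) ; vert = vt ; inj = inj' ; start = refl ; end = Path.end P ; step = st } ; ln = cong suc ln ; mem = mm }
  where
  open AsPath (toPath p u)
  vt : Fin (suc (suc (len P))) → Fin n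
  vt zero = a
  vt (suc i) = vert P i
  mm : ∀ i → vt i ∈ (a ∷ L)
  mm zero = here refl
  mm (suc i) = there (mem i)
  inj' : Injective _≡_ _≡_ vt
  inj' {zero} {zero} _ = refl
  inj' {zero} {suc j} q = void (a∉ (subst (_∈ L) (sym q) (mem j)))
  inj' {suc i} {zero} q = void (a∉ (subst (_∈ L) q (mem i)))
  inj' {suc i} {suc j} q = cong suc (Path.inj P q)
  st : ∀ (i : Fin (suc (len P))) → Edge G (vt (inject₁ i)) (vt (suc i))
  st zero = subst (λ z → Edge G a z) (sym (Path.start P)) e
  st (suc i) = Path.step P i

 fromPath : ∀ {a b} (P : Path G a b) → Σ[ L ∈ List (Fin n) ] PathL (adj G) a b L × (∀ y → y ∈ L → Σ[ i ∈ Fin (suc (len P)) ] vert P i ≡ y)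
 fromPath P = let (L , p , h) = go (len P) (vert P) (Path.step P) in L , subst₂ (λ x y → PathL (adj G) x y L) (Path.start P) (Path.end P) p , h
  where
  go : ∀ m (v : Fin (suc m) → Fin n) → (∀ (i : Fin m) → Edge G (v (inject₁ i)) (v (suc i))) → Σ[ L ∈ List (Fin n) ] PathL (adj G) (v zero) (v (fromℕ m)) L × (∀ y → y ∈ L → Σ[ i ∈ Fin (suc m) ] v i ≡ y)
  go zero v st = v zero ∷ [] , one , λ { y (here e) → zero , sym e }
  go (suc m) v st = let (L , p , h) = go m (λ i → v (suc i)) (λ i → st (suc i)) in
   v zero ∷ L , st zero ◂ p , λ { y (here e) → zero , sym e ; y (there k) → let (i , e) = h y k in suc i , e }

card-lookup : ∀ {n} (v : Subset n) → ∣ v ∣ ≡ card (lookup v)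
card-lookup []          = sym (card-∅ (lookup []) (λ ()))
card-lookup (true ∷ v)  = trans (cong suc (card-lookup v)) (sym (card-suc (lookup (true ∷ v))))
card-lookup (false ∷ v) = trans (card-lookup v) (sym (card-suc (lookup (false ∷ v))))

card-tabulate : ∀ {n} (S : Sub n) → ∣ tabulate S ∣ ≡ card S
card-tabulate S = trans (card-lookup (tabulate S)) (card-cong (lookup∘tabulate S))

∈ˢ-i : ∀ {n} {v : Subset n} {x} → lookup v x ! → x ∈ˢ v
∈ˢ-i {v = v} {x} h = lookup⇒[]= x v h

∈ˢ-tab : ∀ {n} {S : Sub n} {x} → x ∈ˢ tabulate S → S x !
∈ˢ-tab {S = S} {x} m = trans (sym (lookup∘tabulate S x)) ([]=⇒lookup m)

mod2 : ∀ m → m % 2 ≡ b2n (isOdd m)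
mod2 zero          = refl
mod2 (suc zero)    = refl
mod2 (suc (suc m)) = trans (trans (cong (_% 2) (+-comm 2 m)) ([m+n]%n≡m%n m 2)) (trans (mod2 m) (cong b2n (nn (isOdd m))))
 where nn : ∀ b → b ≡ not (not b)
       nn true  = refl
       nn false = refl

module _ {n : ℕ} (G : Graph n) where

 separation : ∀ {κ} → KConnected G κ → ∀ (Z : Sub n) → card Z < κ → ∀ u v → ¬ (Z u !) → ¬ (Z v !) →
  Σ[ L ∈ List (Fin n) ] PathL (adj G) u v L × (∀ y → y ∈ L → ¬ (Z y !))
 separation (_ , con) Z lt u v nu nv =
  let (P , av) = con (tabulate Z) (subst (_< _) (sym (card-tabulate Z)) lt) u v (λ m → nu (∈ˢ-tab m)) (λ m → nv (∈ˢ-tab m))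
      (L , p , h) = fromPath G P
  in L , p , λ y m z → let (i , e) = h y m in av i (subst (_∈ˢ tabulate Z) (sym e) (∈ˢ-i (trans (lookup∘tabulate Z y) z)))

 nbr : ∀ (x : Fin n) (X A : Subset n) y → lookup (Defs.N G x ∩ ∁ X ∩ A) y ≡ adj G x y ∧ (not (lookup X y) ∧ lookup A y)
 nbr x X A y = trans (lookup-zipWith _∧_ y (Defs.N G x) (∁ X ∩ A)) (cong₂ _∧_ (lookup∘tabulate (adj G x) y)
  (trans (lookup-zipWith _∧_ y (∁ X) A) (cong (_∧ lookup A y) (lookup-map y not X))))

 card-nbr : ∀ (x : Fin n) (X A : Subset n) → ∣ Defs.N G x ∩ ∁ X ∩ A ∣ ≡ card (λ y → adj G x y ∧ (not (lookup X y) ∧ lookup A y))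
 card-nbr x X A = trans (card-lookup (Defs.N G x ∩ ∁ X ∩ A)) (card-cong (nbr x X A))

 -- Merges the two conditions of niceness, one per side, into a single comparison of cross and
 -- non-cross neighbours outside the cover.
 majority : ∀ (A X : Subset n) → (∀ x → x ∈ˢ X → ∣ Defs.N G x ∩ ∁ X ∩ A ∣ < ∣ Defs.N G x ∩ ∁ X ∩ ∁ A ∣ → x ∈ˢ A) →
  (∀ x → x ∈ˢ X → ∣ Defs.N G x ∩ ∁ X ∩ ∁ A ∣ < ∣ Defs.N G x ∩ ∁ X ∩ A ∣ → x ∉ˢ A) → ∀ x → lookup X x ! →
  card (λ y → (adj G x y ∧ not (lookup X y)) ∧ not (lookup A x xor lookup A y)) ≤ card (λ y → (adj G x y ∧ not (lookup X y)) ∧ (lookup A x xor lookup A y))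
 majority A X inA notA x xx = go (lookup A x) refl
  where
  asc : ∀ a b c → a ∧ (b ∧ c) ≡ (a ∧ b) ∧ c
  asc true b c = refl
  asc false b c = refl
  nn : ∀ b → b ≡ not (not b)
  nn true = refl
  nn false = refl
  cA : ∣ Defs.N G x ∩ ∁ X ∩ A ∣ ≡ card (λ y → (adj G x y ∧ not (lookup X y)) ∧ lookup A y)
  cA = trans (card-nbr x X A) (card-cong (λ y → asc (adj G x y) (not (lookup X y)) (lookup A y)))
  cB : ∣ Defs.N G x ∩ ∁ X ∩ ∁ A ∣ ≡ card (λ y → (adj G x y ∧ not (lookup X y)) ∧ not (lookup A y))
  cB = trans (card-nbr x X (∁ A)) (card-cong (λ y → trans (asc (adj G x y) (not (lookup X y)) (lookup (∁ A) y)) (cong ((adj G x y ∧ not (lookup X y)) ∧_) (lookup-map y not A))))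
  go : ∀ b → lookup A x ≡ b → card (λ y → (adj G x y ∧ not (lookup X y)) ∧ not (b xor lookup A y)) ≤ card (λ y → (adj G x y ∧ not (lookup X y)) ∧ (b xor lookup A y))
  go true e = ≮⇒≥ (λ lt → notA x (∈ˢ-i xx) (subst₂ _<_ (sym cB) (trans (card-cong (λ y → cong ((adj G x y ∧ not (lookup X y)) ∧_) (sym (nn (lookup A y))))) (sym cA)) lt) (∈ˢ-i e))
  go false e = ≮⇒≥ (λ lt → t≢f (trans (sym ([]=⇒lookup (inA x (∈ˢ-i xx) (subst₂ _<_ (sym cA) (sym cB) lt)))) e))

 cover≥ : ∀ {X : Subset n} → Defs.MinOddCycleCover G X → ∀ (Y : Sub n) (χ : Fin n → Bool) → (∀ u v → ¬ (Y u !) → ¬ (Y v !) → adj G u v ! → χ u ≢ χ v) → ∣ X ∣ ≤ card Y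
 cover≥ {X} (_ , min) Y χ h = subst (∣ X ∣ ≤_) (card-tabulate Y) (min (tabulate Y) (tabulate χ , λ u v nu nv e q →
  h u v (λ yu → nu (∈ˢ-i (trans (lookup∘tabulate Y u) yu))) (λ yv → nv (∈ˢ-i (trans (lookup∘tabulate Y v) yv))) e (trans (sym (lookup∘tabulate χ u)) (trans q (lookup∘tabulate χ v)))))

-- Each matching edge is oriented so that it can be inserted between sᵢ and tᵢ.
module Orient {n k : ℕ} (G : Graph n) (s t : Fin k → Fin n) (s≢t : ∀ i j → s i ≢ t j) (I : Subset k) (A : Subset n) (m : Fin k → Fin n × Fin n)
       (pb : Defs.ParityBreakingMatching G k s t I A m) where

 m₁ m₂ : Fin k → Fin n
 m₁ i = fst (m i)
 m₂ i = snd (m i)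

 swap : Fin k → Bool
 swap i = (m₁ i == t i) ∨ (m₂ i == s i)

 f g : Fin k → Fin n
 f i = if swap i then m₂ i else m₁ i
 g i = if swap i then m₁ i else m₂ i

 inI : Sub k
 inI = lookup I

 IsEnd : Fin k → Fin n → Set
 IsEnd i y = y ≡ m₁ i ⊎ y ≡ m₂ i

 data Dir (i : Fin k) : Set where
  straight : f i ≡ m₁ i → g i ≡ m₂ i → m₁ i ≢ t i → m₂ i ≢ s i → Dir i
  crossed  : f i ≡ m₂ i → g i ≡ m₁ i → m₁ i ≡ t i ⊎ m₂ i ≡ s i → Dir i

 dir : ∀ i → Dir i
 dir i = go (swap i) refl
  where
  go : ∀ b → swap i ≡ b → Dir i
  go true e = crossed (cong (if_then m₂ i else m₁ i) e) (cong (if_then m₁ i else m₂ i) e) ([ (λ h → inl (==-e h)) , (λ h → inr (==-e h)) ] (∨-e {m₁ i == t i} e))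
  go false e = straight (cong (if_then m₂ i else m₁ i) e) (cong (if_then m₁ i else m₂ i) e) (λ h → t≢f (trans (sym (∨-l (==-i h))) e)) (λ h → t≢f (trans (sym (∨-r {m₁ i == t i} (==-i h))) e))

 fEnd : ∀ i → IsEnd i (f i)
 fEnd i with dir i
 ... | straight p _ _ _ = inl p
 ... | crossed p _ _ = inr p
 gEnd : ∀ i → IsEnd i (g i)
 gEnd i with dir i
 ... | straight _ p _ _ = inr p
 ... | crossed _ p _ = inl p

 edge-m : ∀ i → inI i ! → adj G (m₁ i) (m₂ i) !
 edge-m i h = fst (fst pb i (∈ˢ-i h))

 m1≢m2 : ∀ i → inI i ! → m₁ i ≢ m₂ i
 m1≢m2 i h e = t≢f (trans (sym (edge-m i h)) (trans (cong (λ z → adj G z (m₂ i)) e) (Defs.irrefl G (m₂ i))))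

 fgE : ∀ i → inI i ! → adj G (f i) (g i) !
 fgE i h with dir i
 ... | straight p q _ _ = trans (cong₂ (adj G) p q) (edge-m i h)
 ... | crossed p q _ = trans (cong₂ (adj G) p q) (trans (Defs.sym G (m₂ i) (m₁ i)) (edge-m i h))

 fgS : ∀ i → inI i ! → lookup A (f i) ≡ lookup A (g i)
 fgS i h with dir i
 ... | straight p q _ _ = trans (cong (lookup A) p) (trans (snd (fst pb i (∈ˢ-i h))) (cong (lookup A) (sym q)))
 ... | crossed p q _ = trans (cong (lookup A) p) (trans (sym (snd (fst pb i (∈ˢ-i h)))) (cong (lookup A) (sym q)))

 sameEnd : ∀ {i j y} → inI i ! → inI j ! → IsEnd i y → IsEnd j y → i ≡ j
 sameEnd {i} {j} {y} h h' p q with i ≟F j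
 ... | yes e = e
 ... | no ne = void (bad p q (fst (snd pb) i j (∈ˢ-i h) (∈ˢ-i h') ne))
  where
  bad : IsEnd i y → IsEnd j y → m₁ i ≢ m₁ j × m₁ i ≢ m₂ j × m₂ i ≢ m₁ j × m₂ i ≢ m₂ j → ⊥
  bad (inl p) (inl q) (d , _) = d (trans (sym p) q)
  bad (inl p) (inr q) (_ , d , _) = d (trans (sym p) q)
  bad (inr p) (inl q) (_ , _ , d , _) = d (trans (sym p) q)
  bad (inr p) (inr q) (_ , _ , _ , d) = d (trans (sym p) q)

 endS : ∀ {i j} → inI i ! → IsEnd i (s j) → i ≡ j
 endS {i} {j} h p with i ≟F j
 ... | yes e = e
 ... | no ne = void (bad p (snd (snd pb) i j (∈ˢ-i h) ne))
  where
  bad : IsEnd i (s j) → m₁ i ≢ s j × m₁ i ≢ t j × m₂ i ≢ s j × m₂ i ≢ t j → ⊥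
  bad (inl p) (d , _) = d (sym p)
  bad (inr p) (_ , _ , d , _) = d (sym p)

 endT : ∀ {i j} → inI i ! → IsEnd i (t j) → i ≡ j
 endT {i} {j} h p with i ≟F j
 ... | yes e = e
 ... | no ne = void (bad p (snd (snd pb) i j (∈ˢ-i h) ne))
  where
  bad : IsEnd i (t j) → m₁ i ≢ s j × m₁ i ≢ t j × m₂ i ≢ s j × m₂ i ≢ t j → ⊥
  bad (inl p) (_ , d , _) = d (sym p)
  bad (inr p) (_ , _ , _ , d) = d (sym p)

 -- For a foreign index the matching condition excludes equality. For the own index the orientation
 -- does: an edge that begins at `t i` or ends at `s i` has been reversed.
 f≢t : ∀ {i j} → inI i ! → f i ≢ t j
 f≢t {i} {j} h e with endT {i} {j} h (subst (IsEnd i) e (fEnd i))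
 ... | refl with dir i
 ...   | straight p _ d _ = d (trans (sym p) e)
 ...   | crossed p _ (inl q) = m1≢m2 i h (trans q (trans (sym e) p))
 ...   | crossed p _ (inr q) = s≢t i i (trans (sym q) (trans (sym p) e))

 g≢s : ∀ {i j} → inI i ! → g i ≢ s j
 g≢s {i} {j} h e with endS {i} {j} h (subst (IsEnd i) e (gEnd i))
 ... | refl with dir i
 ...   | straight _ p _ d = d (trans (sym p) e)
 ...   | crossed _ p (inl q) = s≢t i i (trans (sym e) (trans p q))
 ...   | crossed _ p (inr q) = m1≢m2 i h (trans (sym p) (trans e (sym q)))

-- The parity of the number of vertices, which is opposite to that of the length.
lengthParity : Parity → Bool
lengthParity Defs.odd  = false
lengthParity Defs.even = true

theorem4 : (n k : ℕ) → 0 < k → (I : Subset k) → (G : Graph n) →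
  KConnected G (26 * k + 24 * ∣ I ∣) →
  (s t : Fin k → Fin n) →
  Injective _≡_ _≡_ s → Injective _≡_ _≡_ t → (∀ i j → s i ≢ t j) →
  (A : Subset n) → Nice G A → HasParityBreakingMatching G k s t I A →
  (p : Fin k → Parity) →
  Σ ((i : Fin k) → Path G (s i) (t i)) λ P →
  (∀ i j → i ≢ j → ∀ a b → vert (P i) a ≢ vert (P j) b) ×
  (∀ i → i ∈ˢ I → HasParity (len (P i)) (p i))
theorem4 n k k≥1 I G con s t s-inj t-inj s≢t A (X , minX , bipX , inA , notA) (m , pb) p =
  (λ i → AsPath.P (pt i)) ,
  (λ i j ne a b e → ne (Answer.disj ans (AsPath.mem (pt i) a) (subst (_∈ Answer.lst ans j) (sym e) (AsPath.mem (pt j) b)))) ,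
  (λ i h → hasParity (p i) (AsPath.ln (pt i)) (Answer.par ans i ([]=⇒lookup h)))
 where
 open Orient G s t s≢t I A m pb
 E : Rl n
 E = adj G
 E-symm : Symm E
 E-symm {u} {v} e = trans (Defs.sym G v u) e
 E-irr : ∀ v → E v v ! → ⊥
 E-irr v e = t≢f (trans (sym e) (Defs.irrefl G v))
 want : Fin k → Bool
 want i = lengthParity (p i)
 eqI : ∣ I ∣ ≡ card inI
 eqI = card-lookup I
 con' : KConnected G (26 * k + 24 * card inI)
 con' = subst (λ c → KConnected G (26 * k + 24 * c)) eqI con
 sideX : ∀ u v → ¬ (lookup X u !) → ¬ (lookup X v !) → E u v ! → lookup A u ≢ lookup A v
 sideX u v nu nv = bipX u v (λ h → nu ([]=⇒lookup h)) (λ h → nv ([]=⇒lookup h))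
 inst : Instance n k
 inst = record { k≥1 = k≥1 ; inI = inI ; E = E ; symm = λ {u} {v} → E-symm {u} {v} ; irr = E-irr ; κ<n = fst con' ; conn = separation G con' ; s = s ; t = t ; s-inj = s-inj ; t-inj = t-inj ; s≢t = s≢t ; want = want }
 cases : Dec (card (lookup X) < 4 * k + 2 * card inI) → NN (Answer E s t inI want)
 cases (yes small) = Main.Small.smallCase inst (record { side = lookup A ; X = lookup X ; bipX = sideX ; nice = majority G A X inA notA ; small = small ; f = f ; g = g ; fgE = fgE ; fgS = fgS
  ; ff = λ {i} {j} h h' e → sameEnd h h' (fEnd i) (subst (IsEnd j) (sym e) (fEnd j)) ; gg = λ {i} {j} h h' e → sameEnd h h' (gEnd i) (subst (IsEnd j) (sym e) (gEnd j))
  ; fg' = λ {i} {j} h h' e → sameEnd h h' (fEnd i) (subst (IsEnd j) (sym e) (gEnd j)) ; fs = λ {i} h e → endS h (subst (IsEnd i) e (fEnd i)) ; gt = λ {i} h e → endT h (subst (IsEnd i) e (gEnd i))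
  ; f≢t = λ {i} {j} → f≢t {i} {j} ; g≢s = λ {i} {j} → g≢s {i} {j} })
 cases (no big) = Main.Large.largeCase inst (λ Y χ h → ≤-trans (≮⇒≥ big) (subst (_≤ card Y) (card-lookup X) (cover≥ G {X} minX Y χ h)))
 ans : Answer E s t inI want
 ans = extractAnswer E s t inI want (cases (card (lookup X) <? 4 * k + 2 * card inI))
 pt : ∀ i → AsPath G {s i} {t i} (Answer.lst ans i)
 pt i = toPath G (Answer.path ans i) (Answer.uniq ans i)
 hasParity : ∀ q {l m} → l ≡ suc m → isOdd l ≡ lengthParity q → HasParity m q
 hasParity Defs.odd {m = m} refl h = trans (mod2 m) (lem (isOdd m) h)
  where lem : ∀ b → not b ≡ false → b2n b ≡ 1
        lem true _ = refl
 hasParity Defs.even {m = m} refl h = trans (mod2 m) (lem (isOdd m) h)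
  where lem : ∀ b → not b ! → b2n b ≡ 0
        lem false _ = refl
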